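{- Let $p$ be an odd prime, $m=p^2$ and $d=\frac{p+1}{2}$. For $1\le i\le p-1$ let $\beta_i$ be the tuple obtained by arranging in increasing order the $p+1$ numbers $i,\ i+p,\ i+2p,\ \dots,\ i+(p-1)p,\ p(p-i)$. Then the indecomposable tuples in $\mathfrak B_m^d$ are exactly the $p-1$ tuples $\beta_1,\dots,\beta_{p-1}$. Furthermore, for every integer $d'$ with $1\le d'\le \frac{m-1}{2}$ and $d'\neq \frac{p+1}{2}$, there are no indecomposable tuples in $\mathfrak B_m^{d'}$.
   Context: For an odd positive integer $m$ and an integer $1\le d\le \frac{m-1}{2}$, $\mathfrak B_m^d$ is the set of tuples $\beta=(b_1,\dots,b_{2d})$ of integers such that (1) $1\le b_1<b_2<\cdots<b_{2d}\le m-1$; (2) $\sum_{i=1}^{2d} b_i\equiv 0\pmod m$; (3) $|t\cdot\beta|=d$ for all $t\in(\mathbb{Z}/m\mathbb{Z})^\times$, where $|t\cdot\beta|=\sum_{i=1}^{2d}\langle tb_i\rangle_m/m$ and $\langle x\rangle_m$ denotes the representative of $x$ modulo $m$ in $\{0,\dots,m-1\}$. A tuple $\beta\in\mathfrak B_m^d$ is exceptional if its entries cannot be partitioned into pairs $b_i,b_j$ with $b_i+b_j\equiv 0\pmod m$. A tuple $\beta\in \mathfrak B_m^d$ is indecomposable if it is exceptional and no nonempty proper subset of $\{b_1,\dots,b_{2d}\}$ with an even number of elements has sum divisible by $m$. -}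

module Defs where

open import Data.Nat using (ℕ; zero; suc; _+_; _*_; _∸_; _≤_; _<_)
open import Data.Nat.DivMod using (_%_)
open import Data.Nat.Divisibility using (_∣_)
open import Data.Nat.Coprimality using (Coprime)
open import Data.Nat.Properties using (≤-decTotalOrder)
open import Data.List using (List; []; _∷_; _++_; [_]; map; length; upTo)
open import Data.Nat.ListAction using (sum)
open import Data.List.Relation.Unary.All using (All)
open import Data.List.Relation.Unary.Linked using (Linked)
open import Data.List.Relation.Binary.Permutation.Propositional using (_↭_)
open import Data.List.Relation.Binary.Sublist.Propositional using (_⊆_)
open import Data.List.Sort ≤-decTotalOrder using (sort)
open import Data.Product using (_×_)
open import Relation.Nullary using (¬_)
open import Relation.Binary.PropositionalEquality using (_≡_)

-- ⟨ x ⟩ m : representative of x modulo m in {0,…,m-1} (m is positive in all uses;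
-- the zero case is a junk value).
⟨_⟩_ : ℕ → ℕ → ℕ
⟨ x ⟩ zero = x
⟨ x ⟩ (suc n) = x % suc n

-- Tuples β = (b₁,…,b_{2d}) are lists of naturals.
-- β ∈ 𝔅_m^d.  Condition (3) |t·β| = d is written (multiplying by m) as
-- Σ ⟨ t bᵢ ⟩_m = d * m, with t ranging over representatives 1 ≤ t < m coprime to m.
record InB (m d : ℕ) (β : List ℕ) : Set where
  field
    len        : length β ≡ 2 * d
    increasing : Linked _<_ β
    bounds     : All (λ b → 1 ≤ b × b ≤ m ∸ 1) β
    sumZero    : m ∣ sum β
    weight     : ∀ t → 1 ≤ t → t < m → Coprime t m →
                 sum (map (λ b → ⟨ t * b ⟩ m) β) ≡ d * m

data PairsOff (m : ℕ) : List ℕ → Set where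
  done : PairsOff m []
  pair : ∀ {x y xs ys} → xs ↭ (y ∷ ys) → m ∣ x + y → PairsOff m ys →
         PairsOff m (x ∷ xs)

Exceptional : ℕ → List ℕ → Set
Exceptional m β = ¬ PairsOff m β

-- Subsets of the (distinct) entries of β are sublists of β.
Indecomposable : ℕ → List ℕ → Set
Indecomposable m β =
  Exceptional m β ×
  (∀ (s : List ℕ) → s ⊆ β → 1 ≤ length s → length s < length β →
     2 ∣ length s → ¬ (m ∣ sum s))

betaTuple : ℕ → ℕ → List ℕ
betaTuple p i = sort (map (λ k → i + k * p) (upTo p) ++ [ p * (p ∸ i) ])

{-# OPTIONS --safe #-}
-- To a tuple β attach the odd function F(z) = [z ∈ β] − [−z ∈ β] on ℤ/m; condition (3) says that F is
-- orthogonal to b ↦ ⟨tb⟩ for every unit t. Let f be any odd function on ℤ/m, supported on the units and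
-- orthogonal to b ↦ ⟨jb⟩ for all j, and put φ(a) = f(a⁻¹). Eisenstein's partial fraction identities give
-- ∑ φ(tk)/k = 0 for all t, and the elementary argument of Mertens, which detects vanishing of L(1,χ), turns
-- this into φ(tc)φ(tcb) = φ(t)φ(tb): up to a constant, f is a quadratic character. If m = p is prime, then
-- f = 0, because the number of a with f(a) = f(1) would be odd (inversion fixes only 1 among them), whereas
-- orthogonality for j = 1 makes it even. For m = p², the function z ↦ F(uz) − F(z) with u ≡ 1 (mod p)
-- satisfies the hypotheses, so it takes the values ±κ on units; telescoping along 1, u, …, u^p ≡ 1 gives
-- κ = 0. Hence F(z) only depends on z mod p for p ∤ z, and the prime case shows F(pz) = −F(z). An
-- indecomposable β contains no pair b, −b, so F = 1 on β, and one element of β forces a whole β_i into β.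
module Submission where

-- All analysis takes place in ℚ, with explicit errors instead of limits: truncated lattice sums
-- stand in for π cot and π²/sin², and a completely additive function with rational values stands in
-- for the logarithm. No complex characters occur either; the argument of Mertens is applied
-- directly to an integer-valued function φ. If ∑ φ(tk)/k = 0 for all t, then ∑ Λ(N)φ(tN)/N over N ≤
-- x is -φ(t) log x + O(1), so where |φ| is maximal nearly all of the weight of prime powers must
-- reverse the sign. Integrality makes this exact: a class a modulo m either carries bounded weight
-- or satisfies φ(az) = -φ(z) for all z. Products φ(z)φ(zb) are then invariant under every heavy
-- class, and so are their differences under z ↦ cz, which have mean zero; such a function is forced
-- to vanish. Condition (3) concerns units t only, whereas the Eisenstein step needs every j. This
-- is the reason for passing to F(uz) - F(z), for which the relations at nonunits j hold
-- automatically.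

-- Finite sums over lists with values in a commutative ring

module Sums where

  open import Algebra.Structures using (IsCommutativeRing)
  open import Data.Empty using (⊥-elim)
  open import Data.List using (List; []; _∷_; _++_; map)
  open import Data.List.Membership.Propositional using (_∈_)
  open import Data.List.Relation.Unary.Any using (here; there)
  open import Data.List.Relation.Unary.All using (lookup)
  open import Data.List.Relation.Unary.AllPairs using (_∷_)
  open import Data.List.Relation.Unary.Unique.Propositional using (Unique)
  open import Relation.Binary.PropositionalEquality
    using (_≡_; refl; sym; trans; cong; cong₂; module ≡-Reasoning)
  open import Relation.Nullary using (Dec; yes; no; ¬_)

  module FiniteSums {R : Set} {_+_ _*_ : R → R → R} { -_ : R → R} {0# 1# : R}
    (isCommutativeRing : IsCommutativeRing (_≡_ {A = R}) _+_ _*_ -_ 0# 1#) where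

    open IsCommutativeRing isCommutativeRing
      using (+-assoc; +-comm; +-identityˡ; +-identityʳ; *-identityˡ; *-comm; distribˡ; zeroˡ; zeroʳ
            ; -‿inverseˡ; -‿inverseʳ)

    -- Abstract, so that sums over concrete lists do not unfold and unification can decompose them.
    abstract

      ∑ : {A : Set} → List A → (A → R) → R
      ∑ []       f = 0#
      ∑ (x ∷ xs) f = f x + ∑ xs f

      ∑-[] : ∀ {A : Set} (f : A → R) → ∑ [] f ≡ 0#
      ∑-[] f = refl

      ∑-∷ : ∀ {A : Set} x xs (f : A → R) → ∑ (x ∷ xs) f ≡ f x + ∑ xs f
      ∑-∷ x xs f = refl

    -- Side conditions enter sums as factors `χ`, so all sums run over fixed lists and can be
    -- interchanged by `∑-swap` whatever the conditions are.
    χ : {P : Set} → Dec P → R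
    χ (yes _) = 1#
    χ (no _)  = 0#

    private
      variable
        A B : Set
        P Q : Set

    interchange : ∀ a b c d → (a + b) + (c + d) ≡ (a + c) + (b + d)
    interchange a b c d = begin
      (a + b) + (c + d) ≡⟨ +-assoc a b (c + d) ⟩
      a + (b + (c + d)) ≡⟨ cong (a +_) (sym (+-assoc b c d)) ⟩
      a + ((b + c) + d) ≡⟨ cong (λ z → a + (z + d)) (+-comm b c) ⟩
      a + ((c + b) + d) ≡⟨ cong (a +_) (+-assoc c b d) ⟩
      a + (c + (b + d)) ≡⟨ sym (+-assoc a c (b + d)) ⟩
      (a + c) + (b + d) ∎
      where open ≡-Reasoning

    private
      neg-unique : ∀ a b → a + b ≡ 0# → - a ≡ b
      neg-unique a b eq = begin
        - a              ≡⟨ sym (+-identityʳ _) ⟩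
        (- a) + 0#       ≡⟨ cong ((- a) +_) (sym eq) ⟩
        (- a) + (a + b)  ≡⟨ sym (+-assoc (- a) a b) ⟩
        ((- a) + a) + b  ≡⟨ cong (_+ b) (-‿inverseˡ a) ⟩
        0# + b           ≡⟨ +-identityˡ b ⟩
        b ∎
        where open ≡-Reasoning

    abstract

      ∑-cong∈ : ∀ xs {f g : A → R} → (∀ {x} → x ∈ xs → f x ≡ g x) → ∑ xs f ≡ ∑ xs g
      ∑-cong∈ []       eq = refl
      ∑-cong∈ (x ∷ xs) eq = cong₂ _+_ (eq (here refl)) (∑-cong∈ xs (λ i → eq (there i)))

      ∑-cong : ∀ xs {f g : A → R} → (∀ x → f x ≡ g x) → ∑ xs f ≡ ∑ xs g
      ∑-cong xs eq = ∑-cong∈ xs (λ {x} _ → eq x)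

      ∑-zero : ∀ (xs : List A) → ∑ xs (λ _ → 0#) ≡ 0#
      ∑-zero []       = refl
      ∑-zero (x ∷ xs) = trans (+-identityˡ _) (∑-zero xs)

      ∑-zero∈ : ∀ (xs : List A) {f : A → R} → (∀ {x} → x ∈ xs → f x ≡ 0#) → ∑ xs f ≡ 0#
      ∑-zero∈ xs eq = trans (∑-cong∈ xs eq) (∑-zero xs)

      ∑-+ : ∀ xs (f g : A → R) → ∑ xs (λ x → f x + g x) ≡ ∑ xs f + ∑ xs g
      ∑-+ []       f g = sym (+-identityˡ 0#)
      ∑-+ (x ∷ xs) f g = trans (cong ((f x + g x) +_) (∑-+ xs f g)) (interchange _ _ _ _)

      ∑-*ˡ : ∀ xs c (f : A → R) → c * ∑ xs f ≡ ∑ xs (λ x → c * f x)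
      ∑-*ˡ []       c f = zeroʳ c
      ∑-*ˡ (x ∷ xs) c f = trans (distribˡ c _ _) (cong ((c * f x) +_) (∑-*ˡ xs c f))

      ∑-*ʳ : ∀ xs c (f : A → R) → ∑ xs f * c ≡ ∑ xs (λ x → f x * c)
      ∑-*ʳ xs c f = trans (*-comm _ c) (trans (∑-*ˡ xs c f) (∑-cong xs (λ x → *-comm c (f x))))

      ∑-neg : ∀ xs (f : A → R) → ∑ xs (λ x → - f x) ≡ - ∑ xs f
      ∑-neg xs f = sym (neg-unique _ _ (begin
        ∑ xs f + ∑ xs (λ x → - f x) ≡⟨ sym (∑-+ xs f (λ x → - f x)) ⟩
        ∑ xs (λ x → f x + (- f x))  ≡⟨ ∑-cong xs (λ x → -‿inverseʳ (f x)) ⟩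
        ∑ xs (λ _ → 0#)             ≡⟨ ∑-zero xs ⟩
        0# ∎))
        where open ≡-Reasoning

      ∑-swap : ∀ xs ys (f : A → B → R) →
        ∑ xs (λ x → ∑ ys (f x)) ≡ ∑ ys (λ y → ∑ xs (λ x → f x y))
      ∑-swap []       ys f = sym (∑-zero ys)
      ∑-swap (x ∷ xs) ys f =
        trans (cong (∑ ys (f x) +_) (∑-swap xs ys f)) (sym (∑-+ ys (f x) _))

      ∑-++ : ∀ xs ys (f : A → R) → ∑ (xs ++ ys) f ≡ ∑ xs f + ∑ ys f
      ∑-++ []       ys f = sym (+-identityˡ _)
      ∑-++ (x ∷ xs) ys f = trans (cong (f x +_) (∑-++ xs ys f)) (sym (+-assoc _ _ _))

      ∑-map : ∀ (h : A → B) xs (f : B → R) → ∑ (map h xs) f ≡ ∑ xs (λ x → f (h x))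
      ∑-map h []       f = refl
      ∑-map h (x ∷ xs) f = cong (f (h x) +_) (∑-map h xs f)

      ∑-*-∑ : ∀ xs ys (f : A → R) (g : B → R) →
        ∑ xs f * ∑ ys g ≡ ∑ xs (λ x → ∑ ys (λ y → f x * g y))
      ∑-*-∑ xs ys f g = trans (∑-*ʳ xs _ f) (∑-cong xs (λ x → ∑-*ˡ ys (f x) g))

    χ-yes : (d : Dec P) → P → χ d ≡ 1#
    χ-yes (yes _) _ = refl
    χ-yes (no ¬p) p = ⊥-elim (¬p p)

    χ-no : (d : Dec P) → ¬ P → χ d ≡ 0#
    χ-no (yes p) ¬p = ⊥-elim (¬p p)
    χ-no (no _)  _  = refl

    χ-⇔ : (d : Dec P) (e : Dec Q) → (P → Q) → (Q → P) → χ d ≡ χ e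
    χ-⇔ (yes p) e f g = sym (χ-yes e (f p))
    χ-⇔ (no ¬p) e f g = sym (χ-no e (λ q → ¬p (g q)))

    χ-cong : (d : Dec P) {a b : R} → (P → a ≡ b) → χ d * a ≡ χ d * b
    χ-cong (yes p) eq = cong (1# *_) (eq p)
    χ-cong (no _)  eq = trans (zeroˡ _) (sym (zeroˡ _))

    χ-1 : (d : Dec P) → P → ∀ a → χ d * a ≡ a
    χ-1 d p a = trans (cong (_* a) (χ-yes d p)) (*-identityˡ a)

    χ-0 : (d : Dec P) → ¬ P → ∀ a → χ d * a ≡ 0#
    χ-0 d ¬p a = trans (cong (_* a) (χ-no d ¬p)) (zeroˡ a)

    ∑-none : {P : A → Set} (P? : ∀ x → Dec (P x)) (f : A → R) → ∀ xs →
      (∀ {x} → x ∈ xs → ¬ P x) → ∑ xs (λ x → χ (P? x) * f x) ≡ 0#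
    ∑-none P? f xs none = ∑-zero∈ xs (λ {x} i → χ-0 (P? x) (none i) (f x))

    abstract

      -- The sifting rule for a condition with a unique solution. Inserting such a sum and applying
      -- `∑-swap` is the standard way here to change a summation variable.
      ∑-one : {P : A → Set} (P? : ∀ x → Dec (P x)) (f : A → R) → ∀ {xs y} →
        Unique xs → y ∈ xs → P y → (∀ {x} → x ∈ xs → P x → x ≡ y) →
        ∑ xs (λ x → χ (P? x) * f x) ≡ f y
      ∑-one P? f {x ∷ xs} (x∉ ∷ u) (here refl) py only = trans
        (cong₂ _+_ (χ-1 (P? x) py (f x))
          (∑-none P? f xs (λ i pz → lookup x∉ i (sym (only (there i) pz)))))
        (+-identityʳ (f x))
      ∑-one {P = P} P? f {x ∷ xs} {y} (x∉ ∷ u) (there y∈) py only = trans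
        (cong₂ _+_ (χ-0 (P? x) (λ px → lookup x∉ y∈ (only (here refl) px)) (f x))
          (∑-one P? f u y∈ py (λ i → only (there i))))
        (+-identityˡ (f y))

-- Rational arithmetic: integers, reciprocals, absolute values and sums in ℚ

module Rat where

  open import Data.Integer as ℤ using (ℤ; +_; -[1+_])
  import Data.Integer.Properties as ℤₚ
  import Data.Integer.Tactic.RingSolver as ℤSolver
  open import Data.Empty using (⊥-elim)
  open import Data.List using (List; []; _∷_; length)
  open import Data.List.Membership.Propositional using (_∈_)
  open import Data.List.Relation.Unary.Any using (here; there)
  open import Data.Nat as ℕ using (ℕ; zero; suc)
  import Data.Nat.Coprimality as Coprimality
  import Data.Nat.Properties as ℕₚ
  open import Data.Product using (∃; _,_)
  open import Data.Rational hiding (_/_)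
  open import Data.Rational.Properties
  import Data.Rational.Unnormalised as ℚᵘ
  import Data.Rational.Unnormalised.Properties as ℚᵘₚ
  open import Data.Sum using (inj₁; inj₂)
  open import Level using (0ℓ)
  open import Relation.Binary.PropositionalEquality
    using (_≡_; _≢_; refl; sym; trans; cong; cong₂; subst; subst₂)
  open import Relation.Nullary using (Dec; yes; no; ¬_)
  open import Relation.Nullary.Decidable using (dec⇒maybe)
  open import Tactic.RingSolver using (solve-∀)
  open import Tactic.RingSolver.Core.AlmostCommutativeRing
    using (AlmostCommutativeRing; fromCommutativeRing)
  open Sums

  open FiniteSums +-*-isCommutativeRing public

  ℚring : AlmostCommutativeRing 0ℓ 0ℓ
  ℚring = fromCommutativeRing +-*-commutativeRing (λ x → dec⇒maybe (0ℚ ≟ x))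

  2ℚ : ℚ
  2ℚ = 1ℚ + 1ℚ

  -- Abstract, so that arithmetic on literals does not unfold during type checking.
  abstract

    ι : ℤ → ℚ
    ι z = mkℚ z 0 (Coprimality.sym (Coprimality.1-coprimeTo ℤ.∣ z ∣))

    ι-+ : ∀ a b → ι (a ℤ.+ b) ≡ ι a + ι b
    ι-+ a b = toℚᵘ-injective (ℚᵘₚ.≃-trans (ℚᵘ.*≡* (eq a b)) (ℚᵘₚ.≃-sym (toℚᵘ-homo-+ (ι a) (ι b))))
      where
      eq : ∀ a b → (a ℤ.+ b) ℤ.* + 1 ≡ (a ℤ.* + 1 ℤ.+ b ℤ.* + 1) ℤ.* + 1
      eq = ℤSolver.solve-∀

    ι-* : ∀ a b → ι (a ℤ.* b) ≡ ι a * ι b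
    ι-* a b = toℚᵘ-injective (ℚᵘₚ.≃-trans (ℚᵘ.*≡* refl) (ℚᵘₚ.≃-sym (toℚᵘ-homo-* (ι a) (ι b))))

    ι-neg : ∀ a → ι (ℤ.- a) ≡ - ι a
    ι-neg a = toℚᵘ-injective (ℚᵘₚ.≃-trans (ℚᵘ.*≡* refl) (ℚᵘₚ.≃-sym (toℚᵘ-homo‿- (ι a))))

    ι-0 : ι (+ 0) ≡ 0ℚ
    ι-0 = refl

    ι-1 : ι (+ 1) ≡ 1ℚ
    ι-1 = refl

    ι-injective : ∀ {a b} → ι a ≡ ι b → a ≡ b
    ι-injective = cong ↥_

    ι-mono-≤ : ∀ {a b} → a ℤ.≤ b → ι a ≤ ι b
    ι-mono-≤ {a} {b} a≤b = *≤* (subst₂ ℤ._≤_ (sym (ℤₚ.*-identityʳ a)) (sym (ℤₚ.*-identityʳ b)) a≤b)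

    ι-cancel-≤ : ∀ {a b} → ι a ≤ ι b → a ℤ.≤ b
    ι-cancel-≤ {a} {b} (*≤* a≤b) = subst₂ ℤ._≤_ (ℤₚ.*-identityʳ a) (ℤₚ.*-identityʳ b) a≤b

    ∣ι∣ : ∀ z → ∣ ι z ∣ ≡ ι (+ ℤ.∣ z ∣)
    ∣ι∣ z = refl

    -- The reciprocal of a natural number, with 1/0 = 0.
    rec : ℕ → ℚ
    rec zero    = 0ℚ
    rec (suc n) = mkℚ (+ 1) n (Coprimality.1-coprimeTo (suc n))

    rec-0 : rec 0 ≡ 0ℚ
    rec-0 = refl

    rec-1 : rec 1 ≡ 1ℚ
    rec-1 = refl

    0≤rec : ∀ n → 0ℚ ≤ rec n
    0≤rec zero    = ≤-refl
    0≤rec (suc n) = nonNegative⁻¹ (rec (suc n))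

    ι*rec : ∀ n → ι (+ suc n) * rec (suc n) ≡ 1ℚ
    ι*rec n = toℚᵘ-injective (ℚᵘₚ.≃-trans (toℚᵘ-homo-* (ι (+ suc n)) (rec (suc n)))
      (ℚᵘ.*≡* (trans (ℤₚ.*-identityʳ _) (trans (ℤₚ.*-identityʳ _)
        (sym (trans (ℤₚ.*-identityˡ _) (cong +_ (ℕₚ.+-identityʳ (suc n)))))))))

    ι-≤-scale : ∀ {p q} n → ι (+ suc n) * p ≤ ι (+ suc n) * q → p ≤ q
    ι-≤-scale n le = *-cancelˡ-≤-pos (ι (+ suc n)) le

    ι-archimedean : ∀ p → ∃ λ n → p ≤ ι (+ n)
    ι-archimedean p@(mkℚ (+ n) d _)    = n , *≤* (ℤₚ.≤-trans (ℤₚ.≤-reflexive (ℤₚ.*-identityʳ (+ n)))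
      (subst (+ n ℤ.≤_) (ℤₚ.pos-* n (suc d)) (ℤ.+≤+ (ℕₚ.m≤m*n n (suc d)))))
    ι-archimedean p@(mkℚ -[1+ n ] d _) = 0 , <⇒≤ (negative⁻¹ p)

  ν : ℕ → ℚ
  ν n = ι (+ n)

  ν*rec : ∀ n → ν (suc n) * rec (suc n) ≡ 1ℚ
  ν*rec = ι*rec

  archimedean : ∀ p → ∃ λ n → p ≤ ν n
  archimedean = ι-archimedean

  ≤-scale : ∀ {p q} n → ν (suc n) * p ≤ ν (suc n) * q → p ≤ q
  ≤-scale = ι-≤-scale

  ≤-respˡ : ∀ {a b c} → a ≡ b → a ≤ c → b ≤ c
  ≤-respˡ refl le = le

  ≤-respʳ : ∀ {a b c} → b ≡ c → a ≤ b → a ≤ c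
  ≤-respʳ refl le = le

  ν-+ : ∀ a b → ν (a ℕ.+ b) ≡ ν a + ν b
  ν-+ a b = ι-+ (+ a) (+ b)

  ν-* : ∀ a b → ν (a ℕ.* b) ≡ ν a * ν b
  ν-* a b = trans (cong ι (ℤₚ.pos-* a b)) (ι-* (+ a) (+ b))

  ν-suc : ∀ n → ν (suc n) ≡ 1ℚ + ν n
  ν-suc n = trans (ν-+ 1 n) (cong (_+ ν n) ι-1)

  ν-mono-≤ : ∀ {a b} → a ℕ.≤ b → ν a ≤ ν b
  ν-mono-≤ a≤b = ι-mono-≤ (ℤ.+≤+ a≤b)

  0≤ν : ∀ n → 0ℚ ≤ ν n
  0≤ν n = ≤-respˡ ι-0 (ν-mono-≤ ℕ.z≤n)

  0≤1 : 0ℚ ≤ 1ℚ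
  0≤1 = subst₂ _≤_ ι-0 ι-1 (ν-mono-≤ ℕ.z≤n)

  zero-*ˡ : ∀ {x} a → x ≡ 0ℚ → x * a ≡ 0ℚ
  zero-*ˡ a refl = *-zeroˡ a

  zero-*ʳ : ∀ a {x} → x ≡ 0ℚ → a * x ≡ 0ℚ
  zero-*ʳ a refl = *-zeroʳ a

  zero-+ˡ : ∀ {x y z} → x ≡ 0ℚ → y ≡ z → x + y ≡ z
  zero-+ˡ {y = y} refl refl = +-identityˡ y

  zero-+ʳ : ∀ {x y z} → x ≡ z → y ≡ 0ℚ → x + y ≡ z
  zero-+ʳ {x = x} refl refl = +-identityʳ x

  1≰0 : ¬ (1ℚ ≤ 0ℚ)
  1≰0 le = <-irrefl refl (<-≤-trans (positive⁻¹ 1ℚ) le)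

  +-nonNeg : ∀ {a b} → 0ℚ ≤ a → 0ℚ ≤ b → 0ℚ ≤ a + b
  +-nonNeg 0≤a 0≤b = ≤-respˡ (+-identityʳ 0ℚ) (+-mono-≤ 0≤a 0≤b)

  *-monoʳ : ∀ {c a b} → 0ℚ ≤ c → a ≤ b → c * a ≤ c * b
  *-monoʳ {c} 0≤c a≤b = *-monoˡ-≤-nonNeg c {{nonNegative 0≤c}} a≤b

  *-monoˡ : ∀ {c a b} → 0ℚ ≤ c → a ≤ b → a * c ≤ b * c
  *-monoˡ {c} 0≤c a≤b = *-monoʳ-≤-nonNeg c {{nonNegative 0≤c}} a≤b

  *-nonNeg : ∀ {a b} → 0ℚ ≤ a → 0ℚ ≤ b → 0ℚ ≤ a * b
  *-nonNeg {a} 0≤a 0≤b = ≤-respˡ (*-zeroʳ a) (*-monoʳ 0≤a 0≤b)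

  *-mono : ∀ {a b c d} → 0ℚ ≤ a → a ≤ b → 0ℚ ≤ c → c ≤ d → a * c ≤ b * d
  *-mono 0≤a a≤b 0≤c c≤d = ≤-trans (*-monoˡ 0≤c a≤b) (*-monoʳ (≤-trans 0≤a a≤b) c≤d)

  p≤q+p : ∀ {p q} → 0ℚ ≤ q → p ≤ q + p
  p≤q+p {p} 0≤q = ≤-respˡ (+-identityˡ p) (+-monoˡ-≤ p 0≤q)

  p≤p+q : ∀ {p q} → 0ℚ ≤ q → p ≤ p + q
  p≤p+q {p} 0≤q = ≤-respˡ (+-identityʳ p) (+-monoʳ-≤ p 0≤q)

  p≤q⇒0≤q-p : ∀ {p q} → p ≤ q → 0ℚ ≤ q - p
  p≤q⇒0≤q-p {p} p≤q = ≤-respˡ (+-inverseʳ p) (+-monoˡ-≤ (- p) p≤q)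

  ≤-from-diff : ∀ {p q} d → q - p ≡ d → 0ℚ ≤ d → p ≤ q
  ≤-from-diff {p} {q} d eq 0≤d =
    subst₂ _≤_ (+-identityˡ p) (lemma q p) (+-monoˡ-≤ p (subst (0ℚ ≤_) (sym eq) 0≤d))
    where
    lemma : ∀ q p → q - p + p ≡ q
    lemma = solve-∀ ℚring

  ≡-scale : ∀ {p q} n → ν (suc n) * p ≡ ν (suc n) * q → p ≡ q
  ≡-scale n eq = ≤-antisym (≤-scale n (≤-reflexive eq)) (≤-scale n (≤-reflexive (sym eq)))

  rec-* : ∀ a b → rec (a ℕ.* b) ≡ rec a * rec b
  rec-* zero    b       = trans rec-0 (sym (trans (cong (_* rec b) rec-0) (*-zeroˡ (rec b))))
  rec-* (suc a) zero    = trans (cong rec (ℕₚ.*-zeroʳ a)) (trans rec-0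
    (sym (trans (cong (rec (suc a) *_) rec-0) (*-zeroʳ (rec (suc a))))))
  rec-* (suc a) (suc b) = ≡-scale (b ℕ.+ a ℕ.* suc b) (trans (ν*rec (b ℕ.+ a ℕ.* suc b)) (sym (begin
    ν (suc a ℕ.* suc b) * (rec (suc a) * rec (suc b))
      ≡⟨ cong (_* (rec (suc a) * rec (suc b))) (ν-* (suc a) (suc b)) ⟩
    ν (suc a) * ν (suc b) * (rec (suc a) * rec (suc b))
      ≡⟨ lemma (ν (suc a)) (ν (suc b)) (rec (suc a)) (rec (suc b)) ⟩
    (ν (suc a) * rec (suc a)) * (ν (suc b) * rec (suc b))
      ≡⟨ cong₂ _*_ (ν*rec a) (ν*rec b) ⟩
    1ℚ * 1ℚ ≡⟨⟩
    1ℚ ∎)))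
    where
    open Relation.Binary.PropositionalEquality.≡-Reasoning
    lemma : ∀ a b c d → a * b * (c * d) ≡ (a * c) * (b * d)
    lemma = solve-∀ ℚring

  rec-anti : ∀ {a b} → a ℕ.≤ b → rec (suc b) ≤ rec (suc a)
  rec-anti {a} {b} a≤b = ≤-scale a (≤-respʳ (sym (ν*rec a))
    (≤-respʳ (ν*rec b) (*-monoˡ (0≤rec (suc b)) (ν-mono-≤ (ℕ.s≤s a≤b)))))

  -- Makes 1/(n(n + 1)) telescope; this serves for the sum of reciprocal squares and for the
  -- variation of (log n)/n.
  rec-diff : ∀ n → rec (suc n) - rec (suc (suc n)) ≡ rec (suc n) * rec (suc (suc n))
  rec-diff n = begin
    a - b                            ≡⟨ sym (cong₂ _-_ (*-identityʳ a) (*-identityʳ b)) ⟩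
    a * 1ℚ - b * 1ℚ                  ≡⟨ sym (cong₂ (λ s t → a * s - b * t) (ν*rec (suc n)) (ν*rec n)) ⟩
    a * (ν (suc (suc n)) * b) - b * (ν (suc n) * a)
      ≡⟨ cong (λ t → a * (t * b) - b * (ν (suc n) * a)) (ν-suc (suc n)) ⟩
    a * ((1ℚ + ν (suc n)) * b) - b * (ν (suc n) * a)
      ≡⟨ lemma a b (ν (suc n)) ⟩
    a * b                            ∎
    where
    open Relation.Binary.PropositionalEquality.≡-Reasoning
    a = rec (suc n)
    b = rec (suc (suc n))
    lemma : ∀ a b A → a * ((1ℚ + A) * b) - b * (A * a) ≡ a * b
    lemma = solve-∀ ℚring

  -- The multiplicative inverse, with 1/0 = 0.
  recip : ℚ → ℚ
  recip p with p ≟ 0ℚ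
  ... | yes _  = 0ℚ
  ... | no p≢0 = (1/ p) {{≢-nonZero p≢0}}

  *-recip : ∀ {p} → p ≢ 0ℚ → p * recip p ≡ 1ℚ
  *-recip {p} p≢0 with p ≟ 0ℚ
  ... | yes p≡0 = ⊥-elim (p≢0 p≡0)
  ... | no p≢0′ = *-inverseʳ p {{≢-nonZero p≢0′}}

  0≤recip : ∀ {p} → 0ℚ ≤ p → 0ℚ ≤ recip p
  0≤recip {p} 0≤p with p ≟ 0ℚ
  ... | yes _  = ≤-refl
  ... | no p≢0 = <⇒≤ (positive⁻¹ ((1/ p) {{≢-nonZero p≢0}})
      {{1/pos⇒pos p {{positive (≰⇒> (λ p≤0 → p≢0 (≤-antisym p≤0 0≤p)))}}}})

  -- The final step whenever a sum of an odd function over all residues is shown to vanish.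
  self-negative : ∀ {p} → p ≡ - p → p ≡ 0ℚ
  self-negative {p} eq = ≡-scale 1 (trans (cong (_* p) (trans (ν-suc 1) (cong (_+_ 1ℚ) ι-1)))
    (trans (trans (lemma p) (trans (cong (_+_ p) eq) (+-inverseʳ p))) (sym (*-zeroʳ (ν 2)))))
    where
    lemma : ∀ p → (1ℚ + 1ℚ) * p ≡ p + p
    lemma = solve-∀ ℚring

  rec≤1 : ∀ n → rec n ≤ 1ℚ
  rec≤1 zero    = ≤-respˡ (sym rec-0) 0≤1
  rec≤1 (suc n) = ≤-respʳ rec-1 (rec-anti {0} {n} ℕ.z≤n)

  p≤∣p∣ : ∀ p → p ≤ ∣ p ∣
  p≤∣p∣ p with ≤-total 0ℚ p
  ... | inj₁ 0≤p = ≤-reflexive (sym (0≤p⇒∣p∣≡p 0≤p))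
  ... | inj₂ p≤0 = ≤-trans p≤0 (0≤∣p∣ p)

  -p≤∣p∣ : ∀ p → - p ≤ ∣ p ∣
  -p≤∣p∣ p = subst (- p ≤_) (∣-p∣≡∣p∣ p) (p≤∣p∣ (- p))

  ∣+∣≤ : ∀ {p q b c} → ∣ p ∣ ≤ b → ∣ q ∣ ≤ c → ∣ p + q ∣ ≤ b + c
  ∣+∣≤ {p} {q} p≤ q≤ = ≤-trans (∣p+q∣≤∣p∣+∣q∣ p q) (+-mono-≤ p≤ q≤)

  ∣-∣≤ : ∀ {p q b c} → ∣ p ∣ ≤ b → ∣ q ∣ ≤ c → ∣ p - q ∣ ≤ b + c
  ∣-∣≤ {p} {q} p≤ q≤ = ∣+∣≤ p≤ (≤-respˡ (sym (∣-p∣≡∣p∣ q)) q≤)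

  ∣*∣≤ : ∀ {p q b c} → ∣ p ∣ ≤ b → ∣ q ∣ ≤ c → ∣ p * q ∣ ≤ b * c
  ∣*∣≤ {p} {q} p≤ q≤ =
    ≤-respˡ (sym (∣p*q∣≡∣p∣*∣q∣ p q)) (*-mono (0≤∣p∣ p) p≤ (0≤∣p∣ q) q≤)

  ∣*∣ˡ : ∀ {c} p → 0ℚ ≤ c → ∣ c * p ∣ ≡ c * ∣ p ∣
  ∣*∣ˡ {c} p 0≤c = trans (∣p*q∣≡∣p∣*∣q∣ c p) (cong (_* ∣ p ∣) (0≤p⇒∣p∣≡p 0≤c))

  ∣*∣ˡ≤ : ∀ {c p b} → 0ℚ ≤ c → ∣ p ∣ ≤ b → ∣ c * p ∣ ≤ c * b
  ∣*∣ˡ≤ {c} {p} 0≤c p≤ = ≤-respˡ (sym (∣*∣ˡ p 0≤c)) (*-monoʳ 0≤c p≤)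

  ∣∣≤⇒0≤ : ∀ {p b} → ∣ p ∣ ≤ b → 0ℚ ≤ b
  ∣∣≤⇒0≤ {p} = ≤-trans (0≤∣p∣ p)

  private
    variable
      A : Set
      P Q : Set

  0≤χ : (d : Dec P) → 0ℚ ≤ χ d
  0≤χ (yes _) = 0≤1
  0≤χ (no _)  = ≤-refl

  χ≤1 : (d : Dec P) → χ d ≤ 1ℚ
  χ≤1 (yes _) = ≤-refl
  χ≤1 (no _)  = 0≤1

  χ*≤ : (d : Dec P) {a : ℚ} → 0ℚ ≤ a → χ d * a ≤ a
  χ*≤ d {a} 0≤a = subst (χ d * a ≤_) (*-identityˡ a) (*-monoˡ 0≤a (χ≤1 d))

  ∑-mono∈ : ∀ (xs : List A) {f g} → (∀ {x} → x ∈ xs → f x ≤ g x) → ∑ xs f ≤ ∑ xs g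
  ∑-mono∈ []       {f} {g} le = ≤-reflexive (trans (∑-[] f) (sym (∑-[] g)))
  ∑-mono∈ (x ∷ xs) {f} {g} le = subst₂ _≤_ (sym (∑-∷ x xs f)) (sym (∑-∷ x xs g))
    (+-mono-≤ (le (here refl)) (∑-mono∈ xs (λ i → le (there i))))

  ∑-mono : ∀ (xs : List A) {f g} → (∀ x → f x ≤ g x) → ∑ xs f ≤ ∑ xs g
  ∑-mono xs le = ∑-mono∈ xs (λ {x} _ → le x)

  ∑-nonNeg : ∀ (xs : List A) {f} → (∀ {x} → x ∈ xs → 0ℚ ≤ f x) → 0ℚ ≤ ∑ xs f
  ∑-nonNeg xs le = ≤-respˡ (∑-zero xs) (∑-mono∈ xs le)

  ∣∑∣≤∑ : ∀ (xs : List A) {f g} → (∀ {x} → x ∈ xs → ∣ f x ∣ ≤ g x) → ∣ ∑ xs f ∣ ≤ ∑ xs g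
  ∣∑∣≤∑ []       {f} {g} le = ≤-reflexive (trans (cong ∣_∣ (∑-[] f)) (sym (∑-[] g)))
  ∣∑∣≤∑ (x ∷ xs) {f} {g} le = subst₂ (λ p q → ∣ p ∣ ≤ q) (sym (∑-∷ x xs f)) (sym (∑-∷ x xs g))
    (∣+∣≤ (le (here refl)) (∣∑∣≤∑ xs (λ i → le (there i))))

  ∑-const : ∀ (xs : List A) c → ∑ xs (λ _ → c) ≡ ν (length xs) * c
  ∑-const []       c = trans (∑-[] (λ _ → c)) (sym (zero-*ˡ c ι-0))
  ∑-const (x ∷ xs) c = trans (∑-∷ x xs (λ _ → c)) (trans (cong (_+_ c) (∑-const xs c))
    (trans (lemma c (ν (length xs))) (cong (_* c) (sym (ν-suc (length xs))))))
    where
    lemma : ∀ c n → c + n * c ≡ (1ℚ + n) * c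
    lemma = solve-∀ ℚring

  term≤∑ : ∀ (xs : List A) {f y} → (∀ {x} → x ∈ xs → 0ℚ ≤ f x) → y ∈ xs → f y ≤ ∑ xs f
  term≤∑ (x ∷ xs) {f} le (here refl) = ≤-respʳ (sym (∑-∷ x xs f)) (p≤p+q (∑-nonNeg xs (λ i → le (there i))))
  term≤∑ (x ∷ xs) {f} le (there i)   = ≤-respʳ (sym (∑-∷ x xs f))
    (≤-trans (term≤∑ xs (λ j → le (there j)) i) (p≤q+p (le (here refl))))

-- Initial segments of the positive integers

module Ranges where

  open import Data.List using (List; map; downFrom; length)
  open import Data.List.Properties using (length-downFrom; length-map)
  open import Data.List.Membership.Propositional using (_∈_)
  open import Data.List.Membership.Propositional.Properties using (∈-downFrom⁺; ∈-downFrom⁻; ∈-map⁺; ∈-map⁻)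
  open import Data.List.Relation.Unary.Unique.Propositional using (Unique)
  open import Data.List.Relation.Unary.Unique.Propositional.Properties using (downFrom⁺; map⁺)
  open import Data.Nat using (ℕ; suc; _≤_; s≤s; z≤n)
  open import Data.Nat.Properties using (suc-injective)
  open import Data.Product using (_×_; _,_)
  open import Relation.Binary.PropositionalEquality using (_≡_; refl; trans)

  range : ℕ → List ℕ
  range n = map suc (downFrom n)

  range-unique : ∀ n → Unique (range n)
  range-unique n = map⁺ suc-injective (downFrom⁺ n)

  ∈-range⁺ : ∀ {n k} → 1 ≤ k → k ≤ n → k ∈ range n
  ∈-range⁺ {k = suc k} _ k<n = ∈-map⁺ suc (∈-downFrom⁺ k<n)

  ∈-range⁻ : ∀ {n k} → k ∈ range n → 1 ≤ k × k ≤ n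
  ∈-range⁻ k∈ with ∈-map⁻ suc k∈
  ... | j , j∈ , refl = s≤s z≤n , ∈-downFrom⁻ j∈

  length-range : ∀ n → length (range n) ≡ n
  length-range n = trans (length-map suc (downFrom n)) (length-downFrom n)

-- Congruences modulo m, periodic functions and units

module Mod where

  open import Data.Integer as ℤ using (ℤ; +_; _+_; _*_; -_; _-_)
  import Data.Integer.Properties as ℤₚ
  import Data.Integer.DivMod as ℤ
  open import Data.Integer.Divisibility.Signed using (_∣_; divides; ∣⇒∣ᵤ; _∣?_)
  open import Data.Integer.Tactic.RingSolver using (solve-∀)
  open import Data.List using (List; downFrom)
  open import Data.List.Membership.Propositional.Properties using (∈-downFrom⁺; ∈-downFrom⁻)
  open import Data.List.Relation.Unary.Unique.Propositional.Properties using (downFrom⁺)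
  open import Data.Nat as ℕ using (ℕ; NonZero)
  import Data.Nat.Properties as ℕₚ
  import Data.Nat.Divisibility as ℕ
  open import Data.Product using (_,_)
  open import Data.Rational using (ℚ) renaming (_*_ to _·_)
  open import Data.Sum using (inj₁; inj₂)
  open import Data.Empty using (⊥-elim)
  open import Relation.Binary.PropositionalEquality
    using (_≡_; refl; sym; trans; cong; cong₂; subst; subst₂; module ≡-Reasoning)
  open import Relation.Nullary using (Dec; yes; no; ¬_)
  open import Relation.Nullary.Decidable using (map′)
  open Rat using (∑; χ; ∑-cong; ∑-swap; ∑-one; χ-⇔)

  module Modulo (m : ℕ) .{{m≢0 : NonZero m}} where

    infix 4 _~_ _~?_

    -- A record and not an abbreviation for divisibility of a - b, so that a and b can be inferred
    -- from a proof of `a ~ b`.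
    record _~_ (a b : ℤ) : Set where
      constructor mk~
      field
        divisible : (+ m) ∣ (a - b)

    open _~_ public

    _~?_ : ∀ a b → Dec (a ~ b)
    a ~? b = map′ mk~ divisible ((+ m) ∣? (a - b))

    private
      combine : ∀ {a b c : ℤ} {q} → a ≡ b → b ≡ q * + m → c ≡ a → (+ m) ∣ c
      combine {q = q} refl e refl = divides q e

    ~-reflexive : ∀ {a b} → a ≡ b → a ~ b
    ~-reflexive {a} refl = mk~ (divides (+ 0) (ℤₚ.+-inverseʳ a))

    ~-refl : ∀ {a} → a ~ a
    ~-refl = ~-reflexive refl

    ~-sym : ∀ {a b} → a ~ b → b ~ a
    ~-sym {a} {b} (mk~ (divides q e)) = mk~ (divides (- q) (begin
      b - a          ≡⟨ lemma a b ⟩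
      - (a - b)      ≡⟨ cong -_ e ⟩
      - (q * + m)    ≡⟨ ℤₚ.neg-distribˡ-* q (+ m) ⟩
      - q * + m      ∎))
      where
      open ≡-Reasoning
      lemma : ∀ a b → b - a ≡ - (a - b)
      lemma = solve-∀

    ~-trans : ∀ {a b c} → a ~ b → b ~ c → a ~ c
    ~-trans {a} {b} {c} (mk~ (divides q e)) (mk~ (divides r f)) = mk~ (divides (q + r) (begin
      a - c                ≡⟨ lemma a b c ⟩
      (a - b) + (b - c)    ≡⟨ cong₂ _+_ e f ⟩
      q * + m + r * + m    ≡⟨ sym (ℤₚ.*-distribʳ-+ (+ m) q r) ⟩
      (q + r) * + m        ∎))
      where
      open ≡-Reasoning
      lemma : ∀ a b c → a - c ≡ (a - b) + (b - c)
      lemma = solve-∀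

    ~-+ : ∀ {a b c d} → a ~ b → c ~ d → a + c ~ b + d
    ~-+ {a} {b} {c} {d} (mk~ (divides q e)) (mk~ (divides r f)) = mk~ (divides (q + r) (begin
      a + c - (b + d)      ≡⟨ lemma a b c d ⟩
      (a - b) + (c - d)    ≡⟨ cong₂ _+_ e f ⟩
      q * + m + r * + m    ≡⟨ sym (ℤₚ.*-distribʳ-+ (+ m) q r) ⟩
      (q + r) * + m        ∎))
      where
      open ≡-Reasoning
      lemma : ∀ a b c d → a + c - (b + d) ≡ (a - b) + (c - d)
      lemma = solve-∀

    ~-* : ∀ {a b c d} → a ~ b → c ~ d → a * c ~ b * d
    ~-* {a} {b} {c} {d} (mk~ (divides q e)) (mk~ (divides r f)) = mk~ (divides (a * r + q * d) (begin
      a * c - b * d                  ≡⟨ lemma a b c d ⟩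
      a * (c - d) + (a - b) * d      ≡⟨ cong₂ (λ x y → a * x + y * d) f e ⟩
      a * (r * + m) + q * + m * d    ≡⟨ lemma′ a r (+ m) q d ⟩
      (a * r + q * d) * + m          ∎))
      where
      open ≡-Reasoning
      lemma : ∀ a b c d → a * c - b * d ≡ a * (c - d) + (a - b) * d
      lemma = solve-∀
      lemma′ : ∀ a r m q d → a * (r * m) + q * m * d ≡ (a * r + q * d) * m
      lemma′ = solve-∀

    ~-neg : ∀ {a b} → a ~ b → - a ~ - b
    ~-neg {a} {b} e = subst₂ _~_ (ℤₚ.-1*i≡-i a) (ℤₚ.-1*i≡-i b) (~-* (~-refl {ℤ.-1ℤ}) e)

    ~-*ˡ : ∀ c {a b} → a ~ b → c * a ~ c * b
    ~-*ˡ c = ~-* (~-refl {c})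

    ~-*ʳ : ∀ c {a b} → a ~ b → a * c ~ b * c
    ~-*ʳ c e = ~-* e (~-refl {c})

    m~0 : + m ~ + 0
    m~0 = mk~ (divides (+ 1) (trans (ℤₚ.+-identityʳ (+ m)) (sym (ℤₚ.*-identityˡ (+ m)))))

    ⌊_⌋ : ℤ → ℕ
    ⌊ z ⌋ = z ℤ.%ℕ m

    ⌊⌋<m : ∀ z → ⌊ z ⌋ ℕ.< m
    ⌊⌋<m z = ℤ.n%ℕd<d z m

    ~⌊⌋ : ∀ z → z ~ + ⌊ z ⌋
    ~⌊⌋ z = mk~ (divides (z ℤ./ℕ m) (begin
      z - r                  ≡⟨ cong (_- r) (ℤ.a≡a%ℕn+[a/ℕn]*n z m) ⟩
      (r + q * + m) - r      ≡⟨ lemma r (q * + m) ⟩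
      q * + m                ∎))
      where
      open ≡-Reasoning
      q = z ℤ./ℕ m
      r = + ⌊ z ⌋
      lemma : ∀ r x → (r + x) - r ≡ x
      lemma = solve-∀

    private
      small-unique : ∀ {a b} → a ℕ.≤ b → b ℕ.< m → + b ~ + a → a ≡ b
      small-unique {a} {b} a≤b b<m (mk~ d) = ℕₚ.≤-antisym a≤b (ℕₚ.m∸n≡0⇒m≤n (zero-diff (b ℕ.∸ a)
          (subst (m ℕ.∣_) (cong ℤ.∣_∣ (ℤₚ.⊖-≥ a≤b)) (∣⇒∣ᵤ (subst ((+ m) ∣_) (ℤₚ.m-n≡m⊖n b a) d)))
          (ℕₚ.≤-<-trans (ℕₚ.m∸n≤m b a) b<m)))
        where
        zero-diff : ∀ c → m ℕ.∣ c → c ℕ.< m → c ≡ 0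
        zero-diff ℕ.zero    _ _   = refl
        zero-diff (ℕ.suc c) d c<m = ⊥-elim (ℕ.>⇒∤ c<m d)

    residue-unique : ∀ {a b} → a ℕ.< m → b ℕ.< m → + a ~ + b → a ≡ b
    residue-unique {a} {b} a<m b<m e with ℕₚ.≤-total a b
    ... | inj₁ a≤b = small-unique a≤b b<m (~-sym e)
    ... | inj₂ b≤a = sym (small-unique b≤a a<m e)

    ⌊⌋-cong : ∀ {a b} → a ~ b → ⌊ a ⌋ ≡ ⌊ b ⌋
    ⌊⌋-cong {a} {b} e = residue-unique (⌊⌋<m a) (⌊⌋<m b) (~-trans (~-sym (~⌊⌋ a)) (~-trans e (~⌊⌋ b)))

    ⌊⌋-small : ∀ {a} → a ℕ.< m → ⌊ + a ⌋ ≡ a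
    ⌊⌋-small {a} a<m = residue-unique (⌊⌋<m (+ a)) a<m (~-sym (~⌊⌋ (+ a)))

    ⌊⌋≡0 : ∀ {z} → z ~ + 0 → ⌊ z ⌋ ≡ 0
    ⌊⌋≡0 {z} e = residue-unique (⌊⌋<m z) (ℕₚ.≤-<-trans ℕ.z≤n (⌊⌋<m z)) (~-trans (~-sym (~⌊⌋ z)) e)

    residues : List ℕ
    residues = downFrom m

    Periodic : {A : Set} → (ℤ → A) → Set
    Periodic F = ∀ {a b} → a ~ b → F a ≡ F b

    ∑-residue : ∀ {F : ℤ → ℚ} → Periodic F → ∀ z → ∑ residues (λ a → χ (+ a ~? z) · F (+ a)) ≡ F z
    ∑-residue {F} per z = trans
      (∑-one (λ a → + a ~? z) (λ a → F (+ a)) (downFrom⁺ m) (∈-downFrom⁺ (⌊⌋<m z)) (~-sym (~⌊⌋ z))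
        (λ a∈ e → residue-unique (∈-downFrom⁻ a∈) (⌊⌋<m z) (~-trans e (~⌊⌋ z))))
      (per (~-sym (~⌊⌋ z)))

    -- The maps σ and τ are mutually inverse on classes but need not map the list `residues` to
    -- itself. Expanding F(σ a) by `∑-residue` as a sum over representatives b and interchanging the
    -- sums avoids any permutation of lists.
    ∑-reindex : ∀ {F : ℤ → ℚ} → Periodic F → (σ τ : ℤ → ℤ) →
      (∀ {a b} → b ~ σ a → a ~ τ b) → (∀ {a b} → a ~ τ b → b ~ σ a) →
      ∑ residues (λ a → F (σ (+ a))) ≡ ∑ residues (λ a → F (+ a))
    ∑-reindex {F} per σ τ to from = begin
      ∑ residues (λ a → F (σ (+ a)))
        ≡⟨ ∑-cong residues (λ a → sym (∑-residue per (σ (+ a)))) ⟩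
      ∑ residues (λ a → ∑ residues (λ b → χ (+ b ~? σ (+ a)) · F (+ b)))
        ≡⟨ ∑-swap residues residues _ ⟩
      ∑ residues (λ b → ∑ residues (λ a → χ (+ b ~? σ (+ a)) · F (+ b)))
        ≡⟨ ∑-cong residues (λ b → trans
             (∑-cong residues (λ a → cong (_· F (+ b)) (χ-⇔ (+ b ~? σ (+ a)) (+ a ~? τ (+ b)) to from)))
             (∑-residue {λ _ → F (+ b)} (λ _ → refl) (τ (+ b)))) ⟩
      ∑ residues (λ b → F (+ b)) ∎
      where open ≡-Reasoning

    record Unit (a : ℤ) : Set where
      constructor _,_
      field
        inverse   : ℤ
        isInverse : a * inverse ~ + 1

    ∑-affine : ∀ {F : ℤ → ℚ} → Periodic F → ∀ t {u} → Unit u →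
      ∑ residues (λ a → F (t + u * + a)) ≡ ∑ residues (λ a → F (+ a))
    ∑-affine per t {u} (u′ , uu′) = ∑-reindex per (λ a → t + u * a) (λ b → u′ * (b - t))
      (λ {a} {b} e → ~-sym (~-trans (~-*ˡ u′ (subst (b - t ~_) (cancel-t t (u * a)) (~-+ e (~-refl { - t }))))
        (cancel u u′ uu′ a)))
      (λ {a} {b} e → ~-sym (~-trans (~-+ (~-refl {t}) (~-trans (~-*ˡ u e)
        (cancel u′ u (subst (_~ + 1) (ℤₚ.*-comm u u′) uu′) (b - t)))) (~-reflexive (restore-t t b))))
      where
      cancel-t : ∀ t x → t + x - t ≡ x
      cancel-t = solve-∀
      restore-t : ∀ t b → t + (b - t) ≡ b
      restore-t = solve-∀
      swap : ∀ u′ u a → u′ * (u * a) ≡ u * u′ * a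
      swap = solve-∀
      cancel : ∀ u u′ → u * u′ ~ + 1 → ∀ a → u′ * (u * a) ~ a
      cancel u u′ e a = subst₂ _~_ (sym (swap u′ u a)) (ℤₚ.*-identityˡ a) (~-*ʳ a e)

    ∑-scale : ∀ {F : ℤ → ℚ} → Periodic F → ∀ {u} → Unit u →
      ∑ residues (λ a → F (u * + a)) ≡ ∑ residues (λ a → F (+ a))
    ∑-scale {F} per {u} uu = trans (∑-cong residues (λ a → cong F (sym (ℤₚ.+-identityˡ (u * + a)))))
      (∑-affine {F} per (+ 0) {u} uu)

    ∑-neg-index : ∀ {F : ℤ → ℚ} → Periodic F →
      ∑ residues (λ a → F (- (+ a))) ≡ ∑ residues (λ a → F (+ a))
    ∑-neg-index per = ∑-reindex per (-_) (-_) flip flip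
      where
      flip : ∀ {a b} → b ~ - a → a ~ - b
      flip {a} {b} e = ~-sym (subst (- b ~_) (ℤₚ.neg-involutive a) (~-neg e))

    unit-resp : ∀ {a b} → a ~ b → Unit a → Unit b
    unit-resp {a} {b} e (a′ , aa′) = a′ , ~-trans (~-*ʳ a′ (~-sym e)) aa′

    unit-* : ∀ {a b} → Unit a → Unit b → Unit (a * b)
    unit-* {a} {b} (a′ , aa′) (b′ , bb′) = a′ * b′ , subst (_~ + 1) (lemma a b a′ b′) (~-* aa′ bb′)
      where
      lemma : ∀ a b a′ b′ → a * a′ * (b * b′) ≡ a * b * (a′ * b′)
      lemma = solve-∀

    unit-factorʳ : ∀ {a b} → Unit (a * b) → Unit b
    unit-factorʳ {a} {b} (c , e) = a * c , subst (_~ + 1) (lemma a b c) e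
      where
      lemma : ∀ a b c → a * b * c ≡ b * (a * c)
      lemma = solve-∀

    unit-1 : Unit (+ 1)
    unit-1 = + 1 , ~-refl

    unit-neg : ∀ {a} → Unit a → Unit (- a)
    unit-neg {a} (a′ , e) = - a′ , subst (_~ + 1) (lemma a a′) e
      where
      lemma : ∀ a a′ → a * a′ ≡ - a * - a′
      lemma = solve-∀

    unit-unique : ∀ a b c → a * b ~ + 1 → a * c ~ + 1 → b ~ c
    unit-unique a b c ab ac = ~-trans
      (subst₂ _~_ (ℤₚ.*-identityˡ b) (lemma a b c) (~-*ʳ b (~-sym ac)))
      (subst (c * (a * b) ~_) (ℤₚ.*-identityʳ c) (~-*ˡ c ab))
      where
      lemma : ∀ a b c → a * c * b ≡ c * (a * b)
      lemma = solve-∀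

    module Inverse (unit? : ∀ a → Dec (Unit a)) where

      -- The inverse modulo m, with the value 0 on nonunits.
      inv : ℤ → ℤ
      inv a with unit? a
      ... | yes (a′ , _) = a′
      ... | no  _        = + 0

      *-inv : ∀ a → Unit a → a * inv a ~ + 1
      *-inv a ua with unit? a
      ... | yes (a′ , e) = e
      ... | no ¬ua       = ⊥-elim (¬ua ua)

      inv-nonunit : ∀ {a} → ¬ Unit a → inv a ≡ + 0
      inv-nonunit {a} ¬ua with unit? a
      ... | yes ua = ⊥-elim (¬ua ua)
      ... | no _   = refl

      inv-* : ∀ a → Unit a → inv a * a ~ + 1
      inv-* a ua = subst (_~ + 1) (ℤₚ.*-comm a (inv a)) (*-inv a ua)

      inv-unit : ∀ {a} → Unit a → Unit (inv a)
      inv-unit {a} ua = a , inv-* a ua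

      inv-unique : ∀ a b → a * b ~ + 1 → inv a ~ b
      inv-unique a b e = unit-unique a (inv a) b (*-inv a (b , e)) e

      inv-cong : ∀ {a b} → a ~ b → inv a ~ inv b
      inv-cong {a} {b} e = go (unit? a)
        where
        go : Dec (Unit a) → inv a ~ inv b
        go (yes ua) = ~-sym (inv-unique b (inv a) (~-trans (~-*ʳ (inv a) (~-sym e)) (*-inv a ua)))
        go (no ¬ua) = ~-reflexive (trans (inv-nonunit ¬ua)
          (sym (inv-nonunit (λ ub → ¬ua (unit-resp (~-sym e) ub)))))

      inv-involutive : ∀ {a} → Unit a → inv (inv a) ~ a
      inv-involutive {a} ua = inv-unique (inv a) a (inv-* a ua)

-- Symmetric lattice sums and the corner error

module Lattice where

  open import Data.Empty using (⊥-elim)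
  open import Data.Integer as ℤ using (ℤ; +_; -[1+_])
  import Data.Integer.Properties as ℤₚ
  open import Data.List using (List; _∷_; _++_; map)
  open import Data.List.Membership.Propositional using (_∈_)
  open import Data.List.Membership.Propositional.Properties using (∈-map⁺; ∈-map⁻; ∈-++⁺ˡ; ∈-++⁺ʳ; ∈-++⁻)
  open import Data.List.Relation.Unary.All as All using (All)
  open import Data.List.Relation.Unary.AllPairs using (_∷_)
  open import Data.List.Relation.Unary.Any using (here; there)
  open import Data.List.Relation.Unary.Unique.Propositional using (Unique)
  open import Data.List.Relation.Unary.Unique.Propositional.Properties using (map⁺; ++⁺)
  open import Data.Nat as ℕ using (ℕ; zero; suc)
  import Data.Nat.Properties as ℕₚ
  open import Data.Product using (_×_; _,_; proj₁; proj₂)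
  open import Data.Rational
  open import Data.Rational.Properties
  open import Data.Sum using (inj₁; inj₂)
  open import Relation.Binary.PropositionalEquality
    using (_≡_; _≢_; refl; sym; trans; cong; cong₂; subst; module ≡-Reasoning)
  open import Relation.Nullary using (yes; no; ¬_)
  open import Tactic.RingSolver using (solve-∀)
  open Rat
  open Ranges

  minus : ℕ → ℤ
  minus n = ℤ.- (+ n)

  -- The truncation is symmetric about 0, so that sums over it respect z ↦ -z exactly, as in
  -- Eisenstein summation.
  ints : ℕ → List ℤ
  ints Z = + 0 ∷ (map +_ (range Z) ++ map minus (range Z))

  private
    +∈ : ∀ {Z n} → n ℕ.≤ Z → + n ∈ ints Z
    +∈ {n = zero}  _   = here refl
    +∈ {n = suc n} n≤Z = there (∈-++⁺ˡ (∈-map⁺ +_ (∈-range⁺ (ℕ.s≤s ℕ.z≤n) n≤Z)))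

  ∈-ints⁺ : ∀ {Z z} → ℤ.∣ z ∣ ℕ.≤ Z → z ∈ ints Z
  ∈-ints⁺     {z = + n}      n≤Z = +∈ n≤Z
  ∈-ints⁺ {Z} {z = -[1+ n ]} n≤Z =
    there (∈-++⁺ʳ (map +_ (range Z)) (∈-map⁺ minus (∈-range⁺ (ℕ.s≤s ℕ.z≤n) n≤Z)))

  ∈-ints⁻ : ∀ {Z z} → z ∈ ints Z → ℤ.∣ z ∣ ℕ.≤ Z
  ∈-ints⁻ (here refl) = ℕ.z≤n
  ∈-ints⁻ {Z} (there z∈) with ∈-++⁻ (map +_ (range Z)) z∈
  ... | inj₁ i with ∈-map⁻ +_ i
  ...   | n , n∈ , refl = proj₂ (∈-range⁻ n∈)
  ∈-ints⁻ {Z} (there z∈) | inj₂ i with ∈-map⁻ minus i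
  ...   | n , n∈ , refl = subst (ℕ._≤ Z) (sym (ℤₚ.∣-i∣≡∣i∣ (+ n))) (proj₂ (∈-range⁻ n∈))

  ints-unique : ∀ Z → Unique (ints Z)
  ints-unique Z = All.tabulate 0∉ ∷ ++⁺ (map⁺ ℤₚ.+-injective (range-unique Z))
      (map⁺ (λ e → ℤₚ.+-injective (ℤₚ.neg-injective e)) (range-unique Z)) disjoint
    where
    0∉ : ∀ {z} → z ∈ (map +_ (range Z) ++ map minus (range Z)) → + 0 ≢ z
    0∉ z∈ with ∈-++⁻ (map +_ (range Z)) z∈
    0∉ z∈ | inj₁ i with ∈-map⁻ +_ i
    ... | suc n , n∈ , refl = λ ()
    ... | zero  , n∈ , refl with proj₁ (∈-range⁻ n∈)
    ...   | ()
    0∉ z∈ | inj₂ i with ∈-map⁻ minus i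
    ... | suc n , n∈ , refl = λ ()
    ... | zero  , n∈ , refl with proj₁ (∈-range⁻ n∈)
    ...   | ()
    disjoint : ∀ {z} → z ∈ map +_ (range Z) × z ∈ map minus (range Z) → _
    disjoint (i , j) with ∈-map⁻ +_ i | ∈-map⁻ minus j
    ... | n , _ , refl | suc k , _ , ()
    ... | n , _ , refl | zero , k∈ , _ with proj₁ (∈-range⁻ k∈)
    ...   | ()

  ∑-ints : ∀ Z (F : ℤ → ℚ) →
    ∑ (ints Z) F ≡ F (+ 0) + (∑ (range Z) (λ n → F (+ n)) + ∑ (range Z) (λ n → F (minus n)))
  ∑-ints Z F = trans (∑-∷ (+ 0) (map +_ (range Z) ++ map minus (range Z)) F) (cong (_+_ (F (+ 0))) (trans (∑-++ (map +_ (range Z)) (map minus (range Z)) F)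
    (cong₂ _+_ (∑-map +_ (range Z) F) (∑-map minus (range Z) F))))

  ∑-ints-neg : ∀ Z (F : ℤ → ℚ) → ∑ (ints Z) (λ z → F (ℤ.- z)) ≡ ∑ (ints Z) F
  ∑-ints-neg Z F = begin
    ∑ (ints Z) (λ z → F (ℤ.- z)) ≡⟨ ∑-ints Z (λ z → F (ℤ.- z)) ⟩
    F (+ 0) + (∑ (range Z) (λ n → F (minus n)) + ∑ (range Z) (λ n → F (ℤ.- minus n)))
      ≡⟨ cong (λ t → F (+ 0) + (∑ (range Z) (λ n → F (minus n)) + t))
           (∑-cong (range Z) (λ n → cong F (ℤₚ.neg-involutive (+ n)))) ⟩
    F (+ 0) + (∑ (range Z) (λ n → F (minus n)) + ∑ (range Z) (λ n → F (+ n)))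
      ≡⟨ cong (_+_ (F (+ 0))) (+-comm (∑ (range Z) (λ n → F (minus n))) _) ⟩
    F (+ 0) + (∑ (range Z) (λ n → F (+ n)) + ∑ (range Z) (λ n → F (minus n)))
      ≡⟨ sym (∑-ints Z F) ⟩
    ∑ (ints Z) F ∎
    where open ≡-Reasoning

  -- The reciprocal with 1/0 = 0, which is odd on all of ℤ.
  recℤ : ℤ → ℚ
  recℤ (+ n)      = rec n
  recℤ (-[1+ n ]) = - rec (suc n)

  recℤ-neg : ∀ z → recℤ (ℤ.- z) ≡ - recℤ z
  recℤ-neg (+ zero)   = trans rec-0 (cong -_ (sym rec-0))
  recℤ-neg (+ suc n)  = refl
  recℤ-neg (-[1+ n ]) = sym (neg² (rec (suc n)))
    where
    neg² : ∀ p → - - p ≡ p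
    neg² = solve-∀ ℚring

  ∣rec∣ : ∀ n → ∣ rec n ∣ ≡ rec n
  ∣rec∣ n = 0≤p⇒∣p∣≡p (0≤rec n)

  ∣recℤ∣ : ∀ z → ∣ recℤ z ∣ ≡ rec ℤ.∣ z ∣
  ∣recℤ∣ (+ n)      = ∣rec∣ n
  ∣recℤ∣ (-[1+ n ]) = trans (∣-p∣≡∣p∣ (rec (suc n))) (∣rec∣ (suc n))

  ι*recℤ : ∀ z → z ≢ + 0 → ι z * recℤ z ≡ 1ℚ
  ι*recℤ (+ zero)   z≢0 = ⊥-elim (z≢0 refl)
  ι*recℤ (+ suc n)  z≢0 = ν*rec n
  ι*recℤ (-[1+ n ]) z≢0 = trans (cong (_* (- rec (suc n))) (ι-neg (+ suc n)))
    (trans (lemma (ν (suc n)) (rec (suc n))) (ν*rec n))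
    where
    lemma : ∀ a b → (- a) * (- b) ≡ a * b
    lemma = solve-∀ ℚring

  -- Eisenstein's partial fraction identity 1/α·1/ξ² − 1/α·1/η² = 1/ξ·1/η² + 1/ξ²·1/η for η = α + ξ.
  partial-fractions : ∀ α ξ η → η ≡ α ℤ.+ ξ → α ≢ + 0 → ξ ≢ + 0 → η ≢ + 0 →
    recℤ α * (recℤ ξ * recℤ ξ) ≡
    (recℤ α * (recℤ η * recℤ η) + recℤ ξ * (recℤ η * recℤ η)) + recℤ η * (recℤ ξ * recℤ ξ)
  partial-fractions α ξ η eq α≢0 ξ≢0 η≢0 = begin
    A * (X * X)                              ≡⟨ l₁ A X ⟩
    A * X * X                                ≡⟨ cong (_* X) AX ⟩
    (X + A) * Y * X                          ≡⟨ l₂ A X Y ⟩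
    A * X * Y + Y * (X * X)                  ≡⟨ cong (λ t → t * Y + Y * (X * X)) AX ⟩
    (X + A) * Y * Y + Y * (X * X)            ≡⟨ l₃ A X Y ⟩
    (A * (Y * Y) + X * (Y * Y)) + Y * (X * X) ∎
    where
    open ≡-Reasoning
    A = recℤ α
    X = recℤ ξ
    Y = recℤ η
    l₁ : ∀ A X → A * (X * X) ≡ A * X * X
    l₁ = solve-∀ ℚring
    l₂ : ∀ A X Y → (X + A) * Y * X ≡ A * X * Y + Y * (X * X)
    l₂ = solve-∀ ℚring
    l₃ : ∀ A X Y → (X + A) * Y * Y + Y * (X * X) ≡ (A * (Y * Y) + X * (Y * Y)) + Y * (X * X)
    l₃ = solve-∀ ℚring
    l₄ : ∀ A X Y a x → A * X * ((a + x) * Y) ≡ ((a * A) * X + (x * X) * A) * Y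
    l₄ = solve-∀ ℚring
    -- This is 1/(αξ) = (1/ξ + 1/α)/η for η = α + ξ; the identity above results from applying it
    -- twice.
    AX : A * X ≡ (X + A) * Y
    AX = begin
      A * X                        ≡⟨ sym (*-identityʳ (A * X)) ⟩
      A * X * 1ℚ                   ≡⟨ cong (A * X *_) (sym (ι*recℤ η η≢0)) ⟩
      A * X * (ι η * Y)            ≡⟨ cong (λ t → A * X * (t * Y)) (trans (cong ι eq) (ι-+ α ξ)) ⟩
      A * X * ((ι α + ι ξ) * Y)    ≡⟨ l₄ A X Y (ι α) (ι ξ) ⟩
      ((ι α * A) * X + (ι ξ * X) * A) * Y
        ≡⟨ cong₂ (λ s t → (s * X + t * A) * Y) (ι*recℤ α α≢0) (ι*recℤ ξ ξ≢0) ⟩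
      (1ℚ * X + 1ℚ * A) * Y        ≡⟨ cong₂ (λ s t → (s + t) * Y) (*-identityˡ X) (*-identityˡ A) ⟩
      (X + A) * Y                  ∎

  harmonic : ℕ → ℚ
  harmonic Z = ∑ (range Z) rec

  -- Pairs in the square [-Z, Z]² whose sum leaves [-Z, Z] fill two opposite corners of the square.
  -- They are the only source of error when Eisenstein's identities are summed over a truncated
  -- range.
  corner : ℕ → ℤ → ℤ → ℚ
  corner Z u v = χ (Z ℕ.<? ℤ.∣ u ℤ.+ v ∣) * (rec ℤ.∣ u ∣ * (rec ℤ.∣ v ∣ * rec ℤ.∣ v ∣))

  cornerSum : ℕ → ℚ
  cornerSum Z = ∑ (ints Z) (λ u → ∑ (ints Z) (corner Z u))

  count-above : ∀ Z k N → ∑ (range N) (λ n → χ (Z ℕ.<? n ℕ.+ k)) ≤ ν ((N ℕ.+ k) ℕ.∸ Z)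
  count-above Z k zero    = ≤-trans (≤-reflexive (∑-[] _)) (0≤ν (k ℕ.∸ Z))
  count-above Z k (suc N) = ≤-trans (≤-reflexive (∑-∷ (suc N) (range N) (λ n → χ (Z ℕ.<? n ℕ.+ k)))) step
    where
    step : χ (Z ℕ.<? suc N ℕ.+ k) + ∑ (range N) (λ n → χ (Z ℕ.<? n ℕ.+ k)) ≤ ν ((suc N ℕ.+ k) ℕ.∸ Z)
    step with Z ℕ.<? suc N ℕ.+ k
    ... | yes Z< = ≤-trans (+-monoʳ-≤ 1ℚ (count-above Z k N)) (≤-reflexive (trans
      (sym (ν-suc ((N ℕ.+ k) ℕ.∸ Z))) (cong ν (sym (ℕₚ.+-∸-assoc 1 (ℕ.s≤s⁻¹ Z<))))))
    ... | no Z≮ = ≤-respˡ (sym (+-identityˡ _)) (≤-trans (count-above Z k N)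
      (ν-mono-≤ (ℕₚ.∸-monoˡ-≤ Z (ℕₚ.n≤1+n (N ℕ.+ k)))))

  private
    -- If n + k > Z then 1 ≤ (n + k)/(Z + 1). Multiplication by this factor turns 1/(nk²) into (1/k²
    -- + 1/(nk))/(Z + 1), which gains the decisive factor 1/(Z + 1).
    rec-split : ∀ n k Z → 1 ℕ.≤ n → 1 ℕ.≤ k →
      χ (Z ℕ.<? n ℕ.+ k) * (rec n * (rec k * rec k)) ≤
      rec (suc Z) * (χ (Z ℕ.<? n ℕ.+ k) * (rec k * rec k) + rec n * rec k)
    rec-split (suc n) (suc k) Z _ _ with Z ℕ.<? suc n ℕ.+ suc k
    ... | no _ = ≤-respˡ (sym (*-zeroˡ (rec (suc n) * (rec (suc k) * rec (suc k))))) (*-nonNeg (0≤rec (suc Z)) (+-nonNeg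
        (*-nonNeg {0ℚ} ≤-refl (*-nonNeg (0≤rec (suc k)) (0≤rec (suc k)))) (*-nonNeg (0≤rec (suc n)) (0≤rec (suc k)))))
    ... | yes Z<n+k = begin
        1ℚ * (N * (K * K))                                ≤⟨ *-monoˡ (*-nonNeg (0≤rec (suc n)) 0≤KK) one≤ ⟩
        ρ * (ν (suc n) + ν (suc k)) * (N * (K * K))       ≡⟨ l₂ ρ (ν (suc n)) (ν (suc k)) N K ⟩
        ρ * ((ν (suc n) * N) * (K * K) + (ν (suc k) * K) * (N * K))
          ≡⟨ cong₂ (λ s t → ρ * (s * (K * K) + t * (N * K))) (ν*rec n) (ν*rec k) ⟩
        ρ * (1ℚ * (K * K) + 1ℚ * (N * K))                 ≡⟨ cong (λ t → ρ * (1ℚ * (K * K) + t)) (*-identityˡ (N * K)) ⟩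
        ρ * (1ℚ * (K * K) + N * K)                        ∎
      where
      open ≤-Reasoning
      N = rec (suc n)
      K = rec (suc k)
      ρ = rec (suc Z)
      0≤KK = *-nonNeg (0≤rec (suc k)) (0≤rec (suc k))
      l₂ : ∀ ρ n k N K → ρ * (n + k) * (N * (K * K)) ≡ ρ * ((n * N) * (K * K) + (k * K) * (N * K))
      l₂ = solve-∀ ℚring
      one≤ : 1ℚ ≤ ρ * (ν (suc n) + ν (suc k))
      one≤ = ≤-respˡ (trans (*-comm ρ (ν (suc Z))) (ν*rec Z))
        (*-monoʳ (0≤rec (suc Z)) (≤-respʳ (ν-+ (suc n) (suc k)) (ν-mono-≤ Z<n+k)))

  -- Of order (log Z)²/Z, hence tending to 0.
  cornerBound : ℕ → ℚ
  cornerBound Z = rec (suc Z) * (harmonic Z + harmonic Z * harmonic Z)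

  positive-corner : ∀ Z →
    ∑ (range Z) (λ n → ∑ (range Z) (λ k → χ (Z ℕ.<? n ℕ.+ k) * (rec n * (rec k * rec k)))) ≤ cornerBound Z
  positive-corner Z = begin
    ∑ R (λ n → ∑ R (λ k → χ (Z ℕ.<? n ℕ.+ k) * (rec n * (rec k * rec k))))
      ≤⟨ ∑-mono∈ R (λ {n} n∈ → ∑-mono∈ R (λ {k} k∈ →
           rec-split n k Z (proj₁ (∈-range⁻ n∈)) (proj₁ (∈-range⁻ k∈)))) ⟩
    ∑ R (λ n → ∑ R (λ k → ρ * (χ (Z ℕ.<? n ℕ.+ k) * (rec k * rec k) + rec n * rec k)))
      ≡⟨ ∑-cong R (λ n → trans (sym (∑-*ˡ R ρ _)) (cong (ρ *_) (∑-+ R _ _))) ⟩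
    ∑ R (λ n → ρ * (∑ R (λ k → χ (Z ℕ.<? n ℕ.+ k) * (rec k * rec k)) + ∑ R (λ k → rec n * rec k)))
      ≡⟨ trans (sym (∑-*ˡ R ρ _)) (cong (ρ *_) (∑-+ R _ _)) ⟩
    ρ * (∑ R (λ n → ∑ R (λ k → χ (Z ℕ.<? n ℕ.+ k) * (rec k * rec k))) + ∑ R (λ n → ∑ R (λ k → rec n * rec k)))
      ≤⟨ *-monoʳ (0≤rec (suc Z)) (+-mono-≤ first (≤-reflexive (sym (∑-*-∑ R R rec rec)))) ⟩
    cornerBound Z ∎
    where
    open ≤-Reasoning
    R = range Z
    ρ = rec (suc Z)
    cancel : ∀ k → 1 ℕ.≤ k → ν k * (rec k * rec k) ≡ rec k
    cancel (suc k) _ = trans (sym (*-assoc (ν (suc k)) (rec (suc k)) (rec (suc k))))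
      (trans (cong (_* rec (suc k)) (ν*rec k)) (*-identityˡ (rec (suc k))))
    -- For fixed k at most k values n ≤ Z satisfy n + k > Z, so that their terms 1/k² add up to at
    -- most 1/k.
    first : ∑ R (λ n → ∑ R (λ k → χ (Z ℕ.<? n ℕ.+ k) * (rec k * rec k))) ≤ harmonic Z
    first = ≤-respˡ (∑-swap R R _) (∑-mono∈ R (λ {k} k∈ →
      ≤-respˡ (∑-*ʳ R (rec k * rec k) _) (≤-trans
        (*-monoˡ (*-nonNeg (0≤rec k) (0≤rec k)) (≤-trans (count-above Z k Z)
          (≤-reflexive (cong ν (ℕₚ.m+n∸m≡n Z k)))))
        (≤-reflexive (cancel k (proj₁ (∈-range⁻ k∈)))))))

  -- Terms with u or v equal to 0 vanish because 1/0 = 0, and for opposite signs |u + v| ≤ max(|u|,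
  -- |v|) ≤ Z. Each of the two quadrants of equal signs contributes at most one `cornerBound`.
  cornerSum-bound : ∀ Z → cornerSum Z ≤ cornerBound Z + cornerBound Z
  cornerSum-bound Z = ≤-trans (≤-reflexive (trans (∑-ints Z (λ u → ∑ (ints Z) (corner Z u)))
      (zero-+ˡ (∑-zero∈ (ints Z) (λ {v} _ → vanishˡ v))
        (cong₂ _+_ (∑-cong∈ R (λ {n} n∈ → row₊ n n∈)) (∑-cong∈ R (λ {n} n∈ → row₋ n n∈))))))
      (+-mono-≤ (positive-corner Z) (positive-corner Z))
    where
    R = range Z
    base : ℕ → ℕ → ℚ
    base n k = χ (Z ℕ.<? n ℕ.+ k) * (rec n * (rec k * rec k))
    vanishˡ : ∀ v → corner Z (+ 0) v ≡ 0ℚ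
    vanishˡ v = zero-*ʳ (χ (Z ℕ.<? ℤ.∣ + 0 ℤ.+ v ∣)) (zero-*ˡ (rec ℤ.∣ v ∣ * rec ℤ.∣ v ∣) rec-0)
    vanishʳ : ∀ u → corner Z u (+ 0) ≡ 0ℚ
    vanishʳ u = zero-*ʳ (χ (Z ℕ.<? ℤ.∣ u ℤ.+ + 0 ∣)) (zero-*ʳ (rec ℤ.∣ u ∣) (zero-*ˡ (rec 0) rec-0))
    small : ∀ {n k} → n ℕ.≤ Z → k ℕ.≤ Z → ¬ (Z ℕ.< ℤ.∣ n ℤ.⊖ k ∣)
    small {n} {k} n≤Z k≤Z Z< = ℕₚ.<⇒≱ Z< (ℕₚ.≤-trans (ℤₚ.∣m⊝n∣≤m⊔n n k) (ℕₚ.⊔-lub n≤Z k≤Z))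
    row₊ : ∀ n → n ∈ R → ∑ (ints Z) (corner Z (+ n)) ≡ ∑ R (base n)
    row₊ n n∈ = trans (∑-ints Z (corner Z (+ n))) (zero-+ˡ (vanishʳ (+ n)) (zero-+ʳ refl
      (∑-zero∈ R (λ {k} k∈ → zero-*ˡ _ (χ-no (Z ℕ.<? ℤ.∣ + n ℤ.+ minus k ∣)
        (λ lt → small (proj₂ (∈-range⁻ n∈)) (proj₂ (∈-range⁻ k∈)) (subst (λ t → Z ℕ.< ℤ.∣ t ∣) (ℤₚ.m-n≡m⊖n n k) lt)))))))
    row₋ : ∀ n → n ∈ R → ∑ (ints Z) (corner Z (minus n)) ≡ ∑ R (base n)
    row₋ n n∈ = trans (∑-ints Z (corner Z (minus n))) (zero-+ˡ (vanishʳ (minus n)) (zero-+ˡ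
      (∑-zero∈ R (λ {k} k∈ → zero-*ˡ _ (χ-no (Z ℕ.<? ℤ.∣ minus n ℤ.+ + k ∣)
        (λ lt → small (proj₂ (∈-range⁻ k∈)) (proj₂ (∈-range⁻ n∈)) (subst (λ t → Z ℕ.< ℤ.∣ t ∣) (ℤₚ.-m+n≡n⊖m n k) lt)))))
      (∑-cong R (λ k → both n k))))
      where
      both : ∀ n k → corner Z (minus n) (minus k) ≡ base n k
      both n k = cong₂ _*_ (cong (λ t → χ (Z ℕ.<? t))
          (trans (cong ℤ.∣_∣ (sym (ℤₚ.neg-distrib-+ (+ n) (+ k)))) (ℤₚ.∣-i∣≡∣i∣ (+ (n ℕ.+ k)))))
        (cong₂ (λ s t → rec s * (rec t * rec t)) (ℤₚ.∣-i∣≡∣i∣ (+ n)) (ℤₚ.∣-i∣≡∣i∣ (+ k)))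

-- Eisenstein's addition formula for truncated sums

module Eisenstein where

  open import Data.Integer as ℤ using (ℤ; +_)
  import Data.Integer.Properties as ℤₚ
  import Data.Integer.Tactic.RingSolver as ℤSolver
  open import Data.List using (List)
  open import Data.Nat as ℕ using (ℕ; NonZero)
  import Data.Nat.Properties as ℕₚ
  open import Data.Rational hiding (NonZero)
  open import Data.Rational.Properties
  open import Relation.Binary.PropositionalEquality
    using (_≡_; _≢_; refl; sym; trans; cong; cong₂; subst; subst₂; module ≡-Reasoning)
  open import Relation.Nullary using (Dec; yes; no; ¬_)
  open import Tactic.RingSolver using (solve-∀)
  open Rat
  open Mod
  open Lattice

  module EisensteinSums (m : ℕ) .{{m≢0 : NonZero m}} (Z : ℕ) where

    open Modulo m

    zs : List ℤ
    zs = ints Z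

    recℤ² : ℤ → ℚ
    recℤ² z = recℤ z * recℤ z

    -- Truncations of the sums of 1/z and 1/z² over z ≡ a (mod m).
    c q : ℤ → ℚ
    c a = ∑ zs (λ z → χ (z ~? a) * recℤ z)
    q a = ∑ zs (λ z → χ (z ~? a) * recℤ² z)

    c-cong : Periodic c
    c-cong e = ∑-cong zs (λ z → cong (_* recℤ z) (χ-⇔ (z ~? _) (z ~? _) (λ f → ~-trans f e) (λ f → ~-trans f (~-sym e))))

    q-cong : Periodic q
    q-cong e = ∑-cong zs (λ z → cong (_* recℤ² z) (χ-⇔ (z ~? _) (z ~? _) (λ f → ~-trans f e) (λ f → ~-trans f (~-sym e))))

    c-odd : ∀ a → c (ℤ.- a) ≡ - c a
    c-odd a = begin
      c (ℤ.- a)                                          ≡⟨ sym (∑-ints-neg Z (λ z → χ (z ~? (ℤ.- a)) * recℤ z)) ⟩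
      ∑ zs (λ z → χ ((ℤ.- z) ~? (ℤ.- a)) * recℤ (ℤ.- z)) ≡⟨ ∑-cong zs flip ⟩
      ∑ zs (λ z → - (χ (z ~? a) * recℤ z))               ≡⟨ ∑-neg zs _ ⟩
      - c a                                              ∎
      where
      open ≡-Reasoning
      flip : ∀ z → χ ((ℤ.- z) ~? (ℤ.- a)) * recℤ (ℤ.- z) ≡ - (χ (z ~? a) * recℤ z)
      flip z = trans (cong₂ _*_ (χ-⇔ ((ℤ.- z) ~? (ℤ.- a)) (z ~? a)
          (λ e → subst₂ _~_ (ℤₚ.neg-involutive z) (ℤₚ.neg-involutive a) (~-neg e)) ~-neg) (recℤ-neg z))
        (sym (neg-distribʳ-* (χ (z ~? a)) (recℤ z)))

    private
      cut : ∀ s (g : ℚ) → ∑ zs (λ w → χ (w ℤ.≟ s) * g) ≡ χ (ℤ.∣ s ∣ ℕ.≤? Z) * g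
      cut s g with ℤ.∣ s ∣ ℕ.≤? Z
      ... | yes s≤ = trans (∑-one (λ w → w ℤ.≟ s) (λ _ → g) (ints-unique Z) (∈-ints⁺ s≤) refl (λ _ e → e))
                       (sym (*-identityˡ g))
      ... | no s≰ = trans (∑-none (λ w → w ℤ.≟ s) (λ _ → g) zs (λ w∈ e → s≰ (subst (λ t → ℤ.∣ t ∣ ℕ.≤ Z) e (∈-ints⁻ w∈))))
                      (sym (*-zeroˡ g))

      complement : ∀ n (g : ℚ) → g ≡ χ (n ℕ.≤? Z) * g + χ (Z ℕ.<? n) * g
      complement n g with n ℕ.≤? Z
      ... | yes n≤Z = sym (zero-+ʳ (*-identityˡ g) (zero-*ˡ g (χ-no (Z ℕ.<? n) (ℕₚ.≤⇒≯ n≤Z))))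
      ... | no  n≰Z = sym (zero-+ˡ (*-zeroˡ g) (trans (cong (_* g) (χ-yes (Z ℕ.<? n) (ℕₚ.≰⇒> n≰Z))) (*-identityˡ g)))

      split : ∀ s (g : ℚ) → g ≡ ∑ zs (λ w → χ (w ℤ.≟ s) * g) + χ (Z ℕ.<? ℤ.∣ s ∣) * g
      split s g = trans (complement ℤ.∣ s ∣ g) (cong (_+ χ (Z ℕ.<? ℤ.∣ s ∣) * g) (sym (cut s g)))

      overflow : (s : ℤ → ℤ → ℤ) (G : ℤ → ℤ → ℚ) → ℚ
      overflow s G = ∑ zs (λ u → ∑ zs (λ v → χ (Z ℕ.<? ℤ.∣ s u v ∣) * G u v))

      inner : (s : ℤ → ℤ → ℤ) (G : ℤ → ℤ → ℚ) → ℚ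
      inner s G = ∑ zs (λ u → ∑ zs (λ v → ∑ zs (λ w → χ (w ℤ.≟ s u v) * G u v)))

      -- If s u v lies in [-Z, Z], it becomes a third summation variable w; otherwise the term goes
      -- into the overflow. In this way the four products in Eisenstein's identity all become sums
      -- over the same triples with η = α + ξ, whichever two of the three variables they started
      -- from.
      double-split : ∀ s G → ∑ zs (λ u → ∑ zs (G u)) ≡ inner s G + overflow s G
      double-split s G = trans
        (∑-cong zs (λ u → trans (∑-cong zs (λ v → split (s u v) (G u v))) (∑-+ zs _ _)))
        (∑-+ zs _ _)

      term : ℤ → ℤ → ℤ → ℤ → ℚ
      term a b u v = (χ (u ~? a) * recℤ u) * (χ (v ~? b) * recℤ² v)

      overflow-bound : ∀ a b (s t : ℤ → ℤ → ℤ) → (∀ u v → ℤ.∣ s u v ∣ ≡ ℤ.∣ t u v ∣) →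
        ∣ overflow s (term a b) ∣ ≤
        ∑ zs (λ u → ∑ zs (λ v → χ (Z ℕ.<? ℤ.∣ t u v ∣) * (rec ℤ.∣ u ∣ * (rec ℤ.∣ v ∣ * rec ℤ.∣ v ∣))))
      overflow-bound a b s t eq = ∣∑∣≤∑ zs (λ {u} _ → ∣∑∣≤∑ zs (λ {v} _ →
          subst (λ n → ∣ χ (Z ℕ.<? n) * term a b u v ∣ ≤ χ (Z ℕ.<? ℤ.∣ t u v ∣) * (rec ℤ.∣ u ∣ * (rec ℤ.∣ v ∣ * rec ℤ.∣ v ∣)))
            (sym (eq u v))
            (∣*∣ˡ≤ (0≤χ (Z ℕ.<? ℤ.∣ t u v ∣)) (∣*∣≤ (drop (u ~? a) (≤-reflexive (∣recℤ∣ u)))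
              (drop (v ~? b) (∣*∣≤ (≤-reflexive (∣recℤ∣ v)) (≤-reflexive (∣recℤ∣ v))))))))
        where
        drop : ∀ {P : Set} (d : Dec P) {x r} → ∣ x ∣ ≤ r → ∣ χ d * x ∣ ≤ r
        drop d {x} le = ≤-respˡ (sym (∣*∣ˡ x (0≤χ d))) (≤-trans (χ*≤ d (0≤∣p∣ x)) le)

      overflow-sum : ∀ a b → ∣ overflow ℤ._+_ (term a b) ∣ ≤ cornerSum Z
      overflow-sum a b = overflow-bound a b ℤ._+_ ℤ._+_ (λ _ _ → refl)

      -- Replacing u by -u turns the condition |v - u| > Z into the one that defines `corner`.
      overflow-diff : ∀ a b s → (∀ u v → ℤ.∣ s u v ∣ ≡ ℤ.∣ (ℤ.- u) ℤ.+ v ∣) →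
        ∣ overflow s (term a b) ∣ ≤ cornerSum Z
      overflow-diff a b s eq = ≤-trans (overflow-bound a b s (λ u v → (ℤ.- u) ℤ.+ v) eq) (≤-reflexive (trans
        (∑-cong zs (λ u → ∑-cong zs (λ v → cong (λ n → χ (Z ℕ.<? ℤ.∣ (ℤ.- u) ℤ.+ v ∣) * (rec n * (rec ℤ.∣ v ∣ * rec ℤ.∣ v ∣)))
          (sym (ℤₚ.∣-i∣≡∣i∣ u)))))
        (∑-ints-neg Z (λ u → ∑ zs (corner Z u)))))

      product : ∀ a b → c a * q b ≡ ∑ zs (λ u → ∑ zs (term a b u))
      product a b = ∑-*-∑ zs zs _ _

      triple : (ℤ → ℤ → ℤ → ℚ) → ℚ
      triple F = ∑ zs (λ α → ∑ zs (λ ξ → ∑ zs (λ η → χ (η ℤ.≟ α ℤ.+ ξ) * F α ξ η)))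

      sub-add : ∀ {α ξ η} → ξ ≡ η ℤ.- α → η ≡ α ℤ.+ ξ
      sub-add {α} {_} {η} refl = lemma η α
        where
        lemma : ∀ η α → η ≡ α ℤ.+ (η ℤ.- α)
        lemma = ℤSolver.solve-∀

      add-sub : ∀ {α ξ η} → η ≡ α ℤ.+ ξ → ξ ≡ η ℤ.- α
      add-sub {α} {ξ} refl = lemma α ξ
        where
        lemma : ∀ α ξ → ξ ≡ α ℤ.+ ξ ℤ.- α
        lemma = ℤSolver.solve-∀

      triple-2 : ∀ (G : ℤ → ℤ → ℚ) → inner (λ α η → η ℤ.- α) G ≡ triple (λ α ξ η → G α η)
      triple-2 G = ∑-cong zs (λ α → trans (∑-swap zs zs _) (∑-cong zs (λ ξ → ∑-cong zs (λ η →
        cong (_* G α η) (χ-⇔ (ξ ℤ.≟ η ℤ.- α) (η ℤ.≟ α ℤ.+ ξ) sub-add add-sub)))))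

      triple-3 : ∀ (G : ℤ → ℤ → ℚ) → inner (λ ξ η → η ℤ.- ξ) G ≡ triple (λ α ξ η → G ξ η)
      triple-3 G = trans (∑-cong zs (λ ξ → trans (∑-swap zs zs _) (∑-cong zs (λ α → ∑-cong zs (λ η →
        cong (_* G ξ η) (χ-⇔ (α ℤ.≟ η ℤ.- ξ) (η ℤ.≟ α ℤ.+ ξ)
          (λ e → trans (sub-add e) (ℤₚ.+-comm ξ α)) (λ e → add-sub (trans e (ℤₚ.+-comm α ξ)))))))))
        (∑-swap zs zs _)

      triple-4 : ∀ (G : ℤ → ℤ → ℚ) → inner (λ η ξ → η ℤ.- ξ) G ≡ triple (λ α ξ η → G η ξ)
      triple-4 G = trans (∑-swap zs zs _) (triple-3 (λ ξ η → G η ξ))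

    module Relation (a x : ℤ) (a≁0 : ¬ (a ~ + 0)) (x≁0 : ¬ (x ~ + 0)) (y≁0 : ¬ (a ℤ.+ x ~ + 0)) where

      private
        y = a ℤ.+ x

        nonzero : ∀ {z b} → ¬ (b ~ + 0) → z ~ b → z ≢ + 0
        nonzero b≁0 e refl = b≁0 (~-sym e)

        cancel-+ : ∀ {u v b d} → u ~ b → u ℤ.+ v ~ b ℤ.+ d → v ~ d
        cancel-+ {u} {v} {b} {d} e f = subst₂ _~_ (lemma u v) (lemma b d) (~-+ f (~-neg e))
          where
          lemma : ∀ u v → u ℤ.+ v ℤ.+ (ℤ.- u) ≡ v
          lemma = ℤSolver.solve-∀

        zeros : ∀ e {t₁ t₂ t₃ t₄} → t₁ ≡ 0ℚ → t₂ ≡ 0ℚ → t₃ ≡ 0ℚ → t₄ ≡ 0ℚ → e * t₁ ≡ (e * t₂ + e * t₃) + e * t₄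
        zeros e refl refl refl refl = lemma e
          where
          lemma : ∀ e → e * 0ℚ ≡ (e * 0ℚ + e * 0ℚ) + e * 0ℚ
          lemma = solve-∀ ℚring

        term-0ˡ : ∀ {b d u} v → ¬ (u ~ b) → term b d u v ≡ 0ℚ
        term-0ˡ {b} {d} {u} v u≁ = zero-*ˡ (χ (v ~? d) * recℤ² v) (zero-*ˡ (recℤ u) (χ-no (u ~? b) u≁))

        term-0ʳ : ∀ {b d v} u → ¬ (v ~ d) → term b d u v ≡ 0ℚ
        term-0ʳ {b} {d} {v} u v≁ = zero-*ʳ (χ (u ~? b) * recℤ u) (zero-*ˡ (recℤ² v) (χ-no (v ~? d) v≁))

        term-1 : ∀ {b d u v} → u ~ b → v ~ d → term b d u v ≡ recℤ u * recℤ² v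
        term-1 {b} {d} {u} {v} e f = cong₂ _*_ (χ-1 (u ~? b) e (recℤ u)) (χ-1 (v ~? d) f (recℤ² v))

        pointwise : ∀ α ξ η → χ (η ℤ.≟ α ℤ.+ ξ) * term a x α ξ ≡
          (χ (η ℤ.≟ α ℤ.+ ξ) * term a y α η + χ (η ℤ.≟ α ℤ.+ ξ) * term x y ξ η) + χ (η ℤ.≟ α ℤ.+ ξ) * term y x η ξ
        pointwise α ξ η with η ℤ.≟ α ℤ.+ ξ
        ... | no _ = trans (*-zeroˡ (term a x α ξ)) (sym (zero-+ˡ (zero-+ˡ (*-zeroˡ (term a y α η)) (*-zeroˡ (term x y ξ η))) (*-zeroˡ (term y x η ξ))))
        -- Any two of the congruences α ≡ a, ξ ≡ x, η ≡ y imply the third. Each of the four terms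
        -- tests two of them, so either all are tested successfully or all four terms vanish.
        ... | yes eq = go (α ~? a) (ξ ~? x)
          where
          go : Dec (α ~ a) → Dec (ξ ~ x) → 1ℚ * term a x α ξ ≡ (1ℚ * term a y α η + 1ℚ * term x y ξ η) + 1ℚ * term y x η ξ
          go (yes α~a) (yes ξ~x) = trans (*-identityˡ (term a x α ξ)) (trans
            (trans (term-1 α~a ξ~x) (trans (partial-fractions α ξ η eq (nonzero a≁0 α~a) (nonzero x≁0 ξ~x) (nonzero y≁0 η~y))
              (sym (cong₂ _+_ (cong₂ _+_ (term-1 α~a η~y) (term-1 ξ~x η~y)) (term-1 η~y ξ~x)))))
            (sym (cong₂ _+_ (cong₂ _+_ (*-identityˡ (term a y α η)) (*-identityˡ (term x y ξ η))) (*-identityˡ (term y x η ξ)))))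
            where
            η~y : η ~ y
            η~y = ~-trans (~-reflexive eq) (~-+ α~a ξ~x)
          go (yes α~a) (no ξ≁x) = zeros 1ℚ (term-0ʳ α ξ≁x) (term-0ʳ α η≁y) (term-0ˡ η ξ≁x) (term-0ʳ η ξ≁x)
            where
            η≁y : ¬ (η ~ y)
            η≁y e = ξ≁x (cancel-+ α~a (~-trans (~-reflexive (sym eq)) e))
          go (no α≁a) (yes ξ~x) = zeros 1ℚ (term-0ˡ ξ α≁a) (term-0ˡ η α≁a) (term-0ʳ ξ η≁y) (term-0ˡ ξ η≁y)
            where
            η≁y : ¬ (η ~ y)
            η≁y e = α≁a (cancel-+ ξ~x (subst₂ _~_ (trans eq (ℤₚ.+-comm α ξ)) (ℤₚ.+-comm a x) e))
          go (no α≁a) (no ξ≁x) = zeros 1ℚ (term-0ˡ ξ α≁a) (term-0ˡ η α≁a) (term-0ˡ η ξ≁x) (term-0ʳ η ξ≁x)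

        T₁ = inner ℤ._+_ (term a x)
        T₂ = inner (λ α η → η ℤ.- α) (term a y)
        T₃ = inner (λ ξ η → η ℤ.- ξ) (term x y)
        T₄ = inner (λ η ξ → η ℤ.- ξ) (term y x)
        e₁ = overflow ℤ._+_ (term a x)
        e₂ = overflow (λ α η → η ℤ.- α) (term a y)
        e₃ = overflow (λ ξ η → η ℤ.- ξ) (term x y)
        e₄ = overflow (λ η ξ → η ℤ.- ξ) (term y x)

        T-relation : T₁ ≡ (T₂ + T₃) + T₄
        T-relation = begin
          T₁ ≡⟨ ∑-cong zs (λ α → trans (∑-cong zs (λ ξ → trans (∑-cong zs (λ η → pointwise α ξ η)) (linear _ _ _)))
                  (linear _ _ _)) ⟩
          ∑ zs (λ α → (∑ zs (λ ξ → ∑ zs (λ η → χ (η ℤ.≟ α ℤ.+ ξ) * term a y α η))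
                     + ∑ zs (λ ξ → ∑ zs (λ η → χ (η ℤ.≟ α ℤ.+ ξ) * term x y ξ η)))
                     + ∑ zs (λ ξ → ∑ zs (λ η → χ (η ℤ.≟ α ℤ.+ ξ) * term y x η ξ)))
            ≡⟨ linear _ _ _ ⟩
          (triple (λ α ξ η → term a y α η) + triple (λ α ξ η → term x y ξ η)) + triple (λ α ξ η → term y x η ξ)
            ≡⟨ sym (cong₂ _+_ (cong₂ _+_ (triple-2 (term a y)) (triple-3 (term x y))) (triple-4 (term y x))) ⟩
          (T₂ + T₃) + T₄ ∎
          where
          open ≡-Reasoning
          linear : ∀ (f g h : ℤ → ℚ) → ∑ zs (λ z → (f z + g z) + h z) ≡ (∑ zs f + ∑ zs g) + ∑ zs h
          linear f g h = trans (∑-+ zs (λ z → f z + g z) h) (cong (_+ ∑ zs h) (∑-+ zs f g))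

      -- Summing `partial-fractions` over α ≡ a, ξ ≡ x, η = α + ξ gives an exact relation between
      -- the inner parts of four products; each product deviates from its inner part by one overflow
      -- of at most `cornerSum`. In the limit this is (cot a - cot y)/sin² x = (cot a + cot x)/sin²
      -- y, in suitable units.
      relation : ∣ (c a - c y) * q x - (c a + c x) * q y ∣ ≤ (cornerSum Z + cornerSum Z) + (cornerSum Z + cornerSum Z)
      relation = subst (λ t → ∣ t ∣ ≤ (cornerSum Z + cornerSum Z) + (cornerSum Z + cornerSum Z)) (sym eq)
          (∣-∣≤ (∣-∣≤ (overflow-sum a x) (overflow-diff a y (λ α η → η ℤ.- α) (λ u v → cong ℤ.∣_∣ (ℤₚ.+-comm v (ℤ.- u)))))
            (∣+∣≤ (overflow-diff x y (λ α η → η ℤ.- α) (λ u v → cong ℤ.∣_∣ (ℤₚ.+-comm v (ℤ.- u))))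
              (overflow-diff y x (λ η ξ → η ℤ.- ξ) (λ u v → trans (sym (ℤₚ.∣-i∣≡∣i∣ (u ℤ.- v))) (cong ℤ.∣_∣ (flip u v))))))
        where
        open ≡-Reasoning
        flip : ∀ u v → ℤ.- (u ℤ.- v) ≡ (ℤ.- u) ℤ.+ v
        flip = ℤSolver.solve-∀
        expand : ∀ A X Y p r → (A - Y) * p - (A + X) * r ≡ (A * p - Y * p) - (A * r + X * r)
        expand = solve-∀ ℚring
        collect : ∀ t₂ t₃ t₄ e₁ e₂ e₃ e₄ →
          (((t₂ + t₃) + t₄ + e₁) - (t₄ + e₄)) - ((t₂ + e₂) + (t₃ + e₃)) ≡ (e₁ - e₂) - (e₃ + e₄)
        collect = solve-∀ ℚring
        eq : (c a - c y) * q x - (c a + c x) * q y ≡ (e₁ - e₂) - (e₃ + e₄)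
        eq = begin
          (c a - c y) * q x - (c a + c x) * q y
            ≡⟨ expand (c a) (c x) (c y) (q x) (q y) ⟩
          (c a * q x - c y * q x) - (c a * q y + c x * q y)
            ≡⟨ cong₂ _-_ (cong₂ _-_ (trans (product a x) (double-split ℤ._+_ (term a x)))
                                    (trans (product y x) (double-split (λ η ξ → η ℤ.- ξ) (term y x))))
                         (cong₂ _+_ (trans (product a y) (double-split (λ α η → η ℤ.- α) (term a y)))
                                    (trans (product x y) (double-split (λ ξ η → η ℤ.- ξ) (term x y)))) ⟩
          ((T₁ + e₁) - (T₄ + e₄)) - ((T₂ + e₂) + (T₃ + e₃))
            ≡⟨ cong (λ t → ((t + e₁) - (T₄ + e₄)) - ((T₂ + e₂) + (T₃ + e₃))) T-relation ⟩
          (((T₂ + T₃) + T₄ + e₁) - (T₄ + e₄)) - ((T₂ + e₂) + (T₃ + e₃))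
            ≡⟨ collect T₂ T₃ T₄ e₁ e₂ e₃ e₄ ⟩
          (e₁ - e₂) - (e₃ + e₄) ∎

-- From orthogonality to the vanishing of the sum of φ(n)/n

module Vanish where

  open import Data.Empty using (⊥-elim)
  open import Data.Integer as ℤ using (ℤ; +_; -[1+_])
  import Data.Integer.Properties as ℤₚ
  import Data.Integer.Tactic.RingSolver as ℤSolver
  open import Data.List using (List; []; _∷_; downFrom)
  open import Data.List.Properties using (length-downFrom)
  open import Data.List.Membership.Propositional using (_∈_)
  open import Data.List.Membership.Propositional.Properties using (∈-downFrom⁺; ∈-downFrom⁻)
  open import Data.Nat as ℕ using (ℕ; zero; suc; NonZero)
  import Data.Nat.Properties as ℕₚ
  open import Data.Product using (_,_)
  open import Data.Rational hiding (NonZero; floor)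
  open import Data.Rational.Properties
  open import Relation.Binary.PropositionalEquality
    using (_≡_; _≢_; refl; sym; trans; cong; cong₂; subst; subst₂; module ≡-Reasoning)
  open import Relation.Nullary using (Dec; yes; no; ¬_)
  open import Tactic.RingSolver using (solve-∀)
  open Rat
  open Ranges
  open Mod
  open Lattice
  open Eisenstein

  -- The source of the numbers ⟨ja⁻¹⟩: with F(k) = g(ak) the weight k is the residue of ja⁻¹ for j =
  -- ak, and the differences of g collapse to a plain sum.
  ∑-by-parts : ∀ (F : ℕ → ℚ) n →
    ∑ (downFrom n) (λ k → ν k * (F (suc k) - F k)) ≡ ν n * F n - ∑ (downFrom n) (λ k → F (suc k))
  ∑-by-parts F zero = trans (∑-[] (λ k → ν k * (F (suc k) - F k)))
    (sym (trans (cong₂ _-_ (zero-*ˡ (F 0) ι-0) (∑-[] (λ k → F (suc k)))) (+-inverseʳ 0ℚ)))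
  ∑-by-parts F (suc n) = begin
    ∑ (n ∷ downFrom n) (λ k → ν k * (F (suc k) - F k))
      ≡⟨ ∑-∷ n (downFrom n) _ ⟩
    ν n * (F (suc n) - F n) + ∑ (downFrom n) (λ k → ν k * (F (suc k) - F k))
      ≡⟨ cong (_+_ (ν n * (F (suc n) - F n))) (∑-by-parts F n) ⟩
    ν n * (F (suc n) - F n) + (ν n * F n - S)
      ≡⟨ lemma (ν n) (F (suc n)) (F n) S ⟩
    (1ℚ + ν n) * F (suc n) - (F (suc n) + S)
      ≡⟨ cong₂ (λ s t → s * F (suc n) - t) (sym (ν-suc n)) (sym (∑-∷ n (downFrom n) (λ k → F (suc k)))) ⟩
    ν (suc n) * F (suc n) - ∑ (n ∷ downFrom n) (λ k → F (suc k)) ∎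
    where
    open ≡-Reasoning
    S = ∑ (downFrom n) (λ k → F (suc k))
    lemma : ∀ n F₁ F₀ S → n * (F₁ - F₀) + (n * F₀ - S) ≡ (1ℚ + n) * F₁ - (F₁ + S)
    lemma = solve-∀ ℚring

  -- The induction carries the sharper bound 2 - 1/N, which absorbs the next term because 1/(N + 1)²
  -- ≤ 1/N - 1/(N + 1).
  ∑-rec² : ∀ N → ∑ (range N) (λ n → rec n * rec n) ≤ 2ℚ
  ∑-rec² zero    = ≤-trans (≤-reflexive (∑-[] (λ n → rec n * rec n))) (+-nonNeg 0≤1 0≤1)
  ∑-rec² (suc N) = ≤-trans (sharp N) (≤-respʳ (+-identityʳ 2ℚ) (+-monoʳ-≤ 2ℚ (neg-antimono-≤ (0≤rec (suc N)))))
    where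
    sharp : ∀ N → ∑ (range (suc N)) (λ n → rec n * rec n) ≤ 2ℚ - rec (suc N)
    sharp zero = ≤-reflexive (trans (∑-∷ 1 [] (λ n → rec n * rec n))
      (trans (cong₂ _+_ (cong₂ _*_ rec-1 rec-1) (∑-[] (λ n → rec n * rec n))) (cong (λ t → 2ℚ - t) (sym rec-1))))
    sharp (suc N) = ≤-trans (≤-reflexive (∑-∷ (suc (suc N)) (range (suc N)) (λ n → rec n * rec n)))
      (≤-trans (+-mono-≤ (*-monoˡ (0≤rec (suc (suc N))) (rec-anti (ℕₚ.n≤1+n N))) (sharp N))
        (≤-reflexive (trans (cong (_+ (2ℚ - rec (suc N))) (sym (rec-diff N))) (lemma (rec (suc N)) (rec (suc (suc N))) 2ℚ))))
      where
      lemma : ∀ a b t → (a - b) + (t - a) ≡ t - b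
      lemma = solve-∀ ℚring

  module Vanishing (m : ℕ) .{{m≢0 : NonZero m}} (Z : ℕ) (m≤Z : m ℕ.≤ Z) where

    open Modulo m
    open EisensteinSums m Z

    private
      0≤recℤ² : ∀ z → 0ℚ ≤ recℤ² z
      0≤recℤ² (+ n)      = *-nonNeg (0≤rec n) (0≤rec n)
      0≤recℤ² (-[1+ n ]) = ≤-respʳ (lemma (rec (suc n))) (*-nonNeg (0≤rec (suc n)) (0≤rec (suc n)))
        where
        lemma : ∀ r → r * r ≡ (- r) * (- r)
        lemma = solve-∀ ℚring

      0≤q-term : ∀ x z → 0ℚ ≤ χ (z ~? x) * recℤ² z
      0≤q-term x z = *-nonNeg (0≤χ (z ~? x)) (0≤recℤ² z)

    0≤q : ∀ x → 0ℚ ≤ q x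
    0≤q x = ∑-nonNeg zs (λ {z} _ → 0≤q-term x z)

    M : ℚ
    M = ν m * ν m

    0≤M : 0ℚ ≤ M
    0≤M = *-nonNeg (0≤ν m) (0≤ν m)

    -- The representative n of x with 0 < n < m ≤ Z occurs in the truncated sum and contributes 1/n²
    -- ≥ 1/m². The bound is uniform in Z, so dividing by q keeps errors small.
    q-lower : ∀ x → ¬ (x ~ + 0) → 1ℚ ≤ M * q x
    q-lower x x≁0 = go ⌊ x ⌋ (⌊⌋<m x) (~⌊⌋ x)
      where
      go : ∀ n → n ℕ.< m → x ~ + n → 1ℚ ≤ M * q x
      go zero    _   e = ⊥-elim (x≁0 e)
      go (suc n) n<m e = begin
        1ℚ                                                  ≡⟨ sym (*-identityʳ 1ℚ) ⟩
        1ℚ * 1ℚ                                             ≡⟨ cong₂ _*_ (sym (ν*rec n)) (sym (ν*rec n)) ⟩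
        (ν (suc n) * r) * (ν (suc n) * r)                   ≡⟨ lemma (ν (suc n)) r ⟩
        (ν (suc n) * ν (suc n)) * (r * r)                   ≤⟨ *-mono (*-nonNeg (0≤ν (suc n)) (0≤ν (suc n)))
                                                                 (*-mono (0≤ν (suc n)) n≤m (0≤ν (suc n)) n≤m)
                                                                 (*-nonNeg (0≤rec (suc n)) (0≤rec (suc n))) term≤ ⟩
        M * q x                                             ∎
        where
        open ≤-Reasoning
        r = rec (suc n)
        n≤m : ν (suc n) ≤ ν m
        n≤m = ν-mono-≤ (ℕₚ.<⇒≤ n<m)
        lemma : ∀ a r → (a * r) * (a * r) ≡ (a * a) * (r * r)
        lemma = solve-∀ ℚring
        term≤ : r * r ≤ q x
        term≤ = ≤-respˡ (χ-1 (+ suc n ~? x) (~-sym e) (r * r))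
          (term≤∑ zs {λ z → χ (z ~? x) * recℤ² z} (λ {z} _ → 0≤q-term x z)
            (∈-ints⁺ (ℕₚ.≤-trans (ℕₚ.<⇒≤ n<m) m≤Z)))

    q-upper : ∀ x → q x ≤ 2ℚ + 2ℚ
    q-upper x = begin
      q x                 ≤⟨ ∑-mono zs (λ z → χ*≤ (z ~? x) (0≤recℤ² z)) ⟩
      ∑ zs recℤ²          ≡⟨ ∑-ints Z recℤ² ⟩
      recℤ² (+ 0) + (∑ (range Z) (λ n → rec n * rec n) + ∑ (range Z) (λ n → recℤ² (minus n)))
        ≡⟨ zero-+ˡ (zero-*ˡ (rec 0) rec-0) (cong (_+_ (∑ (range Z) (λ n → rec n * rec n))) (∑-cong (range Z) square)) ⟩
      ∑ (range Z) (λ n → rec n * rec n) + ∑ (range Z) (λ n → rec n * rec n)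
        ≤⟨ +-mono-≤ (∑-rec² Z) (∑-rec² Z) ⟩
      2ℚ + 2ℚ             ∎
      where
      open ≤-Reasoning
      square : ∀ n → recℤ² (minus n) ≡ rec n * rec n
      square n = trans (cong₂ _*_ (recℤ-neg (+ n)) (recℤ-neg (+ n))) (lemma (rec n))
        where
        lemma : ∀ r → (- r) * (- r) ≡ r * r
        lemma = solve-∀ ℚring

    q≢0 : ∀ {x} → ¬ (x ~ + 0) → q x ≢ 0ℚ
    q≢0 {x} x≁0 eq = 1≰0 (≤-respʳ (zero-*ʳ M eq) (q-lower x x≁0))

    -- Up to a constant factor, g approximates sin² and s approximates sin 2, of πz/m.
    g s : ℤ → ℚ
    g z with z ~? + 0
    ... | yes _ = 0ℚ
    ... | no  _ = recip (q z)
    s z = c z * g z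

    g-0 : ∀ {z} → z ~ + 0 → g z ≡ 0ℚ
    g-0 {z} e with z ~? + 0
    ... | yes _  = refl
    ... | no z≁0 = ⊥-elim (z≁0 e)

    q*g : ∀ {z} → ¬ (z ~ + 0) → q z * g z ≡ 1ℚ
    q*g {z} z≁0 with z ~? + 0
    ... | yes e = ⊥-elim (z≁0 e)
    ... | no _  = *-recip (q≢0 z≁0)

    0≤g : ∀ z → 0ℚ ≤ g z
    0≤g z with z ~? + 0
    ... | yes _ = ≤-refl
    ... | no _  = 0≤recip (0≤q z)

    g≤M : ∀ z → g z ≤ M
    g≤M z = go (z ~? + 0)
      where
      go : Dec (z ~ + 0) → g z ≤ M
      go (yes e)  = ≤-respˡ (sym (g-0 e)) 0≤M
      go (no z≁0) = begin
        g z               ≡⟨ sym (*-identityˡ (g z)) ⟩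
        1ℚ * g z          ≤⟨ *-monoˡ (0≤g z) (q-lower z z≁0) ⟩
        M * q z * g z     ≡⟨ trans (*-assoc M (q z) (g z)) (cong (M *_) (q*g z≁0)) ⟩
        M * 1ℚ            ≡⟨ *-identityʳ M ⟩
        M                 ∎
        where open ≤-Reasoning

    g-cong : Periodic g
    g-cong {a} {b} e = go (a ~? + 0)
      where
      go : Dec (a ~ + 0) → g a ≡ g b
      go (yes a~0) = trans (g-0 a~0) (sym (g-0 (~-trans (~-sym e) a~0)))
      go (no a≁0)  = begin
        g a               ≡⟨ sym (*-identityʳ (g a)) ⟩
        g a * 1ℚ          ≡⟨ cong (g a *_) (sym (q*g {b} (λ b~0 → a≁0 (~-trans e b~0)))) ⟩
        g a * (q b * g b) ≡⟨ cong (λ t → g a * (t * g b)) (sym (q-cong e)) ⟩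
        g a * (q a * g b) ≡⟨ lemma (g a) (q a) (g b) ⟩
        q a * g a * g b   ≡⟨ cong (_* g b) (q*g a≁0) ⟩
        1ℚ * g b          ≡⟨ *-identityˡ (g b) ⟩
        g b               ∎
        where
        open ≡-Reasoning
        lemma : ∀ x y z → x * (y * z) ≡ y * x * z
        lemma = solve-∀ ℚring

    s-cong : Periodic s
    s-cong e = cong₂ _*_ (c-cong e) (g-cong e)

    s-0 : ∀ {z} → z ~ + 0 → s z ≡ 0ℚ
    s-0 {z} e = zero-*ʳ (c z) (g-0 e)

    ε : ℚ
    ε = (cornerSum Z + cornerSum Z) + (cornerSum Z + cornerSum Z)

    0≤ε : 0ℚ ≤ ε
    0≤ε = +-nonNeg (+-nonNeg 0≤E 0≤E) (+-nonNeg 0≤E 0≤E)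
      where
      0≤E : 0ℚ ≤ cornerSum Z
      0≤E = ∑-nonNeg (ints Z) (λ {u} _ → ∑-nonNeg (ints Z) (λ {v} _ →
        *-nonNeg (0≤χ (Z ℕ.<? ℤ.∣ u ℤ.+ v ∣)) (*-nonNeg (0≤rec ℤ.∣ u ∣) (*-nonNeg (0≤rec ℤ.∣ v ∣) (0≤rec ℤ.∣ v ∣)))))

    MMε : ℚ
    MMε = (M * M) * ε

    0≤MMε : 0ℚ ≤ MMε
    0≤MMε = *-nonNeg (*-nonNeg 0≤M 0≤M) 0≤ε

    -- This is `relation` multiplied by g(z)g(a + z), the analogue of cot a (sin² y - sin² z) = (sin
    -- 2y + sin 2z)/2 for y = a + z. In contrast to `relation` it extends to z ≡ 0 and y ≡ 0, where
    -- it is exact since g vanishes there; hence it can be summed over a full period.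
    addition : ∀ a → ¬ (a ~ + 0) → ∀ z → ∣ c a * (g (a ℤ.+ z) - g z) - (s (a ℤ.+ z) + s z) ∣ ≤ MMε
    addition a a≁0 z = go (z ~? + 0) ((a ℤ.+ z) ~? + 0)
      where
      y = a ℤ.+ z
      exact : c a * (g y - g z) - (s y + s z) ≡ 0ℚ → ∣ c a * (g y - g z) - (s y + s z) ∣ ≤ MMε
      exact eq = ≤-respˡ (cong ∣_∣ (sym eq)) 0≤MMε
      go : Dec (z ~ + 0) → Dec (y ~ + 0) → ∣ c a * (g y - g z) - (s y + s z) ∣ ≤ MMε
      go (yes z~0) _ = exact (begin
        c a * (g y - g z) - (c y * g y + c z * g z)
          ≡⟨ cong₂ (λ t r → c a * (g y - r) - (t * g y + c z * r)) (c-cong y~a) (g-0 z~0) ⟩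
        c a * (g y - 0ℚ) - (c a * g y + c z * 0ℚ)
          ≡⟨ lemma (c a) (g y) (c z) ⟩
        0ℚ ∎)
        where
        open ≡-Reasoning
        y~a : y ~ a
        y~a = subst (y ~_) (ℤₚ.+-identityʳ a) (~-+ (~-refl {a}) z~0)
        lemma : ∀ A G C → A * (G - 0ℚ) - (A * G + C * 0ℚ) ≡ 0ℚ
        lemma = solve-∀ ℚring
      go (no _) (yes y~0) = exact (begin
        c a * (g y - g z) - (c y * g y + c z * g z)
          ≡⟨ cong₂ (λ t r → c a * (r - g z) - (c y * r + t * g z)) (trans (c-cong z~-a) (c-odd a)) (g-0 y~0) ⟩
        c a * (0ℚ - g z) - (c y * 0ℚ + (- c a) * g z)
          ≡⟨ lemma (c a) (g z) (c y) ⟩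
        0ℚ ∎)
        where
        open ≡-Reasoning
        z~-a : z ~ ℤ.- a
        z~-a = subst₂ _~_ (cancel a z) (ℤₚ.+-identityʳ (ℤ.- a)) (~-+ (~-refl {ℤ.- a}) y~0)
          where
          cancel : ∀ a z → ℤ.- a ℤ.+ (a ℤ.+ z) ≡ z
          cancel = ℤSolver.solve-∀
        lemma : ∀ A G C → A * (0ℚ - G) - (C * 0ℚ + (- A) * G) ≡ 0ℚ
        lemma = solve-∀ ℚring
      go (no z≁0) (no y≁0) = subst (λ t → ∣ t ∣ ≤ MMε) (sym eq)
        (∣*∣ˡ≤′ (∣*∣≤ (≤-respˡ (sym (0≤p⇒∣p∣≡p (0≤g z))) (g≤M z)) (≤-respˡ (sym (0≤p⇒∣p∣≡p (0≤g y))) (g≤M y)))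
          (Relation.relation a z a≁0 z≁0 y≁0))
        where
        open ≡-Reasoning
        ∣*∣ˡ≤′ : ∀ {p r b d} → ∣ p ∣ ≤ b → ∣ r ∣ ≤ d → ∣ p * r ∣ ≤ b * d
        ∣*∣ˡ≤′ = ∣*∣≤
        e = (c a - c y) * q z - (c a + c z) * q y
        expand : ∀ A X Y gz gy → A * (gy - gz) - (Y * gy + X * gz) ≡ (A - Y) * gy * 1ℚ - (A + X) * gz * 1ℚ
        expand = solve-∀ ℚring
        collect : ∀ A X Y gz gy qz qy →
          (A - Y) * gy * (qz * gz) - (A + X) * gz * (qy * gy) ≡ (gz * gy) * ((A - Y) * qz - (A + X) * qy)
        collect = solve-∀ ℚring
        eq : c a * (g y - g z) - (s y + s z) ≡ (g z * g y) * e
        eq = begin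
          c a * (g y - g z) - (c y * g y + c z * g z)
            ≡⟨ expand (c a) (c z) (c y) (g z) (g y) ⟩
          (c a - c y) * g y * 1ℚ - (c a + c z) * g z * 1ℚ
            ≡⟨ sym (cong₂ (λ t r → (c a - c y) * g y * t - (c a + c z) * g z * r) (q*g z≁0) (q*g y≁0)) ⟩
          (c a - c y) * g y * (q z * g z) - (c a + c z) * g z * (q y * g y)
            ≡⟨ collect (c a) (c z) (c y) (g z) (g y) (q z) (q y) ⟩
          (g z * g y) * e ∎

    G : ℚ
    G = ∑ residues (λ j → g (+ j))

    weight : ℤ → ℤ → ℚ
    weight a′ j = 2ℚ * ν ⌊ j ℤ.* a′ ⌋ - 1ℚ

    -- Sum `addition` at z = ak with weight k over 0 ≤ k < m. By parts, the differences of g give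
    -- -c(a)G, while the substitutions j = ak and j = a(k + 1) give s(j) the weights ⟨ja⁻¹⟩ and
    -- ⟨ja⁻¹⟩ - 1. Thus c(a) is, up to a small error, a combination of the numbers 2⟨ja⁻¹⟩ - 1 with
    -- coefficients that do not depend on a.
    cotangent : ∀ a a′ → a ℤ.* a′ ~ + 1 → ¬ (a ~ + 0) →
      ∣ c a * G + ∑ residues (λ j → s (+ j) * weight a′ (+ j)) ∣ ≤ (ν m * ν m) * MMε
    cotangent a a′ aa′ a≁0 = subst (_≤ (ν m * ν m) * MMε) (trans (cong ∣_∣ total) (∣-p∣≡∣p∣ _))
        (≤-trans (∣∑∣≤∑ residues {g = λ _ → ν m * MMε} (λ {k} k∈ → ∣*∣≤
            (≤-respˡ (sym (0≤p⇒∣p∣≡p (0≤ν k))) (ν-mono-≤ (ℕₚ.<⇒≤ (∈-downFrom⁻ k∈)))) (addition a a≁0 (a ℤ.* + k))))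
          (≤-reflexive (trans (∑-const residues (ν m * MMε))
            (trans (cong (λ t → ν t * (ν m * MMε)) (length-downFrom m)) (sym (*-assoc (ν m) (ν m) MMε))))))
      where
      open ≡-Reasoning
      S = ∑ residues (λ j → s (+ j) * weight a′ (+ j))
      F₀ F₁ : ℤ → ℚ
      F₀ z = ν ⌊ z ℤ.* a′ ⌋ * s z
      F₁ z = ν ⌊ z ℤ.* a′ ℤ.- + 1 ⌋ * s z
      F₀-cong : Periodic F₀
      F₀-cong e = cong₂ (λ x y → ν x * y) (⌊⌋-cong (~-*ʳ a′ e)) (s-cong e)
      F₁-cong : Periodic F₁
      F₁-cong e = cong₂ (λ x y → ν x * y) (⌊⌋-cong (~-+ (~-*ʳ a′ e) ~-refl)) (s-cong e)
      step : ∀ k → a ℤ.+ a ℤ.* + k ≡ a ℤ.* (+ 1 ℤ.+ + k)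
      step k = lemma a (+ k)
        where
        lemma : ∀ a k → a ℤ.+ a ℤ.* k ≡ a ℤ.* (+ 1 ℤ.+ k)
        lemma = ℤSolver.solve-∀
      cancel : ∀ z → a ℤ.* z ℤ.* a′ ~ z
      cancel z = subst₂ _~_ (lemma a a′ z) (ℤₚ.*-identityˡ z) (~-*ʳ z aa′)
        where
        lemma : ∀ a a′ z → a ℤ.* a′ ℤ.* z ≡ a ℤ.* z ℤ.* a′
        lemma = ℤSolver.solve-∀
      index₀ : ∀ {k} → k ∈ residues → ⌊ a ℤ.* + k ℤ.* a′ ⌋ ≡ k
      index₀ {k} k∈ = trans (⌊⌋-cong (cancel (+ k))) (⌊⌋-small (∈-downFrom⁻ k∈))
      index₁ : ∀ {k} → k ∈ residues → ⌊ (a ℤ.+ a ℤ.* + k) ℤ.* a′ ℤ.- + 1 ⌋ ≡ k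
      index₁ {k} k∈ = trans (⌊⌋-cong (subst (_~ + k) (cong (λ t → t ℤ.* a′ ℤ.- + 1) (sym (step k)))
          (subst (a ℤ.* (+ 1 ℤ.+ + k) ℤ.* a′ ℤ.- + 1 ~_) (lemma (+ k)) (~-+ (cancel (+ 1 ℤ.+ + k)) (~-refl {ℤ.- + 1}))))) (⌊⌋-small (∈-downFrom⁻ k∈))
        where
        lemma : ∀ k → + 1 ℤ.+ k ℤ.- + 1 ≡ k
        lemma = ℤSolver.solve-∀
      a-unit : Unit a
      a-unit = a′ , aa′
      S₀ : ∑ residues (λ k → ν k * s (a ℤ.* + k)) ≡ ∑ residues (λ j → F₀ (+ j))
      S₀ = trans (∑-cong∈ residues (λ {k} k∈ → cong (λ n → ν n * s (a ℤ.* + k)) (sym (index₀ k∈))))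
        (∑-scale {F₀} F₀-cong {a} a-unit)
      S₁ : ∑ residues (λ k → ν k * s (a ℤ.+ a ℤ.* + k)) ≡ ∑ residues (λ j → F₁ (+ j))
      S₁ = trans (∑-cong∈ residues (λ {k} k∈ → cong (λ n → ν n * s (a ℤ.+ a ℤ.* + k)) (sym (index₁ k∈))))
        (∑-affine {F₁} F₁-cong a {a} a-unit)
      decrement : ∀ z → F₁ z ≡ (ν ⌊ z ℤ.* a′ ⌋ - 1ℚ) * s z
      decrement z = go (z ~? + 0)
        where
        go : Dec (z ~ + 0) → F₁ z ≡ (ν ⌊ z ℤ.* a′ ⌋ - 1ℚ) * s z
        -- Here ⟨za′ - 1⟩ is m - 1 and not ⟨za′⟩ - 1 = -1; the factor s(z) = 0 makes this harmless.
        go (yes e) = trans (zero-*ʳ (ν ⌊ z ℤ.* a′ ℤ.- + 1 ⌋) (s-0 e)) (sym (zero-*ʳ (ν ⌊ z ℤ.* a′ ⌋ - 1ℚ) (s-0 e)))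
        go (no z≁0) = cong (_* s z) (nonzero-case ⌊ z ℤ.* a′ ⌋ (⌊⌋<m (z ℤ.* a′)) (~⌊⌋ (z ℤ.* a′)))
          where
          nonzero-case : ∀ n → n ℕ.< m → z ℤ.* a′ ~ + n → ν ⌊ z ℤ.* a′ ℤ.- + 1 ⌋ ≡ ν n - 1ℚ
          nonzero-case zero _ e = ⊥-elim (z≁0 (~-trans (~-sym (cancel z))
              (subst₂ _~_ (lemma a a′ z) (ℤₚ.*-zeroʳ a) (~-*ˡ a e))))
            where
            lemma : ∀ a a′ z → a ℤ.* (z ℤ.* a′) ≡ a ℤ.* z ℤ.* a′
            lemma = ℤSolver.solve-∀
          nonzero-case (suc n) n<m e = trans
            (cong ν (trans (⌊⌋-cong (~-+ e (~-refl {ℤ.- + 1}))) (⌊⌋-small (ℕₚ.<⇒≤ n<m))))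
            (sym (trans (cong (_- 1ℚ) (ν-suc n)) (lemma (ν n))))
            where
            lemma : ∀ x → 1ℚ + x - 1ℚ ≡ x
            lemma = solve-∀ ℚring
      differences : ∑ residues (λ k → ν k * (g (a ℤ.+ a ℤ.* + k) - g (a ℤ.* + k))) ≡ - G
      differences = begin
        ∑ residues (λ k → ν k * (g (a ℤ.+ a ℤ.* + k) - g (a ℤ.* + k)))
          ≡⟨ ∑-cong residues (λ k → cong (λ t → ν k * (g t - g (a ℤ.* + k))) (step k)) ⟩
        ∑ residues (λ k → ν k * (g (a ℤ.* + suc k) - g (a ℤ.* + k)))
          ≡⟨ ∑-by-parts (λ k → g (a ℤ.* + k)) m ⟩
        ν m * g (a ℤ.* + m) - ∑ residues (λ k → g (a ℤ.* + suc k))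
          -- The boundary term m g(am) vanishes because am ≡ 0.
          ≡⟨ cong₂ _-_ (zero-*ʳ (ν m) (g-0 (subst (a ℤ.* + m ~_) (ℤₚ.*-zeroʳ a) (~-*ˡ a m~0))))
               (trans (∑-cong residues (λ k → cong g (sym (step k)))) (∑-affine {g} g-cong a {a} a-unit)) ⟩
        0ℚ - G ≡⟨ +-identityˡ (- G) ⟩
        - G ∎
      total : ∑ residues (λ k → ν k * (c a * (g (a ℤ.+ a ℤ.* + k) - g (a ℤ.* + k)) - (s (a ℤ.+ a ℤ.* + k) + s (a ℤ.* + k))))
        ≡ - (c a * G + S)
      total = begin
        ∑ residues (λ k → ν k * (c a * (g (a ℤ.+ a ℤ.* + k) - g (a ℤ.* + k)) - (s (a ℤ.+ a ℤ.* + k) + s (a ℤ.* + k))))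
          ≡⟨ ∑-cong residues (λ k → expand (ν k) (c a) (g (a ℤ.+ a ℤ.* + k) - g (a ℤ.* + k)) (s (a ℤ.+ a ℤ.* + k)) (s (a ℤ.* + k))) ⟩
        ∑ residues (λ k → c a * (ν k * (g (a ℤ.+ a ℤ.* + k) - g (a ℤ.* + k)))
            + - (ν k * s (a ℤ.+ a ℤ.* + k) + ν k * s (a ℤ.* + k)))
          ≡⟨ trans (∑-+ residues _ _) (cong₂ _+_ (sym (∑-*ˡ residues (c a) _)) (∑-neg residues _)) ⟩
        c a * ∑ residues (λ k → ν k * (g (a ℤ.+ a ℤ.* + k) - g (a ℤ.* + k)))
            + - ∑ residues (λ k → ν k * s (a ℤ.+ a ℤ.* + k) + ν k * s (a ℤ.* + k))
          ≡⟨ cong₂ (λ x y → c a * x + - y) differences (trans (∑-+ residues _ _) (trans (cong₂ _+_ S₁ S₀) (sym (∑-+ residues _ _)))) ⟩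
        c a * (- G) + - ∑ residues (λ j → F₁ (+ j) + F₀ (+ j))
          ≡⟨ cong (λ x → c a * (- G) + - x) (∑-cong residues (λ j →
               trans (cong (_+ F₀ (+ j)) (decrement (+ j))) (merge (ν ⌊ + j ℤ.* a′ ⌋) (s (+ j))))) ⟩
        c a * (- G) + - S
          ≡⟨ factor (c a) G S ⟩
        - (c a * G + S) ∎
        where
        expand : ∀ k A d s₁ s₀ → k * (A * d - (s₁ + s₀)) ≡ A * (k * d) + - (k * s₁ + k * s₀)
        expand = solve-∀ ℚring
        merge : ∀ n s → (n - 1ℚ) * s + n * s ≡ s * ((1ℚ + 1ℚ) * n - 1ℚ)
        merge = solve-∀ ℚring
        factor : ∀ A G S → A * (- G) + - S ≡ - (A * G + S)
        factor = solve-∀ ℚring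

    module _ (1<m : 1 ℕ.< m) (unit? : ∀ a → Dec (Unit a)) where

      open Inverse unit?

      unit≁0 : ∀ {a} → Unit a → ¬ (a ~ + 0)
      unit≁0 {a} (a′ , e) a~0 with residue-unique 1<m (ℕₚ.<-trans (ℕ.s≤s ℕ.z≤n) 1<m) (~-trans (~-sym e) (~-*ʳ a′ a~0))
      ... | ()

      -- If the odd function a ↦ φ(a⁻¹) is orthogonal to all a ↦ ⟨ja⟩, then ∑ φ(n)/n vanishes in the limit.
      vanishing : (φ : ℤ → ℤ) (B : ℚ) → Periodic φ → (∀ z → φ (ℤ.- z) ≡ ℤ.- φ z) →
        (∀ {a} → ¬ Unit a → φ a ≡ + 0) → (∀ z → ∣ ι (φ z) ∣ ≤ B) →
        (∀ j → ∑ residues (λ a → ι (φ (+ a)) * ν ⌊ j ℤ.* inv (+ a) ⌋) ≡ 0ℚ) →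
        ∣ ∑ (range Z) (λ n → ι (φ (+ n)) * rec n) ∣ ≤ 2ℚ * ((ν m * B) * ((ν m * ν m) * MMε))
      vanishing φ B φ-cong φ-odd φ-nonunit φ-bound orth = begin
        ∣ E ∣                                    ≡⟨ sym (*-identityˡ ∣ E ∣) ⟩
        -- The unknown constant G is bounded below through 1 = q(1)g(1) ≤ 4G; the factor 4 splits
        -- into the 2 in front and the 2 of E + E.
        1ℚ * ∣ E ∣                               ≡⟨ cong (_* ∣ E ∣) (sym (q*g {+ 1} (unit≁0 unit-1))) ⟩
        q (+ 1) * g (+ 1) * ∣ E ∣                ≤⟨ *-monoˡ (0≤∣p∣ E) (*-mono (0≤q (+ 1)) (q-upper (+ 1)) (0≤g (+ 1)) g≤G) ⟩
        (2ℚ + 2ℚ) * G * ∣ E ∣                    ≡⟨ regroup 1ℚ G ∣ E ∣ ⟩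
        2ℚ * (G * (∣ E ∣ + ∣ E ∣))               ≡⟨ cong (2ℚ *_) (trans (cong (G *_) (sym double)) (sym (∣*∣ˡ (E + E) 0≤G))) ⟩
        2ℚ * ∣ G * (E + E) ∣                     ≤⟨ *-monoʳ (+-nonNeg 0≤1 0≤1) (≤-respˡ (cong ∣_∣ main) total≤) ⟩
        2ℚ * ((ν m * B) * D)                     ∎
        where
        open ≤-Reasoning
        E = ∑ (range Z) (λ n → ι (φ (+ n)) * rec n)
        D = (ν m * ν m) * MMε
        S : ℤ → ℚ
        S a = ∑ residues (λ j → s (+ j) * weight (inv a) (+ j))
        0≤G : 0ℚ ≤ G
        0≤G = ∑-nonNeg residues (λ {j} _ → 0≤g (+ j))
        g≤G : g (+ 1) ≤ G
        g≤G = term≤∑ residues {λ j → g (+ j)} (λ {j} _ → 0≤g (+ j)) (∈-downFrom⁺ 1<m)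
        regroup : ∀ o G e → ((o + o) + (o + o)) * G * e ≡ (o + o) * (G * (e + e))
        regroup = solve-∀ ℚring
        double : ∣ E + E ∣ ≡ ∣ E ∣ + ∣ E ∣
        double = trans (cong ∣_∣ (two E)) (trans (∣*∣ˡ E (+-nonNeg 0≤1 0≤1)) (sym (two ∣ E ∣)))
          where
          two : ∀ e → e + e ≡ (1ℚ + 1ℚ) * e
          two = solve-∀ ℚring
        0≤D : 0ℚ ≤ D
        0≤D = *-nonNeg (*-nonNeg (0≤ν m) (0≤ν m)) 0≤MMε
        total≤ : ∣ ∑ residues (λ a → ι (φ (+ a)) * (c (+ a) * G + S (+ a))) ∣ ≤ (ν m * B) * D
        total≤ = ≤-trans (∣∑∣≤∑ residues {g = λ _ → B * D} (λ {a} _ → bound (+ a) (unit? (+ a))))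
          (≤-reflexive (trans (∑-const residues (B * D)) (trans (cong (λ t → ν t * (B * D)) (length-downFrom m)) (sym (*-assoc (ν m) B D)))))
          where
          bound : ∀ a → Dec (Unit a) → ∣ ι (φ a) * (c a * G + S a) ∣ ≤ B * D
          bound a (yes ua) = ∣*∣≤ (φ-bound a) (cotangent a (inv a) (*-inv a ua) (unit≁0 ua))
          bound a (no ¬ua) = ≤-respˡ (sym (cong ∣_∣ (zero-*ˡ (c a * G + S a) (trans (cong ι (φ-nonunit ¬ua)) ι-0))))
            (*-nonNeg (∣∣≤⇒0≤ (φ-bound a)) 0≤D)
        φ-sum : ∑ residues (λ a → ι (φ (+ a))) ≡ 0ℚ
        φ-sum = self-negative (trans (sym (∑-neg-index {λ z → ι (φ z)} (λ e → cong ι (φ-cong e))))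
          (trans (∑-cong residues (λ a → trans (cong ι (φ-odd (+ a))) (ι-neg (φ (+ a))))) (∑-neg residues _)))
        -- After interchanging the sums, the coefficient of s(j) is 2 ∑ φ(a)⟨ja⁻¹⟩ - ∑ φ(a); the
        -- first sum vanishes by orthogonality and the second by oddness.
        S-total : ∑ residues (λ a → ι (φ (+ a)) * S (+ a)) ≡ 0ℚ
        S-total = trans
          (∑-cong residues (λ a → ∑-*ˡ residues (ι (φ (+ a))) _))
          (trans (∑-swap residues residues _) (∑-zero∈ residues (λ {j} _ → trans
            (∑-cong residues (λ a → rearrange (ι (φ (+ a))) (s (+ j)) (ν ⌊ + j ℤ.* inv (+ a) ⌋)))
            (trans (sym (∑-*ˡ residues (s (+ j)) _)) (zero-*ʳ (s (+ j)) (trans (∑-+ residues _ _)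
              (zero-+ˡ (trans (sym (∑-*ˡ residues 2ℚ _)) (zero-*ʳ 2ℚ (orth (+ j))))
                (trans (∑-neg residues _) (cong -_ φ-sum)))))))))
          where
          rearrange : ∀ f s n → f * (s * ((1ℚ + 1ℚ) * n - 1ℚ)) ≡ s * ((1ℚ + 1ℚ) * (f * n) + - f)
          rearrange = solve-∀ ℚring
        -- Collecting the classes gives ∑ φ(z)/z over [-Z, Z], and φ(z)/z is even.
        c-total : ∑ residues (λ a → ι (φ (+ a)) * c (+ a)) ≡ E + E
        c-total = begin-equality
          ∑ residues (λ a → ι (φ (+ a)) * c (+ a))
            ≡⟨ ∑-cong residues (λ a → ∑-*ˡ zs (ι (φ (+ a))) _) ⟩
          ∑ residues (λ a → ∑ zs (λ z → ι (φ (+ a)) * (χ (z ~? + a) * recℤ z)))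
            ≡⟨ ∑-swap residues zs _ ⟩
          ∑ zs (λ z → ∑ residues (λ a → ι (φ (+ a)) * (χ (z ~? + a) * recℤ z)))
            ≡⟨ ∑-cong zs (λ z → trans (∑-cong residues (λ a → trans
                 (cong (λ t → ι (φ (+ a)) * (t * recℤ z)) (χ-⇔ (z ~? + a) (+ a ~? z) ~-sym ~-sym))
                 (reorder (ι (φ (+ a))) (χ (+ a ~? z)) (recℤ z))))
                 (trans (sym (∑-*ʳ residues (recℤ z) _)) (cong (_* recℤ z)
                   (∑-residue {λ w → ι (φ w)} (λ e → cong ι (φ-cong e)) z)))) ⟩
          ∑ zs (λ z → ι (φ z) * recℤ z)
            ≡⟨ ∑-ints Z (λ z → ι (φ z) * recℤ z) ⟩
          ι (φ (+ 0)) * rec 0 + (E + ∑ (range Z) (λ n → ι (φ (minus n)) * recℤ (minus n)))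
            ≡⟨ zero-+ˡ (zero-*ʳ (ι (φ (+ 0))) rec-0) (cong (_+_ E) (∑-cong (range Z) (λ n →
                 trans (cong₂ _*_ (trans (cong ι (φ-odd (+ n))) (ι-neg (φ (+ n)))) (recℤ-neg (+ n)))
                   (negneg (ι (φ (+ n))) (rec n))))) ⟩
          E + E ∎
          where
          reorder : ∀ f x r → f * (x * r) ≡ (x * f) * r
          reorder = solve-∀ ℚring
          negneg : ∀ a b → (- a) * (- b) ≡ a * b
          negneg = solve-∀ ℚring
        main : ∑ residues (λ a → ι (φ (+ a)) * (c (+ a) * G + S (+ a))) ≡ G * (E + E)
        main = begin-equality
          ∑ residues (λ a → ι (φ (+ a)) * (c (+ a) * G + S (+ a)))
            ≡⟨ ∑-cong residues (λ a → expand (ι (φ (+ a))) (c (+ a)) G (S (+ a))) ⟩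
          ∑ residues (λ a → G * (ι (φ (+ a)) * c (+ a)) + ι (φ (+ a)) * S (+ a))
            ≡⟨ trans (∑-+ residues _ _) (cong (_+ ∑ residues (λ a → ι (φ (+ a)) * S (+ a))) (sym (∑-*ˡ residues G _))) ⟩
          G * ∑ residues (λ a → ι (φ (+ a)) * c (+ a)) + ∑ residues (λ a → ι (φ (+ a)) * S (+ a))
            ≡⟨ zero-+ʳ (cong (G *_) c-total) S-total ⟩
          G * (E + E) ∎
          where
          expand : ∀ f c G s → f * (c * G + s) ≡ G * (f * c) + f * s
          expand = solve-∀ ℚring

-- Passage to the limit, Abel summation and the growth of the harmonic sum

module Tail where

  open import Data.Empty using (⊥-elim)
  open import Data.Integer as ℤ using (+_)
  open import Data.List using (List; []; _∷_; downFrom)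
  open import Data.List.Properties using (length-downFrom)
  open import Data.Nat as ℕ using (ℕ; zero; suc; NonZero; _^_)
  import Data.Nat.DivMod as ℕ
  import Data.Nat.Properties as ℕₚ
  import Data.Nat.Tactic.RingSolver as ℕSolver
  open import Data.Product using (proj₁; proj₂)
  open import Data.Rational hiding (NonZero; floor)
  open import Data.Rational.Properties
  open import Relation.Binary.PropositionalEquality
    using (_≡_; _≢_; refl; sym; trans; cong; cong₂; subst; subst₂; module ≡-Reasoning)
  open import Relation.Nullary using (yes; no)
  open import Tactic.RingSolver using (solve-∀)
  open Rat
  open Ranges
  open Lattice

  0≤2 : 0ℚ ≤ 2ℚ
  0≤2 = +-nonNeg 0≤1 0≤1

  -- By the Archimedean property K/(i + 1) drops below any positive p - q. This replaces limits:
  -- quantities depending on a cutoff enter only through such errors.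
  ≤-limit : ∀ {p q} K i₀ → (∀ i → i₀ ℕ.≤ i → p ≤ q + K * rec (suc i)) → p ≤ q
  ≤-limit {p} {q} K i₀ approx with p ≤? q
  ... | yes p≤q = p≤q
  ... | no p≰q  = ⊥-elim (<-irrefl refl (<-≤-trans 0<δ δ≤0))
    where
    δ = p - q
    0<δ : 0ℚ < δ
    0<δ = subst (_< δ) (+-inverseʳ q) (+-monoˡ-< (- q) (≰⇒> p≰q))
    0≤δ = <⇒≤ 0<δ
    δ≢0 : δ ≢ 0ℚ
    δ≢0 e = <-irrefl (sym e) 0<δ
    n = proj₁ (archimedean (K * recip δ))
    i = i₀ ℕ.+ n
    K≤ : K ≤ δ * ν n
    K≤ = ≤-respˡ (trans (lemma δ K (recip δ)) (trans (cong (K *_) (*-recip δ≢0)) (*-identityʳ K)))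
      (*-monoʳ 0≤δ (proj₂ (archimedean (K * recip δ))))
      where
      lemma : ∀ d k r → d * (k * r) ≡ k * (d * r)
      lemma = solve-∀ ℚring
    δ≤ : δ ≤ K * rec (suc i)
    δ≤ = ≤-respʳ (lemma q (K * rec (suc i))) (+-monoˡ-≤ (- q) (approx i (ℕₚ.m≤m+n i₀ n)))
      where
      lemma : ∀ q x → q + x - q ≡ x
      lemma = solve-∀ ℚring
    step : δ * (1ℚ + ν n) ≤ δ * ν n
    step = begin
      δ * (1ℚ + ν n)                ≤⟨ *-monoʳ 0≤δ (≤-respˡ (ν-suc n) (ν-mono-≤ (ℕ.s≤s (ℕₚ.m≤n+m n i₀)))) ⟩
      δ * ν (suc i)                 ≤⟨ *-monoˡ (0≤ν (suc i)) δ≤ ⟩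
      K * rec (suc i) * ν (suc i)   ≡⟨ trans (*-assoc K (rec (suc i)) (ν (suc i))) (trans (cong (K *_)
                                         (trans (*-comm (rec (suc i)) (ν (suc i))) (ν*rec i))) (*-identityʳ K)) ⟩
      K                             ≤⟨ K≤ ⟩
      δ * ν n                       ∎
      where open ≤-Reasoning
    δ≤0 : δ ≤ 0ℚ
    δ≤0 = subst₂ _≤_ (lemma δ (ν n)) (+-inverseʳ (δ * ν n)) (+-monoˡ-≤ (- (δ * ν n)) step)
      where
      lemma : ∀ d n → d * (1ℚ + n) - d * n ≡ d
      lemma = solve-∀ ℚring

  range-+ : ∀ k n (F : ℕ → ℚ) → ∑ (range (k ℕ.+ n)) F ≡ ∑ (downFrom k) (λ i → F (suc (i ℕ.+ n))) + ∑ (range n) F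
  range-+ zero    n F = sym (zero-+ˡ (∑-[] (λ i → F (suc (i ℕ.+ n)))) refl)
  range-+ (suc k) n F = begin
    ∑ (range (suc k ℕ.+ n)) F
      ≡⟨ ∑-∷ (suc (k ℕ.+ n)) (range (k ℕ.+ n)) F ⟩
    F (suc (k ℕ.+ n)) + ∑ (range (k ℕ.+ n)) F
      ≡⟨ cong (_+_ (F (suc (k ℕ.+ n)))) (range-+ k n F) ⟩
    F (suc (k ℕ.+ n)) + (∑ (downFrom k) (λ i → F (suc (i ℕ.+ n))) + ∑ (range n) F)
      ≡⟨ sym (+-assoc (F (suc (k ℕ.+ n))) (∑ (downFrom k) (λ i → F (suc (i ℕ.+ n)))) (∑ (range n) F)) ⟩
    (F (suc (k ℕ.+ n)) + ∑ (downFrom k) (λ i → F (suc (i ℕ.+ n)))) + ∑ (range n) F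
      ≡⟨ cong (_+ ∑ (range n) F) (sym (∑-∷ k (downFrom k) (λ i → F (suc (i ℕ.+ n))))) ⟩
    ∑ (k ∷ downFrom k) (λ i → F (suc (i ℕ.+ n))) + ∑ (range n) F ∎
    where open ≡-Reasoning

  module Abel (ψ : ℕ → ℚ) (B : ℚ) (bounded : ∀ n → ∣ ∑ (range n) ψ ∣ ≤ B) where

    Ψ H : ℕ → ℚ
    Ψ n = ∑ (range n) ψ
    H n = ∑ (range n) (λ k → ψ k * rec k)

    private
      D : ℕ → ℚ
      D n = H n - Ψ n * rec (suc n)

      D-step : ∀ n → D (suc n) - D n ≡ Ψ (suc n) * (rec (suc n) - rec (suc (suc n)))
      D-step n = trans
        (cong₂ (λ h s → (h - s * r′) - (H n - Ψ n * r)) (∑-∷ (suc n) (range n) (λ k → ψ k * rec k)) Ψ-suc)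
        (trans (lemma (ψ (suc n)) (Ψ n) (H n) r r′) (cong (_* (r - r′)) (sym Ψ-suc)))
        where
        r  = rec (suc n)
        r′ = rec (suc (suc n))
        Ψ-suc = ∑-∷ (suc n) (range n) ψ
        lemma : ∀ p P h r r′ → ((p * r + h) - (p + P) * r′) - (h - P * r) ≡ (p + P) * (r - r′)
        lemma = solve-∀ ℚring

      D-bound : ∀ k n → ∣ D (k ℕ.+ n) - D n ∣ ≤ B * (rec (suc n) - rec (suc (k ℕ.+ n)))
      D-bound zero    n = ≤-reflexive (trans (cong ∣_∣ (+-inverseʳ (D n)))
        (sym (trans (cong (B *_) (+-inverseʳ (rec (suc n)))) (*-zeroʳ B))))
      D-bound (suc k) n = subst₂ (λ x y → ∣ x ∣ ≤ y) (telescope (D (suc (k ℕ.+ n))) (D (k ℕ.+ n)) (D n))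
        (add B (rec (suc n)) (rec (suc (k ℕ.+ n))) (rec (suc (suc (k ℕ.+ n)))))
        (∣+∣≤ (subst (λ t → ∣ t ∣ ≤ B * (r - r′)) (sym (D-step (k ℕ.+ n)))
            (∣*∣≤ (bounded (suc (k ℕ.+ n))) (≤-reflexive (0≤p⇒∣p∣≡p (p≤q⇒0≤q-p (rec-anti (ℕₚ.n≤1+n (k ℕ.+ n))))))))
          (D-bound k n))
        where
        r  = rec (suc (k ℕ.+ n))
        r′ = rec (suc (suc (k ℕ.+ n)))
        telescope : ∀ a b c → (a - b) + (b - c) ≡ a - c
        telescope = solve-∀ ℚring
        add : ∀ B x y z → B * (y - z) + B * (x - y) ≡ B * (x - z)
        add = solve-∀ ℚring

    -- Abel summation: H(n) - Ψ(n)/(n + 1) has the increments Ψ(n + 1)(1/(n + 1) - 1/(n + 2)), and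
    -- the bounds B(1/(n + 1) - 1/(n + 2)) telescope.
    tail : ∀ {n n′} → n ℕ.≤ n′ → ∣ H n′ - H n ∣ ≤ 2ℚ * B * rec (suc n)
    tail {n} {n′} n≤n′ = subst (λ x → ∣ H x - H n ∣ ≤ 2ℚ * B * rec (suc n)) (ℕₚ.m∸n+n≡m n≤n′) (go (n′ ℕ.∸ n))
      where
      go : ∀ k → ∣ H (k ℕ.+ n) - H n ∣ ≤ 2ℚ * B * rec (suc n)
      go k = subst₂ (λ x y → ∣ x ∣ ≤ y) (lemma (H (k ℕ.+ n)) (H n) (Ψ (k ℕ.+ n) * r′) (Ψ n * r)) (add B r r′)
        (∣+∣≤ (D-bound k n) (∣-∣≤ (∣*∣≤ (bounded (k ℕ.+ n)) (≤-reflexive (∣rec∣ (suc (k ℕ.+ n)))))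
                                  (∣*∣≤ (bounded n) (≤-reflexive (∣rec∣ (suc n))))))
        where
        r  = rec (suc n)
        r′ = rec (suc (k ℕ.+ n))
        lemma : ∀ a b x y → ((a - x) - (b - y)) + (x - y) ≡ a - b
        lemma = solve-∀ ℚring
        add : ∀ B x y → B * (x - y) + (B * y + B * x) ≡ (1ℚ + 1ℚ) * B * x
        add = solve-∀ ℚring

    -- Small values along a single sequence of cutoffs suffice: H(n) = H(Z i) - (H(Z i) - H(n)),
    -- where `tail` bounds the difference independently of i. So the sums tend to 0 at rate 1/n,
    -- although the given rate along `Z` is much weaker.
    tail-zero : ∀ K i₀ (Z : ℕ → ℕ) → (∀ i → i ℕ.≤ Z i) →
      (∀ i → i₀ ℕ.≤ i → ∣ H (Z i) ∣ ≤ K * rec (suc i)) → ∀ n → ∣ H n ∣ ≤ 2ℚ * B * rec (suc n)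
    tail-zero K i₀ Z i≤Z small n = ≤-limit K (i₀ ℕ.+ n) (λ i le → subst (_≤ 2ℚ * B * rec (suc n) + K * rec (suc i))
      (cong ∣_∣ (lemma (H (Z i)) (H n)))
      (≤-respʳ (+-comm (K * rec (suc i)) (2ℚ * B * rec (suc n)))
        (∣-∣≤ (small i (ℕₚ.≤-trans (ℕₚ.m≤m+n i₀ n) le))
        (tail (ℕₚ.≤-trans (ℕₚ.≤-trans (ℕₚ.m≤n+m n i₀) le) (i≤Z i))))))
      where
      lemma : ∀ a b → a - (a - b) ≡ b
      lemma = solve-∀ ℚring

  1+i≤2^i : ∀ i → suc i ℕ.≤ 2 ^ i
  1+i≤2^i zero    = ℕₚ.≤-refl
  1+i≤2^i (suc i) = ℕₚ.≤-trans (ℕₚ.+-mono-≤ (ℕₚ.≤-trans (ℕ.s≤s ℕ.z≤n) (1+i≤2^i i)) (1+i≤2^i i))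
    (ℕₚ.≤-reflexive (cong (2 ^ i ℕ.+_) (sym (ℕₚ.+-identityʳ (2 ^ i)))))

  rec-mono : ∀ {a b} → 1 ℕ.≤ a → a ℕ.≤ b → rec b ≤ rec a
  rec-mono {suc a} {suc b} _ (ℕ.s≤s a≤b) = rec-anti a≤b

  1≤2^ : ∀ i → 1 ℕ.≤ 2 ^ i
  1≤2^ i = ℕₚ.≤-trans (ℕ.s≤s ℕ.z≤n) (1+i≤2^i i)

  ν*rec′ : ∀ {n} → 1 ℕ.≤ n → ν n * rec n ≡ 1ℚ
  ν*rec′ {suc n} _ = ν*rec n

  -- Each dyadic block has 2^j terms of size at most 1/2^j.
  harmonic-2^ : ∀ j → harmonic (2 ^ j) ≤ ν (suc j)
  harmonic-2^ zero    = ≤-reflexive (trans (∑-∷ 1 [] rec) (zero-+ʳ (trans rec-1 (sym ι-1)) (∑-[] rec)))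
  harmonic-2^ (suc j) = begin
    ∑ (range (2 ^ j ℕ.+ (2 ^ j ℕ.+ 0))) rec
      ≡⟨ cong (λ t → ∑ (range (2 ^ j ℕ.+ t)) rec) (ℕₚ.+-identityʳ (2 ^ j)) ⟩
    ∑ (range (2 ^ j ℕ.+ 2 ^ j)) rec
      ≡⟨ range-+ (2 ^ j) (2 ^ j) rec ⟩
    ∑ (downFrom (2 ^ j)) (λ i → rec (suc (i ℕ.+ 2 ^ j))) + harmonic (2 ^ j)
      ≤⟨ +-mono-≤ (∑-mono (downFrom (2 ^ j)) (λ i → rec-mono (1≤2^ j) (ℕₚ.m≤n⇒m≤1+n (ℕₚ.m≤n+m (2 ^ j) i)))) (harmonic-2^ j) ⟩
    ∑ (downFrom (2 ^ j)) (λ i → rec (2 ^ j)) + ν (suc j)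
      ≡⟨ cong (_+ ν (suc j)) (trans (∑-const (downFrom (2 ^ j)) (rec (2 ^ j)))
           (trans (cong (λ t → ν t * rec (2 ^ j)) (length-downFrom (2 ^ j))) (ν*rec′ (1≤2^ j)))) ⟩
    1ℚ + ν (suc j)
      ≡⟨ sym (ν-suc (suc j)) ⟩
    ν (suc (suc j)) ∎
    where open ≤-Reasoning

  0≤harmonic : ∀ Z → 0ℚ ≤ harmonic Z
  0≤harmonic Z = ∑-nonNeg (range Z) (λ {n} _ → 0≤rec n)

  2^4i : ∀ i → 2 ^ (4 ℕ.* i) ≡ (2 ^ i ℕ.* 2 ^ i) ℕ.* (2 ^ i ℕ.* 2 ^ i)
  2^4i i = trans (cong (2 ^_) (lemma i)) (trans (ℕₚ.^-distribˡ-+-* 2 (i ℕ.+ i) (i ℕ.+ i))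
    (cong₂ ℕ._*_ (ℕₚ.^-distribˡ-+-* 2 i i) (ℕₚ.^-distribˡ-+-* 2 i i)))
    where
    lemma : ∀ i → 4 ℕ.* i ≡ (i ℕ.+ i) ℕ.+ (i ℕ.+ i)
    lemma = ℕSolver.solve-∀

  -- Write Z = X⁴ with X = 2^i. The harmonic sum H is at most 4i + 1 ≤ 4X, so H + H² ≤ 20X² ≤ 32X²,
  -- and division by Z leaves 32/X² ≤ 32/(i + 1).
  cornerBound-small : ∀ i → cornerBound (2 ^ (4 ℕ.* i)) ≤ ν 32 * rec (suc i)
  cornerBound-small i = begin
    rec (suc Z) * (harmonic Z + harmonic Z * harmonic Z)
      ≤⟨ *-mono (0≤rec (suc Z)) (rec-mono (1≤2^ j) (ℕₚ.n≤1+n Z))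
           (+-nonNeg (0≤harmonic Z) (*-nonNeg (0≤harmonic Z) (0≤harmonic Z)))
           (+-mono-≤ (harmonic-2^ j) (*-mono (0≤harmonic Z) (harmonic-2^ j) (0≤harmonic Z) (harmonic-2^ j))) ⟩
    rec Z * (ν h + ν h * ν h)
      ≡⟨ cong₂ _*_ (trans (cong rec (2^4i i)) (rec-* (X ℕ.* X) (X ℕ.* X)))
           (trans (cong (_+_ (ν h)) (sym (ν-* h h))) (sym (ν-+ h (h ℕ.* h)))) ⟩
    (rec (X ℕ.* X) * rec (X ℕ.* X)) * ν (h ℕ.+ h ℕ.* h)
      ≤⟨ *-monoʳ (*-nonNeg (0≤rec (X ℕ.* X)) (0≤rec (X ℕ.* X))) (ν-mono-≤ h≤) ⟩
    (rec (X ℕ.* X) * rec (X ℕ.* X)) * ν (32 ℕ.* (X ℕ.* X))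
      ≡⟨ cong ((rec (X ℕ.* X) * rec (X ℕ.* X)) *_) (ν-* 32 (X ℕ.* X)) ⟩
    (rec (X ℕ.* X) * rec (X ℕ.* X)) * (ν 32 * ν (X ℕ.* X))
      ≡⟨ lemma (rec (X ℕ.* X)) (ν 32) (ν (X ℕ.* X)) ⟩
    ν 32 * rec (X ℕ.* X) * (ν (X ℕ.* X) * rec (X ℕ.* X))
      ≡⟨ trans (cong (ν 32 * rec (X ℕ.* X) *_) (ν*rec′ (ℕₚ.*-mono-≤ (1≤2^ i) (1≤2^ i)))) (*-identityʳ _) ⟩
    ν 32 * rec (X ℕ.* X)
      ≤⟨ *-monoʳ (0≤ν 32) (rec-mono (ℕ.s≤s ℕ.z≤n) (ℕₚ.≤-trans (1+i≤2^i i) (ℕₚ.m≤m*n X X {{ℕ.>-nonZero (1≤2^ i)}}))) ⟩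
    ν 32 * rec (suc i) ∎
    where
    open ≤-Reasoning
    j = 4 ℕ.* i
    Z = 2 ^ j
    X = 2 ^ i
    h = suc j
    lemma : ∀ r c x → (r * r) * (c * x) ≡ c * r * (x * r)
    lemma = solve-∀ ℚring
    h≤4X : h ℕ.≤ 4 ℕ.* X
    h≤4X = ℕₚ.≤-trans (ℕₚ.≤-trans (ℕₚ.+-monoˡ-≤ (4 ℕ.* i) (ℕ.s≤s (ℕ.z≤n {3}))) (ℕₚ.≤-reflexive (sym (ℕₚ.*-suc 4 i))))
      (ℕₚ.*-monoʳ-≤ 4 (1+i≤2^i i))
    h≤ : h ℕ.+ h ℕ.* h ℕ.≤ 32 ℕ.* (X ℕ.* X)
    h≤ = ℕₚ.≤-trans (ℕₚ.+-mono-≤ (ℕₚ.≤-trans h≤4X (ℕₚ.*-monoʳ-≤ 4 (ℕₚ.m≤m*n X X {{ℕ.>-nonZero (1≤2^ i)}}))) (ℕₚ.*-mono-≤ h≤4X h≤4X))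
      (ℕₚ.≤-trans (ℕₚ.≤-reflexive (expand X)) (ℕₚ.*-monoˡ-≤ (X ℕ.* X) {20} {32} (ℕₚ.m≤m+n 20 12)))
      where
      expand : ∀ X → 4 ℕ.* (X ℕ.* X) ℕ.+ 4 ℕ.* X ℕ.* (4 ℕ.* X) ≡ 20 ℕ.* (X ℕ.* X)
      expand = ℕSolver.solve-∀

-- Functions whose twisted harmonic sums all vanish

module Small where

  open import Data.Integer as ℤ using (ℤ; +_)
  import Data.Integer.Properties as ℤₚ
  import Data.Integer.Tactic.RingSolver as ℤSolver
  open import Data.Nat as ℕ using (ℕ; zero; suc; NonZero; _^_)
  import Data.Nat.DivMod as ℕ
  import Data.Nat.Properties as ℕₚ
  open import Data.Rational hiding (NonZero; floor)
  open import Data.Rational.Properties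
  open import Relation.Binary.PropositionalEquality
    using (_≡_; refl; sym; trans; cong; cong₂; subst)
  open import Relation.Nullary using (Dec; yes; no; ¬_)
  open import Tactic.RingSolver using (solve-∀)
  open Rat
  open Ranges
  open Mod
  open Lattice
  open Vanish
  open Tail

  -- Quantitative form of: ∑ ψ(tk)/k converges to 0 for every t.
  record Small (ψ : ℤ → ℤ) (C : ℚ) : Set where
    field
      value     : ∀ z → ∣ ι (ψ z) ∣ ≤ C
      partial   : ∀ t n → ∣ ∑ (range n) (λ k → ι (ψ (t ℤ.* + k))) ∣ ≤ C
      harmonic≤ : ∀ t n → ∣ ∑ (range n) (λ k → ι (ψ (t ℤ.* + k)) * rec k) ∣ ≤ C * rec (suc n)

  module PeriodicSums (m : ℕ) .{{m≢0 : NonZero m}} where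

    open Modulo m

    1≤m : 1 ℕ.≤ m
    1≤m = ℕ.>-nonZero⁻¹ m

    -- Full periods contribute 0, so the partial sum up to n equals the one up to n mod m, which has
    -- fewer than m terms.
    periodic-partial : ∀ (F : ℤ → ℚ) → Periodic F → ∑ residues (λ a → F (+ a)) ≡ 0ℚ →
      ∀ B → (∀ z → ∣ F z ∣ ≤ B) → ∀ n → ∣ ∑ (range n) (λ k → F (+ k)) ∣ ≤ ν m * B
    periodic-partial F F-cong mean-zero B F≤B n = subst (λ x → ∣ Ψ x ∣ ≤ ν m * B) (sym (ℕ.m≡m%n+[m/n]*n n m))
        (subst (λ x → ∣ x ∣ ≤ ν m * B) (sym (drop-periods (n ℕ./ m) (n ℕ.% m)))
          (≤-trans (∣∑∣≤∑ (range (n ℕ.% m)) {g = λ _ → B} (λ {k} _ → F≤B (+ k)))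
            (≤-trans (≤-reflexive (trans (∑-const (range (n ℕ.% m)) B) (cong (λ x → ν x * B) (length-range (n ℕ.% m)))))
              (*-monoˡ (∣∣≤⇒0≤ (F≤B (+ 0))) (ν-mono-≤ (ℕₚ.<⇒≤ (ℕ.m%n<n n m)))))))
      where
      Ψ : ℕ → ℚ
      Ψ n = ∑ (range n) (λ k → F (+ k))
      shift : ∀ n → Ψ (m ℕ.+ n) ≡ Ψ n
      shift n = trans (range-+ m n (λ k → F (+ k))) (zero-+ˡ (trans
        (∑-cong residues (λ i → cong F (lemma n i)))
        (trans (∑-affine {F} F-cong (+ suc n) {+ 1} unit-1) mean-zero)) refl)
        where
        lemma : ∀ n i → + suc (i ℕ.+ n) ≡ + suc n ℤ.+ + 1 ℤ.* + i
        lemma n i = trans (cong +_ (trans (ℕₚ.+-comm (suc i) n) (ℕₚ.+-suc n i)))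
          (cong (λ x → + suc n ℤ.+ x) (sym (ℤₚ.*-identityˡ (+ i))))
      drop-periods : ∀ q r → Ψ (r ℕ.+ q ℕ.* m) ≡ Ψ r
      drop-periods zero    r = cong Ψ (ℕₚ.+-identityʳ r)
      drop-periods (suc q) r = trans (cong Ψ (lemma r m (q ℕ.* m))) (trans (shift (r ℕ.+ q ℕ.* m)) (drop-periods q r))
        where
        lemma : ∀ r m x → r ℕ.+ (m ℕ.+ x) ≡ m ℕ.+ (r ℕ.+ x)
        lemma r m x = trans (sym (ℕₚ.+-assoc r m x)) (trans (cong (ℕ._+ x) (ℕₚ.+-comm r m)) (ℕₚ.+-assoc m r x))

    B≤mB : ∀ {B} → 0ℚ ≤ B → B ≤ ν m * B
    B≤mB {B} 0≤B = ≤-respˡ (trans (cong (_* B) ι-1) (*-identityˡ B)) (*-monoˡ 0≤B (ν-mono-≤ 1≤m))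

    x≤2x : ∀ {x} → 0ℚ ≤ x → x ≤ 2ℚ * x
    x≤2x {x} 0≤x = ≤-respʳ (lemma x) (p≤p+q 0≤x)
      where
      lemma : ∀ x → x + x ≡ (1ℚ + 1ℚ) * x
      lemma = solve-∀ ℚring

    module _ (unit? : ∀ a → Dec (Unit a)) where

      -- Multiplication by a unit t permutes the residues, so the mean of ψ(tz) is still 0; for a
      -- nonunit t no multiple of t is a unit and every term vanishes.
      unit-supported-partial : (ψ : ℤ → ℤ) (B : ℚ) → Periodic ψ → (∀ {a} → ¬ Unit a → ψ a ≡ + 0) →
        (∀ z → ∣ ι (ψ z) ∣ ≤ B) → ∑ residues (λ a → ι (ψ (+ a))) ≡ 0ℚ →
        ∀ t n → ∣ ∑ (range n) (λ k → ι (ψ (t ℤ.* + k))) ∣ ≤ ν m * B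
      unit-supported-partial ψ B ψ-cong ψ-nonunit ψ≤B mean-zero t =
        periodic-partial (λ z → ι (ψ (t ℤ.* z))) (λ e → cong ι (ψ-cong (~-*ˡ t e))) (go (unit? t)) B (λ z → ψ≤B (t ℤ.* z))
        where
        go : Dec (Unit t) → ∑ residues (λ a → ι (ψ (t ℤ.* + a))) ≡ 0ℚ
        go (yes ut) = trans (∑-scale {λ z → ι (ψ z)} (λ e → cong ι (ψ-cong e)) {t} ut) mean-zero
        go (no ¬ut) = ∑-zero∈ residues (λ {a} _ → trans (cong ι (ψ-nonunit
          (λ u → ¬ut (unit-factorʳ {+ a} {t} (subst Unit (ℤₚ.*-comm t (+ a)) u))))) ι-0)

      module _ (1<m : 1 ℕ.< m) where

        open Inverse unit?

        -- Along the cutoffs 2^(4i) the error in `vanishing` tends to 0, and `tail-zero` upgrades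
        -- this to the rate 1/n demanded by `Small`. Cutoffs count from i = m on, so that they
        -- exceed m.
        orthogonal⇒small : (φ : ℤ → ℤ) (B : ℚ) → Periodic φ → (∀ z → φ (ℤ.- z) ≡ ℤ.- φ z) →
          (∀ {a} → ¬ Unit a → φ a ≡ + 0) → (∀ z → ∣ ι (φ z) ∣ ≤ B) →
          (∀ j → ∑ residues (λ a → ι (φ (+ a)) * ν ⌊ j ℤ.* inv (+ a) ⌋) ≡ 0ℚ) →
          Small φ (2ℚ * (ν m * B))
        orthogonal⇒small φ B φ-cong φ-odd φ-nonunit φ≤B orth = record
          { value     = λ z → ≤-trans (φ≤B z) (≤-trans (B≤mB 0≤B) (x≤2x 0≤mB))
          ; partial   = λ t n → ≤-trans (partial≤ t n) (x≤2x 0≤mB)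
          ; harmonic≤ = λ t → go t (unit? t)
          }
          where
          0≤B = ∣∣≤⇒0≤ (φ≤B (+ 0))
          0≤mB = *-nonNeg (0≤ν m) 0≤B
          mean-zero : ∑ residues (λ a → ι (φ (+ a))) ≡ 0ℚ
          mean-zero = self-negative (trans (sym (∑-neg-index {λ z → ι (φ z)} (λ e → cong ι (φ-cong e))))
            (trans (∑-cong residues (λ a → trans (cong ι (φ-odd (+ a))) (ι-neg (φ (+ a))))) (∑-neg residues _)))
          partial≤ = unit-supported-partial φ B φ-cong φ-nonunit φ≤B mean-zero
          go : ∀ t → Dec (Unit t) → ∀ n → ∣ ∑ (range n) (λ k → ι (φ (t ℤ.* + k)) * rec k) ∣ ≤ 2ℚ * (ν m * B) * rec (suc n)
          go t (no ¬ut) n = ≤-respˡ (sym (cong ∣_∣ (∑-zero∈ (range n) (λ {k} _ → zero-*ˡ (rec k) (trans (cong ι (φ-nonunit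
            (λ u → ¬ut (unit-factorʳ {+ k} {t} (subst Unit (ℤₚ.*-comm t (+ k)) u))))) ι-0)))))
            (*-nonNeg (*-nonNeg 0≤2 0≤mB) (0≤rec (suc n)))
          go t (yes ut) = Abel.tail-zero (λ k → ι (φ (t ℤ.* + k))) (ν m * B) (partial≤ t)
              K m (λ i → 2 ^ (4 ℕ.* i)) i≤Z small
            where
            -- `K₀` is the factor of ε in `vanishing`. Since ε is four times `cornerSum`, which is
            -- at most twice 32/(i + 1), eight copies of 32 appear in `K`.
            K₀ = 2ℚ * ((ν m * B) * (ν m * ν m * ((ν m * ν m) * (ν m * ν m))))
            K = K₀ * (((ν 32 + ν 32) + (ν 32 + ν 32)) + ((ν 32 + ν 32) + (ν 32 + ν 32)))
            i≤Z : ∀ i → i ℕ.≤ 2 ^ (4 ℕ.* i)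
            i≤Z i = ℕₚ.≤-trans (ℕₚ.m≤n⇒m≤1+n (ℕₚ.m≤n*m i 4)) (1+i≤2^i (4 ℕ.* i))
            -- As a⁻¹ = t(ta)⁻¹, the relation at j for the translate z ↦ φ(tz) is the relation at jt
            -- for φ.
            φₜ-orth : ∀ j → ∑ residues (λ a → ι (φ (t ℤ.* + a)) * ν ⌊ j ℤ.* inv (+ a) ⌋) ≡ 0ℚ
            φₜ-orth j = trans (∑-cong residues (λ a → pointwise (+ a) (unit? (+ a))))
                (trans (∑-scale {F} F-cong {t} ut) (orth (j ℤ.* t)))
              where
              F : ℤ → ℚ
              F z = ι (φ z) * ν ⌊ j ℤ.* t ℤ.* inv z ⌋
              F-cong : Periodic F
              F-cong e = cong₂ (λ x y → ι x * ν y) (φ-cong e) (⌊⌋-cong (~-*ˡ (j ℤ.* t) (inv-cong e)))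
              pointwise : ∀ a → Dec (Unit a) → ι (φ (t ℤ.* a)) * ν ⌊ j ℤ.* inv a ⌋ ≡ F (t ℤ.* a)
              pointwise a (yes ua) = cong (λ x → ι (φ (t ℤ.* a)) * ν x) (⌊⌋-cong (subst (j ℤ.* inv a ~_)
                  (sym (ℤₚ.*-assoc j t (inv (t ℤ.* a))))
                  (~-*ˡ j (inv-unique a (t ℤ.* inv (t ℤ.* a)) (subst (_~ + 1) (lemma t a (inv (t ℤ.* a)))
                    (*-inv (t ℤ.* a) (unit-* {t} {a} ut ua)))))))
                where
                lemma : ∀ t a b → t ℤ.* a ℤ.* b ≡ a ℤ.* (t ℤ.* b)
                lemma = ℤSolver.solve-∀
              pointwise a (no ¬ua) = trans (zero-*ˡ (ν ⌊ j ℤ.* inv a ⌋) zero′) (sym (zero-*ˡ (ν ⌊ j ℤ.* t ℤ.* inv (t ℤ.* a) ⌋) zero′))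
                where
                zero′ : ι (φ (t ℤ.* a)) ≡ 0ℚ
                zero′ = trans (cong ι (φ-nonunit (λ u → ¬ua (unit-factorʳ {t} {a} u)))) ι-0
            small : ∀ i → m ℕ.≤ i → ∣ ∑ (range (2 ^ (4 ℕ.* i))) (λ k → ι (φ (t ℤ.* + k)) * rec k) ∣ ≤ K * rec (suc i)
            small i m≤i = begin
              ∣ ∑ (range Z) (λ k → ι (φ (t ℤ.* + k)) * rec k) ∣
                ≤⟨ Vanishing.vanishing m Z (ℕₚ.≤-trans m≤i (i≤Z i)) 1<m unit? (λ z → φ (t ℤ.* z)) B
                     (λ e → φ-cong (~-*ˡ t e))
                     (λ z → trans (cong φ (sym (ℤₚ.neg-distribʳ-* t z))) (φ-odd (t ℤ.* z)))
                     (λ {a} ¬ua → φ-nonunit (λ u → ¬ua (unit-factorʳ {t} {a} u)))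
                     (λ z → φ≤B (t ℤ.* z)) φₜ-orth ⟩
              2ℚ * ((ν m * B) * ((ν m * ν m) * (((ν m * ν m) * (ν m * ν m)) * ((E + E) + (E + E)))))
                ≡⟨ regroup 2ℚ (ν m * B) (ν m * ν m) ((E + E) + (E + E)) ⟩
              K₀ * ((E + E) + (E + E))
                ≤⟨ *-monoʳ 0≤K₀ (+-mono-≤ (+-mono-≤ E≤ E≤) (+-mono-≤ E≤ E≤)) ⟩
              K₀ * (((κ + κ) + (κ + κ)) + ((κ + κ) + (κ + κ)))
                ≡⟨ collect K₀ (ν 32) (rec (suc i)) ⟩
              K * rec (suc i) ∎
              where
              open ≤-Reasoning
              Z = 2 ^ (4 ℕ.* i)
              E = cornerSum Z
              κ = ν 32 * rec (suc i)
              E≤ : E ≤ κ + κ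
              E≤ = ≤-trans (cornerSum-bound Z) (+-mono-≤ (cornerBound-small i) (cornerBound-small i))
              0≤mm = *-nonNeg (0≤ν m) (0≤ν m)
              0≤K₀ : 0ℚ ≤ K₀
              0≤K₀ = *-nonNeg 0≤2 (*-nonNeg 0≤mB (*-nonNeg 0≤mm (*-nonNeg 0≤mm 0≤mm)))
              regroup : ∀ t b m E → t * (b * (m * ((m * m) * E))) ≡ (t * (b * (m * (m * m)))) * E
              regroup = solve-∀ ℚring
              collect : ∀ K n r → K * (((n * r + n * r) + (n * r + n * r)) + ((n * r + n * r) + (n * r + n * r)))
                ≡ K * (((n + n) + (n + n)) + ((n + n) + (n + n))) * r
              collect = solve-∀ ℚring

-- Prime factorisation, the Möbius function and additive functions

module Factor where

  open import Data.Empty using (⊥-elim)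
  open import Data.List using (List; []; _∷_; map)
  open import Data.List.Membership.Propositional using (_∈_; _∉_)
  open import Data.List.Relation.Binary.Permutation.Propositional using (_↭_; refl; prep; swap; trans; ↭-sym)
  open import Data.List.Relation.Binary.Permutation.Propositional.Properties using (∈-resp-↭; map⁺)
  open import Data.List.Relation.Unary.All using (All; []; _∷_)
  open import Data.List.Relation.Unary.Any using (here; there)
  open import Data.Nat as ℕ using (ℕ; zero; suc; NonZero)
  open import Data.Nat.Divisibility using (_∣_; _∣?_)
  open import Data.Nat.ListAction using (sum; product)
  open import Data.Nat.ListAction.Properties using (sum-↭; ∈⇒∣product)
  open import Data.Nat.Primality using (Prime; prime⇒nonTrivial; prime⇒nonZero)
  open import Data.Nat.Primality.Factorisation
    using (PrimeFactorisation; factorise; factorisationUnique; factorisationHasAllPrimeFactors)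
  import Data.Nat.Properties as ℕₚ
  open import Data.List.Membership.DecPropositional ℕₚ._≟_ using (_∈?_)
  open import Data.Product using (_×_; _,_; proj₁; proj₂)
  open import Data.Rational hiding (NonZero; floor)
  open import Data.Rational.Properties
  open import Relation.Binary.PropositionalEquality as ≡
    using (_≡_; _≢_; refl; sym; cong; cong₂; subst; module ≡-Reasoning)
  open import Relation.Nullary using (Dec; yes; no)
  open import Relation.Nullary.Decidable using (¬?)
  open import Tactic.RingSolver using (solve-∀)
  open Rat

  factors : ℕ → List ℕ
  factors zero    = []
  factors (suc n) = PrimeFactorisation.factors (factorise (suc n))

  factors-prime : ∀ n → All Prime (factors n)
  factors-prime zero    = []
  factors-prime (suc n) = PrimeFactorisation.factorsPrime (factorise (suc n))

  factors-product : ∀ {n} → 1 ℕ.≤ n → product (factors n) ≡ n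
  factors-product {suc n} _ = sym (PrimeFactorisation.isFactorisation (factorise (suc n)))

  prime-pos : ∀ {q} → Prime q → 1 ℕ.≤ q
  prime-pos pq = ℕ.>-nonZero⁻¹ _ {{prime⇒nonZero pq}}

  2≤prime : ∀ {q} → Prime q → 2 ℕ.≤ q
  2≤prime pq = ℕ.nonTrivial⇒n>1 _ {{prime⇒nonTrivial pq}}

  *-pos : ∀ {a b} → 1 ℕ.≤ a → 1 ℕ.≤ b → 1 ℕ.≤ a ℕ.* b
  *-pos = ℕₚ.*-mono-≤

  factors-* : ∀ {q d} → Prime q → 1 ℕ.≤ d → factors (q ℕ.* d) ↭ q ∷ factors d
  factors-* {q} {d} pq 1≤d = go (q ℕ.* d) refl (*-pos (prime-pos pq) 1≤d)
    where
    go : ∀ n → n ≡ q ℕ.* d → 1 ℕ.≤ n → factors n ↭ q ∷ factors d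
    go (suc n) eq _ = factorisationUnique (factorise (suc n)) (record
      { factors         = q ∷ factors d
      ; isFactorisation = ≡.trans eq (cong (q ℕ.*_) (sym (factors-product 1≤d)))
      ; factorsPrime    = pq ∷ factors-prime d
      })

  product-pos : ∀ {ps} → All Prime ps → 1 ℕ.≤ product ps
  product-pos []         = ℕₚ.≤-refl
  product-pos (pq ∷ pps) = *-pos (prime-pos pq) (product-pos pps)

  -- Divisor sums are evaluated by adding one prime factor at a time, repeated or new, instead of by
  -- splitting into coprime prime powers.
  prime-induction : (P : ℕ → Set) → P 1 → (∀ q M → Prime q → 1 ℕ.≤ M → P M → P (q ℕ.* M)) → ∀ N → 1 ℕ.≤ N → P N
  prime-induction P P1 step N 1≤N = subst P (factors-product 1≤N) (go (factors-prime N))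
    where
    go : ∀ {ps} → All Prime ps → P (product ps)
    go []         = P1
    go (pq ∷ pps) = step _ _ pq (product-pos pps) (go pps)

  prime∣⇔∈ : ∀ {q d} → Prime q → 1 ℕ.≤ d → (q ∣ d → q ∈ factors d) × (q ∈ factors d → q ∣ d)
  prime∣⇔∈ {q} {d} pq 1≤d =
    (λ q∣d → factorisationHasAllPrimeFactors pq (subst (q ∣_) (sym (factors-product 1≤d)) q∣d) (factors-prime d)) ,
    (λ q∈ → subst (q ∣_) (factors-product 1≤d) (∈⇒∣product q∈))

  ω : ℕ → ℕ → ℚ
  ω q d = χ (¬? (q ∣? d))

  private
    μ-list : List ℕ → ℚ
    μ-list []       = 1ℚ
    μ-list (q ∷ ps) = χ (¬? (q ∈? ps)) * (- μ-list ps)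

    χ-∉-∷ : ∀ x y xs → χ (¬? (x ∈? (y ∷ xs))) ≡ χ (¬? (x ℕ.≟ y)) * χ (¬? (x ∈? xs))
    χ-∉-∷ x y xs = go (x ℕ.≟ y) (x ∈? xs)
      where
      go : Dec (x ≡ y) → Dec (x ∈ xs) → χ (¬? (x ∈? (y ∷ xs))) ≡ χ (¬? (x ℕ.≟ y)) * χ (¬? (x ∈? xs))
      go (yes x≡y) _ = ≡.trans (χ-no (¬? (x ∈? (y ∷ xs))) (λ ∉ → ∉ (here x≡y)))
        (sym (zero-*ˡ (χ (¬? (x ∈? xs))) (χ-no (¬? (x ℕ.≟ y)) (λ ≢ → ≢ x≡y))))
      go (no _) (yes x∈) = ≡.trans (χ-no (¬? (x ∈? (y ∷ xs))) (λ ∉ → ∉ (there x∈)))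
        (sym (zero-*ʳ (χ (¬? (x ℕ.≟ y))) (χ-no (¬? (x ∈? xs)) (λ ∉ → ∉ x∈))))
      go (no x≢y) (no x∉) = ≡.trans (χ-yes (¬? (x ∈? (y ∷ xs))) (λ { (here e) → x≢y e ; (there i) → x∉ i }))
        (sym (cong₂ _*_ (χ-yes (¬? (x ℕ.≟ y)) x≢y) (χ-yes (¬? (x ∈? xs)) x∉)))

    μ-↭ : ∀ {xs ys} → xs ↭ ys → μ-list xs ≡ μ-list ys
    μ-↭ refl = refl
    μ-↭ (prep {xs} {ys} x p) = cong₂ (λ s t → s * (- t))
      (χ-⇔ (¬? (x ∈? xs)) (¬? (x ∈? ys)) (λ ∉ i → ∉ (∈-resp-↭ (↭-sym p) i)) (λ ∉ i → ∉ (∈-resp-↭ p i))) (μ-↭ p)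
    -- Splitting x ∉ y ∷ ys into x ≠ y and x ∉ ys makes the expression visibly symmetric in x and y.
    μ-↭ (swap {xs} {ys} x y p) = begin
      χ (¬? (x ∈? (y ∷ xs))) * (- (χ (¬? (y ∈? xs)) * (- μ-list xs)))
        ≡⟨ cong (λ t → t * (- (χ (¬? (y ∈? xs)) * (- μ-list xs)))) (χ-∉-∷ x y xs) ⟩
      χ (¬? (x ℕ.≟ y)) * χ (¬? (x ∈? xs)) * (- (χ (¬? (y ∈? xs)) * (- μ-list xs)))
        ≡⟨ cong₂ (λ s t → s * χ (¬? (x ∈? xs)) * (- (χ (¬? (y ∈? xs)) * (- t))))
             (χ-⇔ (¬? (x ℕ.≟ y)) (¬? (y ℕ.≟ x)) (λ ≢ e → ≢ (sym e)) (λ ≢ e → ≢ (sym e))) (μ-↭ p) ⟩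
      χ (¬? (y ℕ.≟ x)) * χ (¬? (x ∈? xs)) * (- (χ (¬? (y ∈? xs)) * (- μ-list ys)))
        ≡⟨ cong₂ (λ s t → χ (¬? (y ℕ.≟ x)) * s * (- (t * (- μ-list ys)))) (resp x) (resp y) ⟩
      χ (¬? (y ℕ.≟ x)) * χ (¬? (x ∈? ys)) * (- (χ (¬? (y ∈? ys)) * (- μ-list ys)))
        ≡⟨ lemma (χ (¬? (y ℕ.≟ x))) (χ (¬? (x ∈? ys))) (χ (¬? (y ∈? ys))) (μ-list ys) ⟩
      χ (¬? (y ℕ.≟ x)) * χ (¬? (y ∈? ys)) * (- (χ (¬? (x ∈? ys)) * (- μ-list ys)))
        ≡⟨ cong (λ t → t * (- (χ (¬? (x ∈? ys)) * (- μ-list ys)))) (sym (χ-∉-∷ y x ys)) ⟩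
      χ (¬? (y ∈? (x ∷ ys))) * (- (χ (¬? (x ∈? ys)) * (- μ-list ys))) ∎
      where
      open ≡-Reasoning
      resp : ∀ z → χ (¬? (z ∈? xs)) ≡ χ (¬? (z ∈? ys))
      resp z = χ-⇔ (¬? (z ∈? xs)) (¬? (z ∈? ys)) (λ ∉ i → ∉ (∈-resp-↭ (↭-sym p) i)) (λ ∉ i → ∉ (∈-resp-↭ p i))
      lemma : ∀ e a b m → e * a * (- (b * (- m))) ≡ e * b * (- (a * (- m)))
      lemma = solve-∀ ℚring
    μ-↭ (trans p r) = ≡.trans (μ-↭ p) (μ-↭ r)

    ∣μ-list∣≤1 : ∀ ps → ∣ μ-list ps ∣ ≤ 1ℚ
    ∣μ-list∣≤1 []       = ≤-refl
    ∣μ-list∣≤1 (q ∷ ps) = ≤-trans (≤-reflexive (≡.trans (∣*∣ˡ (- μ-list ps) (0≤χ (¬? (q ∈? ps))))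
      (cong (χ (¬? (q ∈? ps)) *_) (∣-p∣≡∣p∣ (μ-list ps)))))
      (≤-trans (χ*≤ (¬? (q ∈? ps)) (0≤∣p∣ (μ-list ps))) (∣μ-list∣≤1 ps))

  -- The Möbius function, computed along the list of prime factors with value 0 once a prime
  -- repeats. Independence of the order, `μ-↭`, yields the recursion `μ-*`.
  μ : ℕ → ℚ
  μ n = μ-list (factors n)

  ∣μ∣≤1 : ∀ n → ∣ μ n ∣ ≤ 1ℚ
  ∣μ∣≤1 n = ∣μ-list∣≤1 (factors n)

  μ-* : ∀ {q d} → Prime q → 1 ℕ.≤ d → μ (q ℕ.* d) ≡ ω q d * (- μ d)
  μ-* {q} {d} pq 1≤d = ≡.trans (μ-↭ (factors-* pq 1≤d)) (cong (_* (- μ d))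
    (χ-⇔ (¬? (q ∈? factors d)) (¬? (q ∣? d))
      (λ ∉ q∣d → ∉ (proj₁ (prime∣⇔∈ pq 1≤d) q∣d)) (λ ∤ q∈ → ∤ (proj₂ (prime∣⇔∈ pq 1≤d) q∈))))

  factors-1 : factors 1 ≡ []
  factors-1 = go (factors 1) (factors-prime 1) (factors-product {1} ℕₚ.≤-refl)
    where
    go : ∀ ps → All Prime ps → product ps ≡ 1 → ps ≡ []
    go []       _          _  = refl
    go (q ∷ ps) (pq ∷ pps) eq = ⊥-elim (ℕₚ.<⇒≱ (2≤prime pq)
      (ℕₚ.≤-trans (ℕₚ.m≤m*n q (product ps) {{ℕ.>-nonZero (product-pos pps)}}) (ℕₚ.≤-reflexive eq)))

  μ-1 : μ 1 ≡ 1ℚ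
  μ-1 = cong μ-list factors-1

  -- The completely additive function with prescribed values at primes; the substitute for the
  -- logarithm is of this form.
  additive : (ℕ → ℕ) → ℕ → ℕ
  additive τ n = sum (map τ (factors n))

  additive-* : ∀ τ {q d} → Prime q → 1 ℕ.≤ d → additive τ (q ℕ.* d) ≡ τ q ℕ.+ additive τ d
  additive-* τ pq 1≤d = sum-↭ (map⁺ τ (factors-* pq 1≤d))

  additive-1 : ∀ τ → additive τ 1 ≡ 0
  additive-1 τ = cong (λ ps → sum (map τ ps)) factors-1

-- Divisor sums and the von Mangoldt function

module Divisor where

  open import Data.Empty using (⊥-elim)
  open import Data.List using (List)
  open import Data.List.Membership.Propositional using (_∈_)
  open import Data.Nat as ℕ using (ℕ; NonZero)
  open import Data.Nat.Coprimality using (Coprime; coprime-divisor)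
  open import Data.Nat.Divisibility
    using (_∣_; divides; _∣?_; m∣m*n; ∣-trans; ∣⇒≤; *-monoʳ-∣; *-cancelˡ-∣; ∣1⇒≡1; ∣n⇒∣m*n)
  import Data.Nat.DivMod as ℕ
  open import Data.Nat.Primality using (Prime; prime⇒nonZero; prime⇒irreducible; euclidsLemma)
  import Data.Nat.Properties as ℕₚ
  open import Data.Product using (_,_; proj₁; proj₂)
  open import Data.Rational hiding (NonZero; floor)
  open import Data.Rational.Properties
  open import Data.Sum using (inj₁; inj₂)
  open import Relation.Binary.PropositionalEquality
    using (_≡_; _≢_; refl; sym; trans; cong; cong₂; subst; module ≡-Reasoning)
  open import Relation.Nullary using (Dec; yes; no; ¬_)
  open import Relation.Nullary.Decidable using (¬?)
  open import Tactic.RingSolver using (solve-∀)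
  open Rat
  open Ranges
  open Factor

  ∣-pos : ∀ {d n} → 1 ℕ.≤ n → d ∣ n → d ℕ.≤ n
  ∣-pos 1≤n d∣n = ∣⇒≤ {{ℕ.>-nonZero 1≤n}} d∣n

  ∤⇒coprime : ∀ {q d} → Prime q → ¬ (q ∣ d) → Coprime d q
  ∤⇒coprime pq q∤d (e∣d , e∣q) with prime⇒irreducible pq e∣q
  ... | inj₁ e≡1  = e≡1
  ... | inj₂ refl = ⊥-elim (q∤d e∣d)

  prime∣prime : ∀ {q r} → Prime q → Prime r → q ∣ r → q ≡ r
  prime∣prime pq pr q∣r with prime⇒irreducible pr q∣r
  ... | inj₁ refl = ⊥-elim (ℕₚ.<⇒≱ (2≤prime pq) ℕₚ.≤-refl)
  ... | inj₂ q≡r  = q≡r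

  ∑-multiples : ∀ x n .{{_ : NonZero n}} (G : ℕ → ℚ) →
    ∑ (range x) (λ k → χ (n ∣? k) * G k) ≡ ∑ (range (x ℕ./ n)) (λ k → G (n ℕ.* k))
  ∑-multiples x n G = begin
    ∑ (range x) (λ k → χ (n ∣? k) * G k)
      ≡⟨ ∑-cong∈ (range x) (λ {k} k∈ → expand k k∈ (n ∣? k)) ⟩
    ∑ (range x) (λ k → ∑ (range (x ℕ./ n)) (λ j → χ (k ℕ.≟ n ℕ.* j) * G k))
      ≡⟨ ∑-swap (range x) (range (x ℕ./ n)) _ ⟩
    ∑ (range (x ℕ./ n)) (λ j → ∑ (range x) (λ k → χ (k ℕ.≟ n ℕ.* j) * G k))
      ≡⟨ ∑-cong∈ (range (x ℕ./ n)) (λ {j} j∈ → ∑-one (λ k → k ℕ.≟ n ℕ.* j) G (range-unique x)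
           (∈-range⁺ (*-pos (ℕ.>-nonZero⁻¹ n) (proj₁ (∈-range⁻ j∈)))
             (ℕₚ.≤-trans (ℕₚ.*-monoʳ-≤ n (proj₂ (∈-range⁻ j∈)))
               (subst (ℕ._≤ x) (ℕₚ.*-comm (x ℕ./ n) n) (ℕ.m/n*n≤m x n))))
           refl (λ _ e → e)) ⟩
    ∑ (range (x ℕ./ n)) (λ j → G (n ℕ.* j)) ∎
    where
    open ≡-Reasoning
    expand : ∀ k → k ∈ range x → Dec (n ∣ k) → χ (n ∣? k) * G k ≡ ∑ (range (x ℕ./ n)) (λ j → χ (k ℕ.≟ n ℕ.* j) * G k)
    expand k k∈ (yes d@(divides j k≡j*n)) = trans (χ-1 (n ∣? k) d (G k)) (sym (∑-one (λ j → k ℕ.≟ n ℕ.* j) (λ _ → G k)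
        (range-unique (x ℕ./ n)) (∈-range⁺ 1≤j j≤) k≡n*j
        (λ {i} _ e → ℕₚ.*-cancelˡ-≡ i j n (trans (sym e) k≡n*j))))
      where
      k≡n*j : k ≡ n ℕ.* j
      k≡n*j = trans k≡j*n (ℕₚ.*-comm j n)
      1≤j : 1 ℕ.≤ j
      1≤j = ℕₚ.n≢0⇒n>0 (λ j≡0 → ℕₚ.<⇒≢ (proj₁ (∈-range⁻ k∈)) (sym (trans k≡j*n (cong (ℕ._* n) j≡0))))
      j≤ : j ℕ.≤ x ℕ./ n
      j≤ = subst (ℕ._≤ x ℕ./ n) (trans (cong (ℕ._/ n) k≡j*n) (ℕ.m*n/n≡m j n)) (ℕ./-monoˡ-≤ n (proj₂ (∈-range⁻ k∈)))
    expand k k∈ (no n∤k) = trans (χ-0 (n ∣? k) n∤k (G k)) (sym (∑-none (λ j → k ℕ.≟ n ℕ.* j) (λ _ → G k) (range (x ℕ./ n))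
      (λ {j} _ e → n∤k (divides j (trans e (ℕₚ.*-comm n j))))))

  module DivisorSums (x : ℕ) where

    private
      R : List ℕ
      R = range x

    -- For 1 ≤ N ≤ x this is the sum of F over the divisors of N.
    divisorSum : ℕ → (ℕ → ℚ) → ℚ
    divisorSum N F = ∑ R (λ d → χ (d ∣? N) * F d)

    divisorSum-cong : ∀ N {F G} → 1 ℕ.≤ N → (∀ d → 1 ℕ.≤ d → d ∣ N → F d ≡ G d) → divisorSum N F ≡ divisorSum N G
    divisorSum-cong N 1≤N eq = ∑-cong∈ R (λ {d} d∈ → χ-cong (d ∣? N) (eq d (proj₁ (∈-range⁻ d∈))))

    divisorSum-+ : ∀ N F G → divisorSum N (λ d → F d + G d) ≡ divisorSum N F + divisorSum N G
    divisorSum-+ N F G = trans (∑-cong R (λ d → *-distribˡ-+ (χ (d ∣? N)) (F d) (G d))) (∑-+ R _ _)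

    divisorSum-*ˡ : ∀ N c F → divisorSum N (λ d → c * F d) ≡ c * divisorSum N F
    divisorSum-*ˡ N c F = trans (∑-cong R (λ d → lemma (χ (d ∣? N)) c (F d))) (sym (∑-*ˡ R c _))
      where
      lemma : ∀ a c f → a * (c * f) ≡ c * (a * f)
      lemma = solve-∀ ℚring

    divisorSum-zero : ∀ N {F} → 1 ℕ.≤ N → (∀ d → 1 ℕ.≤ d → d ∣ N → F d ≡ 0ℚ) → divisorSum N F ≡ 0ℚ
    divisorSum-zero N 1≤N eq = ∑-zero∈ R (λ {d} d∈ → trans (χ-cong (d ∣? N) (eq d (proj₁ (∈-range⁻ d∈)))) (*-zeroʳ (χ (d ∣? N))))

    divisorSum-1 : ∀ N → 1 ℕ.≤ N → N ℕ.≤ x → divisorSum N (λ d → χ (d ℕ.≟ 1)) ≡ 1ℚ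
    divisorSum-1 N 1≤N N≤x = trans (∑-cong R (λ d → trans (*-comm (χ (d ∣? N)) (χ (d ℕ.≟ 1))) refl))
      (trans (∑-one (λ d → d ℕ.≟ 1) (λ d → χ (d ∣? N)) (range-unique x) (∈-range⁺ ℕₚ.≤-refl (ℕₚ.≤-trans 1≤N N≤x)) refl (λ _ e → e))
        (χ-yes (1 ∣? N) (divides N (sym (ℕₚ.*-identityʳ N)))))

    -- Divisors of qM either are prime to q, hence divide M, or are q times a divisor of M.
    divisorSum-q* : ∀ {q M} → Prime q → 1 ℕ.≤ M → q ℕ.* M ℕ.≤ x → ∀ F →
      divisorSum (q ℕ.* M) F ≡ divisorSum M (λ d → ω q d * F d) + divisorSum M (λ e → F (q ℕ.* e))
    divisorSum-q* {q} {M} pq 1≤M qM≤x F = begin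
      ∑ R (λ d → χ (d ∣? (q ℕ.* M)) * F d)
        ≡⟨ ∑-cong R (λ d → split d (q ∣? d)) ⟩
      ∑ R (λ d → χ (d ∣? M) * (ω q d * F d) + χ (q ∣? d) * (χ (d ∣? (q ℕ.* M)) * F d))
        ≡⟨ ∑-+ R _ _ ⟩
      divisorSum M (λ d → ω q d * F d) + ∑ R (λ d → χ (q ∣? d) * (χ (d ∣? (q ℕ.* M)) * F d))
        ≡⟨ cong (_+_ (divisorSum M (λ d → ω q d * F d))) multiples ⟩
      divisorSum M (λ d → ω q d * F d) + divisorSum M (λ e → F (q ℕ.* e)) ∎
      where
      open ≡-Reasoning
      instance
        q≢0 : NonZero q
        q≢0 = prime⇒nonZero pq
      split : ∀ d → Dec (q ∣ d) → χ (d ∣? (q ℕ.* M)) * F d ≡ χ (d ∣? M) * (ω q d * F d) + χ (q ∣? d) * (χ (d ∣? (q ℕ.* M)) * F d)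
      split d (yes q∣d) = sym (zero-+ˡ (zero-*ʳ (χ (d ∣? M)) (zero-*ˡ (F d) (χ-no (¬? (q ∣? d)) (λ ∤ → ∤ q∣d))))
        (χ-1 (q ∣? d) q∣d (χ (d ∣? (q ℕ.* M)) * F d)))
      split d (no q∤d) = sym (zero-+ʳ (cong₂ _*_ (χ-⇔ (d ∣? M) (d ∣? (q ℕ.* M)) (λ d∣M → ∣n⇒∣m*n q d∣M)
          (λ d∣qM → coprime-divisor (∤⇒coprime pq q∤d) d∣qM)) (χ-1 (¬? (q ∣? d)) q∤d (F d)))
        (χ-0 (q ∣? d) q∤d (χ (d ∣? (q ℕ.* M)) * F d)))
      multiples : ∑ R (λ d → χ (q ∣? d) * (χ (d ∣? (q ℕ.* M)) * F d)) ≡ divisorSum M (λ e → F (q ℕ.* e))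
      multiples = begin
        ∑ R (λ d → χ (q ∣? d) * (χ (d ∣? (q ℕ.* M)) * F d))
          ≡⟨ ∑-cong∈ R (λ {d} d∈ → expand d d∈ (q ∣? d)) ⟩
        ∑ R (λ d → ∑ R (λ e → χ (d ℕ.≟ q ℕ.* e) * (χ (d ∣? (q ℕ.* M)) * F d)))
          ≡⟨ ∑-swap R R _ ⟩
        ∑ R (λ e → ∑ R (λ d → χ (d ℕ.≟ q ℕ.* e) * (χ (d ∣? (q ℕ.* M)) * F d)))
          ≡⟨ ∑-cong∈ R (λ {e} e∈ → collapse e e∈ (e ∣? M)) ⟩
        divisorSum M (λ e → F (q ℕ.* e)) ∎
        where
        expand : ∀ d → d ∈ R → Dec (q ∣ d) → χ (q ∣? d) * (χ (d ∣? (q ℕ.* M)) * F d) ≡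
          ∑ R (λ e → χ (d ℕ.≟ q ℕ.* e) * (χ (d ∣? (q ℕ.* M)) * F d))
        expand d d∈ (yes q∣d@(divides j d≡j*q)) = trans (χ-1 (q ∣? d) q∣d _) (sym (∑-one (λ e → d ℕ.≟ q ℕ.* e) (λ _ → χ (d ∣? (q ℕ.* M)) * F d)
            (range-unique x) (∈-range⁺ 1≤j (ℕₚ.≤-trans (ℕₚ.≤-trans (ℕₚ.m≤n*m j q) (ℕₚ.≤-reflexive (sym d≡q*j))) (proj₂ (∈-range⁻ d∈))))
            d≡q*j (λ {i} _ e → ℕₚ.*-cancelˡ-≡ i j q (trans (sym e) d≡q*j))))
          where
          d≡q*j : d ≡ q ℕ.* j
          d≡q*j = trans d≡j*q (ℕₚ.*-comm j q)
          1≤j : 1 ℕ.≤ j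
          1≤j = ℕₚ.n≢0⇒n>0 (λ j≡0 → ℕₚ.<⇒≢ (proj₁ (∈-range⁻ d∈)) (sym (trans d≡j*q (cong (ℕ._* q) j≡0))))
        expand d d∈ (no q∤d) = trans (χ-0 (q ∣? d) q∤d _) (sym (∑-none (λ e → d ℕ.≟ q ℕ.* e) (λ _ → χ (d ∣? (q ℕ.* M)) * F d) R
          (λ {e} _ eq → q∤d (divides e (trans eq (ℕₚ.*-comm q e))))))
        collapse : ∀ e → e ∈ R → Dec (e ∣ M) → ∑ R (λ d → χ (d ℕ.≟ q ℕ.* e) * (χ (d ∣? (q ℕ.* M)) * F d)) ≡ χ (e ∣? M) * F (q ℕ.* e)
        collapse e e∈ (yes e∣M) = trans (∑-one (λ d → d ℕ.≟ q ℕ.* e) (λ d → χ (d ∣? (q ℕ.* M)) * F d) (range-unique x)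
            (∈-range⁺ (*-pos (prime-pos pq) (proj₁ (∈-range⁻ e∈))) (ℕₚ.≤-trans (ℕₚ.*-monoʳ-≤ q (∣-pos 1≤M e∣M)) qM≤x))
            refl (λ _ eq → eq))
          (trans (χ-1 ((q ℕ.* e) ∣? (q ℕ.* M)) (*-monoʳ-∣ q e∣M) (F (q ℕ.* e))) (sym (χ-1 (e ∣? M) e∣M (F (q ℕ.* e)))))
        collapse e e∈ (no e∤M) = trans (∑-zero∈ R (λ {d} _ → zero-term d (d ℕ.≟ q ℕ.* e))) (sym (χ-0 (e ∣? M) e∤M (F (q ℕ.* e))))
          where
          zero-term : ∀ d → Dec (d ≡ q ℕ.* e) → χ (d ℕ.≟ q ℕ.* e) * (χ (d ∣? (q ℕ.* M)) * F d) ≡ 0ℚ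
          zero-term d (yes refl) = zero-*ʳ (χ (d ℕ.≟ q ℕ.* e)) (χ-0 (d ∣? (q ℕ.* M)) (λ dv → e∤M (*-cancelˡ-∣ q dv)) (F d))
          zero-term d (no d≢)    = χ-0 (d ℕ.≟ q ℕ.* e) d≢ _

    private
      *≤x : ∀ {q M} → Prime q → q ℕ.* M ℕ.≤ x → M ℕ.≤ x
      *≤x {q} {M} pq le = ℕₚ.≤-trans (ℕₚ.m≤n*m M q {{prime⇒nonZero pq}}) le

    -- A divisor d of M prime to q is cancelled by the divisor qd of qM, because μ(qd) = -μ(d).
    ∑μ-q* : ∀ {q M} → Prime q → 1 ℕ.≤ M → q ℕ.* M ℕ.≤ x → divisorSum (q ℕ.* M) μ ≡ 0ℚ
    ∑μ-q* {q} {M} pq 1≤M qM≤x = trans (divisorSum-q* pq 1≤M qM≤x μ) (trans (sym (divisorSum-+ M _ _))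
      (divisorSum-zero M 1≤M (λ d 1≤d _ → trans (cong (_+_ (ω q d * μ d)) (μ-* pq 1≤d)) (lemma (ω q d) (μ d)))))
      where
      lemma : ∀ w m → w * m + w * (- m) ≡ 0ℚ
      lemma = solve-∀ ℚring

    divisorSum-of-1 : ∀ F → 1 ℕ.≤ x → divisorSum 1 F ≡ F 1
    divisorSum-of-1 F 1≤x = ∑-one (λ d → d ∣? 1) F (range-unique x) (∈-range⁺ ℕₚ.≤-refl 1≤x)
      (divides 1 refl) (λ _ → ∣1⇒≡1)

    ∑μ : ∀ N → 1 ℕ.≤ N → N ℕ.≤ x → divisorSum N μ ≡ χ (N ℕ.≟ 1)
    ∑μ = prime-induction (λ N → N ℕ.≤ x → divisorSum N μ ≡ χ (N ℕ.≟ 1))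
      (λ 1≤x → trans (divisorSum-of-1 μ 1≤x) μ-1)
      (λ q M pq 1≤M _ qM≤x → trans (∑μ-q* pq 1≤M qM≤x) (sym (χ-no (q ℕ.* M ℕ.≟ 1)
        (λ e → ℕₚ.<⇒≱ (2≤prime pq) (ℕₚ.≤-trans (ℕₚ.m≤m*n q M {{ℕ.>-nonZero 1≤M}}) (ℕₚ.≤-reflexive e))))))

    -- The indicator function of the powers of the prime q.
    power : ℕ → ℕ → ℚ
    power q M = divisorSum M (λ d → ω q d * μ d)

    ω-∣ : ∀ {q d M} → d ∣ M → ¬ (q ∣ M) → ω q d ≡ 1ℚ
    ω-∣ {q} {d} d∣M q∤M = χ-yes (¬? (q ∣? d)) (λ q∣d → q∤M (∣-trans q∣d d∣M))

    ω-q* : ∀ q e → ω q (q ℕ.* e) ≡ 0ℚ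
    ω-q* q e = χ-no (¬? (q ∣? (q ℕ.* e))) (λ ∤ → ∤ (m∣m*n e))

    power-∤ : ∀ {q M} → 1 ℕ.≤ M → M ℕ.≤ x → ¬ (q ∣ M) → power q M ≡ χ (M ℕ.≟ 1)
    power-∤ {q} {M} 1≤M M≤x q∤M = trans (divisorSum-cong M 1≤M (λ d _ d∣M →
      trans (cong (_* μ d) (ω-∣ {q} d∣M q∤M)) (*-identityˡ (μ d)))) (∑μ M 1≤M M≤x)

    power-q* : ∀ {q M} → Prime q → 1 ℕ.≤ M → q ℕ.* M ℕ.≤ x → power q (q ℕ.* M) ≡ power q M
    power-q* {q} {M} pq 1≤M qM≤x = trans (divisorSum-q* pq 1≤M qM≤x (λ d → ω q d * μ d)) (zero-+ʳ
      (divisorSum-cong M 1≤M (λ d _ _ → trans (sym (*-assoc (ω q d) (ω q d) (μ d))) (cong (_* μ d) (idem (¬? (q ∣? d))))))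
      (divisorSum-zero M 1≤M (λ e _ _ → zero-*ˡ (μ (q ℕ.* e)) (ω-q* q e))))
      where
      idem : ∀ {P : Set} (d : Dec P) → χ d * χ d ≡ χ d
      idem (yes _) = refl
      idem (no _)  = refl

    power-r* : ∀ {q r M} → Prime q → Prime r → q ≢ r → 1 ℕ.≤ M → r ℕ.* M ℕ.≤ x → power q (r ℕ.* M) ≡ 0ℚ
    power-r* {q} {r} {M} pq pr q≢r 1≤M rM≤x = trans (divisorSum-q* pr 1≤M rM≤x (λ d → ω q d * μ d))
      (trans (sym (divisorSum-+ M _ _)) (divisorSum-zero M 1≤M (λ d 1≤d _ → trans
        (cong₂ (λ s t → ω r d * (ω q d * μ d) + s * t) (ω-r d) (μ-* pr 1≤d)) (lemma (ω r d) (ω q d) (μ d)))))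
      where
      ω-r : ∀ d → ω q (r ℕ.* d) ≡ ω q d
      ω-r d = χ-⇔ (¬? (q ∣? (r ℕ.* d))) (¬? (q ∣? d)) (λ ∤ q∣d → ∤ (∣n⇒∣m*n r q∣d)) (λ ∤ q∣rd → ∤ (second q∣rd))
        where
        second : q ∣ r ℕ.* d → q ∣ d
        second q∣rd with euclidsLemma r d pq q∣rd
        ... | inj₁ q∣r = ⊥-elim (q≢r (prime∣prime pq pr q∣r))
        ... | inj₂ q∣d = q∣d
      lemma : ∀ a b m → a * (b * m) + b * (a * (- m)) ≡ 0ℚ
      lemma = solve-∀ ℚring

    0≤power : ∀ {q} → Prime q → ∀ M → 1 ℕ.≤ M → M ℕ.≤ x → 0ℚ ≤ power q M
    0≤power {q} pq = prime-induction (λ M → M ℕ.≤ x → 0ℚ ≤ power q M)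
      (λ 1≤x → ≤-respʳ (sym (power-∤ {q} ℕₚ.≤-refl 1≤x (λ q∣1 → ℕₚ.<⇒≱ (2≤prime pq) (ℕₚ.≤-reflexive (∣1⇒≡1 q∣1))))) 0≤1)
      step
      where
      step : ∀ r M → Prime r → 1 ℕ.≤ M → (M ℕ.≤ x → 0ℚ ≤ power q M) → r ℕ.* M ℕ.≤ x → 0ℚ ≤ power q (r ℕ.* M)
      step r M pr 1≤M ih rM≤x with q ℕ.≟ r
      ... | yes refl = ≤-respʳ (sym (power-q* pr 1≤M rM≤x)) (ih (*≤x pr rM≤x))
      ... | no q≢r   = ≤-reflexive (sym (power-r* pq pr q≢r 1≤M rM≤x))

    -- Of the powers of q dividing M, one is 1 and the others are multiples of q, where `P` counts
    -- them. `P` is kept general because it will be Λ / t q, which agrees with `power` only at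
    -- multiples of q.
    ∑power : ∀ {q} M → Prime q → 1 ℕ.≤ M → q ℕ.* M ℕ.≤ x → ∀ (P : ℕ → ℚ) →
      (∀ e → 1 ℕ.≤ e → q ℕ.* e ℕ.≤ x → P (q ℕ.* e) ≡ power q e) →
      divisorSum M (power q) ≡ 1ℚ + divisorSum M (λ d → (1ℚ - ω q d) * P d)
    ∑power {q} M pq 1≤M qM≤x P P-q* with q ∣? M
    ... | no q∤M = trans (divisorSum-cong M 1≤M (λ e 1≤e e∣M → power-∤ {q} {e} 1≤e (ℕₚ.≤-trans (∣-pos 1≤M e∣M) M≤x)
        (λ q∣e → q∤M (∣-trans q∣e e∣M))))
      (trans (divisorSum-1 M 1≤M M≤x) (sym (zero-+ʳ refl (divisorSum-zero M 1≤M (λ d _ d∣M →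
        zero-*ˡ (P d) (trans (cong (λ t → 1ℚ - t) (ω-∣ {q} d∣M q∤M)) (+-inverseʳ 1ℚ)))))))
      where
      M≤x = *≤x pq qM≤x
    ... | yes (divides M′ M≡) = subst (λ M → M ℕ.≤ x → divisorSum M (power q) ≡ 1ℚ + divisorSum M (λ d → (1ℚ - ω q d) * P d))
        (sym M≡q*) main (*≤x pq qM≤x)
      where
      M≡q* : M ≡ q ℕ.* M′
      M≡q* = trans M≡ (ℕₚ.*-comm M′ q)
      1≤M′ : 1 ℕ.≤ M′
      1≤M′ = ℕₚ.n≢0⇒n>0 (λ z → ℕₚ.<⇒≢ 1≤M (sym (trans M≡ (cong (ℕ._* q) z))))
      main : q ℕ.* M′ ℕ.≤ x → divisorSum (q ℕ.* M′) (power q) ≡ 1ℚ + divisorSum (q ℕ.* M′) (λ d → (1ℚ - ω q d) * P d)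
      main qM′≤x = begin
        divisorSum (q ℕ.* M′) (power q)
          ≡⟨ divisorSum-q* pq 1≤M′ qM′≤x (power q) ⟩
        divisorSum M′ (λ e → ω q e * power q e) + divisorSum M′ (λ e → power q (q ℕ.* e))
          ≡⟨ cong₂ _+_ (trans (divisorSum-cong M′ 1≤M′ (λ e 1≤e e∣ → coprime-part e 1≤e (ℕₚ.≤-trans (∣-pos 1≤M′ e∣) M′≤x)))
                         (divisorSum-1 M′ 1≤M′ M′≤x))
               (divisorSum-cong M′ 1≤M′ (λ e 1≤e e∣ → trans (power-q* pq 1≤e (qe≤ e e∣)) (sym (P-q* e 1≤e (qe≤ e e∣))))) ⟩
        1ℚ + divisorSum M′ (λ e → P (q ℕ.* e))
          ≡⟨ cong (_+_ 1ℚ) (sym (trans (divisorSum-q* pq 1≤M′ qM′≤x (λ d → (1ℚ - ω q d) * P d)) (zero-+ˡ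
               (divisorSum-zero M′ 1≤M′ (λ d _ _ → trans (sym (*-assoc (ω q d) (1ℚ - ω q d) (P d))) (zero-*ˡ (P d) (disjoint (¬? (q ∣? d))))))
               (divisorSum-cong M′ 1≤M′ (λ e _ _ → trans (cong (λ t → (1ℚ - t) * P (q ℕ.* e)) (ω-q* q e)) (drop (P (q ℕ.* e)))))))) ⟩
        1ℚ + divisorSum (q ℕ.* M′) (λ d → (1ℚ - ω q d) * P d) ∎
        where
        open ≡-Reasoning
        M′≤x = *≤x pq qM′≤x
        qe≤ : ∀ e → e ∣ M′ → q ℕ.* e ℕ.≤ x
        qe≤ e e∣ = ℕₚ.≤-trans (ℕₚ.*-monoʳ-≤ q (∣-pos 1≤M′ e∣)) qM′≤x
        disjoint : ∀ {Q : Set} (d : Dec Q) → χ d * (1ℚ - χ d) ≡ 0ℚ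
        disjoint (yes _) = refl
        disjoint (no _)  = refl
        drop : ∀ p → (1ℚ - 0ℚ) * p ≡ p
        drop = solve-∀ ℚring
        coprime-part : ∀ e → 1 ℕ.≤ e → e ℕ.≤ x → ω q e * power q e ≡ χ (e ℕ.≟ 1)
        coprime-part e 1≤e e≤x with q ∣? e
        ... | no q∤e = trans (*-identityˡ (power q e)) (power-∤ 1≤e e≤x q∤e)
        ... | yes q∣e = trans (*-zeroˡ (power q e)) (sym (χ-no (e ℕ.≟ 1) (λ { refl → ℕₚ.<⇒≱ (2≤prime pq) (ℕₚ.≤-reflexive (∣1⇒≡1 q∣e)) })))

    -- The von Mangoldt function attached to a completely additive function l.
    module VonMangoldt (l t : ℕ → ℚ) (l-1 : l 1 ≡ 0ℚ) (0≤t : ∀ q → 0ℚ ≤ t q)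
      (l-* : ∀ {q d} → Prime q → 1 ℕ.≤ d → l (q ℕ.* d) ≡ t q + l d) where

      Λ : ℕ → ℚ
      Λ N = - divisorSum N (λ d → μ d * l d)

      Λ-1 : 1 ℕ.≤ x → Λ 1 ≡ 0ℚ
      Λ-1 1≤x = trans (cong -_ (trans (divisorSum-of-1 _ 1≤x) (zero-*ʳ (μ 1) l-1))) refl

      -- The terms of d and qd combine: l(qd) = t(q) + l(d) and μ(qd) = -μ(d) leave -t(q)μ(d) for d
      -- prime to q, and the sum of these μ(d) is the indicator of the powers of q. So Λ is
      -- supported on prime powers.
      Λ-q* : ∀ {q M} → Prime q → 1 ℕ.≤ M → q ℕ.* M ℕ.≤ x → Λ (q ℕ.* M) ≡ t q * power q M
      Λ-q* {q} {M} pq 1≤M qM≤x = begin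
        - divisorSum (q ℕ.* M) (λ d → μ d * l d)
          ≡⟨ cong -_ (trans (divisorSum-q* pq 1≤M qM≤x (λ d → μ d * l d)) (sym (divisorSum-+ M _ _))) ⟩
        - divisorSum M (λ d → ω q d * (μ d * l d) + μ (q ℕ.* d) * l (q ℕ.* d))
          ≡⟨ cong -_ (divisorSum-cong M 1≤M (λ d 1≤d _ → trans
               (cong₂ (λ a b → ω q d * (μ d * l d) + a * b) (μ-* pq 1≤d) (l-* pq 1≤d)) (lemma (ω q d) (μ d) (l d) (t q)))) ⟩
        - divisorSum M (λ d → (- t q) * (ω q d * μ d))
          ≡⟨ cong -_ (divisorSum-*ˡ M (- t q) (λ d → ω q d * μ d)) ⟩
        - ((- t q) * power q M)
          ≡⟨ lemma′ (t q) (power q M) ⟩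
        t q * power q M ∎
        where
        open ≡-Reasoning
        lemma : ∀ w m l t → w * (m * l) + w * (- m) * (t + l) ≡ (- t) * (w * m)
        lemma = solve-∀ ℚring
        lemma′ : ∀ t p → - ((- t) * p) ≡ t * p
        lemma′ = solve-∀ ℚring

      0≤Λ : ∀ N → 1 ℕ.≤ N → N ℕ.≤ x → 0ℚ ≤ Λ N
      0≤Λ = prime-induction (λ N → N ℕ.≤ x → 0ℚ ≤ Λ N) (λ 1≤x → ≤-reflexive (sym (Λ-1 1≤x)))
        (λ q M pq 1≤M _ qM≤x → ≤-respʳ (sym (Λ-q* pq 1≤M qM≤x))
          (*-nonNeg (0≤t q) (0≤power pq M 1≤M (*≤x pq qM≤x))))

      -- In passing from M to qM, the divisors prime to q stay the same, while the divisors qe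
      -- contribute t(q) for each power of q dividing M, the power 1 included. This is t(q) more
      -- than the multiples of q contributed for M.
      ∑Λ : ∀ n → 1 ℕ.≤ n → n ℕ.≤ x → divisorSum n Λ ≡ l n
      ∑Λ = prime-induction (λ n → n ℕ.≤ x → divisorSum n Λ ≡ l n)
        (λ 1≤x → trans (divisorSum-of-1 Λ 1≤x) (trans (Λ-1 1≤x) (sym l-1))) step
        where
        open ≡-Reasoning
        step : ∀ q M → Prime q → 1 ℕ.≤ M → (M ℕ.≤ x → divisorSum M Λ ≡ l M) → q ℕ.* M ℕ.≤ x →
          divisorSum (q ℕ.* M) Λ ≡ l (q ℕ.* M)
        step q M pq 1≤M ih qM≤x = begin
          divisorSum (q ℕ.* M) Λ
            ≡⟨ divisorSum-q* pq 1≤M qM≤x Λ ⟩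
          A + divisorSum M (λ e → Λ (q ℕ.* e))
            ≡⟨ cong (_+_ A) (trans (divisorSum-cong M 1≤M (λ e 1≤e e∣ → Λ-q* pq 1≤e (ℕₚ.≤-trans (ℕₚ.*-monoʳ-≤ q (∣-pos 1≤M e∣)) qM≤x)))
                               (divisorSum-*ˡ M (t q) (power q))) ⟩
          A + t q * divisorSum M (power q)
            ≡⟨ cong (_+_ A) powers ⟩
          A + (t q + B)
            ≡⟨ lemma A (t q) B ⟩
          t q + (A + B)
            ≡⟨ cong (_+_ (t q)) (trans (sym (divisorSum-+ M _ _)) (divisorSum-cong M 1≤M (λ d _ _ → recombine (ω q d) (Λ d)))) ⟩
          t q + divisorSum M Λ
            ≡⟨ cong (_+_ (t q)) (ih (*≤x pq qM≤x)) ⟩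
          t q + l M
            ≡⟨ sym (l-* pq 1≤M) ⟩
          l (q ℕ.* M) ∎
          where
          A = divisorSum M (λ d → ω q d * Λ d)
          B = divisorSum M (λ d → (1ℚ - ω q d) * Λ d)
          lemma : ∀ a t b → a + (t + b) ≡ t + (a + b)
          lemma = solve-∀ ℚring
          recombine : ∀ w a → w * a + (1ℚ - w) * a ≡ a
          recombine = solve-∀ ℚring
          -- If t q ≠ 0 then Λ / t q agrees with the indicator function of the powers of q on multiples of q.
          powers : t q * divisorSum M (power q) ≡ t q + B
          powers with t q ≟ 0ℚ
          ... | yes t≡0 = trans (zero-*ˡ _ t≡0) (sym (trans (cong₂ _+_ t≡0 B≡0) (+-identityʳ 0ℚ)))
            where
            B≡0 : B ≡ 0ℚ
            B≡0 = divisorSum-zero M 1≤M (λ d 1≤d d∣M → vanish d 1≤d (ℕₚ.≤-trans (∣-pos 1≤M d∣M) (*≤x pq qM≤x)) (q ∣? d))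
              where
              vanish : ∀ d → 1 ℕ.≤ d → d ℕ.≤ x → Dec (q ∣ d) → (1ℚ - ω q d) * Λ d ≡ 0ℚ
              vanish d 1≤d d≤x (no q∤d) = zero-*ˡ (Λ d) (trans (cong (λ w → 1ℚ - w) (χ-yes (¬? (q ∣? d)) q∤d)) (+-inverseʳ 1ℚ))
              vanish d 1≤d d≤x (yes (divides e d≡)) = zero-*ʳ (1ℚ - ω q d) (trans (cong Λ d≡q*e)
                (trans (Λ-q* pq 1≤e (subst (ℕ._≤ x) d≡q*e d≤x)) (zero-*ˡ (power q e) t≡0)))
                where
                d≡q*e : d ≡ q ℕ.* e
                d≡q*e = trans d≡ (ℕₚ.*-comm e q)
                1≤e : 1 ℕ.≤ e
                1≤e = ℕₚ.n≢0⇒n>0 (λ z → ℕₚ.<⇒≢ 1≤d (sym (trans d≡ (cong (ℕ._* q) z))))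
          ... | no t≢0 = begin
            t q * divisorSum M (power q)
              ≡⟨ cong (t q *_) (∑power M pq 1≤M qM≤x (λ d → recip (t q) * Λ d) (λ e 1≤e qe≤x → trans
                   (cong (recip (t q) *_) (Λ-q* pq 1≤e qe≤x)) (cancel (recip (t q)) (t q) (power q e) (*-recip t≢0)))) ⟩
            t q * (1ℚ + divisorSum M (λ d → (1ℚ - ω q d) * (recip (t q) * Λ d)))
              ≡⟨ cong (λ s → t q * (1ℚ + s)) (trans (divisorSum-cong M 1≤M (λ d _ _ → reorder (1ℚ - ω q d) (recip (t q)) (Λ d)))
                   (divisorSum-*ˡ M (recip (t q)) (λ d → (1ℚ - ω q d) * Λ d))) ⟩
            t q * (1ℚ + recip (t q) * B)
              ≡⟨ distribute (t q) (recip (t q)) B ⟩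
            t q + t q * recip (t q) * B
              ≡⟨ cong (λ s → t q + s * B) (*-recip t≢0) ⟩
            t q + 1ℚ * B
              ≡⟨ cong (_+_ (t q)) (*-identityˡ B) ⟩
            t q + B ∎
            where
            cancel : ∀ r t p → t * r ≡ 1ℚ → r * (t * p) ≡ p
            cancel r t p e = trans (assoc r t p) (trans (cong (_* p) e) (*-identityˡ p))
              where
              assoc : ∀ r t p → r * (t * p) ≡ t * r * p
              assoc = solve-∀ ℚring
            reorder : ∀ w r a → w * (r * a) ≡ r * (w * a)
            reorder = solve-∀ ℚring
            distribute : ∀ t r b → t * (1ℚ + r * b) ≡ t + t * r * b
            distribute = solve-∀ ℚring

-- Integer logarithms and Chebyshev's estimate

module LogData where

  open import Data.Empty using (⊥-elim)
  open import Data.List using (List; []; _∷_; length; map; downFrom)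
  open import Data.List.Properties using (length-downFrom)
  open import Data.List.Membership.Propositional using (_∈_)
  open import Data.List.Membership.Propositional.Properties using (∈-downFrom⁻)
  open import Data.List.Relation.Unary.All using (All; []; _∷_)
  open import Data.Nat as ℕ using (ℕ; zero; suc; NonZero; _^_)
  open import Data.Nat.Divisibility using (_∣_; _∣?_)
  import Data.Nat.DivMod as ℕ
  open import Data.Nat.ListAction using (sum; product)
  open import Data.Nat.Primality using (Prime)
  import Data.Nat.Properties as ℕₚ
  import Data.Nat.Tactic.RingSolver as ℕSolver
  open import Data.Product using (_×_; _,_; proj₁; proj₂)
  open import Data.Rational hiding (NonZero; floor)
  open import Data.Rational.Properties
  open import Relation.Binary.PropositionalEquality
    using (_≡_; refl; sym; trans; cong; cong₂; subst; subst₂; module ≡-Reasoning)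
  open import Relation.Nullary using (yes; no)
  open import Tactic.RingSolver using (solve-∀)
  open Rat
  open Ranges
  open Tail
  open Factor
  open Divisor

  -- The integer part of log₂ v, with the default 0 at v = 0.
  lg : ℕ → ℕ
  lg zero    = 0
  lg (suc v) with 2 ^ suc (lg v) ℕ.≤? suc v
  ... | yes _ = suc (lg v)
  ... | no  _ = lg v

  lg-bounds : ∀ v → 1 ℕ.≤ v → (2 ^ lg v ℕ.≤ v) × (v ℕ.< 2 ^ suc (lg v))
  lg-bounds (suc zero)    _ = ℕₚ.≤-refl , ℕₚ.≤-refl
  lg-bounds (suc (suc v)) _ with 2 ^ suc (lg (suc v)) ℕ.≤? suc (suc v) | lg-bounds (suc v) (ℕ.s≤s ℕ.z≤n)
  ... | yes le | _ , v< = le , ℕₚ.≤-trans (ℕ.s≤s v<) (double (2 ^ suc (lg (suc v))) (1≤2^ (suc (lg (suc v)))))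
    where
    double : ∀ a → 1 ℕ.≤ a → suc a ℕ.≤ a ℕ.+ (a ℕ.+ 0)
    double a 1≤a = ℕₚ.≤-trans (ℕₚ.+-monoˡ-≤ a 1≤a) (ℕₚ.≤-reflexive (cong (a ℕ.+_) (sym (ℕₚ.+-identityʳ a))))
  ... | no ≰ | 2^≤ , _ = ℕₚ.m≤n⇒m≤1+n 2^≤ , ℕₚ.≰⇒> ≰

  2^-cancel-< : ∀ {a b} → 2 ^ a ℕ.< 2 ^ b → a ℕ.< b
  2^-cancel-< {a} {b} lt = ℕₚ.≰⇒> (λ b≤a → ℕₚ.<⇒≱ lt (ℕₚ.^-monoʳ-≤ 2 b≤a))

  2^-cancel-≤ : ∀ {a b} → 2 ^ a ℕ.≤ 2 ^ b → a ℕ.≤ b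
  2^-cancel-≤ {a} {b} le = ℕₚ.≮⇒≥ (λ b<a → ℕₚ.<⇒≱ (ℕₚ.^-monoʳ-< 2 (ℕₚ.≤-refl) b<a) le)

  2^≤⇒≤lg : ∀ {i v} → 2 ^ i ℕ.≤ v → i ℕ.≤ lg v
  2^≤⇒≤lg {i} {v} le = ℕ.s≤s⁻¹ (2^-cancel-< (ℕₚ.≤-<-trans le (proj₂ (lg-bounds v (ℕₚ.≤-trans (1≤2^ i) le)))))

  ≤2^⇒lg≤ : ∀ {i v} → 1 ℕ.≤ v → v ℕ.≤ 2 ^ i → lg v ℕ.≤ i
  ≤2^⇒lg≤ {i} {v} 1≤v le = 2^-cancel-≤ (ℕₚ.≤-trans (proj₁ (lg-bounds v 1≤v)) le)

  lg-mono : ∀ {u v} → 1 ℕ.≤ u → u ℕ.≤ v → lg u ℕ.≤ lg v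
  lg-mono 1≤u u≤v = 2^≤⇒≤lg (ℕₚ.≤-trans (proj₁ (lg-bounds _ 1≤u)) u≤v)

  *-^ : ∀ a b n → (a ℕ.* b) ^ n ≡ a ^ n ℕ.* b ^ n
  *-^ a b zero    = refl
  *-^ a b (suc n) = trans (cong (a ℕ.* b ℕ.*_) (*-^ a b n)) (lemma a b (a ^ n) (b ^ n))
    where
    lemma : ∀ a b x y → a ℕ.* b ℕ.* (x ℕ.* y) ≡ a ℕ.* x ℕ.* (b ℕ.* y)
    lemma = ℕSolver.solve-∀

  ^-pos : ∀ {a} n → 1 ℕ.≤ a → 1 ℕ.≤ a ^ n
  ^-pos zero    _   = ℕₚ.≤-refl
  ^-pos (suc n) 1≤a = *-pos 1≤a (^-pos n 1≤a)

  range-split : ∀ i (F : ℕ → ℚ) →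
    ∑ (range (2 ^ suc i)) F ≡ ∑ (downFrom (2 ^ i)) (λ k → F (suc (k ℕ.+ 2 ^ i))) + ∑ (range (2 ^ i)) F
  range-split i F = trans (cong (λ t → ∑ (range (2 ^ i ℕ.+ t)) F) (ℕₚ.+-identityʳ (2 ^ i))) (range-+ (2 ^ i) (2 ^ i) F)

  ∑-range-mono : ∀ {a b} F → a ℕ.≤ b → (∀ {n} → n ∈ range b → 0ℚ ≤ F n) → ∑ (range a) F ≤ ∑ (range b) F
  ∑-range-mono {a} {b} F a≤b nonneg = subst (λ t → ∑ (range a) F ≤ ∑ (range t) F) (ℕₚ.m∸n+n≡m a≤b)
    (≤-respʳ (sym (range-+ (b ℕ.∸ a) a F)) (p≤q+p (subst (_≤ ∑ (downFrom (b ℕ.∸ a)) (λ i → F (suc (i ℕ.+ a))))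
      (∑-zero (downFrom (b ℕ.∸ a))) (∑-mono∈ (downFrom (b ℕ.∸ a)) (λ {i} i∈ → nonneg (∈-range⁺ (ℕ.s≤s ℕ.z≤n)
        (subst (suc (i ℕ.+ a) ℕ.≤_) (ℕₚ.m∸n+n≡m a≤b) (ℕₚ.+-monoˡ-≤ a (∈-downFrom⁻ i∈)))))))))

  2ν : ∀ n → ν (2 ℕ.* n) ≡ ν n + ν n
  2ν n = trans (cong ν (cong (n ℕ.+_) (ℕₚ.+-identityʳ n))) (ν-+ n n)

  -- A weak Stirling formula by dyadic induction: each term of the new block (2^i, 2^(i+1)] is at
  -- most 1, and each old term grows by 1.
  ∑-lg : ∀ i → ∑ (range (2 ^ i)) (λ n → ν i - ν (lg n)) ≤ ν (2 ^ i) + ν (2 ^ i)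
  ∑-lg zero = ≤-trans (≤-reflexive (trans (∑-∷ 1 [] (λ n → ν 0 - ν (lg n))) (zero-+ʳ (+-inverseʳ (ν 0)) (∑-[] (λ n → ν 0 - ν (lg n))))))
    (+-nonNeg (0≤ν 1) (0≤ν 1))
  ∑-lg (suc i) = begin
    ∑ (range (2 ^ suc i)) (λ n → ν (suc i) - ν (lg n))
      ≡⟨ range-split i _ ⟩
    ∑ (downFrom x) (λ k → ν (suc i) - ν (lg (suc (k ℕ.+ x)))) + ∑ (range x) (λ n → ν (suc i) - ν (lg n))
      ≤⟨ +-mono-≤ (∑-mono (downFrom x) upper) (≤-reflexive (∑-cong (range x) (λ n → trans (cong (_- ν (lg n)) (ν-suc i)) (+-assoc 1ℚ (ν i) (- ν (lg n)))))) ⟩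
    ∑ (downFrom x) (λ k → 1ℚ) + ∑ (range x) (λ n → 1ℚ + (ν i - ν (lg n)))
      ≡⟨ cong₂ _+_ (trans (∑-const (downFrom x) 1ℚ) (trans (*-identityʳ _) (cong ν (length-downFrom x))))
           (trans (∑-+ (range x) _ _) (cong (_+ ∑ (range x) (λ n → ν i - ν (lg n)))
             (trans (∑-const (range x) 1ℚ) (trans (*-identityʳ _) (cong ν (length-range x)))))) ⟩
    ν x + (ν x + ∑ (range x) (λ n → ν i - ν (lg n)))
      ≤⟨ +-monoʳ-≤ (ν x) (+-monoʳ-≤ (ν x) (∑-lg i)) ⟩
    ν x + (ν x + (ν x + ν x))
      ≡⟨ trans (sym (+-assoc (ν x) (ν x) (ν x + ν x))) (cong₂ _+_ (sym (2ν x)) (sym (2ν x))) ⟩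
    ν (2 ^ suc i) + ν (2 ^ suc i) ∎
    where
    open ≤-Reasoning
    x = 2 ^ i
    upper : ∀ k → ν (suc i) - ν (lg (suc (k ℕ.+ x))) ≤ 1ℚ
    upper k = ≤-trans (+-monoʳ-≤ (ν (suc i)) (neg-antimono-≤ (ν-mono-≤ (2^≤⇒≤lg (ℕₚ.m≤n⇒m≤1+n (ℕₚ.m≤n+m x k))))))
      (≤-reflexive (trans (cong (_- ν i) (ν-suc i)) (lemma (ν i))))
      where
      lemma : ∀ a → 1ℚ + a - a ≡ 1ℚ
      lemma = solve-∀ ℚring

  -- Convergence of ∑ (log n)/n² with an explicit remainder. The block (2^i, 2^(i+1)] contributes at
  -- most (i + 2)/2^i, and the subtracted term is designed to pay for it: (6 + 2i)/2^i - (8 +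
  -- 2i)/2^(i+1) = (2 + i)/2^i. The 7 leaves room for the first term.
  ∑-lg-rec² : ∀ i → ∑ (range (2 ^ i)) (λ n → ν (suc (lg n)) * (rec n * rec (suc n))) ≤ ν 7 - ν (6 ℕ.+ 2 ℕ.* i) * rec (2 ^ i)
  ∑-lg-rec² zero = ≤-trans (≤-reflexive (trans (∑-∷ 1 [] (λ n → ν (suc (lg n)) * (rec n * rec (suc n))))
      (zero-+ʳ refl (∑-[] (λ n → ν (suc (lg n)) * (rec n * rec (suc n)))))))
    (≤-trans (≤-reflexive (trans (cong (_* (rec 1 * rec 2)) ι-1) (trans (*-identityˡ _) (trans (cong (_* rec 2) rec-1) (*-identityˡ (rec 2))))))
    (≤-trans (rec≤1 2) (≤-reflexive (sym (trans (cong (λ t → ν 7 - ν 6 * t) rec-1) (trans (cong (λ t → t - ν 6 * 1ℚ) (ν-suc 6)) (lemma (ν 6))))))))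
    where
    lemma : ∀ a → 1ℚ + a - a * 1ℚ ≡ 1ℚ
    lemma = solve-∀ ℚring
  ∑-lg-rec² (suc i) = begin
    ∑ (range (2 ^ suc i)) W
      ≡⟨ range-split i W ⟩
    ∑ (downFrom x) (λ k → W (suc (k ℕ.+ x))) + ∑ (range x) W
      ≤⟨ +-mono-≤ (∑-mono∈ (downFrom x) upper) (∑-lg-rec² i) ⟩
    ∑ (downFrom x) (λ k → ν (suc (suc i)) * (rec x * rec x)) + (ν 7 - ν (6 ℕ.+ 2 ℕ.* i) * rec x)
      ≡⟨ cong (_+ (ν 7 - ν (6 ℕ.+ 2 ℕ.* i) * rec x)) constant ⟩
    ν (suc (suc i)) * rec x + (ν 7 - ν (6 ℕ.+ 2 ℕ.* i) * rec x)
      ≡⟨ cong₂ (λ a b → a * rec x + (ν 7 - b * rec x)) (ν-+ 2 i) (trans (ν-+ 6 (2 ℕ.* i)) (cong (_+_ (ν 6)) (ν-* 2 i))) ⟩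
    (ν 2 + ν i) * rec x + (ν 7 - (ν 6 + ν 2 * ν i) * rec x)
      ≡⟨ cong₂ (λ a b → (a + ν i) * rec x + (ν 7 - (b + a * ν i) * rec x)) ν2 ν6 ⟩
    (2ℚ + ν i) * rec x + (ν 7 - ((2ℚ + 2ℚ + 2ℚ) + 2ℚ * ν i) * rec x)
      ≡⟨ cong (λ r → (2ℚ + ν i) * r + (ν 7 - ((2ℚ + 2ℚ + 2ℚ) + 2ℚ * ν i) * r)) halve ⟩
    (2ℚ + ν i) * (2ℚ * rec (2 ^ suc i)) + (ν 7 - ((2ℚ + 2ℚ + 2ℚ) + 2ℚ * ν i) * (2ℚ * rec (2 ^ suc i)))
      ≡⟨ arith (ν i) (rec (2 ^ suc i)) (ν 7) ⟩
    ν 7 - ((2ℚ + 2ℚ + 2ℚ) + 2ℚ * (1ℚ + ν i)) * rec (2 ^ suc i)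
      ≡⟨ sym (cong (λ a → ν 7 - a * rec (2 ^ suc i)) (trans (ν-+ 6 (2 ℕ.* suc i)) (cong₂ _+_ ν6 (trans (ν-* 2 (suc i)) (cong₂ _*_ ν2 (ν-suc i)))))) ⟩
    ν 7 - ν (6 ℕ.+ 2 ℕ.* suc i) * rec (2 ^ suc i) ∎
    where
    open ≤-Reasoning
    x = 2 ^ i
    W : ℕ → ℚ
    W n = ν (suc (lg n)) * (rec n * rec (suc n))
    constant : ∑ (downFrom x) (λ k → ν (suc (suc i)) * (rec x * rec x)) ≡ ν (suc (suc i)) * rec x
    constant = begin-equality
      ∑ (downFrom x) (λ k → ν (suc (suc i)) * (rec x * rec x))
        ≡⟨ ∑-const (downFrom x) (ν (suc (suc i)) * (rec x * rec x)) ⟩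
      ν (length (downFrom x)) * (ν (suc (suc i)) * (rec x * rec x))
        ≡⟨ cong (λ n → ν n * (ν (suc (suc i)) * (rec x * rec x))) (length-downFrom x) ⟩
      ν x * (ν (suc (suc i)) * (rec x * rec x))
        ≡⟨ regroup (ν x) (ν (suc (suc i))) (rec x) ⟩
      (ν x * rec x) * (ν (suc (suc i)) * rec x)
        ≡⟨ cong (_* (ν (suc (suc i)) * rec x)) (ν*rec′ (1≤2^ i)) ⟩
      1ℚ * (ν (suc (suc i)) * rec x)
        ≡⟨ *-identityˡ (ν (suc (suc i)) * rec x) ⟩
      ν (suc (suc i)) * rec x ∎
      where
      regroup : ∀ x c r → x * (c * (r * r)) ≡ (x * r) * (c * r)
      regroup = solve-∀ ℚring
    ν2 : ν 2 ≡ 2ℚ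
    ν2 = trans (ν-suc 1) (cong (_+_ 1ℚ) ι-1)
    ν6 : ν 6 ≡ 2ℚ + 2ℚ + 2ℚ
    ν6 = trans (ν-+ 4 2) (cong₂ _+_ (trans (ν-+ 2 2) (cong₂ _+_ ν2 ν2)) ν2)
    halve : rec x ≡ 2ℚ * rec (2 ^ suc i)
    halve = sym (trans (cong (2ℚ *_) (rec-* 2 x)) (trans (sym (*-assoc 2ℚ (rec 2) (rec x)))
      (trans (cong (_* rec x) (trans (cong (_* rec 2) (sym ν2)) (ν*rec 1))) (*-identityˡ (rec x)))))
    arith : ∀ i r s → ((1ℚ + 1ℚ) + i) * ((1ℚ + 1ℚ) * r) + (s - (((1ℚ + 1ℚ) + (1ℚ + 1ℚ) + (1ℚ + 1ℚ)) + (1ℚ + 1ℚ) * i) * ((1ℚ + 1ℚ) * r))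
      ≡ s - (((1ℚ + 1ℚ) + (1ℚ + 1ℚ) + (1ℚ + 1ℚ)) + (1ℚ + 1ℚ) * (1ℚ + i)) * r
    arith = solve-∀ ℚring
    upper : ∀ {k} → k ∈ downFrom x → W (suc (k ℕ.+ x)) ≤ ν (suc (suc i)) * (rec x * rec x)
    upper {k} k∈ = *-mono (0≤ν _) (ν-mono-≤ (ℕ.s≤s (≤2^⇒lg≤ (ℕ.s≤s ℕ.z≤n) k+x<)))
        (*-nonNeg (0≤rec (suc (k ℕ.+ x))) (0≤rec (suc (suc (k ℕ.+ x)))))
        (*-mono (0≤rec (suc (k ℕ.+ x))) (rec-mono (1≤2^ i) x≤) (0≤rec (suc (suc (k ℕ.+ x)))) (rec-mono (1≤2^ i) (ℕₚ.m≤n⇒m≤1+n x≤)))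
      where
      x≤ : x ℕ.≤ suc (k ℕ.+ x)
      x≤ = ℕₚ.m≤n⇒m≤1+n (ℕₚ.m≤n+m x k)
      k+x< : suc (k ℕ.+ x) ℕ.≤ 2 ^ suc i
      k+x< = ℕₚ.≤-trans (ℕₚ.+-monoˡ-≤ x (∈-downFrom⁻ k∈)) (ℕₚ.≤-reflexive (cong (x ℕ.+_) (sym (ℕₚ.+-identityʳ x))))

  -- The completely additive function λ takes the value ⌊S log₂ q⌋ on primes q, so that λ/S
  -- approximates log₂ on [1, 2^L] well enough when S is large.
  module Log (L : ℕ) where

    -- `l` and `h` below differ by at most 1/S for each prime factor of n, hence by at most L/S for
    -- n ≤ 2^L. Summed against 1/n this gives at most L(L + 1)/S, which the square keeps below 1.
    S : ℕ
    S = suc L ℕ.* suc L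

    x : ℕ
    x = 2 ^ L

    1≤S : 1 ℕ.≤ S
    1≤S = ℕ.s≤s ℕ.z≤n

    τ : ℕ → ℕ
    τ q = lg (q ^ S)

    λ′ Ω : ℕ → ℕ
    λ′ = additive τ
    Ω n = length (factors n)

    private
      -- Multiply 2^τ(q) ≤ q^S < 2^(τ(q)+1) over all prime factors; each factor loses at most 1 in
      -- the exponent.
      list-bounds : ∀ {ps} → All Prime ps →
        (2 ^ sum (map τ ps) ℕ.≤ product ps ^ S) × (product ps ^ S ℕ.≤ 2 ^ (sum (map τ ps) ℕ.+ length ps)) × (2 ^ length ps ℕ.≤ product ps)
      list-bounds [] = ℕₚ.≤-reflexive (sym (ℕₚ.^-zeroˡ S)) , ℕₚ.≤-reflexive (ℕₚ.^-zeroˡ S) , ℕₚ.≤-refl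
      list-bounds {q ∷ ps} (pq ∷ pps) with list-bounds pps | lg-bounds (q ^ S) (^-pos S (prime-pos pq))
      ... | lo , hi , len | qlo , qhi =
        subst₂ ℕ._≤_ (sym (ℕₚ.^-distribˡ-+-* 2 (τ q) (sum (map τ ps)))) (sym (*-^ q (product ps) S)) (ℕₚ.*-mono-≤ qlo lo) ,
        subst₂ ℕ._≤_ (sym (*-^ q (product ps) S))
          (trans (sym (ℕₚ.^-distribˡ-+-* 2 (suc (τ q)) (sum (map τ ps) ℕ.+ length ps))) (cong (2 ^_) (lemma (τ q) (sum (map τ ps)) (length ps))))
          (ℕₚ.*-mono-≤ (ℕₚ.<⇒≤ qhi) hi) ,
        ℕₚ.*-mono-≤ (2≤prime pq) len
        where
        lemma : ∀ t s l → suc t ℕ.+ (s ℕ.+ l) ≡ t ℕ.+ s ℕ.+ suc l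
        lemma = ℕSolver.solve-∀

      bounds : ∀ {n} → 1 ℕ.≤ n → (2 ^ λ′ n ℕ.≤ n ^ S) × (n ^ S ℕ.≤ 2 ^ (λ′ n ℕ.+ Ω n)) × (2 ^ Ω n ℕ.≤ n)
      bounds {n} 1≤n = subst (λ p → (2 ^ λ′ n ℕ.≤ p ^ S) × (p ^ S ℕ.≤ 2 ^ (λ′ n ℕ.+ Ω n)) × (2 ^ Ω n ℕ.≤ p))
        (factors-product 1≤n) (list-bounds (factors-prime n))

    Ω≤ : ∀ {n} → 1 ℕ.≤ n → n ℕ.≤ x → Ω n ℕ.≤ L
    Ω≤ 1≤n n≤x = 2^-cancel-≤ (ℕₚ.≤-trans (proj₂ (proj₂ (bounds 1≤n))) n≤x)

    λ′≤ : ∀ {n} i → 1 ℕ.≤ n → n ℕ.≤ 2 ^ i → λ′ n ℕ.≤ i ℕ.* S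
    λ′≤ {n} i 1≤n n≤ = 2^-cancel-≤ (ℕₚ.≤-trans (proj₁ (bounds 1≤n)) (ℕₚ.≤-trans (ℕₚ.^-monoˡ-≤ S n≤)
      (ℕₚ.≤-reflexive (ℕₚ.^-*-assoc 2 i S))))

    lg≤λ′ : ∀ {n} → 1 ℕ.≤ n → lg n ℕ.* S ℕ.≤ λ′ n ℕ.+ Ω n
    lg≤λ′ {n} 1≤n = 2^-cancel-≤ (ℕₚ.≤-trans (ℕₚ.≤-reflexive (sym (ℕₚ.^-*-assoc 2 (lg n) S)))
      (ℕₚ.≤-trans (ℕₚ.^-monoˡ-≤ S (proj₁ (lg-bounds n 1≤n))) (proj₁ (proj₂ (bounds 1≤n)))))

    -- ⌊S log₂ n⌋ is monotone in n and close to λ n.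
    ℓ : ℕ → ℕ
    ℓ n = lg (n ^ S)

    λ′≤ℓ : ∀ {n} → 1 ℕ.≤ n → λ′ n ℕ.≤ ℓ n
    λ′≤ℓ 1≤n = 2^≤⇒≤lg (proj₁ (bounds 1≤n))

    ℓ≤λ′+Ω : ∀ {n} → 1 ℕ.≤ n → ℓ n ℕ.≤ λ′ n ℕ.+ Ω n
    ℓ≤λ′+Ω 1≤n = ≤2^⇒lg≤ (^-pos S 1≤n) (proj₁ (proj₂ (bounds 1≤n)))

    ℓ-mono : ∀ {a b} → 1 ℕ.≤ a → a ℕ.≤ b → ℓ a ℕ.≤ ℓ b
    ℓ-mono 1≤a a≤b = lg-mono (^-pos S 1≤a) (ℕₚ.^-monoˡ-≤ S a≤b)

    ℓ≤lg : ∀ {n} → 1 ℕ.≤ n → ℓ n ℕ.≤ suc (lg n) ℕ.* S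
    ℓ≤lg {n} 1≤n = ≤2^⇒lg≤ (^-pos S 1≤n) (ℕₚ.≤-trans (ℕₚ.^-monoˡ-≤ S (ℕₚ.<⇒≤ (proj₂ (lg-bounds n 1≤n))))
      (ℕₚ.≤-reflexive (ℕₚ.^-*-assoc 2 (suc (lg n)) S)))

    ρ : ℚ
    ρ = rec S

    0≤ρ : 0ℚ ≤ ρ
    0≤ρ = 0≤rec S

    ν-S* : ∀ i → ν (i ℕ.* S) * ρ ≡ ν i
    ν-S* i = trans (cong (_* ρ) (ν-* i S)) (trans (*-assoc (ν i) (ν S) ρ) (trans (cong (ν i *_) (ν*rec′ 1≤S)) (*-identityʳ (ν i))))

    -- Two approximations of log₂ n: `l` is completely additive, as divisor sums require, and `h` is
    -- monotone, as summation by parts requires; `t` gives the values of `l` at primes.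
    l t h : ℕ → ℚ
    l n = ν (λ′ n) * ρ
    t q = ν (τ q) * ρ
    h n = ν (ℓ n) * ρ

    l-1 : l 1 ≡ 0ℚ
    l-1 = zero-*ˡ ρ (trans (cong ν (additive-1 τ)) ι-0)

    0≤t : ∀ q → 0ℚ ≤ t q
    0≤t q = *-nonNeg (0≤ν (τ q)) 0≤ρ

    l-* : ∀ {q d} → Prime q → 1 ℕ.≤ d → l (q ℕ.* d) ≡ t q + l d
    l-* {q} {d} pq 1≤d = trans (cong (_* ρ) (trans (cong ν (additive-* τ pq 1≤d)) (ν-+ (τ q) (λ′ d)))) (*-distribʳ-+ ρ (ν (τ q)) (ν (λ′ d)))

    l≤ : ∀ {n} i → 1 ℕ.≤ n → n ℕ.≤ 2 ^ i → l n ≤ ν i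
    l≤ i 1≤n n≤ = ≤-respʳ (ν-S* i) (*-monoˡ 0≤ρ (ν-mono-≤ (λ′≤ i 1≤n n≤)))

    L≤S : L ℕ.≤ S
    L≤S = ℕₚ.≤-trans (ℕₚ.n≤1+n L) (ℕₚ.m≤m*n (suc L) (suc L))

    lg≤l+1 : ∀ {n} → 1 ℕ.≤ n → n ℕ.≤ x → ν (lg n) ≤ l n + 1ℚ
    lg≤l+1 {n} 1≤n n≤x = begin
      ν (lg n)                         ≡⟨ sym (ν-S* (lg n)) ⟩
      ν (lg n ℕ.* S) * ρ               ≤⟨ *-monoˡ 0≤ρ (ν-mono-≤ (ℕₚ.≤-trans (lg≤λ′ 1≤n) (ℕₚ.+-monoʳ-≤ (λ′ n) (ℕₚ.≤-trans (Ω≤ 1≤n n≤x) L≤S)))) ⟩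
      ν (λ′ n ℕ.+ S) * ρ               ≡⟨ trans (cong (_* ρ) (ν-+ (λ′ n) S)) (*-distribʳ-+ ρ (ν (λ′ n)) (ν S)) ⟩
      l n + ν S * ρ                    ≡⟨ cong (_+_ (l n)) (ν*rec′ 1≤S) ⟩
      l n + 1ℚ                         ∎
      where open ≤-Reasoning

    -- Stirling's formula, up to O(2^i).
    stirling : ∀ i → i ℕ.≤ L → ∑ (range (2 ^ i)) (λ n → ν i - l n) ≤ ν (2 ^ i) + ν (2 ^ i) + ν (2 ^ i)
    stirling i i≤L = begin
      ∑ R (λ n → ν i - l n)
        ≤⟨ ∑-mono∈ R (λ {n} n∈ → ≤-from-diff (l n + 1ℚ - ν (lg n)) (lemma (ν i) (l n) (ν (lg n))) (p≤q⇒0≤q-p (lg≤l+1 (proj₁ (∈-range⁻ n∈))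
              (ℕₚ.≤-trans (proj₂ (∈-range⁻ n∈)) (ℕₚ.^-monoʳ-≤ 2 i≤L))))) ⟩
      ∑ R (λ n → (ν i - ν (lg n)) + 1ℚ)
        ≡⟨ trans (∑-+ R _ _) (cong (_+_ (∑ R (λ n → ν i - ν (lg n)))) (trans (∑-const R 1ℚ) (trans (*-identityʳ _) (cong ν (length-range (2 ^ i)))))) ⟩
      ∑ R (λ n → ν i - ν (lg n)) + ν (2 ^ i)
        ≤⟨ +-monoˡ-≤ (ν (2 ^ i)) (∑-lg i) ⟩
      ν (2 ^ i) + ν (2 ^ i) + ν (2 ^ i) ∎
      where
      open ≤-Reasoning
      R = range (2 ^ i)
      lemma : ∀ i l g → ((i - g) + 1ℚ) - (i - l) ≡ l + 1ℚ - g
      lemma = solve-∀ ℚring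

    open DivisorSums x public
    open VonMangoldt l t l-1 0≤t l-* public

    R : List ℕ
    R = range x

    -- This is μ(n) log(x/n). Its divisor sums are Λ(N), with an extra log x at N = 1, and by
    -- Stirling its absolute values add up to only O(x). With μ(n) log n in its place a factor log x
    -- would be lost.
    u : ℕ → ℚ
    u n = μ n * (ν L - l n)

    0≤Λ∈ : ∀ {N} → N ∈ R → 0ℚ ≤ Λ N
    0≤Λ∈ {N} N∈ = 0≤Λ N (proj₁ (∈-range⁻ N∈)) (proj₂ (∈-range⁻ N∈))

    ∑u : ∀ N → 1 ℕ.≤ N → N ℕ.≤ x → divisorSum N u ≡ ν L * χ (N ℕ.≟ 1) + Λ N
    ∑u N 1≤N N≤x = begin
      divisorSum N u
        ≡⟨ ∑-cong R (λ d → cong (χ (d ∣? N) *_) (lemma (μ d) (ν L) (l d))) ⟩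
      divisorSum N (λ d → ν L * μ d + (- 1ℚ) * (μ d * l d))
        ≡⟨ trans (divisorSum-+ N _ _) (cong₂ _+_ (trans (divisorSum-*ˡ N (ν L) μ) (cong (ν L *_) (∑μ N 1≤N N≤x)))
             (trans (divisorSum-*ˡ N (- 1ℚ) (λ d → μ d * l d)) (minus-one (divisorSum N (λ d → μ d * l d))))) ⟩
      ν L * χ (N ℕ.≟ 1) + Λ N ∎
      where
      open ≡-Reasoning
      lemma : ∀ m L l → m * (L - l) ≡ L * m + (- 1ℚ) * (m * l)
      lemma = solve-∀ ℚring
      minus-one : ∀ a → (- 1ℚ) * a ≡ - a
      minus-one = solve-∀ ℚring

    ∑∣u∣ : ∑ R (λ n → ∣ u n ∣) ≤ ν x + ν x + ν x
    ∑∣u∣ = ≤-trans (∑-mono∈ R (λ {n} n∈ → bound n (p≤q⇒0≤q-p (l≤ L (proj₁ (∈-range⁻ n∈)) (proj₂ (∈-range⁻ n∈))))))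
      (stirling L ℕₚ.≤-refl)
      where
      bound : ∀ n → 0ℚ ≤ ν L - l n → ∣ u n ∣ ≤ ν L - l n
      bound n 0≤ = ≤-respʳ (*-identityˡ (ν L - l n)) (∣*∣≤ (∣μ∣≤1 n) (≤-reflexive (0≤p⇒∣p∣≡p 0≤)))

    count : ℕ → ℕ → ℚ
    count y N = ∑ (range y) (λ n → χ (N ∣? n))

    count≡ : ∀ y N .{{_ : NonZero N}} → count y N ≡ ν (y ℕ./ N)
    count≡ y N = trans (∑-cong (range y) (λ n → sym (*-identityʳ (χ (N ∣? n)))))
      (trans (∑-multiples y N (λ _ → 1ℚ)) (trans (∑-const (range (y ℕ./ N)) 1ℚ) (trans (*-identityʳ _) (cong ν (length-range (y ℕ./ N))))))

    -- Legendre's formula log y! = ∑ Λ(N)⌊y/N⌋.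
    ∑l : ∀ y → y ℕ.≤ x → ∑ (range y) l ≡ ∑ R (λ N → Λ N * count y N)
    ∑l y y≤x = begin
      ∑ (range y) l
        ≡⟨ ∑-cong∈ (range y) (λ {n} n∈ → sym (∑Λ n (proj₁ (∈-range⁻ n∈)) (ℕₚ.≤-trans (proj₂ (∈-range⁻ n∈)) y≤x))) ⟩
      ∑ (range y) (λ n → ∑ R (λ N → χ (N ∣? n) * Λ N))
        ≡⟨ ∑-swap (range y) R _ ⟩
      ∑ R (λ N → ∑ (range y) (λ n → χ (N ∣? n) * Λ N))
        ≡⟨ ∑-cong R (λ N → trans (sym (∑-*ʳ (range y) (Λ N) _)) (*-comm (count y N) (Λ N))) ⟩
      ∑ R (λ N → Λ N * count y N) ∎
      where open ≡-Reasoning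

    -- Compared with 1/N, the weight 1/N - 1/x satisfies x·w(N) ≤ ⌊x/N⌋ without any error, because
    -- x/N - 1 < ⌊x/N⌋; it also vanishes at the cutoff N = x.
    w : ℕ → ℚ
    w N = rec N - rec x

    0≤w : ∀ {N} → N ∈ R → 0ℚ ≤ w N
    0≤w N∈ = p≤q⇒0≤q-p (rec-mono (proj₁ (∈-range⁻ N∈)) (proj₂ (∈-range⁻ N∈)))

    x*w≤count : ∀ {N} → N ∈ R → ν x * w N ≤ count x N
    x*w≤count {zero}  N∈ = ⊥-elim (ℕₚ.<⇒≱ (proj₁ (∈-range⁻ N∈)) ℕ.z≤n)
    x*w≤count {suc N} N∈ = ≤-respʳ (sym (count≡ x (suc N))) (begin
      ν x * (rec (suc N) - rec x)                    ≡⟨ expand (ν x) (rec (suc N)) (rec x) ⟩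
      ν x * rec (suc N) - ν x * rec x                ≡⟨ cong (λ a → ν x * rec (suc N) - a) (ν*rec′ (1≤2^ L)) ⟩
      ν x * rec (suc N) - 1ℚ                         ≤⟨ +-monoˡ-≤ (- 1ℚ) (*-monoˡ (0≤rec (suc N)) (ν-mono-≤ x≤)) ⟩
      ν (suc (x ℕ./ suc N) ℕ.* suc N) * rec (suc N) - 1ℚ
        ≡⟨ cong (_- 1ℚ) (trans (cong (_* rec (suc N)) (ν-* (suc (x ℕ./ suc N)) (suc N))) (trans (*-assoc (ν (suc (x ℕ./ suc N))) (ν (suc N)) (rec (suc N)))
             (trans (cong (ν (suc (x ℕ./ suc N)) *_) (ν*rec N)) (trans (*-identityʳ (ν (suc (x ℕ./ suc N)))) (ν-suc (x ℕ./ suc N)))))) ⟩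
      1ℚ + ν (x ℕ./ suc N) - 1ℚ                      ≡⟨ cancel (ν (x ℕ./ suc N)) ⟩
      ν (x ℕ./ suc N)                                ∎)
      where
      open ≤-Reasoning
      expand : ∀ a b c → a * (b - c) ≡ a * b - a * c
      expand = solve-∀ ℚring
      cancel : ∀ a → 1ℚ + a - 1ℚ ≡ a
      cancel = solve-∀ ℚring
      x≤ : x ℕ.≤ suc (x ℕ./ suc N) ℕ.* suc N
      x≤ = ℕₚ.≤-trans (ℕₚ.≤-reflexive (ℕ.m≡m%n+[m/n]*n x (suc N))) (ℕₚ.+-monoˡ-≤ _ (ℕₚ.<⇒≤ (ℕ.m%n<n x (suc N))))

    W : ℚ
    W = ∑ R (λ N → Λ N * w N)

    -- x·W ≤ ∑ Λ(N)⌊x/N⌋ = log x! ≤ x log x. That no O(1) appears is convenient when W is compared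
    -- with log x at a maximum of φ.
    W≤L : W ≤ ν L
    W≤L = ≤-scale′ (begin
      ν x * W                          ≡⟨ ∑-*ˡ R (ν x) _ ⟩
      ∑ R (λ N → ν x * (Λ N * w N))    ≤⟨ ∑-mono∈ R (λ {N} N∈ → ≤-respˡ (swap (Λ N) (ν x) (w N)) (*-monoʳ (0≤Λ∈ N∈) (x*w≤count N∈))) ⟩
      ∑ R (λ N → Λ N * count x N)      ≡⟨ sym (∑l x ℕₚ.≤-refl) ⟩
      ∑ R l                            ≤⟨ ∑-mono∈ R (λ {n} n∈ → l≤ L (proj₁ (∈-range⁻ n∈)) (proj₂ (∈-range⁻ n∈))) ⟩
      ∑ R (λ _ → ν L)                  ≡⟨ trans (∑-const R (ν L)) (cong (λ k → ν k * ν L) (length-range x)) ⟩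
      ν x * ν L                        ∎)
      where
      open ≤-Reasoning
      swap : ∀ a b c → a * (b * c) ≡ b * (a * c)
      swap = solve-∀ ℚring
      ≤-scale′ : ∀ {p q} → ν x * p ≤ ν x * q → p ≤ q
      ≤-scale′ le with x | 1≤2^ L
      ... | suc k | _ = ≤-scale k le

    -- The argument of the central binomial coefficient. For y = 2^i, ∑ Λ(N)D(N) is log (2y)! - 2
    -- log y!, where D ≥ 0 throughout and D ≥ 1 on (y, 2y]. By `stirling` it is at most 2y(i + 1) -
    -- 2(yi - 3y) = 8y, and 8y for the new block plus 8y from the induction is 8·2y.
    chebyshev : ∀ i → i ℕ.≤ L → ∑ (range (2 ^ i)) Λ ≤ ν (8 ℕ.* 2 ^ i)
    chebyshev zero _ = ≤-trans (≤-reflexive (trans (∑-∷ 1 [] Λ) (trans (cong₂ _+_ (Λ-1 (1≤2^ L)) (∑-[] Λ)) (+-identityʳ 0ℚ)))) (0≤ν 8)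
    chebyshev (suc i) i<L = begin
      ∑ (range y′) Λ
        ≡⟨ range-split i Λ ⟩
      ∑ (downFrom y) (λ k → Λ (suc (k ℕ.+ y))) + ∑ (range y) Λ
        ≤⟨ +-mono-≤ block (chebyshev i i≤L) ⟩
      ν (4 ℕ.* y′) + ν (8 ℕ.* y)
        ≡⟨ trans (sym (ν-+ (4 ℕ.* y′) (8 ℕ.* y))) (cong ν (arith y)) ⟩
      ν (8 ℕ.* y′) ∎
      where
      open ≤-Reasoning
      y  = 2 ^ i
      y′ = 2 ^ suc i
      i≤L = ℕₚ.<⇒≤ i<L
      y≤x : y ℕ.≤ x
      y≤x = ℕₚ.^-monoʳ-≤ 2 i≤L
      y′≤x : y′ ℕ.≤ x
      y′≤x = ℕₚ.^-monoʳ-≤ 2 i<L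
      arith : ∀ y → 4 ℕ.* (2 ℕ.* y) ℕ.+ 8 ℕ.* y ≡ 8 ℕ.* (2 ℕ.* y)
      arith = ℕSolver.solve-∀
      D : ℕ → ℚ
      D N = count y′ N - (count y N + count y N)
      double : ∀ N .{{_ : NonZero N}} → ν (y ℕ./ N) + ν (y ℕ./ N) ≤ ν (y′ ℕ./ N)
      double N = ≤-respˡ (2ν (y ℕ./ N)) (ν-mono-≤ (ℕₚ.≤-trans (ℕₚ.≤-reflexive (sym (ℕ.m*n/n≡m (2 ℕ.* (y ℕ./ N)) N)))
        (ℕ./-monoˡ-≤ N (ℕₚ.≤-trans (ℕₚ.≤-reflexive (ℕₚ.*-assoc 2 (y ℕ./ N) N)) (ℕₚ.*-monoʳ-≤ 2 (ℕ.m/n*n≤m y N))))))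
      0≤D : ∀ N → 1 ℕ.≤ N → 0ℚ ≤ D N
      0≤D (suc N) _ = p≤q⇒0≤q-p (subst₂ _≤_ (sym (cong₂ _+_ (count≡ y (suc N)) (count≡ y (suc N)))) (sym (count≡ y′ (suc N))) (double (suc N)))
      1≤D : ∀ {k} → k ∈ downFrom y → 1ℚ ≤ D (suc (k ℕ.+ y))
      1≤D {k} k∈ = ≤-respʳ (sym (trans (cong₂ (λ a b → a - (b + b)) (count≡ y′ N) (trans (count≡ y N) (trans (cong ν (ℕ.m<n⇒m/n≡0 (ℕ.s≤s (ℕₚ.m≤n+m y k)))) ι-0)))
          (drop (ν (y′ ℕ./ N))))) (≤-respˡ ι-1 (ν-mono-≤ (ℕ.m≥n⇒m/n>0 (ℕₚ.≤-trans (ℕₚ.+-monoˡ-≤ y (∈-downFrom⁻ k∈)) (ℕₚ.≤-reflexive (cong (y ℕ.+_) (sym (ℕₚ.+-identityʳ y))))))))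
        where
        N = suc (k ℕ.+ y)
        drop : ∀ a → a - (0ℚ + 0ℚ) ≡ a
        drop = solve-∀ ℚring
      ΛD : ℕ → ℚ
      ΛD N = Λ N * D N
      0≤ΛD : ∀ {n} → n ∈ range x → 0ℚ ≤ ΛD n
      0≤ΛD n∈ = *-nonNeg (0≤Λ∈ n∈) (0≤D _ (proj₁ (∈-range⁻ n∈)))
      total : ∑ R ΛD ≤ ν (4 ℕ.* y′)
      total = begin
        ∑ R ΛD
          ≡⟨ trans (∑-cong R (λ N → expand (Λ N) (count y′ N) (count y N))) (trans (∑-+ R _ _) (cong (_+_ (∑ R (λ N → Λ N * count y′ N)))
               (trans (∑-neg R _) (cong -_ (∑-+ R _ _))))) ⟩
        ∑ R (λ N → Λ N * count y′ N) - (∑ R (λ N → Λ N * count y N) + ∑ R (λ N → Λ N * count y N))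
          ≡⟨ cong₂ (λ a b → a - (b + b)) (sym (∑l y′ y′≤x)) (sym (∑l y y≤x)) ⟩
        ∑ (range y′) l - (∑ (range y) l + ∑ (range y) l)
          ≤⟨ +-mono-≤ l-upper (neg-antimono-≤ (+-mono-≤ l-lower l-lower)) ⟩
        ν y′ * ν (suc i) - ((ν y * ν i - (ν y + ν y + ν y)) + (ν y * ν i - (ν y + ν y + ν y)))
          ≡⟨ cong₂ (λ a b → a * b - ((ν y * ν i - (ν y + ν y + ν y)) + (ν y * ν i - (ν y + ν y + ν y)))) (2ν y) (ν-suc i) ⟩
        (ν y + ν y) * (1ℚ + ν i) - ((ν y * ν i - (ν y + ν y + ν y)) + (ν y * ν i - (ν y + ν y + ν y)))
          ≡⟨ simplify (ν y) (ν i) ⟩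
        ((ν y + ν y) + (ν y + ν y)) + ((ν y + ν y) + (ν y + ν y))
          ≡⟨ cong₂ _+_ (cong₂ _+_ (sym (2ν y)) (sym (2ν y))) (cong₂ _+_ (sym (2ν y)) (sym (2ν y))) ⟩
        (ν y′ + ν y′) + (ν y′ + ν y′)
          ≡⟨ sym (trans (cong ν (quad y′)) (trans (ν-+ (y′ ℕ.+ y′) (y′ ℕ.+ y′)) (cong₂ _+_ (ν-+ y′ y′) (ν-+ y′ y′)))) ⟩
        ν (4 ℕ.* y′) ∎
        where
        quad : ∀ a → 4 ℕ.* a ≡ (a ℕ.+ a) ℕ.+ (a ℕ.+ a)
        quad = ℕSolver.solve-∀
        expand : ∀ a b c → a * (b - (c + c)) ≡ a * b + - (a * c + a * c)
        expand = solve-∀ ℚring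
        simplify : ∀ y i → (y + y) * (1ℚ + i) - ((y * i - (y + y + y)) + (y * i - (y + y + y))) ≡ ((y + y) + (y + y)) + ((y + y) + (y + y))
        simplify = solve-∀ ℚring
        l-upper : ∑ (range y′) l ≤ ν y′ * ν (suc i)
        l-upper = ≤-trans (∑-mono∈ (range y′) (λ {n} n∈ → l≤ (suc i) (proj₁ (∈-range⁻ n∈)) (proj₂ (∈-range⁻ n∈))))
          (≤-reflexive (trans (∑-const (range y′) (ν (suc i))) (cong (λ k → ν k * ν (suc i)) (length-range y′))))
        l-lower : ν y * ν i - (ν y + ν y + ν y) ≤ ∑ (range y) l
        l-lower = ≤-from-diff ((ν y + ν y + ν y) - (ν y * ν i - ∑ (range y) l)) (rearrange (∑ (range y) l) (ν y * ν i) (ν y + ν y + ν y))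
          (p≤q⇒0≤q-p (≤-respˡ (trans (∑-+ (range y) _ _) (cong₂ _+_ (trans (∑-const (range y) (ν i)) (cong (λ k → ν k * ν i) (length-range y))) (∑-neg (range y) l)))
            (stirling i i≤L)))
          where
          rearrange : ∀ a b c → a - (b - c) ≡ c - (b - a)
          rearrange = solve-∀ ℚring
      block : ∑ (downFrom y) (λ k → Λ (suc (k ℕ.+ y))) ≤ ν (4 ℕ.* y′)
      block = begin
        ∑ (downFrom y) (λ k → Λ (suc (k ℕ.+ y)))
          ≤⟨ ∑-mono∈ (downFrom y) (λ {k} k∈ → ≤-respˡ (*-identityʳ (Λ (suc (k ℕ.+ y)))) (*-monoʳ (0≤Λ (suc (k ℕ.+ y)) (ℕ.s≤s ℕ.z≤n) (k+y< k∈)) (1≤D k∈))) ⟩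
        ∑ (downFrom y) (λ k → ΛD (suc (k ℕ.+ y)))
          ≤⟨ p≤p+q (∑-nonNeg (range y) (λ n∈ → 0≤ΛD (∈-range⁺ (proj₁ (∈-range⁻ n∈)) (ℕₚ.≤-trans (proj₂ (∈-range⁻ n∈)) y≤x)))) ⟩
        ∑ (downFrom y) (λ k → ΛD (suc (k ℕ.+ y))) + ∑ (range y) ΛD
          ≡⟨ sym (range-split i ΛD) ⟩
        ∑ (range y′) ΛD
          ≤⟨ ∑-range-mono ΛD y′≤x 0≤ΛD ⟩
        ∑ R ΛD
          ≤⟨ total ⟩
        ν (4 ℕ.* y′) ∎
        where
        k+y< : ∀ {k} → k ∈ downFrom y → suc (k ℕ.+ y) ℕ.≤ x
        k+y< {k} k∈ = ℕₚ.≤-trans (ℕₚ.+-monoˡ-≤ y (∈-downFrom⁻ k∈)) (ℕₚ.≤-trans (ℕₚ.≤-reflexive (cong (y ℕ.+_) (sym (ℕₚ.+-identityʳ y)))) y′≤x)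

-- Mertens' estimates for weighted prime powers

module Mertens where

  open import Data.Empty using (⊥-elim)
  open import Data.Integer as ℤ using (ℤ; +_)
  import Data.Integer.Properties as ℤₚ
  open import Data.List using (List)
  open import Data.List.Membership.Propositional using (_∈_)
  open import Data.Nat as ℕ using (ℕ; zero; suc; NonZero)
  open import Data.Nat.Divisibility using (_∣_; _∣?_)
  import Data.Nat.DivMod as ℕ
  import Data.Nat.Properties as ℕₚ
  open import Data.Product using (proj₁; proj₂)
  open import Data.Rational hiding (NonZero; floor)
  open import Data.Rational.Properties
  open import Relation.Binary.PropositionalEquality
    using (_≡_; refl; sym; trans; cong; cong₂; subst; subst₂; module ≡-Reasoning)
  open import Tactic.RingSolver using (solve-∀)
  open Rat
  open Ranges
  open Lattice
  open Tail
  open Small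
  open Divisor
  open LogData

  -- A tail of order 1/(⌊x/n⌋ + 1), divided by n, is at most 1/x uniformly in n.
  rec-quotient : ∀ x n .{{_ : NonZero n}} → 1 ℕ.≤ x → rec n * rec (suc (x ℕ./ n)) ≤ rec x
  rec-quotient x n 1≤x = ≤-respˡ (rec-* n (suc (x ℕ./ n))) (rec-mono 1≤x (ℕₚ.≤-trans
    (ℕₚ.≤-reflexive (ℕ.m≡m%n+[m/n]*n x n)) (ℕₚ.≤-trans (ℕₚ.+-monoˡ-≤ _ (ℕₚ.<⇒≤ (ℕ.m%n<n x n)))
    (ℕₚ.≤-reflexive (ℕₚ.*-comm (suc (x ℕ./ n)) n)))))

  module LogSums (L : ℕ) where

    open Log L

    k : ℕ → ℚ
    k n = h n * rec n

    0≤h : ∀ n → 0ℚ ≤ h n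
    0≤h n = *-nonNeg (0≤ν (ℓ n)) 0≤ρ

    0≤k : ∀ n → 0ℚ ≤ k n
    0≤k n = *-nonNeg (0≤h n) (0≤rec n)

    h≤ : ∀ n → 1 ℕ.≤ n → h n ≤ ν (suc (lg n))
    h≤ n 1≤n = ≤-respʳ (ν-S* (suc (lg n))) (*-monoˡ 0≤ρ (ν-mono-≤ (ℓ≤lg 1≤n)))

    a : ℕ → ℚ
    a n = h n * (rec n * rec (suc n))

    -- The decrement of k is P - Q with P = `a` n and Q ≥ 0 coming from the growth of `h`. It is
    -- bounded by P + Q = (Q - P) + 2P: a telescoping part and a term of a convergent series.
    k-variation : ∀ n → 1 ℕ.≤ n → ∣ k n - k (suc n) ∣ ≤ (k (suc n) - k n) + (a n + a n)
    k-variation (suc n) _ = subst₂ (λ p q → ∣ p ∣ ≤ q)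
        (trans (cong (λ t → h₀ * t - (h₁ - h₀) * r₁) (sym (rec-diff n))) (diff h₀ h₁ r₀ r₁))
        (trans (cong (λ t → h₀ * t + (h₁ - h₀) * r₁) (sym (rec-diff n)))
          (trans (add h₀ h₁ r₀ r₁) (cong (λ t → (h₁ * r₁ - h₀ * r₀) + (h₀ * t + h₀ * t)) (rec-diff n))))
        (∣-∣≤ (≤-reflexive (0≤p⇒∣p∣≡p (*-nonNeg (0≤h (suc n)) (*-nonNeg (0≤rec (suc n)) (0≤rec (suc (suc n)))))))
          (≤-reflexive (0≤p⇒∣p∣≡p (*-nonNeg (p≤q⇒0≤q-p (*-monoˡ 0≤ρ (ν-mono-≤ (ℓ-mono (ℕ.s≤s ℕ.z≤n) (ℕₚ.n≤1+n (suc n)))))) (0≤rec (suc (suc n)))))))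
      where
      h₀ = h (suc n)
      h₁ = h (suc (suc n))
      r₀ = rec (suc n)
      r₁ = rec (suc (suc n))
      diff : ∀ h₀ h₁ r₀ r₁ → h₀ * (r₀ - r₁) - (h₁ - h₀) * r₁ ≡ h₀ * r₀ - h₁ * r₁
      diff = solve-∀ ℚring
      add : ∀ h₀ h₁ r₀ r₁ → h₀ * (r₀ - r₁) + (h₁ - h₀) * r₁ ≡ (h₁ * r₁ - h₀ * r₀) + (h₀ * (r₀ - r₁) + h₀ * (r₀ - r₁))
      add = solve-∀ ℚring

    module _ (ψ : ℕ → ℚ) (B : ℚ) (partial : ∀ n → ∣ ∑ (range n) ψ ∣ ≤ B) (ψ≤B : ∀ n → ∣ ψ n ∣ ≤ B) where

      private
        Ψ : ℕ → ℚ
        Ψ n = ∑ (range n) ψ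
        0≤B = ∣∣≤⇒0≤ (ψ≤B 0)

        abel-bound : ∀ N → ∣ ∑ (range N) (λ n → ψ n * k n) - Ψ N * k (suc N) ∣ ≤ B * (k (suc N) + ∑ (range N) (λ n → a n + a n))
        abel-bound zero = ≤-respˡ (sym (cong ∣_∣ (trans (cong₂ _-_ (∑-[] (λ n → ψ n * k n)) (zero-*ˡ (k 1) (∑-[] ψ))) (+-inverseʳ 0ℚ))))
          (*-nonNeg 0≤B (+-nonNeg (0≤k 1) (≤-reflexive (sym (∑-[] (λ n → a n + a n))))))
        abel-bound (suc N) = subst₂ (λ p q → ∣ p ∣ ≤ q)
            (trans (step A (ψ (suc N)) (Ψ N) k₀ k₁) (sym (cong₂ (λ s t → s - t * k₁) (∑-∷ (suc N) (range N) (λ n → ψ n * k n)) (∑-∷ (suc N) (range N) ψ))))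
            (trans (add B k₀ k₁ (a (suc N)) T) (cong (λ t → B * (k₁ + t)) (sym (∑-∷ (suc N) (range N) (λ n → a n + a n)))))
            (∣+∣≤ (abel-bound N) (∣*∣≤ (≤-respˡ (cong ∣_∣ (∑-∷ (suc N) (range N) ψ)) (partial (suc N))) (k-variation (suc N) (ℕ.s≤s ℕ.z≤n))))
          where
          A = ∑ (range N) (λ n → ψ n * k n)
          T = ∑ (range N) (λ n → a n + a n)
          k₀ = k (suc N)
          k₁ = k (suc (suc N))
          step : ∀ A p P k₀ k₁ → (A - P * k₀) + (p + P) * (k₀ - k₁) ≡ (p * k₀ + A) - (p + P) * k₁
          step = solve-∀ ℚring
          add : ∀ B k₀ k₁ a T → B * (k₀ + T) + B * ((k₁ - k₀) + (a + a)) ≡ B * (k₁ + ((a + a) + T))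
          add = solve-∀ ℚring

        ∑a≤7 : ∑ R a ≤ ν 7
        ∑a≤7 = ≤-trans (∑-mono∈ R (λ {n} n∈ → *-monoˡ (*-nonNeg (0≤rec n) (0≤rec (suc n))) (h≤ n (proj₁ (∈-range⁻ n∈)))))
          (≤-trans (∑-lg-rec² L) (≤-respʳ (+-identityʳ (ν 7)) (+-monoʳ-≤ (ν 7) (neg-antimono-≤ (*-nonNeg (0≤ν (6 ℕ.+ 2 ℕ.* L)) (0≤rec x))))))

        k≤2 : k (suc x) ≤ 2ℚ
        k≤2 = begin
          h (suc x) * rec (suc x)               ≤⟨ *-monoˡ (0≤rec (suc x)) (≤-trans (h≤ (suc x) (ℕ.s≤s ℕ.z≤n)) (ν-mono-≤ lg≤)) ⟩
          ν (2 ℕ.* suc x) * rec (suc x)         ≡⟨ trans (cong (_* rec (suc x)) (ν-* 2 (suc x))) (trans (*-assoc (ν 2) (ν (suc x)) (rec (suc x)))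
                                                     (trans (cong (ν 2 *_) (ν*rec x)) (*-identityʳ (ν 2)))) ⟩
          ν 2                                   ≡⟨ trans (ν-suc 1) (cong (_+_ 1ℚ) ι-1) ⟩
          2ℚ                                    ∎
          where
          open ≤-Reasoning
          lg≤ : suc (lg (suc x)) ℕ.≤ 2 ℕ.* suc x
          lg≤ = ℕₚ.≤-trans (ℕ.s≤s (≤2^⇒lg≤ {suc L} (ℕ.s≤s ℕ.z≤n) (ℕₚ.≤-trans (ℕₚ.+-monoˡ-≤ x (1≤2^ L)) (ℕₚ.≤-reflexive (cong (x ℕ.+_) (sym (ℕₚ.+-identityʳ x)))))))
            (ℕₚ.≤-trans (ℕ.s≤s (ℕₚ.m≤n⇒m≤1+n (ℕₚ.≤-trans (1+i≤2^i L) ℕₚ.≤-refl)))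
              (ℕₚ.≤-trans (ℕ.s≤s (ℕ.s≤s (ℕₚ.m≤m+n x (x ℕ.+ 0)))) (ℕₚ.≤-reflexive (sym (ℕₚ.*-suc 2 x)))))

      -- Up to sign and the base of logarithms, these are partial sums of L′(1, ψ). With `h` instead
      -- of `l` they are bounded by summation by parts; the choice of `S` bounds the difference by
      -- B. The constant is 2·2 from k(x + 1), 2·7 from the sum of `a`, and 1 from this correction.
      log-sum-bound : ∣ ∑ R (λ n → ψ n * (l n * rec n)) ∣ ≤ ν 19 * B
      log-sum-bound = ≤-trans (subst₂ (λ p q → ∣ p ∣ ≤ q) main constant (∣-∣≤ (∣+∣≤ (abel-bound x) (∣*∣≤ (partial x) (≤-reflexive (0≤p⇒∣p∣≡p (0≤k (suc x)))))) correction)) total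
        where
        d : ℕ → ℚ
        d n = h n - l n
        T = ∑ R (λ n → a n + a n)
        main : ((∑ R (λ n → ψ n * k n) - Ψ x * k (suc x)) + Ψ x * k (suc x)) - ∑ R (λ n → ψ n * (d n * rec n)) ≡ ∑ R (λ n → ψ n * (l n * rec n))
        main = trans (cong₂ _+_ (cancel (∑ R (λ n → ψ n * k n)) (Ψ x * k (suc x))) (sym (∑-neg R _)))
          (trans (sym (∑-+ R _ _)) (∑-cong R (λ n → lemma (ψ n) (h n) (l n) (rec n))))
          where
          cancel : ∀ a b → (a - b) + b ≡ a
          cancel = solve-∀ ℚring
          lemma : ∀ p h l r → p * (h * r) + - (p * ((h - l) * r)) ≡ p * (l * r)
          lemma = solve-∀ ℚring
        correction : ∣ ∑ R (λ n → ψ n * (d n * rec n)) ∣ ≤ B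
        correction = begin
          ∣ ∑ R (λ n → ψ n * (d n * rec n)) ∣
            ≤⟨ ∣∑∣≤∑ R {g = λ n → B * (ν L * ρ * rec n)} (λ {n} n∈ → ∣*∣≤ (ψ≤B n) (∣*∣≤ (d≤ n∈) (≤-reflexive (∣rec∣ n)))) ⟩
          ∑ R (λ n → B * (ν L * ρ * rec n))
            ≡⟨ trans (sym (∑-*ˡ R B _)) (cong (B *_) (sym (∑-*ˡ R (ν L * ρ) rec))) ⟩
          B * (ν L * ρ * harmonic x)
            ≤⟨ *-monoʳ 0≤B (*-monoʳ (*-nonNeg (0≤ν L) 0≤ρ) (harmonic-2^ L)) ⟩
          B * (ν L * ρ * ν (suc L))
            ≡⟨ cong (B *_) (trans (reorder (ν L) ρ (ν (suc L))) (cong (_* ρ) (sym (ν-* L (suc L))))) ⟩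
          B * (ν (L ℕ.* suc L) * ρ)
            ≤⟨ *-monoʳ 0≤B (*-monoˡ 0≤ρ (ν-mono-≤ (ℕₚ.m≤n+m (L ℕ.* suc L) (suc L)))) ⟩
          B * (ν S * ρ)
            ≡⟨ trans (cong (B *_) (ν*rec′ 1≤S)) (*-identityʳ B) ⟩
          B ∎
          where
          open ≤-Reasoning
          reorder : ∀ a b c → a * b * c ≡ (a * c) * b
          reorder = solve-∀ ℚring
          d≤ : ∀ {n} → n ∈ R → ∣ d n ∣ ≤ ν L * ρ
          d≤ {n} n∈ = ≤-respˡ (sym (0≤p⇒∣p∣≡p (p≤q⇒0≤q-p (*-monoˡ 0≤ρ (ν-mono-≤ (λ′≤ℓ 1≤n))))))
            (≤-trans (+-monoˡ-≤ (- l n) (*-monoˡ 0≤ρ (ν-mono-≤ (ℕₚ.≤-trans (ℓ≤λ′+Ω 1≤n) (ℕₚ.+-monoʳ-≤ (λ′ n) (Ω≤ 1≤n (proj₂ (∈-range⁻ n∈))))))))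
              (≤-reflexive (trans (cong (λ t → t * ρ - l n) (ν-+ (λ′ n) L)) (cancel (ν (λ′ n)) (ν L) ρ))))
            where
            1≤n = proj₁ (∈-range⁻ n∈)
            cancel : ∀ a b r → (a + b) * r - a * r ≡ b * r
            cancel = solve-∀ ℚring
        constant : (B * (k (suc x) + T) + B * k (suc x)) + B ≡ B * ((k (suc x) + k (suc x)) + (∑ R a + ∑ R a) + 1ℚ)
        constant = trans (cong (λ t → (B * (k (suc x) + t) + B * k (suc x)) + B) (∑-+ R a a)) (lemma B (k (suc x)) (∑ R a))
          where
          lemma : ∀ B k s → (B * (k + (s + s)) + B * k) + B ≡ B * ((k + k) + (s + s) + 1ℚ)
          lemma = solve-∀ ℚring
        total : B * ((k (suc x) + k (suc x)) + (∑ R a + ∑ R a) + 1ℚ) ≤ ν 19 * B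
        total = ≤-trans (*-monoʳ 0≤B (+-monoˡ-≤ 1ℚ (+-mono-≤ (+-mono-≤ k≤2 k≤2) (+-mono-≤ ∑a≤7 ∑a≤7))))
          (≤-reflexive (trans (cong (B *_) sum19) (*-comm B (ν 19))))
          where
          sum19 : (2ℚ + 2ℚ) + (ν 7 + ν 7) + 1ℚ ≡ ν 19
          sum19 = sym (trans (ν-+ 18 1) (cong₂ _+_ (trans (ν-+ 4 14) (cong₂ _+_ (trans (ν-+ 2 2) (cong₂ _+_ ν2 ν2)) (ν-+ 7 7))) ι-1))
            where
            ν2 : ν 2 ≡ 2ℚ
            ν2 = trans (ν-suc 1) (cong (_+_ 1ℚ) ι-1)

    module _ (ψ : ℤ → ℤ) (C : ℚ) (small : Small ψ C) where

      open Small.Small small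

      private
        0≤C = ∣∣≤⇒0≤ (value (+ 0))

      -- ∑ Λ(N)ψ(tN)/N = − ψ(t) log x + O(1).
      mertens : ∀ t → ∣ ν L * ι (ψ t) + ∑ R (λ N → Λ N * (w N * ι (ψ (t ℤ.* + N)))) ∣ ≤ ν 7 * C
      mertens t = subst₂ (λ p q → ∣ p ∣ ≤ q) main constant (∣+∣≤ convolution≤ first≤)
        where
        v : ℕ → ℚ
        v N = w N * ι (ψ (t ℤ.* + N))
        inner : ℕ → ℚ
        inner n = ∑ R (λ N → χ (n ∣? N) * v N)
        -- For N = nj the sum is 1/n times a harmonic sum up to ⌊x/n⌋ minus 1/x times a partial sum;
        -- `Small` makes both O(1/x).
        inner≤ : ∀ {n} → n ∈ R → ∣ inner n ∣ ≤ (C + C) * rec x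
        inner≤ {zero}  n∈ = ⊥-elim (ℕₚ.<⇒≱ (proj₁ (∈-range⁻ n∈)) ℕ.z≤n)
        inner≤ {suc n-1} n∈ = subst (λ p → ∣ p ∣ ≤ (C + C) * rec x) (sym expand)
          (≤-trans (∣-∣≤ (∣*∣ˡ≤ (0≤rec n) (harmonic≤ (t ℤ.* + n) Y)) (∣*∣ˡ≤ (0≤rec x) (partial (t ℤ.* + n) Y)))
            (≤-trans (+-monoˡ-≤ (rec x * C) (≤-respˡ (reorder C (rec n) (rec (suc Y))) (*-monoʳ 0≤C (rec-quotient x n (1≤2^ L)))))
              (≤-reflexive (combine C (rec x)))))
          where
          n = suc n-1
          Y = x ℕ./ n
          reorder : ∀ c a b → c * (a * b) ≡ a * (c * b)
          reorder = solve-∀ ℚring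
          combine : ∀ c r → c * r + r * c ≡ (c + c) * r
          combine = solve-∀ ℚring
          expand : inner n ≡ rec n * ∑ (range Y) (λ j → ι (ψ (t ℤ.* + n ℤ.* + j)) * rec j) - rec x * ∑ (range Y) (λ j → ι (ψ (t ℤ.* + n ℤ.* + j)))
          expand = trans (∑-multiples x n v) (trans (∑-cong (range Y) (λ j → pointwise j)) (trans (∑-+ (range Y) _ _)
            (cong₂ _+_ (sym (∑-*ˡ (range Y) (rec n) _)) (trans (∑-neg (range Y) _) (cong -_ (sym (∑-*ˡ (range Y) (rec x) _)))))))
            where
            assoc : ∀ j → t ℤ.* + (n ℕ.* j) ≡ t ℤ.* + n ℤ.* + j
            assoc j = trans (cong (λ z → t ℤ.* z) (ℤₚ.pos-* n j)) (sym (ℤₚ.*-assoc t (+ n) (+ j)))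
            lemma : ∀ a b c p → (a * b - c) * p ≡ a * (p * b) + - (c * p)
            lemma = solve-∀ ℚring
            pointwise : ∀ j → v (n ℕ.* j) ≡ rec n * (ι (ψ (t ℤ.* + n ℤ.* + j)) * rec j) + - (rec x * ι (ψ (t ℤ.* + n ℤ.* + j)))
            pointwise j = trans (cong₂ (λ r z → (r - rec x) * ι (ψ z)) (rec-* n j) (assoc j))
              (lemma (rec n) (rec j) (rec x) (ι (ψ (t ℤ.* + n ℤ.* + j))))
        -- Λ(N), increased by log x at N = 1, is the divisor sum of `u`; interchanging leaves for
        -- each n a sum over the multiples of n.
        convolution : ∑ R (λ N → v N * divisorSum N u) ≡ ∑ R (λ n → u n * inner n)
        convolution = trans (∑-cong R (λ N → ∑-*ˡ R (v N) _)) (trans (∑-swap R R _) (∑-cong R (λ n →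
          trans (∑-cong R (λ N → reorder (v N) (χ (n ∣? N)) (u n))) (sym (∑-*ˡ R (u n) _)))))
          where
          reorder : ∀ v c u → v * (c * u) ≡ u * (c * v)
          reorder = solve-∀ ℚring
        -- The O(x) of `∑∣u∣` meets the O(1/x) of `inner≤`.
        convolution≤ : ∣ ∑ R (λ N → v N * divisorSum N u) ∣ ≤ (ν x + ν x + ν x) * ((C + C) * rec x)
        convolution≤ = ≤-respˡ (sym (cong ∣_∣ convolution)) (≤-trans (∣∑∣≤∑ R {g = λ n → ∣ u n ∣ * ((C + C) * rec x)} (λ {n} n∈ → ∣*∣≤ {u n} {inner n} ≤-refl (inner≤ n∈)))
          (≤-trans (≤-reflexive (sym (∑-*ʳ R ((C + C) * rec x) _))) (*-monoˡ (*-nonNeg (+-nonNeg 0≤C 0≤C) (0≤rec x)) ∑∣u∣)))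
        -- At N = 1 the weight is 1 - 1/x and not 1; the missing (log x)/x is at most 1.
        first≤ : ∣ ν L * rec x * ι (ψ t) ∣ ≤ ν x * rec x * C
        first≤ = ∣*∣≤ (≤-respˡ (sym (0≤p⇒∣p∣≡p (*-nonNeg (0≤ν L) (0≤rec x)))) (*-monoˡ (0≤rec x) (ν-mono-≤ (ℕₚ.≤-trans (ℕₚ.n≤1+n L) (1+i≤2^i L))))) (value t)
        constant : (ν x + ν x + ν x) * ((C + C) * rec x) + ν x * rec x * C ≡ ν 7 * C
        constant = trans (collect (ν x) C (rec x)) (trans (cong (_* (((C + C) + (C + C)) + (C + C) + C)) (ν*rec′ (1≤2^ L)))
          (trans (*-identityˡ (((C + C) + (C + C)) + (C + C) + C)) (sym (trans (cong (_* C) seven) (expand7 C)))))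
          where
          collect : ∀ x c r → (x + x + x) * ((c + c) * r) + x * r * c ≡ (x * r) * (((c + c) + (c + c)) + (c + c) + c)
          collect = solve-∀ ℚring
          seven : ν 7 ≡ ((1ℚ + 1ℚ) + (1ℚ + 1ℚ)) + (1ℚ + 1ℚ) + 1ℚ
          seven = trans (ν-+ 6 1) (cong₂ _+_ (trans (ν-+ 4 2) (cong₂ _+_ (trans (ν-+ 2 2) (cong₂ _+_ ν2 ν2)) ν2)) ι-1)
            where
            ν2 : ν 2 ≡ 1ℚ + 1ℚ
            ν2 = trans (ν-suc 1) (cong (_+_ 1ℚ) ι-1)
          expand7 : ∀ c → (((1ℚ + 1ℚ) + (1ℚ + 1ℚ)) + (1ℚ + 1ℚ) + 1ℚ) * c ≡ ((c + c) + (c + c)) + (c + c) + c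
          expand7 = solve-∀ ℚring
        main : ∑ R (λ N → v N * divisorSum N u) + ν L * rec x * ι (ψ t) ≡ ν L * ι (ψ t) + ∑ R (λ N → Λ N * v N)
        main = begin
          ∑ R (λ N → v N * divisorSum N u) + ν L * rec x * ι (ψ t)
            ≡⟨ cong (_+ ν L * rec x * ι (ψ t)) (trans (∑-cong∈ R (λ {N} N∈ → trans (cong (v N *_) (∑u N (proj₁ (∈-range⁻ N∈)) (proj₂ (∈-range⁻ N∈))))
                 (expand (v N) (ν L) (χ (N ℕ.≟ 1)) (Λ N)))) (trans (∑-+ R _ _) (cong₂ _+_ (sym (∑-*ˡ R (ν L) _)) refl))) ⟩
          ν L * ∑ R (λ N → χ (N ℕ.≟ 1) * v N) + ∑ R (λ N → Λ N * v N) + ν L * rec x * ι (ψ t)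
            ≡⟨ cong (λ s → ν L * s + ∑ R (λ N → Λ N * v N) + ν L * rec x * ι (ψ t))
                 (trans (∑-one (λ N → N ℕ.≟ 1) v (range-unique x) (∈-range⁺ ℕₚ.≤-refl (1≤2^ L)) refl (λ _ e → e))
                   (cong₂ (λ r z → (r - rec x) * ι (ψ z)) rec-1 (ℤₚ.*-identityʳ t))) ⟩
          ν L * ((1ℚ - rec x) * ι (ψ t)) + ∑ R (λ N → Λ N * v N) + ν L * rec x * ι (ψ t)
            ≡⟨ collect (ν L) (rec x) (ι (ψ t)) (∑ R (λ N → Λ N * v N)) ⟩
          ν L * ι (ψ t) + ∑ R (λ N → Λ N * v N) ∎
          where
          open ≡-Reasoning
          expand : ∀ v L c a → v * (L * c + a) ≡ L * (c * v) + a * v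
          expand = solve-∀ ℚring
          collect : ∀ L r p s → L * ((1ℚ - r) * p) + s + L * r * p ≡ L * p + s
          collect = solve-∀ ℚring

-- Sign changes along prime classes and the vanishing of invariant functions

module Nonvanish where

  open import Data.Empty using (⊥; ⊥-elim)
  open import Data.Integer as ℤ using (ℤ; +_)
  import Data.Integer.Properties as ℤₚ
  import Data.Integer.Tactic.RingSolver as ℤSolver
  open import Data.List using (List)
  open import Data.List.Properties using (length-downFrom)
  open import Data.List.Membership.Propositional using (_∈_)
  open import Data.Nat as ℕ using (ℕ; zero; suc; NonZero; _^_)
  open import Data.Nat.Divisibility using (_∣?_)
  import Data.Nat.DivMod as ℕ
  import Data.Nat.Properties as ℕₚ
  open import Data.Product using (∃; _×_; _,_; proj₁; proj₂)
  open import Data.Rational hiding (NonZero; floor)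
  open import Data.Rational.Properties
  open import Data.Sum using (_⊎_; inj₁; inj₂)
  open import Relation.Binary.PropositionalEquality
    using (_≡_; _≢_; refl; sym; trans; cong; cong₂; subst; subst₂; module ≡-Reasoning)
  open import Relation.Nullary using (Dec; yes; no; ¬_)
  open import Tactic.RingSolver using (solve-∀)
  open Rat
  open Ranges
  open Mod
  open Tail
  open Small
  open Divisor
  open LogData
  open Mertens

  argmax : ∀ (f : ℕ → ℕ) n → ∃ λ i → (i ℕ.≤ n) × (∀ j → j ℕ.≤ n → f j ℕ.≤ f i)
  argmax f zero = 0 , ℕ.z≤n , λ { .0 ℕ.z≤n → ℕₚ.≤-refl }
  argmax f (suc n) with argmax f n
  ... | i , i≤n , max with ℕₚ.≤-total (f (suc n)) (f i)
  ...   | inj₁ le = i , ℕₚ.m≤n⇒m≤1+n i≤n , λ j j≤ → case j (ℕₚ.m≤n⇒m<n∨m≡n j≤)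
    where
    case : ∀ j → (j ℕ.< suc n) ⊎ (j ≡ suc n) → f j ℕ.≤ f i
    case j (inj₁ j<)   = max j (ℕ.s≤s⁻¹ j<)
    case j (inj₂ refl) = le
  ...   | inj₂ ge = suc n , ℕₚ.≤-refl , λ j j≤ → case j (ℕₚ.m≤n⇒m<n∨m≡n j≤)
    where
    case : ∀ j → (j ℕ.< suc n) ⊎ (j ≡ suc n) → f j ℕ.≤ f (suc n)
    case j (inj₁ j<)   = ℕₚ.≤-trans (max j (ℕ.s≤s⁻¹ j<)) ge
    case j (inj₂ refl) = ℕₚ.≤-refl

  small-neg : ∀ {ψ C} → Small ψ C → Small (λ z → ℤ.- ψ z) C
  small-neg {ψ} {C} s = record
    { value     = λ z → ≤-respˡ (sym (trans (cong ∣_∣ (ι-neg (ψ z))) (∣-p∣≡∣p∣ (ι (ψ z))))) (value z)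
    ; partial   = λ t n → ≤-respˡ (sym (trans (cong ∣_∣ (trans (∑-cong (range n) (λ k → ι-neg (ψ (t ℤ.* + k)))) (∑-neg (range n) _)))
        (∣-p∣≡∣p∣ (∑ (range n) (λ k → ι (ψ (t ℤ.* + k))))))) (partial t n)
    ; harmonic≤ = λ t n → ≤-respˡ (sym (trans (cong ∣_∣ (trans (∑-cong (range n) (λ k →
        trans (cong (_* rec k) (ι-neg (ψ (t ℤ.* + k)))) (sym (neg-distribˡ-* (ι (ψ (t ℤ.* + k))) (rec k))))) (∑-neg (range n) _)))
        (∣-p∣≡∣p∣ (∑ (range n) (λ k → ι (ψ (t ℤ.* + k)) * rec k))))) (harmonic≤ t n)
    }
    where open Small.Small s

  -- Replacing z by az only replaces t by at, which is why `Small` quantifies over all t.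
  small-translate-+ : ∀ {φ C} a → Small φ C → Small (λ z → φ z ℤ.+ φ (a ℤ.* z)) (C + C)
  small-translate-+ {φ} {C} a s = record
    { value     = λ z → ≤-respˡ (sym (cong ∣_∣ (ι-+ (φ z) (φ (a ℤ.* z))))) (∣+∣≤ (value z) (value (a ℤ.* z)))
    ; partial   = λ t n → ≤-respˡ (sym (cong ∣_∣ (trans (∑-cong (range n) (λ k → split t k)) (∑-+ (range n) _ _))))
        (∣+∣≤ (partial t n) (partial (a ℤ.* t) n))
    ; harmonic≤ = λ t n → subst₂ (λ p q → ∣ p ∣ ≤ q)
        (sym (trans (∑-cong (range n) (λ k → trans (cong (_* rec k) (split t k)) (*-distribʳ-+ (rec k) (ι (φ (t ℤ.* + k))) (ι (φ (a ℤ.* t ℤ.* + k)))))) (∑-+ (range n) _ _)))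
        (sym (*-distribʳ-+ (rec (suc n)) C C))
        (∣+∣≤ (harmonic≤ t n) (harmonic≤ (a ℤ.* t) n))
    }
    where
    open Small.Small s
    split : ∀ t k → ι (φ (t ℤ.* + k) ℤ.+ φ (a ℤ.* (t ℤ.* + k))) ≡ ι (φ (t ℤ.* + k)) + ι (φ (a ℤ.* t ℤ.* + k))
    split t k = trans (ι-+ (φ (t ℤ.* + k)) (φ (a ℤ.* (t ℤ.* + k)))) (cong (λ z → ι (φ (t ℤ.* + k)) + ι (φ z)) (sym (ℤₚ.*-assoc a t (+ k))))

  positive-integer : ∀ {z} → 0ℚ ≤ ι z → z ≢ + 0 → 1ℚ ≤ ι z
  positive-integer {z} 0≤z z≢0 = ≤-respˡ ι-1 (ι-mono-≤ (go z (ι-cancel-≤ (≤-respˡ (sym ι-0) 0≤z)) z≢0))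
    where
    go : ∀ z → + 0 ℤ.≤ z → z ≢ + 0 → + 1 ℤ.≤ z
    go (+ zero)  _ z≢0 = ⊥-elim (z≢0 refl)
    go (+ suc n) _ _   = ℤ.+≤+ (ℕ.s≤s ℕ.z≤n)

  unbounded : ∀ {p} C → 1ℚ ≤ p → (∀ n → ν n * p ≤ C) → ⊥
  unbounded {p} C 1≤p bound with archimedean (C + 1ℚ)
  ... | n , C+1≤n = 1≰0 (≤-respˡ (cancel C) (≤-respʳ (+-inverseʳ C) (+-monoˡ-≤ (- C) (≤-trans C+1≤n
      (≤-respˡ (*-identityʳ (ν n)) (≤-trans (*-monoʳ (0≤ν n) 1≤p) (bound n)))))))
    where
    cancel : ∀ c → c + 1ℚ - c ≡ 1ℚ
    cancel = solve-∀ ℚring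

  neg-unique : ∀ {x y} → x ℤ.+ y ≡ + 0 → ℤ.- x ≡ y
  neg-unique {x} {y} e = trans (sym (trans (cong (λ z → z ℤ.- x) e) (ℤₚ.+-identityˡ (ℤ.- x)))) (lemma x y)
    where
    lemma : ∀ x y → (x ℤ.+ y) ℤ.- x ≡ y
    lemma = ℤSolver.solve-∀

  module PrimeClasses (m : ℕ) .{{m≢0 : NonZero m}} where

    open Modulo m

    module AtLevel (L : ℕ) where

      open Log L using (R; Λ; w; W; W≤L; 0≤Λ∈; 0≤w)

      -- The weight of the prime powers in the class of a. Whether it stays bounded takes the place
      -- of Dirichlet's theorem on primes in this class.
      P : ℤ → ℚ
      P a = ∑ R (λ N → χ (+ N ~? a) * (Λ N * w N))

      0≤Λw : ∀ {N} → N ∈ R → 0ℚ ≤ Λ N * w N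
      0≤Λw N∈ = *-nonNeg (0≤Λ∈ N∈) (0≤w N∈)

      0≤P : ∀ a → 0ℚ ≤ P a
      0≤P a = ∑-nonNeg R (λ {N} N∈ → *-nonNeg (0≤χ (+ N ~? a)) (0≤Λw N∈))

      0≤W : 0ℚ ≤ W
      0≤W = ∑-nonNeg R 0≤Λw

      by-class : ∀ (F : ℤ → ℚ) → Periodic F → ∑ R (λ N → (Λ N * w N) * F (+ N)) ≡ ∑ residues (λ a → P (+ a) * F (+ a))
      by-class F F-cong = begin
        ∑ R (λ N → (Λ N * w N) * F (+ N))
          ≡⟨ ∑-cong R (λ N → trans (cong ((Λ N * w N) *_) (sym (∑-residue F-cong (+ N)))) (∑-*ˡ residues (Λ N * w N) _)) ⟩
        ∑ R (λ N → ∑ residues (λ a → (Λ N * w N) * (χ (+ a ~? + N) * F (+ a))))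
          ≡⟨ ∑-swap R residues _ ⟩
        ∑ residues (λ a → ∑ R (λ N → (Λ N * w N) * (χ (+ a ~? + N) * F (+ a))))
          ≡⟨ ∑-cong residues (λ a → trans (∑-cong R (λ N → trans (cong (λ c → (Λ N * w N) * (c * F (+ a))) (χ-⇔ (+ a ~? + N) (+ N ~? + a) ~-sym ~-sym))
               (reorder (Λ N * w N) (χ (+ N ~? + a)) (F (+ a))))) (sym (∑-*ʳ R (F (+ a)) _))) ⟩
        ∑ residues (λ a → P (+ a) * F (+ a)) ∎
        where
        open ≡-Reasoning
        reorder : ∀ v c f → v * (c * f) ≡ c * v * f
        reorder = solve-∀ ℚring

      private
        reassoc : ∀ (ψ : ℤ → ℤ) t → ∑ R (λ N → Λ N * (w N * ι (ψ (t ℤ.* + N)))) ≡ ∑ R (λ N → (Λ N * w N) * ι (ψ (t ℤ.* + N)))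
        reassoc ψ t = ∑-cong R (λ N → sym (*-assoc (Λ N) (w N) (ι (ψ (t ℤ.* + N)))))

      mertens′ : ∀ ψ C → Small ψ C → ∀ t → ∣ ν L * ι (ψ t) + ∑ R (λ N → (Λ N * w N) * ι (ψ (t ℤ.* + N))) ∣ ≤ ν 7 * C
      mertens′ ψ C s t = subst (λ z → ∣ ν L * ι (ψ t) + z ∣ ≤ ν 7 * C) (reassoc ψ t) (LogSums.mertens L ψ C s t)

      -- Where ψ attains its maximal absolute value, nearly all primes change its sign.
      at-maximum : ∀ ψ C → Small ψ C → Periodic ψ → ∀ t → 0ℚ ≤ ι (ψ t) → (∀ z → - ι (ψ z) ≤ ι (ψ t)) →
        ∀ a → P a * (ι (ψ t) + ι (ψ (t ℤ.* a))) ≤ ν 7 * C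
      at-maximum ψ C s ψ-cong t 0≤ψt max a = begin
        P a * (ι (ψ t) + ι (ψ (t ℤ.* a)))
          ≡⟨ ∑-*ʳ R _ _ ⟩
        ∑ R (λ N → χ (+ N ~? a) * (Λ N * w N) * (ι (ψ t) + ι (ψ (t ℤ.* a))))
          ≡⟨ ∑-cong R (λ N → trans (*-assoc (χ (+ N ~? a)) (Λ N * w N) _) (trans (χ-cong (+ N ~? a) (λ e →
               cong (λ z → (Λ N * w N) * (ι (ψ t) + ι z)) (ψ-cong (~-*ˡ t (~-sym e))))) refl)) ⟩
        ∑ R (λ N → χ (+ N ~? a) * ((Λ N * w N) * (ι (ψ t) + ι (ψ (t ℤ.* + N)))))
          ≤⟨ ∑-mono∈ R (λ {N} N∈ → χ*≤ (+ N ~? a) (*-nonNeg (0≤Λw N∈) (≤-respʳ (neg-neg (ι (ψ t)) (ι (ψ (t ℤ.* + N)))) (p≤q⇒0≤q-p (max (t ℤ.* + N)))))) ⟩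
        ∑ R (λ N → (Λ N * w N) * (ι (ψ t) + ι (ψ (t ℤ.* + N))))
          ≡⟨ trans (∑-cong R (λ N → *-distribˡ-+ (Λ N * w N) (ι (ψ t)) (ι (ψ (t ℤ.* + N))))) (trans (∑-+ R _ _)
               (cong (_+ ∑ R (λ N → (Λ N * w N) * ι (ψ (t ℤ.* + N)))) (sym (∑-*ʳ R (ι (ψ t)) _)))) ⟩
        W * ι (ψ t) + ∑ R (λ N → (Λ N * w N) * ι (ψ (t ℤ.* + N)))
          ≤⟨ +-monoˡ-≤ _ (*-monoˡ 0≤ψt W≤L) ⟩
        ν L * ι (ψ t) + ∑ R (λ N → (Λ N * w N) * ι (ψ (t ℤ.* + N)))
          ≤⟨ ≤-trans (p≤∣p∣ _) (mertens′ ψ C s t) ⟩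
        ν 7 * C ∎
        where
        open ≤-Reasoning
        neg-neg : ∀ a b → a - (- b) ≡ a + b
        neg-neg = solve-∀ ℚring

      private
        sign-change⁺ : ∀ ψ C → Small ψ C → Periodic ψ → ∀ t → 0ℚ ≤ ι (ψ t) → (∀ z → ∣ ι (ψ z) ∣ ≤ ∣ ι (ψ t) ∣) →
          ∀ a → ¬ (P a ≤ ν 7 * C) → ψ (t ℤ.* a) ≡ ℤ.- ψ t
        sign-change⁺ ψ C s ψ-cong t 0≤ψt max a heavy with ψ t ℤ.+ ψ (t ℤ.* a) ℤ.≟ + 0
        ... | yes eq = sym (neg-unique eq)
        ... | no neq = ⊥-elim (heavy (≤-respˡ (*-identityʳ (P a)) (≤-trans (*-monoʳ (0≤P a) (≤-respʳ (ι-+ (ψ t) (ψ (t ℤ.* a)))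
            (positive-integer (≤-respʳ (trans (neg-neg (ι (ψ t)) (ι (ψ (t ℤ.* a)))) (sym (ι-+ (ψ t) (ψ (t ℤ.* a))))) (p≤q⇒0≤q-p (max′ (t ℤ.* a)))) neq)))
            (at-maximum ψ C s ψ-cong t 0≤ψt max′ a))))
          where
          max′ : ∀ z → - ι (ψ z) ≤ ι (ψ t)
          max′ z = ≤-trans (-p≤∣p∣ (ι (ψ z))) (≤-respʳ (0≤p⇒∣p∣≡p 0≤ψt) (max z))
          neg-neg : ∀ a b → a - (- b) ≡ a + b
          neg-neg = solve-∀ ℚring

      -- At a nonnegative value of maximal size, ψ(t) + ψ(ta) is a nonnegative integer; were it at
      -- least 1, `at-maximum` would bound P(a). A negative extremal value is treated by passing to
      -- -ψ.
      sign-change : ∀ ψ C → Small ψ C → Periodic ψ → ∀ t → (∀ z → ∣ ι (ψ z) ∣ ≤ ∣ ι (ψ t) ∣) →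
        ∀ a → ¬ (P a ≤ ν 7 * C) → ψ (t ℤ.* a) ≡ ℤ.- ψ t
      sign-change ψ C s ψ-cong t max a heavy with ≤-total 0ℚ (ι (ψ t))
      ... | inj₁ 0≤ψt = sign-change⁺ ψ C s ψ-cong t 0≤ψt max a heavy
      ... | inj₂ ψt≤0 = ℤₚ.neg-injective (sign-change⁺ (λ z → ℤ.- ψ z) C (small-neg s) (λ e → cong ℤ.-_ (ψ-cong e)) t
            (≤-respʳ (sym (ι-neg (ψ t))) (neg-antimono-≤ ψt≤0))
            (λ z → subst₂ _≤_ (sym (∣ι-neg∣ z)) (sym (∣ι-neg∣ t)) (max z)) a heavy)
        where
        ∣ι-neg∣ : ∀ z → ∣ ι (ℤ.- ψ z) ∣ ≡ ∣ ι (ψ z) ∣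
        ∣ι-neg∣ z = trans (cong ∣_∣ (ι-neg (ψ z))) (∣-p∣≡∣p∣ (ι (ψ z)))

      -- φ(az) + φ(z) is again small. If it did not vanish, then φ would be unbounded along a maximal orbit of it.
      dichotomy : ∀ φ C → Small φ C → Periodic φ → ∀ a → (P a ≤ ν 7 * (C + C)) ⊎ (∀ z → φ (a ℤ.* z) ≡ ℤ.- φ z)
      dichotomy φ C s φ-cong a with P a ≤? ν 7 * (C + C)
      ... | yes light = inj₁ light
      ... | no heavy = inj₂ (λ z → sym (neg-unique (ψ≡0 z)))
        where
        ψ : ℤ → ℤ
        ψ z = φ z ℤ.+ φ (a ℤ.* z)
        ψ-small = small-translate-+ {φ} a s
        ψ-cong : Periodic ψ
        ψ-cong e = cong₂ ℤ._+_ (φ-cong e) (φ-cong (~-*ˡ a e))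
        maximum = argmax (λ n → ℤ.∣ ψ (+ n) ∣) m
        t = + proj₁ maximum
        max : ∀ z → ℤ.∣ ψ z ∣ ℕ.≤ ℤ.∣ ψ t ∣
        max z = subst (λ x → ℤ.∣ x ∣ ℕ.≤ ℤ.∣ ψ t ∣) (ψ-cong (~-sym (~⌊⌋ z)))
          (proj₂ (proj₂ maximum) ⌊ z ⌋ (ℕₚ.<⇒≤ (⌊⌋<m z)))
        IsMax : ℤ → Set
        IsMax s = ∀ z → ∣ ι (ψ z) ∣ ≤ ∣ ι (ψ s) ∣
        max-t : IsMax t
        max-t z = subst₂ _≤_ (sym (∣ι∣ (ψ z))) (sym (∣ι∣ (ψ t))) (ν-mono-≤ (max z))
        flip : ∀ s → IsMax s → ψ (a ℤ.* s) ≡ ℤ.- ψ s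
        flip s max-s = trans (cong ψ (ℤₚ.*-comm a s)) (sign-change ψ (C + C) ψ-small ψ-cong s max-s a heavy)
        flip-max : ∀ s → IsMax s → IsMax (a ℤ.* s)
        flip-max s max-s z = ≤-respʳ (sym (trans (cong (λ x → ∣ ι x ∣) (flip s max-s)) (trans (cong ∣_∣ (ι-neg (ψ s))) (∣-p∣≡∣p∣ (ι (ψ s)))))) (max-s z)
        -- By definition of ψ, φ(a²s) = φ(s) - ψ(s) + ψ(as). Since ψ(as) = -ψ(s) at a maximal point,
        -- and as is maximal again, every double step changes φ by -2ψ(t).
        orbit : ℕ → ℤ
        orbit zero    = t
        orbit (suc k) = a ℤ.* (a ℤ.* orbit k)
        orbit-max : ∀ k → IsMax (orbit k) × (ψ (orbit k) ≡ ψ t)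
        orbit-max zero    = max-t , refl
        orbit-max (suc k) with orbit-max k
        ... | max-k , eq = flip-max (a ℤ.* orbit k) (flip-max (orbit k) max-k) ,
          trans (flip (a ℤ.* orbit k) (flip-max (orbit k) max-k)) (trans (cong ℤ.-_ (flip (orbit k) max-k)) (trans (ℤₚ.neg-involutive (ψ (orbit k))) eq))
        φ-orbit : ∀ k → ι (φ (orbit k)) ≡ ι (φ t) - ν k * (ι (ψ t) + ι (ψ t))
        φ-orbit zero = sym (trans (cong (λ x → ι (φ t) - x) (zero-*ˡ (ι (ψ t) + ι (ψ t)) ι-0)) (+-identityʳ (ι (φ t))))
        φ-orbit (suc k) = begin
          ι (φ (a ℤ.* (a ℤ.* oₖ)))
            ≡⟨ cong ι (step (φ oₖ) (φ (a ℤ.* oₖ)) (φ (a ℤ.* (a ℤ.* oₖ)))) ⟩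
          ι (φ oₖ ℤ.- ψ oₖ ℤ.+ ψ (a ℤ.* oₖ))
            ≡⟨ cong (λ x → ι (φ oₖ ℤ.- ψ oₖ ℤ.+ x)) (flip oₖ (proj₁ (orbit-max k))) ⟩
          ι (φ oₖ ℤ.- ψ oₖ ℤ.- ψ oₖ)
            ≡⟨ cong (λ x → ι (φ oₖ ℤ.- x ℤ.- x)) (proj₂ (orbit-max k)) ⟩
          ι (φ oₖ ℤ.- ψ t ℤ.- ψ t)
            ≡⟨ trans (ι-+ _ _) (cong₂ _+_ (trans (ι-+ _ _) (cong (_+_ (ι (φ oₖ))) (ι-neg (ψ t)))) (ι-neg (ψ t))) ⟩
          ι (φ oₖ) - ι (ψ t) - ι (ψ t)
            ≡⟨ cong (λ x → x - ι (ψ t) - ι (ψ t)) (φ-orbit k) ⟩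
          ι (φ t) - ν k * (ι (ψ t) + ι (ψ t)) - ι (ψ t) - ι (ψ t)
            ≡⟨ collect (ι (φ t)) (ν k) (ι (ψ t)) ⟩
          ι (φ t) - (1ℚ + ν k) * (ι (ψ t) + ι (ψ t))
            ≡⟨ cong (λ x → ι (φ t) - x * (ι (ψ t) + ι (ψ t))) (sym (ν-suc k)) ⟩
          ι (φ t) - ν (suc k) * (ι (ψ t) + ι (ψ t)) ∎
          where
          open ≡-Reasoning
          oₖ = orbit k
          step : ∀ x y z → z ≡ x ℤ.- (x ℤ.+ y) ℤ.+ (y ℤ.+ z)
          step = ℤSolver.solve-∀
          collect : ∀ f k p → f - k * (p + p) - p - p ≡ f - (1ℚ + k) * (p + p)
          collect = solve-∀ ℚring
        ψt≡0 : ψ t ≡ + 0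
        ψt≡0 with ψ t ℤ.≟ + 0
        ... | yes e = e
        ... | no ψt≢0 = ⊥-elim (unbounded (C + C) 1≤ bound)
          where
          open Small.Small s
          1≤∣ψt∣ : 1ℚ ≤ ∣ ι (ψ t) ∣
          1≤∣ψt∣ = ≤-respʳ (sym (∣ι∣ (ψ t))) (≤-respˡ ι-1 (ν-mono-≤ (ℕₚ.n≢0⇒n>0 (λ e → ψt≢0 (ℤₚ.∣i∣≡0⇒i≡0 e)))))
          1≤ : 1ℚ ≤ ∣ ι (ψ t) ∣ + ∣ ι (ψ t) ∣
          1≤ = ≤-trans 1≤∣ψt∣ (p≤p+q (0≤∣p∣ (ι (ψ t))))
          bound : ∀ n → ν n * (∣ ι (ψ t) ∣ + ∣ ι (ψ t) ∣) ≤ C + C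
          bound n = ≤-respˡ (trans (cong ∣_∣ (trans (cong (λ x → ι (φ t) - x) (φ-orbit n)) (cancel (ι (φ t)) (ν n * (ι (ψ t) + ι (ψ t))))))
              (trans (∣*∣ˡ (ι (ψ t) + ι (ψ t)) (0≤ν n)) (cong (ν n *_) (double (ι (ψ t))))))
            (∣-∣≤ (value t) (value (orbit n)))
            where
            cancel : ∀ a b → a - (a - b) ≡ b
            cancel = solve-∀ ℚring
            double : ∀ p → ∣ p + p ∣ ≡ ∣ p ∣ + ∣ p ∣
            double p = trans (cong ∣_∣ (two p)) (trans (∣*∣ˡ p 0≤2) (sym (two ∣ p ∣)))
              where
              two : ∀ e → e + e ≡ (1ℚ + 1ℚ) * e
              two = solve-∀ ℚring
        ψ≡0 : ∀ z → ψ z ≡ + 0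
        ψ≡0 z = ℤₚ.∣i∣≡0⇒i≡0 (ℕₚ.n≤0⇒n≡0 (subst (ℤ.∣ ψ z ∣ ℕ.≤_) (cong ℤ.∣_∣ ψt≡0) (max z)))

      -- The total weight of the prime powers is log x + O(1).
      W-lower : ∀ φ C → Small φ C → Periodic φ → ∀ {z} → φ z ≢ + 0 → ν L ≤ W + ν 7 * C
      W-lower φ C s φ-cong {z} φz≢0 = ≤-from-diff (ν 7 * C - (ν L - W)) (rearrange W (ν 7 * C) (ν L)) (p≤q⇒0≤q-p (begin
        ν L - W
          ≡⟨ sym (*-identityʳ (ν L - W)) ⟩
        (ν L - W) * 1ℚ
          -- The maximum M is at least 1 because φ is integer-valued and not identically 0.
          ≤⟨ *-monoʳ (p≤q⇒0≤q-p W≤L) 1≤M ⟩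
        (ν L - W) * M
          ≡⟨ expand (ν L) W M ⟩
        ν L * M - W * M
          ≤⟨ +-monoʳ-≤ (ν L * M) (neg-antimono-≤ ∑≤) ⟩
        ν L * M - ∣ T ∣
          ≡⟨ cong (_- ∣ T ∣) (sym (∣*∣ˡ (ι (φ t)) (0≤ν L))) ⟩
        ∣ ν L * ι (φ t) ∣ - ∣ T ∣
          ≤⟨ triangle (ν L * ι (φ t)) T ⟩
        ∣ ν L * ι (φ t) + T ∣
          ≤⟨ mertens′ φ C s t ⟩
        ν 7 * C ∎))
        where
        open ≤-Reasoning
        rearrange : ∀ w c l → (w + c) - l ≡ c - (l - w)
        rearrange = solve-∀ ℚring
        expand : ∀ l w m → (l - w) * m ≡ l * m - w * m
        expand = solve-∀ ℚring
        maximum = argmax (λ n → ℤ.∣ φ (+ n) ∣) m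
        t = + proj₁ maximum
        max : ∀ z → ℤ.∣ φ z ∣ ℕ.≤ ℤ.∣ φ t ∣
        max z = subst (λ x → ℤ.∣ x ∣ ℕ.≤ ℤ.∣ φ t ∣) (φ-cong (~-sym (~⌊⌋ z)))
          (proj₂ (proj₂ maximum) ⌊ z ⌋ (ℕₚ.<⇒≤ (⌊⌋<m z)))
        M = ∣ ι (φ t) ∣
        1≤M : 1ℚ ≤ M
        1≤M = ≤-respʳ (sym (∣ι∣ (φ t))) (≤-respˡ ι-1 (ν-mono-≤ (ℕₚ.≤-trans (ℕₚ.n≢0⇒n>0 (λ e → φz≢0 (ℤₚ.∣i∣≡0⇒i≡0 e))) (max z))))
        T = ∑ R (λ N → (Λ N * w N) * ι (φ (t ℤ.* + N)))
        ∑≤ : ∣ T ∣ ≤ W * M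
        ∑≤ = ≤-respʳ (sym (∑-*ʳ R M _)) (∣∑∣≤∑ R (λ {N} N∈ → ∣*∣ˡ≤ (0≤Λw N∈) (subst₂ _≤_ (sym (∣ι∣ (φ (t ℤ.* + N)))) (sym (∣ι∣ (φ t))) (ν-mono-≤ (max (t ℤ.* + N))))))
        triangle : ∀ p q → ∣ p ∣ - ∣ q ∣ ≤ ∣ p + q ∣
        triangle p q = ≤-from-diff ((∣ p + q ∣ + ∣ q ∣) - ∣ p ∣) (shuffle (∣ p + q ∣) (∣ p ∣) (∣ q ∣))
          (p≤q⇒0≤q-p (≤-respˡ (cong ∣_∣ (cancel p q)) (∣-∣≤ {p + q} {q} ≤-refl ≤-refl)))
          where
          shuffle : ∀ a b c → a - (b - c) ≡ a + c - b
          shuffle = solve-∀ ℚring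
          cancel : ∀ p q → p + q - q ≡ p
          cancel = solve-∀ ℚring

    -- The sums E(t) = ∑ ψ(tk)/k inherit the invariance of ψ under heavy classes. Hence W·E(t) is
    -- close to ∑ Λ(N)w(N)E(tN), and this is bounded since it is ∑ ψ(tn)(log n)/n up to O(1). As W
    -- grows like log x, E(t) tends to 0, so ψ is small and `mertens` becomes available for ψ
    -- itself.
    module Mean (ψ : ℤ → ℤ) (B : ℚ) (ψ-cong : Periodic ψ) (ψ≤B : ∀ z → ∣ ι (ψ z) ∣ ≤ B)
      (ψ-partial : ∀ t n → ∣ ∑ (range n) (λ k → ι (ψ (t ℤ.* + k))) ∣ ≤ B)
      (C₁ C₂ : ℚ) (0≤C₁ : 0ℚ ≤ C₁)
      (W-lower′ : ∀ L → ν L ≤ Log.W L + C₂)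
      (invariant : ∀ L a → (AtLevel.P L a ≤ C₁) ⊎ (∀ z → ψ (a ℤ.* z) ≡ ψ z)) where

      E : ℤ → ℕ → ℚ
      E t n = ∑ (range n) (λ k → ι (ψ (t ℤ.* + k)) * rec k)

      private
        0≤B = ∣∣≤⇒0≤ (ψ≤B (+ 0))
        2B = 2ℚ * B
        0≤2B = *-nonNeg 0≤2 0≤B

        E-tail : ∀ t {n n′} → n ℕ.≤ n′ → ∣ E t n′ - E t n ∣ ≤ 2B * rec (suc n)
        E-tail t = Abel.tail (λ k → ι (ψ (t ℤ.* + k))) B (ψ-partial t)

        E≤2B : ∀ t n → ∣ E t n ∣ ≤ 2B
        E≤2B t n = subst₂ (λ p q → ∣ p ∣ ≤ q)
          (trans (cong (λ x → E t n - x) (∑-[] (λ k → ι (ψ (t ℤ.* + k)) * rec k))) (+-identityʳ (E t n)))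
          (trans (cong (2B *_) rec-1) (*-identityʳ 2B)) (E-tail t {0} {n} ℕ.z≤n)

        E-cong : ∀ n {t t′} → t ~ t′ → E t n ≡ E t′ n
        E-cong n e = ∑-cong (range n) (λ k → cong (λ z → ι z * rec k) (ψ-cong (~-*ʳ (+ k) e)))

        C₃ = (ν 19 * B + 2B * ν 8) + 2B * ν 8
        C₄ = ν m * (C₁ * (2B + 2B))

        module Level (L : ℕ) where

          open Log L using (x; R; Λ; w; W; W≤L; 0≤Λ∈; 0≤w; chebyshev; l; ∑Λ)
          open AtLevel L

          D : ℤ → ℤ → ℚ
          D t a = E (t ℤ.* a) x - E t x

          -- Classes that leave ψ invariant contribute 0 by the condition on G; each of the
          -- remaining classes, at most m in number, has weight at most C₁.
          deviation : ∀ (G : ℤ → ℚ) K → 0ℚ ≤ K → Periodic G → (∀ z → ∣ G z ∣ ≤ K) →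
            (∀ a → (∀ z → ψ (a ℤ.* z) ≡ ψ z) → G a ≡ 0ℚ) →
            ∣ ∑ R (λ N → (Λ N * w N) * G (+ N)) ∣ ≤ ν m * (C₁ * K)
          deviation G K 0≤K G-cong G≤K G-zero = subst (λ p → ∣ p ∣ ≤ ν m * (C₁ * K)) (sym (by-class G G-cong))
            (≤-trans (∣∑∣≤∑ residues {g = λ _ → C₁ * K} (λ {a} _ → go (+ a) (invariant L (+ a))))
              (≤-reflexive (trans (∑-const residues (C₁ * K)) (cong (λ k → ν k * (C₁ * K)) (length-downFrom m)))))
            where
            go : ∀ a → (P a ≤ C₁) ⊎ (∀ z → ψ (a ℤ.* z) ≡ ψ z) → ∣ P a * G a ∣ ≤ C₁ * K
            go a (inj₁ light) = ∣*∣≤ (≤-respˡ (sym (0≤p⇒∣p∣≡p (0≤P a))) light) (G≤K a)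
            go a (inj₂ inv)   = ≤-respˡ (sym (cong ∣_∣ (zero-*ʳ (P a) (G-zero a inv)))) (*-nonNeg 0≤C₁ 0≤K)

          ∑Λ≤8x : ∑ R Λ * rec x ≤ ν 8
          ∑Λ≤8x = ≤-trans (*-monoˡ (0≤rec x) (chebyshev L ℕₚ.≤-refl)) (≤-reflexive (trans (cong (_* rec x) (ν-* 8 x))
            (trans (*-assoc (ν 8) (ν x) (rec x)) (trans (cong (ν 8 *_) (ν*rec′ (1≤2^ L))) (*-identityʳ (ν 8))))))

          logs : ∀ t → ∑ R (λ n → ι (ψ (t ℤ.* + n)) * (l n * rec n)) ≡ ∑ R (λ N → Λ N * ∑ R (λ n → χ (N ∣? n) * (ι (ψ (t ℤ.* + n)) * rec n)))
          logs t = trans (∑-cong∈ R (λ {n} n∈ → trans (cong (λ y → ι (ψ (t ℤ.* + n)) * (y * rec n))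
              (sym (∑Λ n (proj₁ (∈-range⁻ n∈)) (proj₂ (∈-range⁻ n∈)))))
              (trans (lemma (ι (ψ (t ℤ.* + n))) (∑ R (λ N → χ (N ∣? n) * Λ N)) (rec n)) (∑-*ʳ R (ι (ψ (t ℤ.* + n)) * rec n) _))))
            (trans (∑-swap R R _) (∑-cong R (λ N → trans (∑-cong R (λ n → reorder (χ (N ∣? n)) (Λ N) (ι (ψ (t ℤ.* + n)) * rec n)))
              (sym (∑-*ˡ R (Λ N) _)))))
            where
            lemma : ∀ p s r → p * (s * r) ≡ s * (p * r)
            lemma = solve-∀ ℚring
            reorder : ∀ c a v → c * a * v ≡ a * (c * v)
            reorder = solve-∀ ℚring

          multiples : ∀ t N → N ∈ R → ∣ ∑ R (λ n → χ (N ∣? n) * (ι (ψ (t ℤ.* + n)) * rec n)) - rec N * E (t ℤ.* + N) x ∣ ≤ 2B * rec x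
          multiples t zero    N∈ = ⊥-elim (ℕₚ.<⇒≱ (proj₁ (∈-range⁻ N∈)) ℕ.z≤n)
          multiples t N@(suc _) N∈ = subst (λ p → ∣ p ∣ ≤ 2B * rec x) (sym eq)
            (≤-trans (∣*∣ˡ≤ (0≤rec N) (≤-respˡ (trans (sym (∣-p∣≡∣p∣ (E (t ℤ.* + N) x - E (t ℤ.* + N) Y))) (cong ∣_∣ (flip (E (t ℤ.* + N) x) (E (t ℤ.* + N) Y))))
                (E-tail (t ℤ.* + N) {Y} {x} (ℕ.m/n≤m x N))))
              (≤-respˡ (reorder 2B (rec N) (rec (suc Y))) (*-monoʳ 0≤2B (rec-quotient x N (1≤2^ L)))))
            where
            Y = x ℕ./ N
            flip : ∀ a b → - (a - b) ≡ b - a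
            flip = solve-∀ ℚring
            reorder : ∀ c a b → c * (a * b) ≡ a * (c * b)
            reorder = solve-∀ ℚring
            factor : ∀ r a b → r * a - r * b ≡ r * (a - b)
            factor = solve-∀ ℚring
            swap : ∀ p r s → p * (r * s) ≡ r * (p * s)
            swap = solve-∀ ℚring
            eq : ∑ R (λ n → χ (N ∣? n) * (ι (ψ (t ℤ.* + n)) * rec n)) - rec N * E (t ℤ.* + N) x ≡ rec N * (E (t ℤ.* + N) Y - E (t ℤ.* + N) x)
            eq = trans (cong (_- rec N * E (t ℤ.* + N) x) (trans (∑-multiples x N (λ n → ι (ψ (t ℤ.* + n)) * rec n))
              (trans (∑-cong (range Y) (λ k → trans (cong₂ (λ z r → ι (ψ z) * r)
                  (trans (cong (λ z → t ℤ.* z) (ℤₚ.pos-* N k)) (sym (ℤₚ.*-assoc t (+ N) (+ k)))) (rec-* N k))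
                (swap (ι (ψ (t ℤ.* + N ℤ.* + k))) (rec N) (rec k)))) (sym (∑-*ˡ (range Y) (rec N) _)))))
              (factor (rec N) (E (t ℤ.* + N) Y) (E (t ℤ.* + N) x))

          -- Writing log n as the sum of Λ(N) over N ∣ n turns ∑ ψ(tn)(log n)/n into ∑ Λ(N)/N times
          -- the sums E(tN) cut off at x/N. Moving the cutoff to x and replacing 1/N by w(N) cost
          -- O(1) each, by Chebyshev's bound ∑ Λ(N) ≤ 8x.
          weighted : ∀ t → ∣ ∑ R (λ N → (Λ N * w N) * E (t ℤ.* + N) x) ∣ ≤ C₃
          weighted t = subst (λ p → ∣ p ∣ ≤ C₃) total (∣-∣≤ (∣-∣≤ (LogSums.log-sum-bound L (λ n → ι (ψ (t ℤ.* + n))) B (ψ-partial t) (λ n → ψ≤B (t ℤ.* + n))) first) second)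
            where
            V : ℕ → ℚ
            V N = ∑ R (λ n → χ (N ∣? n) * (ι (ψ (t ℤ.* + n)) * rec n))
            first : ∣ ∑ R (λ N → Λ N * (V N - rec N * E (t ℤ.* + N) x)) ∣ ≤ 2B * ν 8
            first = ≤-trans (∣∑∣≤∑ R {g = λ N → Λ N * (2B * rec x)} (λ {N} N∈ → ∣*∣ˡ≤ (0≤Λ∈ N∈) (multiples t N N∈)))
              (≤-trans (≤-reflexive (trans (sym (∑-*ʳ R (2B * rec x) Λ)) (reorder (∑ R Λ) 2B (rec x)))) (*-monoʳ 0≤2B ∑Λ≤8x))
              where
              reorder : ∀ s b r → s * (b * r) ≡ b * (s * r)
              reorder = solve-∀ ℚring
            second : ∣ ∑ R (λ N → Λ N * (rec x * E (t ℤ.* + N) x)) ∣ ≤ 2B * ν 8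
            second = ≤-trans (∣∑∣≤∑ R {g = λ N → Λ N * (rec x * 2B)} (λ {N} N∈ → ∣*∣ˡ≤ (0≤Λ∈ N∈) (∣*∣ˡ≤ (0≤rec x) (E≤2B (t ℤ.* + N) x))))
              (≤-trans (≤-reflexive (trans (sym (∑-*ʳ R (rec x * 2B) Λ)) (reorder (∑ R Λ) 2B (rec x)))) (*-monoʳ 0≤2B ∑Λ≤8x))
              where
              reorder : ∀ s b r → s * (r * b) ≡ b * (s * r)
              reorder = solve-∀ ℚring
            total : (∑ R (λ n → ι (ψ (t ℤ.* + n)) * (l n * rec n)) - ∑ R (λ N → Λ N * (V N - rec N * E (t ℤ.* + N) x)))
                - ∑ R (λ N → Λ N * (rec x * E (t ℤ.* + N) x)) ≡ ∑ R (λ N → (Λ N * w N) * E (t ℤ.* + N) x)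
            total = trans (cong₂ _+_ (trans (cong₂ _+_ (logs t) (sym (∑-neg R _))) (sym (∑-+ R _ _))) (sym (∑-neg R _)))
              (trans (sym (∑-+ R _ _)) (∑-cong R (λ N → lemma (Λ N) (V N) (rec N) (rec x) (E (t ℤ.* + N) x))))
              where
              lemma : ∀ a v r s e → (a * v + - (a * (v - r * e))) + - (a * (s * e)) ≡ (a * (r - s)) * e
              lemma = solve-∀ ℚring

          -- Replacing E(tN) by E(t) in `weighted` costs no more than a `deviation`.
          W*E : ∀ t → ∣ W * E t x ∣ ≤ C₃ + C₄
          W*E t = subst (λ p → ∣ p ∣ ≤ C₃ + C₄) total (∣-∣≤ (weighted t) (deviation (D t) (2B + 2B) (+-nonNeg 0≤2B 0≤2B)
              (λ e → cong (_- E t x) (E-cong x (~-*ˡ t e))) (λ z → ∣-∣≤ (E≤2B (t ℤ.* z) x) (E≤2B t x)) D-zero))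
            where
            D-zero : ∀ a → (∀ z → ψ (a ℤ.* z) ≡ ψ z) → D t a ≡ 0ℚ
            D-zero a inv = trans (cong (_- E t x) (∑-cong (range x) (λ k → cong (λ z → ι z * rec k)
              (trans (cong ψ (lemma t a (+ k))) (inv (t ℤ.* + k)))))) (+-inverseʳ (E t x))
              where
              lemma : ∀ t a k → t ℤ.* a ℤ.* k ≡ a ℤ.* (t ℤ.* k)
              lemma = ℤSolver.solve-∀
            total : ∑ R (λ N → (Λ N * w N) * E (t ℤ.* + N) x) - ∑ R (λ N → (Λ N * w N) * D t (+ N)) ≡ W * E t x
            total = trans (cong (_+_ (∑ R (λ N → (Λ N * w N) * E (t ℤ.* + N) x))) (sym (∑-neg R _))) (trans (sym (∑-+ R _ _))
              (trans (∑-cong R (λ N → lemma (Λ N * w N) (E (t ℤ.* + N) x) (E t x))) (sym (∑-*ʳ R (E t x) _))))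
              where
              lemma : ∀ v a b → v * a + - (v * (a - b)) ≡ v * b
              lemma = solve-∀ ℚring

        c₂ = proj₁ (archimedean C₂)

        E-small : ∀ t i → ∣ E t (2 ^ (suc i ℕ.+ c₂)) ∣ ≤ (C₃ + C₄) * rec (suc i)
        E-small t i = ≤-scale i (begin
          ν (suc i) * ∣ e ∣            ≤⟨ *-monoˡ (0≤∣p∣ e) suc-i≤W ⟩
          Log.W L * ∣ e ∣              ≡⟨ sym (∣*∣ˡ e (AtLevel.0≤W L)) ⟩
          ∣ Log.W L * e ∣              ≤⟨ Level.W*E L t ⟩
          C₃ + C₄                      ≡⟨ sym (trans (reorder (ν (suc i)) (C₃ + C₄) (rec (suc i))) (trans (cong ((C₃ + C₄) *_) (ν*rec i)) (*-identityʳ (C₃ + C₄)))) ⟩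
          ν (suc i) * ((C₃ + C₄) * rec (suc i)) ∎)
          where
          open ≤-Reasoning
          -- Since W ≥ L - C₂ and c₂ ≥ C₂, this shift ensures W ≥ i + 1.
          L = suc i ℕ.+ c₂
          e = E t (2 ^ L)
          reorder : ∀ a b c → a * (b * c) ≡ b * (a * c)
          reorder = solve-∀ ℚring
          suc-i≤W : ν (suc i) ≤ Log.W L
          suc-i≤W = ≤-from-diff ((Log.W L + ν c₂) - (ν (suc i) + ν c₂)) (shuffle (Log.W L) (ν (suc i)) (ν c₂))
            (p≤q⇒0≤q-p (≤-respˡ (ν-+ (suc i) c₂) (≤-trans (W-lower′ L) (+-monoʳ-≤ (Log.W L) (proj₂ (archimedean C₂))))))
            where
            shuffle : ∀ w a c → w - a ≡ (w + c) - (a + c)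
            shuffle = solve-∀ ℚring

        ψ-small : Small ψ 2B
        ψ-small = record
          { value     = λ z → ≤-trans (ψ≤B z) B≤2B
          ; partial   = λ t n → ≤-trans (ψ-partial t n) B≤2B
          ; harmonic≤ = λ t → Abel.tail-zero (λ k → ι (ψ (t ℤ.* + k))) B (ψ-partial t) (C₃ + C₄) 0 (λ i → 2 ^ (suc i ℕ.+ c₂))
              (λ i → ℕₚ.≤-trans (ℕₚ.m≤n⇒m≤1+n (ℕₚ.≤-trans (ℕₚ.m≤m+n i c₂) (ℕₚ.n≤1+n (i ℕ.+ c₂)))) (1+i≤2^i (suc i ℕ.+ c₂)))
              (λ i _ → E-small t i)
          }
          where
          B≤2B : B ≤ 2B
          B≤2B = ≤-respʳ (lemma B) (p≤p+q 0≤B)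
            where
            lemma : ∀ x → x + x ≡ (1ℚ + 1ℚ) * x
            lemma = solve-∀ ℚring

      -- Invariance under nearly all primes contradicts the sign changes forced by mertens.
      vanishes : ∀ t → ψ t ≡ + 0
      vanishes t with ψ t ℤ.≟ + 0
      ... | yes e = e
      ... | no ψt≢0 = ⊥-elim (unbounded (ν 7 * 2B + ν m * (C₁ * (B + B))) 1≤∣ψt∣ bound)
        where
        1≤∣ψt∣ : 1ℚ ≤ ∣ ι (ψ t) ∣
        1≤∣ψt∣ = ≤-respʳ (sym (∣ι∣ (ψ t))) (≤-respˡ ι-1 (ν-mono-≤ (ℕₚ.n≢0⇒n>0 (λ e → ψt≢0 (ℤₚ.∣i∣≡0⇒i≡0 e)))))
        bound : ∀ L → ν L * ∣ ι (ψ t) ∣ ≤ ν 7 * 2B + ν m * (C₁ * (B + B))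
        bound L = begin
          -- The weighted sum of ψ(tN) is about -Lψ(t) by `mertens` and about Wψ(t) by invariance,
          -- so (L + W)ψ(t) is bounded independently of L.
          ν L * ∣ ι (ψ t) ∣
            ≤⟨ *-monoˡ (0≤∣p∣ (ι (ψ t))) (p≤p+q {ν L} 0≤W) ⟩
          (ν L + W) * ∣ ι (ψ t) ∣
            ≡⟨ sym (∣*∣ˡ (ι (ψ t)) (+-nonNeg (0≤ν L) 0≤W)) ⟩
          ∣ (ν L + W) * ι (ψ t) ∣
            ≡⟨ cong ∣_∣ (sym total) ⟩
          ∣ (ν L * ι (ψ t) + ∑ R (λ N → (Λ N * w N) * ι (ψ (t ℤ.* + N)))) - ∑ R (λ N → (Λ N * w N) * G (+ N)) ∣
            ≤⟨ ∣-∣≤ (mertens′ ψ 2B ψ-small t) (Level.deviation L G (B + B) (+-nonNeg 0≤B 0≤B)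
                 (λ e → cong (λ z → ι z - ι (ψ t)) (ψ-cong (~-*ˡ t e))) (λ z → ∣-∣≤ (ψ≤B (t ℤ.* z)) (ψ≤B t))
                 (λ a inv → trans (cong (λ z → ι z - ι (ψ t)) (trans (cong ψ (ℤₚ.*-comm t a)) (inv t))) (+-inverseʳ (ι (ψ t))))) ⟩
          ν 7 * 2B + ν m * (C₁ * (B + B)) ∎
          where
          open ≤-Reasoning
          open Log L using (R; Λ; w; W)
          open AtLevel L
          G : ℤ → ℚ
          G z = ι (ψ (t ℤ.* z)) - ι (ψ t)
          total : (ν L * ι (ψ t) + ∑ R (λ N → (Λ N * w N) * ι (ψ (t ℤ.* + N)))) - ∑ R (λ N → (Λ N * w N) * G (+ N)) ≡ (ν L + W) * ι (ψ t)
          total = trans (+-assoc (ν L * ι (ψ t)) _ _) (trans (cong (_+_ (ν L * ι (ψ t))) (trans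
              (cong (_+_ (∑ R (λ N → (Λ N * w N) * ι (ψ (t ℤ.* + N))))) (sym (∑-neg R _))) (trans (sym (∑-+ R _ _))
              (trans (∑-cong R (λ N → lemma (Λ N * w N) (ι (ψ (t ℤ.* + N))) (ι (ψ t)))) (sym (∑-*ʳ R (ι (ψ t)) _))))))
            (sym (*-distribʳ-+ (ι (ψ t)) (ν L) W)))
            where
            lemma : ∀ v a b → v * a + - (v * (a - b)) ≡ v * b
            lemma = solve-∀ ℚring

    module _ (unit? : ∀ a → Dec (Unit a)) where

      open PeriodicSums m

      private
        -- θ(z) = φ(z)φ(zb) is invariant under heavy classes because the sign change of φ enters
        -- twice. The difference θ(cz) - θ(z) inherits this and has mean 0 as c is a unit, so `Mean`
        -- makes it vanish.
        quadratic : ∀ φ C → Small φ C → Periodic φ → (∀ {a} → ¬ Unit a → φ a ≡ + 0) → ∀ {z} → φ z ≢ + 0 →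
          ∀ b c → Unit c → ∀ t → φ (c ℤ.* t) ℤ.* φ (c ℤ.* t ℤ.* b) ≡ φ t ℤ.* φ (t ℤ.* b)
        quadratic φ C s φ-cong φ-nonunit φz≢0 b c uc t = ℤₚ.i-j≡0⇒i≡j _ _
            (Mean.vanishes ψ B ψ-cong (λ z → ≤-trans (ψ≤ z) (B≤mB 0≤B₀)) ψ-partial (ν 7 * (C + C)) (ν 7 * C)
              (*-nonNeg (0≤ν 7) (+-nonNeg 0≤C 0≤C)) (λ L → AtLevel.W-lower L φ C s φ-cong φz≢0) invariant t)
          where
          open Small.Small s
          0≤C = ∣∣≤⇒0≤ (value (+ 0))
          θ ψ : ℤ → ℤ
          θ z = φ z ℤ.* φ (z ℤ.* b)
          ψ z = θ (c ℤ.* z) ℤ.- θ z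
          B₀ = C * C + C * C
          B = ν m * B₀
          0≤B₀ : 0ℚ ≤ B₀
          0≤B₀ = +-nonNeg (*-nonNeg 0≤C 0≤C) (*-nonNeg 0≤C 0≤C)
          θ-cong : Periodic θ
          θ-cong e = cong₂ ℤ._*_ (φ-cong e) (φ-cong (~-*ʳ b e))
          ψ-cong : Periodic ψ
          ψ-cong e = cong₂ ℤ._-_ (θ-cong (~-*ˡ c e)) (θ-cong e)
          ι-ψ : ∀ z → ι (ψ z) ≡ ι (θ (c ℤ.* z)) - ι (θ z)
          ι-ψ z = trans (ι-+ (θ (c ℤ.* z)) (ℤ.- θ z)) (cong (_+_ (ι (θ (c ℤ.* z)))) (ι-neg (θ z)))
          θ≤ : ∀ z → ∣ ι (θ z) ∣ ≤ C * C
          θ≤ z = ≤-respˡ (cong ∣_∣ (sym (ι-* (φ z) (φ (z ℤ.* b))))) (∣*∣≤ (value z) (value (z ℤ.* b)))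
          ψ≤ : ∀ z → ∣ ι (ψ z) ∣ ≤ B₀
          ψ≤ z = ≤-respˡ (cong ∣_∣ (sym (ι-ψ z))) (∣-∣≤ (θ≤ (c ℤ.* z)) (θ≤ z))
          θ-nonunit : ∀ {z} → ¬ Unit z → θ z ≡ + 0
          θ-nonunit {z} ¬u = cong (ℤ._* φ (z ℤ.* b)) (φ-nonunit ¬u)
          ψ-nonunit : ∀ {z} → ¬ Unit z → ψ z ≡ + 0
          ψ-nonunit {z} ¬u = cong₂ ℤ._-_ (θ-nonunit (λ u → ¬u (unit-factorʳ {c} {z} u))) (θ-nonunit ¬u)
          mean-zero : ∑ residues (λ a → ι (ψ (+ a))) ≡ 0ℚ
          mean-zero = trans (∑-cong residues (λ a → ι-ψ (+ a))) (trans (∑-+ residues _ _) (trans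
            (cong₂ _+_ (∑-scale {λ z → ι (θ z)} (λ e → cong ι (θ-cong e)) {c} uc) (∑-neg residues _)) (+-inverseʳ (∑ residues (λ a → ι (θ (+ a)))))))
          ψ-partial = unit-supported-partial unit? ψ B₀ ψ-cong ψ-nonunit ψ≤ mean-zero
          invariant : ∀ L a → (AtLevel.P L a ≤ ν 7 * (C + C)) ⊎ (∀ z → ψ (a ℤ.* z) ≡ ψ z)
          invariant L a with AtLevel.dichotomy L φ C s φ-cong a
          ... | inj₁ light = inj₁ light
          ... | inj₂ flip  = inj₂ (λ z → cong₂ ℤ._-_ (trans (cong θ (swap c a z)) (θ-flip (c ℤ.* z))) (θ-flip z))
            where
            swap : ∀ c a z → c ℤ.* (a ℤ.* z) ≡ a ℤ.* (c ℤ.* z)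
            swap = ℤSolver.solve-∀
            neg-* : ∀ x y → (ℤ.- x) ℤ.* (ℤ.- y) ≡ x ℤ.* y
            neg-* = ℤSolver.solve-∀
            θ-flip : ∀ z → θ (a ℤ.* z) ≡ θ z
            θ-flip z = trans (cong₂ ℤ._*_ (flip z) (trans (cong φ (ℤₚ.*-assoc a z b)) (flip (z ℤ.* b)))) (neg-* (φ z) (φ (z ℤ.* b)))

      -- A small function is a constant multiple of a real character.
      small⇒quadratic : ∀ φ C → Small φ C → Periodic φ → (∀ {a} → ¬ Unit a → φ a ≡ + 0) →
        ∀ b c → Unit c → ∀ t → φ (c ℤ.* t) ℤ.* φ (c ℤ.* t ℤ.* b) ≡ φ t ℤ.* φ (t ℤ.* b)
      small⇒quadratic φ C s φ-cong φ-nonunit b c uc t = go (φ t ℤ.≟ + 0) (φ (c ℤ.* t) ℤ.≟ + 0)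
        where
        go : Dec (φ t ≡ + 0) → Dec (φ (c ℤ.* t) ≡ + 0) → φ (c ℤ.* t) ℤ.* φ (c ℤ.* t ℤ.* b) ≡ φ t ℤ.* φ (t ℤ.* b)
        go (yes e) (yes f) = trans (cong (ℤ._* φ (c ℤ.* t ℤ.* b)) f) (sym (cong (ℤ._* φ (t ℤ.* b)) e))
        go (no φt≢0) _     = quadratic φ C s φ-cong φ-nonunit φt≢0 b c uc t
        go (yes _) (no φ≢0) = quadratic φ C s φ-cong φ-nonunit φ≢0 b c uc t

-- Orthogonal functions are multiples of quadratic characters

module Quadratic where

  open import Data.Empty using (⊥-elim)
  open import Data.Integer as ℤ using (ℤ; +_; -[1+_])
  import Data.Integer.Properties as ℤₚ
  import Data.Integer.Tactic.RingSolver as ℤSolver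
  open import Data.Integer.Divisibility.Signed as Signed using (divides; ∣⇒∣ᵤ; ∣ᵤ⇒∣)
  open import Data.Nat as ℕ using (ℕ; suc; NonZero)
  import Data.Nat.Properties as ℕₚ
  open import Data.Nat.Coprimality using (Coprime; coprime?; coprime-Bézout)
  import Data.Nat.Divisibility as ℕ
  open import Data.Nat.GCD using (module Bézout)
  open import Data.Product using (∃; _×_; _,_; proj₁; proj₂)
  open import Data.Rational hiding (NonZero; floor)
  open import Data.Sum using (_⊎_; inj₁; inj₂)
  open import Relation.Binary.PropositionalEquality
    using (_≡_; refl; sym; trans; cong; cong₂; subst; module ≡-Reasoning)
  open import Relation.Nullary using (Dec; yes; no; ¬_)
  open import Tactic.RingSolver using (solve-∀)
  open Rat
  open Mod
  open Small
  open Nonvanish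

  equal-squares : ∀ x y → x ℤ.* x ≡ y ℤ.* y → (x ≡ y) ⊎ (x ≡ ℤ.- y)
  equal-squares x y eq = go (ℤₚ.i*j≡0⇒i≡0∨j≡0 (x ℤ.- y) {x ℤ.+ y} (trans (lemma x y) (ℤₚ.i≡j⇒i-j≡0 eq)))
    where
    lemma : ∀ x y → (x ℤ.- y) ℤ.* (x ℤ.+ y) ≡ x ℤ.* x ℤ.- y ℤ.* y
    lemma = ℤSolver.solve-∀
    go : (x ℤ.- y ≡ + 0) ⊎ (x ℤ.+ y ≡ + 0) → (x ≡ y) ⊎ (x ≡ ℤ.- y)
    go (inj₁ e) = inj₁ (ℤₚ.i-j≡0⇒i≡j x y e)
    go (inj₂ e) = inj₂ (ℤₚ.i-j≡0⇒i≡j x (ℤ.- y) (trans (cong (λ z → x ℤ.+ z) (ℤₚ.neg-involutive y)) e))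

  module Units (m : ℕ) .{{m≢0 : NonZero m}} where

    open Modulo m

    coprime⇒unit : ∀ a → Coprime ℤ.∣ a ∣ m → Unit a
    coprime⇒unit (+ n) c with coprime-Bézout c
    ... | Bézout.+- x y eq = + x , ~-trans (~-reflexive (trans (ℤₚ.*-comm (+ n) (+ x)) (trans (sym (ℤₚ.pos-* x n)) (trans (cong +_ (sym eq)) (ℤₚ.pos-+ 1 (y ℕ.* m))))))
      (subst (+ 1 ℤ.+ + (y ℕ.* m) ~_) (ℤₚ.+-identityʳ (+ 1)) (~-+ {+ 1} {+ 1} {+ (y ℕ.* m)} {+ 0} ~-refl (mk~ (divides (+ y) (trans (ℤₚ.+-identityʳ (+ (y ℕ.* m))) (ℤₚ.pos-* y m))))))
    ... | Bézout.-+ x y eq = ℤ.- + x , ~-trans (mk~ (divides (ℤ.- + y) (trans (lemma (+ n) (+ x)) (trans (cong ℤ.-_ rest) (ℤₚ.neg-distribˡ-* (+ y) (+ m)))))) ~-refl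
      where
      lemma : ∀ n x → n ℤ.* (ℤ.- x) ℤ.- + 1 ≡ ℤ.- (+ 1 ℤ.+ x ℤ.* n)
      lemma = ℤSolver.solve-∀
      rest : + 1 ℤ.+ + x ℤ.* + n ≡ + y ℤ.* + m
      rest = trans (cong (λ z → + 1 ℤ.+ z) (sym (ℤₚ.pos-* x n))) (trans (cong +_ eq) (ℤₚ.pos-* y m))
    coprime⇒unit (-[1+ n ]) c = unit-neg {+ suc n} (coprime⇒unit (+ suc n) c)

    unit⇒coprime : ∀ {a} → Unit a → Coprime ℤ.∣ a ∣ m
    unit⇒coprime {a} (a′ , mk~ e) {d} (d∣a , d∣m) = ℕ.∣1⇒≡1 (∣⇒∣ᵤ
        (subst (λ z → (+ d) Signed.∣ z) (lemma (a ℤ.* a′))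
          (Signed.∣m∣n⇒∣m-n
            (Signed.∣m⇒∣m*n a′ (∣ᵤ⇒∣ {+ d} {a} d∣a))
            (Signed.∣-trans (∣ᵤ⇒∣ {+ d} {+ m} d∣m) e))))
      where
      lemma : ∀ x → x ℤ.- (x ℤ.- + 1) ≡ + 1
      lemma = ℤSolver.solve-∀

    abstract

      unit? : ∀ a → Dec (Unit a)
      unit? a with coprime? ℤ.∣ a ∣ m
      ... | yes c = yes (coprime⇒unit a c)
      ... | no ¬c = no (λ u → ¬c (unit⇒coprime {a} u))

    open Inverse unit? public

    module _ (1<m : 1 ℕ.< m) where

      zero-nonunit : ∀ {a} → a ~ + 0 → ¬ Unit a
      zero-nonunit {a} a~0 (a′ , e)
        with residue-unique 1<m (ℕₚ.<-trans (ℕ.s≤s ℕ.z≤n) 1<m) (~-trans (~-sym e) (~-*ʳ a′ a~0))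
      ... | ()

      module _ (f : ℤ → ℤ) (f-cong : Periodic f) (f-odd : ∀ z → f (ℤ.- z) ≡ ℤ.- f z)
        (f-nonunit : ∀ {a} → ¬ Unit a → f a ≡ + 0)
        (orth : ∀ j → ∑ residues (λ b → ι (f (+ b)) * ν ⌊ j ℤ.* + b ⌋) ≡ 0ℚ) where

        private
          φ : ℤ → ℤ
          φ a = f (inv a)

          f-0 : f (+ 0) ≡ + 0
          f-0 = f-nonunit (zero-nonunit ~-refl)

          φ-nonunit : ∀ {a} → ¬ Unit a → φ a ≡ + 0
          φ-nonunit ¬u = trans (cong f (inv-nonunit ¬u)) f-0

          φ-odd : ∀ z → φ (ℤ.- z) ≡ ℤ.- φ z
          φ-odd z = go (unit? z)
            where
            neg-* : ∀ x y → x ℤ.* y ≡ (ℤ.- x) ℤ.* (ℤ.- y)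
            neg-* = ℤSolver.solve-∀
            go : Dec (Unit z) → φ (ℤ.- z) ≡ ℤ.- φ z
            go (yes u) = trans (f-cong (inv-unique (ℤ.- z) (ℤ.- inv z) (subst (_~ + 1) (neg-* z (inv z)) (*-inv z u)))) (f-odd (inv z))
            go (no ¬u) = trans (φ-nonunit (λ u → ¬u (subst Unit (ℤₚ.neg-involutive z) (unit-neg u)))) (sym (cong ℤ.-_ (φ-nonunit ¬u)))

          choose : ∀ a → Dec (Unit a) → ℤ
          choose a (yes _) = inv a
          choose a (no _)  = a

          -- Inversion extended to an involution of all of ℤ/m. It allows the relations for f to be
          -- reindexed into relations for φ(a) = f(a⁻¹) over the full list of residues; on nonunits
          -- both functions vanish.
          swapUnits : ℤ → ℤ
          swapUnits a = choose a (unit? a)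

          swapUnits-unit : ∀ {a} → Unit a → swapUnits a ≡ inv a
          swapUnits-unit {a} u = go (unit? a)
            where
            go : ∀ d → choose a d ≡ inv a
            go (yes _) = refl
            go (no ¬u) = ⊥-elim (¬u u)

          swapUnits-nonunit : ∀ {a} → ¬ Unit a → swapUnits a ≡ a
          swapUnits-nonunit {a} ¬u = go (unit? a)
            where
            go : ∀ d → choose a d ≡ a
            go (yes u) = ⊥-elim (¬u u)
            go (no _)  = refl

          swapUnits-involutive : ∀ {a b} → b ~ swapUnits a → a ~ swapUnits b
          swapUnits-involutive {a} {b} e = go (unit? a)
            where
            go : Dec (Unit a) → a ~ swapUnits b
            go (yes u) = ~-sym (subst (_~ a) (sym (swapUnits-unit ub)) (~-trans (inv-cong b~) (inv-involutive u)))
              where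
              b~ : b ~ inv a
              b~ = subst (b ~_) (swapUnits-unit u) e
              ub : Unit b
              ub = unit-resp (~-sym b~) (inv-unit u)
            go (no ¬u) = subst (a ~_) (sym (swapUnits-nonunit (λ ub → ¬u (unit-resp b~ ub)))) (~-sym b~)
              where
              b~ : b ~ a
              b~ = subst (b ~_) (swapUnits-nonunit ¬u) e

          φ-orth : ∀ j → ∑ residues (λ a → ι (φ (+ a)) * ν ⌊ j ℤ.* inv (+ a) ⌋) ≡ 0ℚ
          φ-orth j = trans (∑-cong residues (λ a → pointwise (+ a) (unit? (+ a))))
              (trans (∑-reindex {F} F-cong swapUnits swapUnits (λ e → swapUnits-involutive e) (λ e → swapUnits-involutive e)) (orth j))
            where
            F : ℤ → ℚ
            F z = ι (f z) * ν ⌊ j ℤ.* z ⌋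
            F-cong : Periodic F
            F-cong e = cong₂ (λ x y → ι x * ν y) (f-cong e) (⌊⌋-cong (~-*ˡ j e))
            pointwise : ∀ a → Dec (Unit a) → ι (φ a) * ν ⌊ j ℤ.* inv a ⌋ ≡ F (swapUnits a)
            pointwise a (yes u) = cong F (sym (swapUnits-unit u))
            pointwise a (no ¬u) = trans (zero-*ˡ (ν ⌊ j ℤ.* inv a ⌋) (trans (cong ι (φ-nonunit ¬u)) ι-0))
              (sym (trans (cong F (swapUnits-nonunit ¬u)) (zero-*ˡ (ν ⌊ j ℤ.* a ⌋) (trans (cong ι (f-nonunit ¬u)) ι-0))))

          abstract

            bounded : ∃ λ B → ∀ z → ∣ ι (φ z) ∣ ≤ B
            bounded = bound (argmax (λ n → ℤ.∣ f (+ n) ∣) m)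
              where
              bound : (∃ λ i → (i ℕ.≤ m) × (∀ j → j ℕ.≤ m → ℤ.∣ f (+ j) ∣ ℕ.≤ ℤ.∣ f (+ i) ∣)) → ∃ λ B → ∀ z → ∣ ι (φ z) ∣ ≤ B
              bound (i , _ , max) = ν ℤ.∣ f (+ i) ∣ , λ z → ≤-respˡ (sym (∣ι∣ (φ z))) (ν-mono-≤
                (subst (λ x → ℤ.∣ x ∣ ℕ.≤ ℤ.∣ f (+ i) ∣) (f-cong (~-sym (~⌊⌋ (inv z)))) (max ⌊ inv z ⌋ (ℕₚ.<⇒≤ (⌊⌋<m (inv z))))))

            φ-small : Small φ (2ℚ * (ν m * proj₁ bounded))
            φ-small = PeriodicSums.orthogonal⇒small m unit? 1<m φ (proj₁ bounded) (λ e → f-cong (inv-cong e)) φ-odd φ-nonunit (proj₂ bounded) φ-orth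

            φ-quadratic : ∀ b c → Unit c → ∀ t → φ (c ℤ.* t) ℤ.* φ (c ℤ.* t ℤ.* b) ≡ φ t ℤ.* φ (t ℤ.* b)
            φ-quadratic = PrimeClasses.small⇒quadratic m unit? φ (2ℚ * (ν m * proj₁ bounded)) φ-small (λ e → f-cong (inv-cong e)) φ-nonunit

        -- `φ-quadratic` at t = 1, read through f(c) = φ(c⁻¹). If f(1) ≠ 0, it says that f/f(1) is
        -- multiplicative with values ±1 on units.
        orthogonal⇒quadratic : ∀ {b c} → Unit b → Unit c → f c ℤ.* f (c ℤ.* b) ≡ f (+ 1) ℤ.* f b
        orthogonal⇒quadratic {b} {c} ub uc = begin
          f c ℤ.* f (c ℤ.* b)
            ≡⟨ cong₂ ℤ._*_ (f-cong (~-sym (subst (λ z → inv z ~ c) (sym (ℤₚ.*-identityʳ (inv c))) (inv-involutive uc))))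
                 (f-cong (~-sym (subst (λ z → inv (z ℤ.* inv b) ~ c ℤ.* b) (sym (ℤₚ.*-identityʳ (inv c))) (inv-product c b uc ub)))) ⟩
          φ (inv c ℤ.* + 1) ℤ.* φ (inv c ℤ.* + 1 ℤ.* inv b)
            ≡⟨ φ-quadratic (inv b) (inv c) (inv-unit uc) (+ 1) ⟩
          φ (+ 1) ℤ.* φ (+ 1 ℤ.* inv b)
            ≡⟨ cong₂ ℤ._*_ (f-cong (inv-unique (+ 1) (+ 1) ~-refl))
                 (f-cong (subst (λ z → inv z ~ b) (sym (ℤₚ.*-identityˡ (inv b))) (inv-involutive ub))) ⟩
          f (+ 1) ℤ.* f b ∎
          where
          open ≡-Reasoning
          inv-product : ∀ c b → Unit c → Unit b → inv (inv c ℤ.* inv b) ~ c ℤ.* b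
          inv-product c b uc ub = inv-unique (inv c ℤ.* inv b) (c ℤ.* b) (subst (_~ + 1) (lemma (inv c) c (inv b) b) (~-* (inv-* c uc) (inv-* b ub)))
            where
            lemma : ∀ x c y b → x ℤ.* c ℤ.* (y ℤ.* b) ≡ x ℤ.* y ℤ.* (c ℤ.* b)
            lemma = ℤSolver.solve-∀

        square-constant : ∀ {c} → Unit c → f c ℤ.* f c ≡ f (+ 1) ℤ.* f (+ 1)
        square-constant {c} uc = trans (cong (λ z → f c ℤ.* f z) (sym (ℤₚ.*-identityʳ c))) (orthogonal⇒quadratic {+ 1} {c} unit-1 uc)

        sign : ∀ {c} → Unit c → (f c ≡ f (+ 1)) ⊎ (f c ≡ ℤ.- f (+ 1))
        sign {c} uc = equal-squares (f c) (f (+ 1)) (square-constant uc)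

-- Prime modulus: orthogonal functions are zero

module PrimeCase where

  open import Data.Empty using (⊥; ⊥-elim)
  open import Data.Integer as ℤ using (ℤ; +_; -[1+_])
  import Data.Integer.Properties as ℤₚ
  import Data.Integer.Tactic.RingSolver as ℤSolver
  open import Data.Integer.Divisibility.Signed as Signed using (divides; ∣⇒∣ᵤ; ∣ᵤ⇒∣)
  open import Data.List using (List; []; _∷_)
  open import Data.List.Membership.Propositional using (_∈_)
  open import Data.List.Membership.Propositional.Properties using (∈-downFrom⁻; ∈-downFrom⁺)
  open import Data.List.Relation.Unary.Unique.Propositional.Properties using (downFrom⁺)
  open import Data.Nat as ℕ using (ℕ; zero; suc; NonZero)
  import Data.Nat.Properties as ℕₚ
  import Data.Nat.Divisibility as ℕ
  open import Data.Nat.Primality using (Prime; prime⇒nonZero; euclidsLemma; prime[2])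
  open import Data.Product using (∃; _,_; proj₁; proj₂)
  open import Data.Rational hiding (NonZero; floor)
  open import Data.Rational.Properties
  open import Data.Sum using (_⊎_; inj₁; inj₂)
  open import Relation.Binary.PropositionalEquality
    using (_≡_; _≢_; refl; sym; trans; cong; cong₂; subst; subst₂; module ≡-Reasoning)
  open import Relation.Nullary using (Dec; yes; no; ¬_)
  open import Relation.Binary.Definitions using (tri<; tri≈; tri>)
  open import Tactic.RingSolver using (solve-∀)
  open Rat
  open Mod
  open Factor using (2≤prime)
  open Divisor using (∤⇒coprime; prime∣prime)
  open Quadratic

  IsNat : ℚ → Set
  IsNat q = ∃ λ n → q ≡ ν n

  χ-nat : ∀ {P : Set} (d : Dec P) → IsNat (χ d)
  χ-nat (yes _) = 1 , sym ι-1
  χ-nat (no _)  = 0 , sym ι-0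

  *-nat : ∀ {a b} → IsNat a → IsNat b → IsNat (a * b)
  *-nat (m , refl) (n , refl) = m ℕ.* n , sym (ν-* m n)

  ∑-nat : ∀ {A : Set} (xs : List A) {f} → (∀ x → IsNat (f x)) → IsNat (∑ xs f)
  ∑-nat []       {f} nat = 0 , trans (∑-[] f) (sym ι-0)
  ∑-nat (x ∷ xs) {f} nat = proj₁ (nat x) ℕ.+ proj₁ (∑-nat xs nat) ,
    trans (∑-∷ x xs f) (trans (cong₂ _+_ (proj₂ (nat x)) (proj₂ (∑-nat xs nat))) (sym (ν-+ (proj₁ (nat x)) (proj₁ (∑-nat xs nat)))))

  neg-self : ∀ {z} → z ≡ ℤ.- z → z ≡ + 0
  neg-self {+ zero}   _ = refl
  neg-self {+ suc _}  ()
  neg-self { -[1+ _ ]} ()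

  ⌊-⌋ : ∀ m .{{_ : NonZero m}} → let open Modulo m in ∀ z → ¬ (z ~ + 0) → ν ⌊ ℤ.- z ⌋ ≡ ν m - ν ⌊ z ⌋
  ⌊-⌋ m z z≁0 = go ⌊ z ⌋ (⌊⌋<m z) (~⌊⌋ z)
    where
    open Modulo m
    go : ∀ r → r ℕ.< m → z ~ + r → ν ⌊ ℤ.- z ⌋ ≡ ν m - ν r
    go zero    _   e = ⊥-elim (z≁0 e)
    go (suc r) r<m e = trans (cong ν (residue-unique (⌊⌋<m (ℤ.- z)) (ℕₚ.∸-monoʳ-< {m} (ℕ.s≤s ℕ.z≤n) (ℕₚ.<⇒≤ r<m))
        (~-trans (~-sym (~⌊⌋ (ℤ.- z))) (~-trans (~-neg e) complement))))
      (trans (sym (cancel (ν (m ℕ.∸ suc r)) (ν (suc r)))) (cong (_- ν (suc r)) (trans (sym (ν-+ (m ℕ.∸ suc r) (suc r))) (cong ν (ℕₚ.m∸n+n≡m (ℕₚ.<⇒≤ r<m))))))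
      where
      cancel : ∀ a b → a + b - b ≡ a
      cancel = solve-∀ ℚring
      complement : ℤ.- + suc r ~ + (m ℕ.∸ suc r)
      complement = subst₂ _~_ (ℤₚ.+-identityˡ (ℤ.- + suc r)) (trans (ℤₚ.m-n≡m⊖n m (suc r)) (ℤₚ.⊖-≥ (ℕₚ.<⇒≤ r<m)))
        (~-+ {+ 0} {+ m} {ℤ.- + suc r} {ℤ.- + suc r} (~-sym m~0) ~-refl)

  module PrimeModulus (p : ℕ) (pp : Prime p) (p≢2 : p ≢ 2) where

    private
      instance
        p≢0 : NonZero p
        p≢0 = prime⇒nonZero pp

    open Modulo p
    open Units p

    1<p : 1 ℕ.< p
    1<p = 2≤prime pp

    ∣⇒~0 : ∀ {a} → p ℕ.∣ ℤ.∣ a ∣ → a ~ + 0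
    ∣⇒~0 {a} d = mk~ (subst ((+ p) Signed.∣_) (sym (ℤₚ.+-identityʳ a)) (∣ᵤ⇒∣ {+ p} {a} d))

    nonzero⇒unit : ∀ {a} → ¬ (a ~ + 0) → Unit a
    nonzero⇒unit {a} a≁0 = coprime⇒unit a (∤⇒coprime pp (λ d → a≁0 (∣⇒~0 {a} d)))

    no-zero-divisors : ∀ x y → x ℤ.* y ~ + 0 → (x ~ + 0) ⊎ (y ~ + 0)
    no-zero-divisors x y e = go (euclidsLemma ℤ.∣ x ∣ ℤ.∣ y ∣ pp
        (subst (p ℕ.∣_) (ℤₚ.abs-* x y) (∣⇒∣ᵤ (subst ((+ p) Signed.∣_) (ℤₚ.+-identityʳ (x ℤ.* y)) (divisible e)))))
      where
      go : (p ℕ.∣ ℤ.∣ x ∣) ⊎ (p ℕ.∣ ℤ.∣ y ∣) → (x ~ + 0) ⊎ (y ~ + 0)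
      go (inj₁ d) = inj₁ (∣⇒~0 {x} d)
      go (inj₂ d) = inj₂ (∣⇒~0 {y} d)

    module _ (f : ℤ → ℤ) (f-cong : Periodic f) (f-odd : ∀ z → f (ℤ.- z) ≡ ℤ.- f z)
      (f-nonunit : ∀ {a} → ¬ Unit a → f a ≡ + 0)
      (orth : ∀ j → ∑ residues (λ b → ι (f (+ b)) * ν ⌊ j ℤ.* + b ⌋) ≡ 0ℚ) where

      private
        κ : ℤ
        κ = f (+ 1)

        module Contradiction (κ≢0 : κ ≢ + 0) where

          κ≢-κ : κ ≢ ℤ.- κ
          κ≢-κ e = κ≢0 (neg-self e)

          g : ℤ → ℚ
          g z = χ (f z ℤ.≟ κ)

          g-cong : Periodic g
          g-cong {a} {b} e = χ-⇔ (f a ℤ.≟ κ) (f b ℤ.≟ κ) (trans (sym (f-cong e))) (trans (f-cong e))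

          P A : ℚ
          P = ∑ residues (λ a → g (+ a))
          A = ∑ residues (λ a → g (+ a) * ν ⌊ + a ⌋)

          f-by-g : ∀ z → ι (f z) ≡ ι κ * (g z - g (ℤ.- z))
          f-by-g z = go (unit? z)
            where
            values : ∀ {x} → ι (f z) ≡ ι κ * x → g z - g (ℤ.- z) ≡ x → ι (f z) ≡ ι κ * (g z - g (ℤ.- z))
            values e refl = e
            go : Dec (Unit z) → ι (f z) ≡ ι κ * (g z - g (ℤ.- z))
            go (no ¬u) = values {0ℚ - 0ℚ} (trans (trans (cong ι (f-nonunit ¬u)) ι-0) (sym (zero-*ʳ (ι κ) (+-inverseʳ 0ℚ))))
              (cong₂ _-_ (χ-no (f z ℤ.≟ κ) (λ e → κ≢0 (trans (sym e) (f-nonunit ¬u))))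
                (χ-no (f (ℤ.- z) ℤ.≟ κ) (λ e → κ≢0 (trans (sym e) (trans (f-odd z) (cong ℤ.-_ (f-nonunit ¬u)))))))
            go (yes u) = by-sign (sign 1<p f f-cong f-odd f-nonunit orth u)
              where
              by-sign : (f z ≡ κ) ⊎ (f z ≡ ℤ.- κ) → ι (f z) ≡ ι κ * (g z - g (ℤ.- z))
              by-sign (inj₁ e) = values {1ℚ - 0ℚ} (trans (cong ι e) (lemma (ι κ)))
                (cong₂ _-_ (χ-yes (f z ℤ.≟ κ) e) (χ-no (f (ℤ.- z) ℤ.≟ κ) (λ e′ → κ≢-κ (trans (sym e′) (trans (f-odd z) (cong ℤ.-_ e))))))
                where
                lemma : ∀ k → k ≡ k * (1ℚ - 0ℚ)
                lemma = solve-∀ ℚring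
              by-sign (inj₂ e) = values {0ℚ - 1ℚ} (trans (trans (cong ι e) (ι-neg κ)) (lemma (ι κ)))
                (cong₂ _-_ (χ-no (f z ℤ.≟ κ) (λ e′ → κ≢-κ (trans (sym e′) e))) (χ-yes (f (ℤ.- z) ℤ.≟ κ) (trans (f-odd z) (trans (cong ℤ.-_ e) (ℤₚ.neg-involutive κ)))))
                where
                lemma : ∀ k → - k ≡ k * (0ℚ - 1ℚ)
                lemma = solve-∀ ℚring

          ικ≢0 : ι κ ≢ 0ℚ
          ικ≢0 e = κ≢0 (ι-injective (trans e (sym ι-0)))

          cancel-κ : ∀ {x} → ι κ * x ≡ 0ℚ → x ≡ 0ℚ
          cancel-κ {x} e = trans (sym (*-identityˡ x)) (trans (cong (_* x) (sym (*-recip ικ≢0)))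
            (trans (lemma (ι κ) (recip (ι κ)) x) (zero-*ʳ (recip (ι κ)) e)))
            where
            lemma : ∀ k r x → k * r * x ≡ r * (k * x)
            lemma = solve-∀ ℚring

          reflected : ∑ residues (λ a → g (ℤ.- (+ a)) * ν ⌊ + a ⌋) ≡ ν p * P - A
          reflected = begin
            ∑ residues (λ a → g (ℤ.- (+ a)) * ν ⌊ + a ⌋)
              ≡⟨ ∑-cong residues (λ a → cong (λ z → g (ℤ.- (+ a)) * ν ⌊ z ⌋) (sym (ℤₚ.neg-involutive (+ a)))) ⟩
            ∑ residues (λ a → g (ℤ.- (+ a)) * ν ⌊ ℤ.- (ℤ.- (+ a)) ⌋)
              ≡⟨ ∑-neg-index {λ z → g z * ν ⌊ ℤ.- z ⌋} (λ e → cong₂ (λ x y → x * ν y) (g-cong e) (⌊⌋-cong (~-neg e))) ⟩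
            ∑ residues (λ a → g (+ a) * ν ⌊ ℤ.- (+ a) ⌋)
              ≡⟨ ∑-cong residues (λ a → trans (χ-cong (f (+ a) ℤ.≟ κ) (λ e → ⌊-⌋ p (+ a) (λ a~0 → κ≢0 (trans (sym e) (f-nonunit (zero-nonunit 1<p a~0))))))
                   (lemma (g (+ a)) (ν p) (ν ⌊ + a ⌋))) ⟩
            ∑ residues (λ a → ν p * g (+ a) + - (g (+ a) * ν ⌊ + a ⌋))
              ≡⟨ trans (∑-+ residues _ _) (cong₂ _+_ (sym (∑-*ˡ residues (ν p) _)) (∑-neg residues _)) ⟩
            ν p * P - A ∎
            where
            open ≡-Reasoning
            lemma : ∀ g p a → g * (p - a) ≡ p * g + - (g * a)
            lemma = solve-∀ ℚring

          -- Orthogonality at j = 1 says that the residues with f = κ and those with f = -κ have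
          -- equal sums. The latter are p - a for a among the former, so their sum is pP - A. As p
          -- is odd, this makes P even.
          2A≡pP : A + A ≡ ν p * P
          2A≡pP = trans (cong (_+ A) A≡) (cancel (ν p * P) A)
            where
            cancel : ∀ x a → x - a + a ≡ x
            cancel = solve-∀ ℚring
            factor : ∀ k x y n → k * (x - y) * n ≡ k * (x * n + - (y * n))
            factor = solve-∀ ℚring
            difference : A - ∑ residues (λ a → g (ℤ.- (+ a)) * ν ⌊ + a ⌋) ≡ 0ℚ
            difference = cancel-κ (trans (cong (ι κ *_) (trans (cong (_+_ A) (sym (∑-neg residues _))) (sym (∑-+ residues _ _))))
              (trans (∑-*ˡ residues (ι κ) _) (trans (∑-cong residues (λ a → trans (sym (factor (ι κ) (g (+ a)) (g (ℤ.- (+ a))) (ν ⌊ + a ⌋)))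
                (cong₂ (λ x z → x * ν ⌊ z ⌋) (sym (f-by-g (+ a))) (sym (ℤₚ.*-identityˡ (+ a)))))) (orth (+ 1)))))
            A≡ : A ≡ ν p * P - A
            A≡ = trans (sym (restore A (ν p * P - A))) (trans (cong (λ t → (A - t) + (ν p * P - A)) (sym reflected))
                (trans (cong (_+ (ν p * P - A)) difference) (+-identityˡ (ν p * P - A))))
              where
              restore : ∀ a b → (a - b) + b ≡ a
              restore = solve-∀ ℚring

          g≡κ-inv : ∀ {a} → Unit a → f a ≡ κ → f (inv a) ≡ κ
          g≡κ-inv {a} u e = sym (ℤₚ.*-cancelˡ-≡ κ κ (f (inv a)) {{ℤ.≢-nonZero κ≢0}}
            (trans (sym (cong₂ ℤ._*_ e (f-cong (*-inv a u)))) (orthogonal⇒quadratic 1<p f f-cong f-odd f-nonunit orth (inv-unit u) u)))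

          unit-if : ∀ {a} → f a ≡ κ → Unit a
          unit-if {a} e = go (unit? a)
            where
            go : Dec (Unit a) → Unit a
            go (yes u) = u
            go (no ¬u) = ⊥-elim (κ≢0 (trans (sym e) (f-nonunit ¬u)))

          -- The graph of inversion on the set where f = κ. Off the diagonal it is counted in
          -- symmetric pairs, so its diagonal decides the parity of P.
          D : ℕ → ℕ → ℚ
          D a b = χ (+ b ~? inv (+ a)) * g (+ a)

          D-sym : ∀ a b → D a b ≡ D b a
          D-sym a b = go (f (+ a) ℤ.≟ κ) (f (+ b) ℤ.≟ κ)
            where
            transport : ∀ {a b} → f (+ a) ≡ κ → + b ~ inv (+ a) → + a ~ inv (+ b)
            transport {a} {b} e b~ = ~-trans (~-sym (inv-involutive (unit-if e))) (~-sym (inv-cong b~))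
            partner : ∀ {a b} → f (+ a) ≡ κ → + b ~ inv (+ a) → f (+ b) ≡ κ
            partner e b~ = trans (f-cong b~) (g≡κ-inv (unit-if e) e)
            vanish : ∀ a b → f (+ a) ≢ κ → D a b ≡ 0ℚ
            vanish a b ne = zero-*ʳ (χ (+ b ~? inv (+ a))) (χ-no (f (+ a) ℤ.≟ κ) ne)
            vanish′ : ∀ a b → f (+ a) ≡ κ → f (+ b) ≢ κ → D a b ≡ 0ℚ
            vanish′ a b e ne = zero-*ˡ (g (+ a)) (χ-no (+ b ~? inv (+ a)) (λ b~ → ne (partner e b~)))
            go : Dec (f (+ a) ≡ κ) → Dec (f (+ b) ≡ κ) → D a b ≡ D b a
            go (yes ea) (yes eb) = cong₂ _*_ (χ-⇔ (+ b ~? inv (+ a)) (+ a ~? inv (+ b)) (transport ea) (transport eb))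
              (trans (χ-yes (f (+ a) ℤ.≟ κ) ea) (sym (χ-yes (f (+ b) ℤ.≟ κ) eb)))
            go (yes ea) (no nb) = trans (vanish′ a b ea nb) (sym (vanish b a nb))
            go (no na) (yes eb) = trans (vanish a b na) (sym (vanish′ b a eb na))
            go (no na) (no nb)  = trans (vanish a b na) (sym (vanish b a nb))

          -- Modulo a prime, a² = 1 only for a = 1 and a = -1, and the latter is excluded by f(-1) =
          -- -κ ≠ κ.
          D-diagonal : ∀ {a} → a ∈ residues → D a a ≡ χ (a ℕ.≟ 1)
          D-diagonal {a} a∈ = go (a ℕ.≟ 1) (f (+ a) ℤ.≟ κ)
            where
            go : Dec (a ≡ 1) → Dec (f (+ a) ≡ κ) → D a a ≡ χ (a ℕ.≟ 1)
            go (yes refl) _ = trans (cong₂ _*_ (χ-yes (+ 1 ~? inv (+ 1)) (~-sym (inv-unique (+ 1) (+ 1) ~-refl))) (χ-yes (f (+ 1) ℤ.≟ κ) refl)) (*-identityˡ 1ℚ)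
            go (no a≢1) (no ne) = trans (zero-*ʳ (χ (+ a ~? inv (+ a))) (χ-no (f (+ a) ℤ.≟ κ) ne)) (sym (χ-no (a ℕ.≟ 1) a≢1))
            go (no a≢1) (yes e) = trans (zero-*ˡ (g (+ a)) (χ-no (+ a ~? inv (+ a)) (λ a~ → square a~ (no-zero-divisors (+ a ℤ.- + 1) (+ a ℤ.+ + 1) (product a~)))))
                (sym (χ-no (a ℕ.≟ 1) a≢1))
              where
              product : + a ~ inv (+ a) → (+ a ℤ.- + 1) ℤ.* (+ a ℤ.+ + 1) ~ + 0
              product a~ = subst₂ _~_ (sym (factor (+ a))) refl (~-+ {+ a ℤ.* + a} {+ 1} {ℤ.- + 1} {ℤ.- + 1}
                (~-trans (~-*ˡ (+ a) a~) (*-inv (+ a) (unit-if e))) ~-refl)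
                where
                factor : ∀ x → (x ℤ.- + 1) ℤ.* (x ℤ.+ + 1) ≡ x ℤ.* x ℤ.+ ℤ.- + 1
                factor = ℤSolver.solve-∀
              square : + a ~ inv (+ a) → (+ a ℤ.- + 1 ~ + 0) ⊎ (+ a ℤ.+ + 1 ~ + 0) → ⊥
              square _ (inj₁ z) = a≢1 (residue-unique (∈-downFrom⁻ a∈) 1<p (subst₂ _~_ (cancel (+ a)) refl (~-+ {+ a ℤ.- + 1} {+ 0} {+ 1} {+ 1} z ~-refl)))
                where
                cancel : ∀ x → x ℤ.- + 1 ℤ.+ + 1 ≡ x
                cancel = ℤSolver.solve-∀
              square _ (inj₂ z) = κ≢-κ (trans (sym e) (trans (f-cong (subst₂ _~_ (cancel (+ a)) refl (~-+ {+ a ℤ.+ + 1} {+ 0} {ℤ.- + 1} {ℤ.- + 1} z ~-refl))) (f-odd (+ 1))))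
                where
                cancel : ∀ x → x ℤ.+ + 1 ℤ.+ ℤ.- + 1 ≡ x
                cancel = ℤSolver.solve-∀

          T : ℚ
          T = ∑ residues (λ a → ∑ residues (λ b → χ (a ℕ.<? b) * D a b))

          trichotomy : ∀ a b (x : ℚ) → x ≡ (χ (a ℕ.<? b) * x + χ (b ℕ.<? a) * x) + χ (b ℕ.≟ a) * x
          trichotomy a b x with ℕₚ.<-cmp a b
          ... | tri< a<b a≢b b≮a = sym (zero-+ʳ (zero-+ʳ (χ-1 (a ℕ.<? b) a<b x) (χ-0 (b ℕ.<? a) b≮a x)) (χ-0 (b ℕ.≟ a) (λ e → a≢b (sym e)) x))
          ... | tri> a≮b a≢b b<a = sym (zero-+ʳ (zero-+ˡ (χ-0 (a ℕ.<? b) a≮b x) (χ-1 (b ℕ.<? a) b<a x)) (χ-0 (b ℕ.≟ a) (λ e → a≢b (sym e)) x))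
          ... | tri≈ a≮b a≡b b≮a = sym (zero-+ˡ (trans (cong₂ _+_ (χ-0 (a ℕ.<? b) a≮b x) (χ-0 (b ℕ.<? a) b≮a x)) (+-identityˡ 0ℚ)) (χ-1 (b ℕ.≟ a) (sym a≡b) x))

          -- Inversion is an involution of {f = κ} whose only fixed point is 1.
          P-odd : P ≡ (T + T) + 1ℚ
          P-odd = begin
            ∑ residues (λ a → g (+ a))
              ≡⟨ ∑-cong residues (λ a → sym (∑-residue {λ _ → g (+ a)} (λ _ → refl) (inv (+ a)))) ⟩
            ∑ residues (λ a → ∑ residues (D a))
              ≡⟨ ∑-cong residues (λ a → trans (∑-cong residues (λ b → trichotomy a b (D a b))) (linear _ _ _)) ⟩
            ∑ residues (λ a → (∑ residues (λ b → χ (a ℕ.<? b) * D a b) + ∑ residues (λ b → χ (b ℕ.<? a) * D a b)) + ∑ residues (λ b → χ (b ℕ.≟ a) * D a b))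
              ≡⟨ linear _ _ _ ⟩
            (T + ∑ residues (λ a → ∑ residues (λ b → χ (b ℕ.<? a) * D a b))) + ∑ residues (λ a → ∑ residues (λ b → χ (b ℕ.≟ a) * D a b))
              ≡⟨ cong₂ (λ x y → (T + x) + y)
                   (trans (∑-swap residues residues _) (∑-cong residues (λ b → ∑-cong residues (λ a → cong (χ (b ℕ.<? a) *_) (D-sym a b)))))
                   (trans (∑-cong∈ residues (λ {a} a∈ → trans (∑-one (λ b → b ℕ.≟ a) (D a) (downFrom⁺ p) a∈ refl (λ _ e → e)) (trans (D-diagonal a∈) (sym (*-identityʳ (χ (a ℕ.≟ 1)))))))
                     (∑-one (λ a → a ℕ.≟ 1) (λ _ → 1ℚ) (downFrom⁺ p) (∈-downFrom⁺ 1<p) refl (λ _ e → e))) ⟩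
            (T + T) + 1ℚ ∎
            where
            open ≡-Reasoning
            linear : ∀ (f g h : ℕ → ℚ) → ∑ residues (λ z → (f z + g z) + h z) ≡ (∑ residues f + ∑ residues g) + ∑ residues h
            linear f g h = trans (∑-+ residues (λ z → f z + g z) h) (cong (_+ ∑ residues h) (∑-+ residues f g))

          -- The equation 2A = p(2T + 1) has natural numbers A and T, but p and 2T + 1 are odd.
          impossible : ⊥
          impossible = parity (euclidsLemma p (t ℕ.+ t ℕ.+ 1) prime[2] (ℕ.divides n (trans (sym equation) (trans (cong (n ℕ.+_) (sym (ℕₚ.+-identityʳ n))) (ℕₚ.*-comm 2 n)))))
            where
            A-nat = ∑-nat residues (λ a → *-nat (χ-nat (f (+ a) ℤ.≟ κ)) (⌊ + a ⌋ , refl))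
            T-nat = ∑-nat residues (λ a → ∑-nat residues (λ b → *-nat (χ-nat (a ℕ.<? b)) (*-nat (χ-nat (+ b ~? inv (+ a))) (χ-nat (f (+ a) ℤ.≟ κ)))))
            n = proj₁ A-nat
            t = proj₁ T-nat
            equation : n ℕ.+ n ≡ p ℕ.* (t ℕ.+ t ℕ.+ 1)
            equation = ℤₚ.+-injective (ι-injective (begin
              ν (n ℕ.+ n)                  ≡⟨ ν-+ n n ⟩
              ν n + ν n                    ≡⟨ sym (cong₂ _+_ (proj₂ A-nat) (proj₂ A-nat)) ⟩
              A + A                        ≡⟨ 2A≡pP ⟩
              ν p * P                      ≡⟨ cong (ν p *_) (trans P-odd (cong₂ (λ x y → (x + y) + 1ℚ) (proj₂ T-nat) (proj₂ T-nat))) ⟩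
              ν p * ((ν t + ν t) + 1ℚ)     ≡⟨ cong (ν p *_) (sym (trans (ν-+ (t ℕ.+ t) 1) (cong₂ _+_ (ν-+ t t) ι-1))) ⟩
              ν p * ν (t ℕ.+ t ℕ.+ 1)      ≡⟨ sym (ν-* p (t ℕ.+ t ℕ.+ 1)) ⟩
              ν (p ℕ.* (t ℕ.+ t ℕ.+ 1))    ∎))
              where open ≡-Reasoning
            parity : (2 ℕ.∣ p) ⊎ (2 ℕ.∣ t ℕ.+ t ℕ.+ 1) → ⊥
            parity (inj₁ 2∣p) = p≢2 (sym (prime∣prime prime[2] pp 2∣p))
            parity (inj₂ 2∣o) = ℕₚ.<⇒≢ (ℕₚ.≤-refl {2}) (sym (ℕ.∣1⇒≡1 (ℕ.∣m+n∣m⇒∣n 2∣o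
              (ℕ.divides t (trans (cong (t ℕ.+_) (sym (ℕₚ.+-identityʳ t))) (ℕₚ.*-comm 2 t))))))

      orthogonal⇒zero : ∀ a → f a ≡ + 0
      orthogonal⇒zero a = go (κ ℤ.≟ + 0) (unit? a)
        where
        go : Dec (κ ≡ + 0) → Dec (Unit a) → f a ≡ + 0
        go (no κ≢0) _         = ⊥-elim (Contradiction.impossible κ≢0)
        go (yes _)   (no ¬u)  = f-nonunit ¬u
        go (yes κ≡0) (yes u)  = by-sign (sign 1<p f f-cong f-odd f-nonunit orth u)
          where
          by-sign : (f a ≡ κ) ⊎ (f a ≡ ℤ.- κ) → f a ≡ + 0
          by-sign (inj₁ e) = trans e κ≡0
          by-sign (inj₂ e) = trans e (cong ℤ.-_ κ≡0)

-- Modulus p²: reduction to modulus p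

module SquareCase where

  open import Data.Empty using (⊥-elim)
  open import Data.Integer as ℤ using (ℤ; +_)
  import Data.Integer.DivMod as ℤ
  import Data.Integer.Properties as ℤₚ
  import Data.Integer.Tactic.RingSolver as ℤSolver
  open import Data.Integer.Divisibility.Signed as Signed using (divides; ∣⇒∣ᵤ)
  open import Data.List using (List; downFrom)
  open import Data.List.Properties using (length-downFrom)
  open import Data.List.Membership.Propositional using (_∈_)
  open import Data.List.Membership.Propositional.Properties using (∈-downFrom⁻; ∈-downFrom⁺)
  open import Data.List.Relation.Unary.Unique.Propositional.Properties using (downFrom⁺)
  open import Data.Nat as ℕ using (ℕ; zero; suc; NonZero)
  import Data.Nat.Properties as ℕₚ
  import Data.Nat.Divisibility as ℕ
  open import Data.Nat.Coprimality using (Coprime; coprime-divisor)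
  open import Data.Nat.Primality using (Prime; prime⇒nonZero; prime[2])
  open import Data.Product using (∃; _,_)
  open import Data.Rational hiding (NonZero; floor)
  open import Data.Rational.Properties
  open import Data.Sum using (_⊎_; inj₁; inj₂)
  open import Relation.Binary.PropositionalEquality
    using (_≡_; _≢_; refl; sym; trans; cong; cong₂; subst; subst₂; module ≡-Reasoning)
  open import Relation.Nullary using (Dec; yes; no; ¬_)
  open import Tactic.RingSolver using (solve-∀)
  open Rat
  open Mod
  open Tail using (ν*rec′)
  open Divisor using (∤⇒coprime; prime∣prime)
  open Quadratic
  open PrimeCase

  ∑-blocks : ∀ n k (G : ℕ → ℚ) → ∑ (downFrom (n ℕ.* k)) G ≡ ∑ (downFrom n) (λ i → ∑ (downFrom k) (λ a → G (a ℕ.+ i ℕ.* k)))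
  ∑-blocks zero    k G = trans (∑-[] G) (sym (∑-[] (λ i → ∑ (downFrom k) (λ a → G (a ℕ.+ i ℕ.* k)))))
  ∑-blocks (suc n) k G = trans (split k) (trans (cong (_+_ (∑ (downFrom k) (λ a → G (a ℕ.+ n ℕ.* k)))) (∑-blocks n k G))
      (sym (∑-∷ n (downFrom n) (λ i → ∑ (downFrom k) (λ a → G (a ℕ.+ i ℕ.* k))))))
    where
    N = n ℕ.* k
    split : ∀ j → ∑ (downFrom (j ℕ.+ N)) G ≡ ∑ (downFrom j) (λ a → G (a ℕ.+ N)) + ∑ (downFrom N) G
    split zero    = sym (zero-+ˡ (∑-[] (λ a → G (a ℕ.+ N))) refl)
    split (suc j) = trans (∑-∷ (j ℕ.+ N) (downFrom (j ℕ.+ N)) G) (trans (cong (_+_ (G (j ℕ.+ N))) (split j))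
      (trans (sym (+-assoc (G (j ℕ.+ N)) (∑ (downFrom j) (λ a → G (a ℕ.+ N))) (∑ (downFrom N) G)))
        (cong (_+ ∑ (downFrom N) G) (sym (∑-∷ j (downFrom j) (λ a → G (a ℕ.+ N)))))))

  module SquareModulus (p : ℕ) (pp : Prime p) (p≢2 : p ≢ 2) where

    private
      instance
        p≢0 : NonZero p
        p≢0 = prime⇒nonZero pp
        pp≢0 : NonZero (p ℕ.* p)
        pp≢0 = ℕₚ.m*n≢0 p p

    module 𝔭 = Modulo p
    module 𝔪 = Modulo (p ℕ.* p)
    module 𝔭P = PrimeModulus p pp p≢2
    module 𝔪U = Units (p ℕ.* p)
    open 𝔭 using () renaming (_~_ to _~ₚ_; _~?_ to _~ₚ?_)
    open 𝔪 using () renaming (_~_ to _~ₘ_)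

    1<pp : 1 ℕ.< p ℕ.* p
    1<pp = ℕₚ.<-≤-trans 𝔭P.1<p (ℕₚ.m≤m*n p p)

    ~ₘ⇒~ₚ : ∀ {a b} → a ~ₘ b → a ~ₚ b
    ~ₘ⇒~ₚ (𝔪.mk~ (divides q e)) = 𝔭.mk~ (divides (q ℤ.* + p) (trans e (trans (cong (λ z → q ℤ.* z) (ℤₚ.pos-* p p)) (sym (ℤₚ.*-assoc q (+ p) (+ p))))))

    -- Multiples of p see their cofactors only modulo p.
    *-~ₘ : ∀ a {b c} → a ~ₚ + 0 → b ~ₚ c → a ℤ.* b ~ₘ a ℤ.* c
    *-~ₘ a {b} {c} (𝔭.mk~ (divides q e)) (𝔭.mk~ (divides r f)) = 𝔪.mk~ (divides (q ℤ.* r) (trans (factor a b c)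
        (trans (cong₂ ℤ._*_ (trans (sym (ℤₚ.+-identityʳ a)) e) f) (trans (regroup q r (+ p)) (cong (λ z → q ℤ.* r ℤ.* z) (sym (ℤₚ.pos-* p p)))))))
      where
      factor : ∀ a b c → a ℤ.* b ℤ.- a ℤ.* c ≡ a ℤ.* (b ℤ.- c)
      factor = ℤSolver.solve-∀
      regroup : ∀ q r p → q ℤ.* p ℤ.* (r ℤ.* p) ≡ q ℤ.* r ℤ.* (p ℤ.* p)
      regroup = ℤSolver.solve-∀

    1≁0 : ¬ (+ 1 ~ₚ + 0)
    1≁0 e with 𝔭.residue-unique 𝔭P.1<p (ℕₚ.<-trans (ℕ.s≤s ℕ.z≤n) 𝔭P.1<p) e
    ... | ()

    unitₘ : ∀ {a} → ¬ (a ~ₚ + 0) → 𝔪.Unit a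
    unitₘ {a} a≁0 = 𝔪U.coprime⇒unit a coprime
      where
      base : Coprime ℤ.∣ a ∣ p
      base = ∤⇒coprime pp (λ d → a≁0 (𝔭P.∣⇒~0 {a} d))
      coprime : Coprime ℤ.∣ a ∣ (p ℕ.* p)
      coprime {d} (d∣a , d∣pp) = base (d∣a , coprime-divisor (λ { {e} (e∣d , e∣p) → base (ℕ.∣-trans e∣d d∣a , e∣p) }) d∣pp)

    nonunitₘ : ∀ {a} → ¬ 𝔪.Unit a → a ~ₚ + 0
    nonunitₘ {a} ¬u = go (a ~ₚ? + 0)
      where
      go : Dec (a ~ₚ + 0) → a ~ₚ + 0
      go (yes z) = z
      go (no z)  = ⊥-elim (¬u (unitₘ z))

    digits : ∀ r z → r ℕ.< p → 𝔪.⌊ + r ℤ.+ z ℤ.* + p ⌋ ≡ r ℕ.+ 𝔭.⌊ z ⌋ ℕ.* p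
    digits r z r<p = 𝔪.residue-unique (𝔪.⌊⌋<m (+ r ℤ.+ z ℤ.* + p)) bound
        (𝔪.~-trans (𝔪.~-sym (𝔪.~⌊⌋ (+ r ℤ.+ z ℤ.* + p))) (subst (+ r ℤ.+ z ℤ.* + p ~ₘ_)
          (trans (cong (λ y → + r ℤ.+ y) (trans (ℤₚ.*-comm (+ p) (+ 𝔭.⌊ z ⌋)) (sym (ℤₚ.pos-* 𝔭.⌊ z ⌋ p)))) (sym (ℤₚ.pos-+ r (𝔭.⌊ z ⌋ ℕ.* p))))
          (𝔪.~-+ {+ r} {+ r} {z ℤ.* + p} {+ p ℤ.* + 𝔭.⌊ z ⌋} 𝔪.~-refl
            (subst (_~ₘ + p ℤ.* + 𝔭.⌊ z ⌋) (ℤₚ.*-comm (+ p) z) (*-~ₘ (+ p) 𝔭.m~0 (𝔭.~⌊⌋ z))))))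
      where
      bound : r ℕ.+ 𝔭.⌊ z ⌋ ℕ.* p ℕ.< p ℕ.* p
      bound = ℕₚ.≤-trans (ℕₚ.+-monoˡ-≤ (𝔭.⌊ z ⌋ ℕ.* p) r<p) (ℕₚ.*-monoˡ-≤ p (𝔭.⌊⌋<m z))

    T : ℚ
    T = ∑ 𝔭.residues (λ i → ν i)

    -- The quotient of ja by p is carried into the leading digit. For fixed a that digit is
    -- therefore an affine function of k modulo p.
    digits′ : ∀ j a k → 𝔪.⌊ j ℤ.* + (a ℕ.+ k ℕ.* p) ⌋ ≡ 𝔭.⌊ j ℤ.* + a ⌋ ℕ.+ 𝔭.⌊ (j ℤ.* + a) ℤ./ℕ p ℤ.+ j ℤ.* + k ⌋ ℕ.* p
    digits′ j a k = trans (cong 𝔪.⌊_⌋ (begin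
      j ℤ.* + (a ℕ.+ k ℕ.* p)
        ≡⟨ cong (λ z → j ℤ.* z) (trans (ℤₚ.pos-+ a (k ℕ.* p)) (cong (λ z → + a ℤ.+ z) (ℤₚ.pos-* k p))) ⟩
      j ℤ.* (+ a ℤ.+ + k ℤ.* + p)
        ≡⟨ expand j (+ a) (+ k) (+ p) ⟩
      j ℤ.* + a ℤ.+ j ℤ.* + k ℤ.* + p
        ≡⟨ cong (λ z → z ℤ.+ j ℤ.* + k ℤ.* + p) (ℤ.a≡a%ℕn+[a/ℕn]*n (j ℤ.* + a) p) ⟩
      (+ r ℤ.+ e ℤ.* + p) ℤ.+ j ℤ.* + k ℤ.* + p
        ≡⟨ collect (+ r) e (j ℤ.* + k) (+ p) ⟩
      + r ℤ.+ (e ℤ.+ j ℤ.* + k) ℤ.* + p ∎)) (digits r (e ℤ.+ j ℤ.* + k) (𝔭.⌊⌋<m (j ℤ.* + a)))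
      where
      open ≡-Reasoning
      r = 𝔭.⌊ j ℤ.* + a ⌋
      e = (j ℤ.* + a) ℤ./ℕ p
      expand : ∀ j a k p → j ℤ.* (a ℤ.+ k ℤ.* p) ≡ j ℤ.* a ℤ.+ j ℤ.* k ℤ.* p
      expand = ℤSolver.solve-∀
      collect : ∀ r e y p → (r ℤ.+ e ℤ.* p) ℤ.+ y ℤ.* p ≡ r ℤ.+ (e ℤ.+ y) ℤ.* p
      collect = ℤSolver.solve-∀

    ⌊multiple⌋ : ∀ j k → 𝔪.⌊ j ℤ.* + (k ℕ.* p) ⌋ ≡ 𝔭.⌊ j ℤ.* + k ⌋ ℕ.* p
    ⌊multiple⌋ j k = trans (cong 𝔪.⌊_⌋ (trans (cong (λ z → j ℤ.* z) (ℤₚ.pos-* k p)) (trans (sym (ℤₚ.*-assoc j (+ k) (+ p)))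
      (sym (ℤₚ.+-identityˡ (j ℤ.* + k ℤ.* + p)))))) (digits 0 (j ℤ.* + k) (ℕₚ.<-trans (ℕ.s≤s ℕ.z≤n) 𝔭P.1<p))

    -- The leading digits of j (a + k p) run through all residues modulo p.
    fibre-sum : ∀ {j} → 𝔭.Unit j → ∀ a → ∑ 𝔭.residues (λ k → ν 𝔪.⌊ j ℤ.* + (a ℕ.+ k ℕ.* p) ⌋) ≡ ν p * ν 𝔭.⌊ j ℤ.* + a ⌋ + T * ν p
    fibre-sum {j} j-unit a = trans (∑-cong 𝔭.residues (λ k → trans (cong ν (digits′ j a k)) (trans (ν-+ r (s k ℕ.* p)) (cong (_+_ (ν r)) (ν-* (s k) p)))))
        (trans (∑-+ 𝔭.residues _ _) (cong₂ _+_ (trans (∑-const 𝔭.residues (ν r)) (cong (λ n → ν n * ν r) (length-downFrom p)))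
          (trans (sym (∑-*ʳ 𝔭.residues (ν p) _)) (cong (_* ν p) permuted))))
      where
      r = 𝔭.⌊ j ℤ.* + a ⌋
      e = (j ℤ.* + a) ℤ./ℕ p
      s : ℕ → ℕ
      s k = 𝔭.⌊ e ℤ.+ j ℤ.* + k ⌋
      permuted : ∑ 𝔭.residues (λ k → ν (s k)) ≡ T
      permuted = trans (𝔭.∑-affine {λ z → ν 𝔭.⌊ z ⌋} (λ e → cong ν (𝔭.⌊⌋-cong e)) e {j} j-unit)
        (∑-cong∈ 𝔭.residues (λ {i} i∈ → cong ν (𝔭.⌊⌋-small (∈-downFrom⁻ i∈))))

    module _ (F : ℤ → ℤ) (F-cong : 𝔪.Periodic F) (F-odd : ∀ z → F (ℤ.- z) ≡ ℤ.- F z)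
      (orth : ∀ t → 𝔪.Unit t → ∑ 𝔪.residues (λ b → ι (F (+ b)) * ν 𝔪.⌊ t ℤ.* + b ⌋) ≡ 0ℚ) where

      private
        module Difference (u : ℤ) (u~1 : u ~ₚ + 1) where

          f : ℤ → ℤ
          f z = F (u ℤ.* z) ℤ.- F z

          u-unit : 𝔪.Unit u
          u-unit = unitₘ (λ u~0 → 1≁0 (𝔭.~-trans (𝔭.~-sym u~1) u~0))

          u′ : ℤ
          u′ = 𝔪.Unit.inverse u-unit

          uu′ : u ℤ.* u′ ~ₘ + 1
          uu′ = 𝔪.Unit.isInverse u-unit

          u′~1 : u′ ~ₚ + 1
          u′~1 = 𝔭.~-trans (subst (_~ₚ u ℤ.* u′) (ℤₚ.*-identityˡ u′) (𝔭.~-*ʳ u′ (𝔭.~-sym u~1))) (~ₘ⇒~ₚ uu′)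

          absorb : ∀ z {v} → z ~ₚ + 0 → v ~ₚ + 1 → z ℤ.* v ~ₘ z
          absorb z {v} z~0 v~1 = subst (z ℤ.* v ~ₘ_) (ℤₚ.*-identityʳ z) (*-~ₘ z z~0 v~1)

          f-cong : 𝔪.Periodic f
          f-cong e = cong₂ ℤ._-_ (F-cong (𝔪.~-*ˡ u e)) (F-cong e)

          f-odd : ∀ z → f (ℤ.- z) ≡ ℤ.- f z
          f-odd z = trans (cong₂ ℤ._-_ (trans (cong F (sym (ℤₚ.neg-distribʳ-* u z))) (F-odd (u ℤ.* z))) (F-odd z)) (lemma (F (u ℤ.* z)) (F z))
            where
            lemma : ∀ x y → ℤ.- x ℤ.- ℤ.- y ≡ ℤ.- (x ℤ.- y)
            lemma = ℤSolver.solve-∀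

          -- A nonunit a is a multiple of p, so that ua ≡ a modulo p² follows from u ≡ 1 modulo p.
          f-nonunit : ∀ {a} → ¬ 𝔪.Unit a → f a ≡ + 0
          f-nonunit {a} ¬u = ℤₚ.i≡j⇒i-j≡0 (trans (cong F (ℤₚ.*-comm u a)) (F-cong (absorb a (nonunitₘ ¬u) u~1)))

          -- Substituting z = ub turns the first half into the relation for F at ju⁻¹. If j is a
          -- unit, both halves vanish by hypothesis; if p ∣ j, then ju⁻¹ ≡ j modulo p² and the
          -- halves are equal, whatever their value.
          f-orth : ∀ j → ∑ 𝔪.residues (λ b → ι (f (+ b)) * ν 𝔪.⌊ j ℤ.* + b ⌋) ≡ 0ℚ
          f-orth j = begin
            ∑ 𝔪.residues (λ b → ι (f (+ b)) * ν 𝔪.⌊ j ℤ.* + b ⌋)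
              ≡⟨ ∑-cong 𝔪.residues (λ b → trans (cong (_* ν 𝔪.⌊ j ℤ.* + b ⌋) (trans (ι-+ (F (u ℤ.* + b)) (ℤ.- F (+ b))) (cong (_+_ (ι (F (u ℤ.* + b)))) (ι-neg (F (+ b))))))
                   (expand (ι (F (u ℤ.* + b))) (ι (F (+ b))) (ν 𝔪.⌊ j ℤ.* + b ⌋))) ⟩
            ∑ 𝔪.residues (λ b → ι (F (u ℤ.* + b)) * ν 𝔪.⌊ j ℤ.* + b ⌋ + - (ι (F (+ b)) * ν 𝔪.⌊ j ℤ.* + b ⌋))
              ≡⟨ trans (∑-+ 𝔪.residues _ _) (cong₂ _+_ (trans (∑-cong 𝔪.residues (λ b → cong (λ r → ι (F (u ℤ.* + b)) * ν r) (𝔪.⌊⌋-cong (shift (+ b)))))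
                   (𝔪.∑-scale {H} (λ e → cong₂ (λ x y → ι x * ν y) (F-cong e) (𝔪.⌊⌋-cong (𝔪.~-*ˡ (j ℤ.* u′) e))) {u} u-unit)) (∑-neg 𝔪.residues _)) ⟩
            ∑ 𝔪.residues (λ b → H (+ b)) - ∑ 𝔪.residues (λ b → ι (F (+ b)) * ν 𝔪.⌊ j ℤ.* + b ⌋)
              ≡⟨ equal (𝔪U.unit? j) ⟩
            0ℚ ∎
            where
            open ≡-Reasoning
            H : ℤ → ℚ
            H z = ι (F z) * ν 𝔪.⌊ j ℤ.* u′ ℤ.* z ⌋
            expand : ∀ a b n → (a - b) * n ≡ a * n + - (b * n)
            expand = solve-∀ ℚring
            shift : ∀ z → j ℤ.* z ~ₘ j ℤ.* u′ ℤ.* (u ℤ.* z)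
            shift z = subst₂ _~ₘ_ (ℤₚ.*-identityʳ (j ℤ.* z)) (lemma j u u′ z) (𝔪.~-*ˡ (j ℤ.* z) (𝔪.~-sym uu′))
              where
              lemma : ∀ j u u′ z → j ℤ.* z ℤ.* (u ℤ.* u′) ≡ j ℤ.* u′ ℤ.* (u ℤ.* z)
              lemma = ℤSolver.solve-∀
            equal : Dec (𝔪.Unit j) → ∑ 𝔪.residues (λ b → H (+ b)) - ∑ 𝔪.residues (λ b → ι (F (+ b)) * ν 𝔪.⌊ j ℤ.* + b ⌋) ≡ 0ℚ
            equal (yes uj) = trans (cong₂ _-_ (orth (j ℤ.* u′) (𝔪.unit-* uj (u 𝔪., subst (_~ₘ + 1) (ℤₚ.*-comm u u′) uu′))) (orth j uj)) (+-inverseʳ 0ℚ)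
            equal (no ¬uj) = trans (cong (_- ∑ 𝔪.residues (λ b → ι (F (+ b)) * ν 𝔪.⌊ j ℤ.* + b ⌋)) (∑-cong 𝔪.residues (λ b →
                cong (λ r → ι (F (+ b)) * ν r) (𝔪.⌊⌋-cong (𝔪.~-*ʳ (+ b) (absorb j (nonunitₘ ¬uj) u′~1))))))
              (+-inverseʳ (∑ 𝔪.residues (λ b → ι (F (+ b)) * ν 𝔪.⌊ j ℤ.* + b ⌋)))

          κ : ℤ
          κ = f (+ 1)

          f-sign : ∀ z → 𝔪.Unit z → (f z ≡ κ) ⊎ (f z ≡ ℤ.- κ)
          f-sign z uz = 𝔪U.sign 1<pp f f-cong f-odd f-nonunit f-orth uz

          power : ℕ → ℤ
          power zero    = + 1
          power (suc n) = u ℤ.* power n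

          -- Modulo p² the binomial expansion of (1 + wp)^n stops after its linear term; at n = p
          -- this gives u^p ≡ 1.
          power~ : ∀ w → u ≡ + 1 ℤ.+ w ℤ.* + p → ∀ n → power n ~ₘ + 1 ℤ.+ + n ℤ.* (w ℤ.* + p)
          power~ w eq zero    = 𝔪.~-refl
          power~ w eq (suc n) = 𝔪.~-trans (𝔪.~-*ˡ u (power~ w eq n)) (𝔪.mk~ (divides (+ n ℤ.* w ℤ.* w)
              (trans (cong (λ z → z ℤ.* (+ 1 ℤ.+ + n ℤ.* (w ℤ.* + p)) ℤ.- (+ 1 ℤ.+ + suc n ℤ.* (w ℤ.* + p))) eq)
                (trans (lemma w (+ p) (+ n)) (cong (λ z → + n ℤ.* w ℤ.* w ℤ.* z) (sym (ℤₚ.pos-* p p)))))))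
            where
            lemma : ∀ w p n → (+ 1 ℤ.+ w ℤ.* p) ℤ.* (+ 1 ℤ.+ n ℤ.* (w ℤ.* p)) ℤ.- (+ 1 ℤ.+ (+ 1 ℤ.+ n) ℤ.* (w ℤ.* p)) ≡ n ℤ.* w ℤ.* w ℤ.* (p ℤ.* p)
            lemma = ℤSolver.solve-∀

          power-p : power p ~ₘ + 1
          power-p = go u~1
            where
            go : u ~ₚ + 1 → power p ~ₘ + 1
            go (𝔭.mk~ (divides w e)) = 𝔪.~-trans (power~ w (trans (lemma u) (cong (λ z → + 1 ℤ.+ z) e)) p)
                (subst (+ 1 ℤ.+ + p ℤ.* (w ℤ.* + p) ~ₘ_) (ℤₚ.+-identityʳ (+ 1)) (𝔪.~-+ {+ 1} {+ 1} {+ p ℤ.* (w ℤ.* + p)} {+ 0} 𝔪.~-refl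
                  (𝔪.mk~ (divides w (trans (ℤₚ.+-identityʳ (+ p ℤ.* (w ℤ.* + p))) (trans (lemma′ (+ p) w) (cong (λ z → w ℤ.* z) (sym (ℤₚ.pos-* p p)))))))))
              where
              lemma : ∀ u → u ≡ + 1 ℤ.+ (u ℤ.- + 1)
              lemma = ℤSolver.solve-∀
              lemma′ : ∀ p w → p ℤ.* (w ℤ.* p) ≡ w ℤ.* (p ℤ.* p)
              lemma′ = ℤSolver.solve-∀

          power-unit : ∀ n → 𝔪.Unit (power n)
          power-unit zero    = 𝔪.unit-1
          power-unit (suc n) = 𝔪.unit-* u-unit (power-unit n)

          -- `k` counts the steps F(u·u^i) - F(u^i) that equal -κ instead of κ.
          telescope : ∀ n → ∃ λ k → F (power n) ℤ.- F (+ 1) ≡ κ ℤ.* (+ n ℤ.- (k ℤ.+ k))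
          telescope zero    = + 0 , trans (ℤₚ.+-inverseʳ (F (+ 1))) (sym (ℤₚ.*-zeroʳ κ))
          telescope (suc n) = step (telescope n) (f-sign (power n) (power-unit n))
            where
            chain : ∀ a b c → a ℤ.- c ≡ (a ℤ.- b) ℤ.+ (b ℤ.- c)
            chain = ℤSolver.solve-∀
            plus : ∀ κ n k → κ ℤ.+ κ ℤ.* (n ℤ.- (k ℤ.+ k)) ≡ κ ℤ.* (+ 1 ℤ.+ n ℤ.- (k ℤ.+ k))
            plus = ℤSolver.solve-∀
            minus : ∀ κ n k → ℤ.- κ ℤ.+ κ ℤ.* (n ℤ.- (k ℤ.+ k)) ≡ κ ℤ.* (+ 1 ℤ.+ n ℤ.- (k ℤ.+ + 1 ℤ.+ (k ℤ.+ + 1)))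
            minus = ℤSolver.solve-∀
            step : (∃ λ k → F (power n) ℤ.- F (+ 1) ≡ κ ℤ.* (+ n ℤ.- (k ℤ.+ k))) → (f (power n) ≡ κ) ⊎ (f (power n) ≡ ℤ.- κ) →
              ∃ λ k → F (power (suc n)) ℤ.- F (+ 1) ≡ κ ℤ.* (+ suc n ℤ.- (k ℤ.+ k))
            step (k , e) (inj₁ s) = k , trans (chain (F (power (suc n))) (F (power n)) (F (+ 1))) (trans (cong₂ ℤ._+_ s e) (plus κ (+ n) k))
            step (k , e) (inj₂ s) = k ℤ.+ + 1 , trans (chain (F (power (suc n))) (F (power n)) (F (+ 1))) (trans (cong₂ ℤ._+_ s e) (minus κ (+ n) k))

          -- A sum of p terms ±κ vanishes, and p is odd.
          κ≡0 : κ ≡ + 0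
          κ≡0 = conclude (telescope p)
            where
            odd : ∀ k → + p ≢ k ℤ.+ k
            odd k e = p≢2 (sym (prime∣prime prime[2] pp (subst (2 ℕ.∣_) (cong ℤ.∣_∣ (sym e)) (∣⇒∣ᵤ {+ 2} {k ℤ.+ k} (divides k (lemma k))))))
              where
              lemma : ∀ k → k ℤ.+ k ≡ k ℤ.* + 2
              lemma = ℤSolver.solve-∀
            conclude : (∃ λ k → F (power p) ℤ.- F (+ 1) ≡ κ ℤ.* (+ p ℤ.- (k ℤ.+ k))) → κ ≡ + 0
            conclude (k , e) = by-cases (ℤₚ.i*j≡0⇒i≡0∨j≡0 κ (trans (sym e) (ℤₚ.i≡j⇒i-j≡0 (F-cong power-p))))
              where
              by-cases : (κ ≡ + 0) ⊎ (+ p ℤ.- (k ℤ.+ k) ≡ + 0) → κ ≡ + 0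
              by-cases (inj₁ z) = z
              by-cases (inj₂ z) = ⊥-elim (odd k (ℤₚ.i-j≡0⇒i≡j (+ p) (k ℤ.+ k) z))

          invariant : ∀ z → F (u ℤ.* z) ≡ F z
          invariant z = ℤₚ.i-j≡0⇒i≡j (F (u ℤ.* z)) (F z) (go (𝔪U.unit? z))
            where
            by-sign : (f z ≡ κ) ⊎ (f z ≡ ℤ.- κ) → f z ≡ + 0
            by-sign (inj₁ e) = trans e κ≡0
            by-sign (inj₂ e) = trans e (cong ℤ.-_ κ≡0)
            go : Dec (𝔪.Unit z) → f z ≡ + 0
            go (yes uz) = by-sign (f-sign z uz)
            go (no ¬u)  = f-nonunit ¬u

      -- As a is a unit modulo p², u = ba⁻¹ exists and is ≡ 1 modulo p; so F(b) = F(ua) = F(a).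
      reduction : ∀ {a b} → ¬ (a ~ₚ + 0) → a ~ₚ b → F a ≡ F b
      reduction {a} {b} a≁0 e = trans (sym (Difference.invariant u u~1 a)) (F-cong ua~b)
        where
        ua : 𝔪.Unit a
        ua = unitₘ a≁0
        a′ = 𝔪.Unit.inverse ua
        aa′ = 𝔪.Unit.isInverse ua
        u = b ℤ.* a′
        u~1 : u ~ₚ + 1
        u~1 = 𝔭.~-trans (𝔭.~-*ʳ a′ (𝔭.~-sym e)) (~ₘ⇒~ₚ aa′)
        ua~b : u ℤ.* a ~ₘ b
        ua~b = subst₂ _~ₘ_ (lemma b a a′) (ℤₚ.*-identityʳ b) (𝔪.~-*ˡ b aa′)
          where
          lemma : ∀ b a a′ → b ℤ.* (a ℤ.* a′) ≡ b ℤ.* a′ ℤ.* a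
          lemma = ℤSolver.solve-∀

      private
        F-0 : ∀ {z} → z ~ₘ + 0 → F z ≡ + 0
        F-0 {z} e = trans (F-cong e) (neg-self (F-odd (+ 0)))

        restrict : ∀ z → Dec (z ~ₚ + 0) → ℤ
        restrict z (yes _) = + 0
        restrict z (no _)  = F z

        -- All three depend on z modulo p only: `F₁` is F on the classes prime to p, by `reduction`,
        -- and `F₂` is F on the multiples of p. The prime case will give h = 0, that is F(pz) =
        -- -F(z).
        F₁ F₂ h : ℤ → ℤ
        F₁ z = restrict z (z ~ₚ? + 0)
        F₂ z = F (+ p ℤ.* z)
        h z = F₁ z ℤ.+ F₂ z

        F₁-0 : ∀ {z} → z ~ₚ + 0 → F₁ z ≡ + 0
        F₁-0 {z} e = go (z ~ₚ? + 0)
          where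
          go : ∀ d → restrict z d ≡ + 0
          go (yes _) = refl
          go (no n)  = ⊥-elim (n e)

        F₁-F : ∀ {z} → ¬ (z ~ₚ + 0) → F₁ z ≡ F z
        F₁-F {z} n = go (z ~ₚ? + 0)
          where
          go : ∀ d → restrict z d ≡ F z
          go (yes e) = ⊥-elim (n e)
          go (no _)  = refl

        F₁-cong : 𝔭.Periodic F₁
        F₁-cong {a} {b} e = go (a ~ₚ? + 0)
          where
          go : Dec (a ~ₚ + 0) → F₁ a ≡ F₁ b
          go (yes z) = trans (F₁-0 z) (sym (F₁-0 (𝔭.~-trans (𝔭.~-sym e) z)))
          go (no n)  = trans (F₁-F n) (trans (reduction n e) (sym (F₁-F (λ z → n (𝔭.~-trans e z)))))

        F₂-cong : 𝔭.Periodic F₂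
        F₂-cong e = F-cong (*-~ₘ (+ p) 𝔭.m~0 e)

        F₂-0 : ∀ {z} → z ~ₚ + 0 → F₂ z ≡ + 0
        F₂-0 {z} e = F-0 (subst (+ p ℤ.* z ~ₘ_) (ℤₚ.*-zeroʳ (+ p)) (*-~ₘ (+ p) 𝔭.m~0 e))

        neg~0 : ∀ {z} → ℤ.- z ~ₚ + 0 → z ~ₚ + 0
        neg~0 {z} e = subst (_~ₚ + 0) (ℤₚ.neg-involutive z) (𝔭.~-neg e)

        F₁-odd : ∀ z → F₁ (ℤ.- z) ≡ ℤ.- F₁ z
        F₁-odd z = go (z ~ₚ? + 0)
          where
          go : Dec (z ~ₚ + 0) → F₁ (ℤ.- z) ≡ ℤ.- F₁ z
          go (yes e) = trans (F₁-0 (𝔭.~-neg e)) (sym (cong ℤ.-_ (F₁-0 e)))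
          go (no n)  = trans (F₁-F (λ e → n (neg~0 e))) (trans (F-odd z) (cong ℤ.-_ (sym (F₁-F n))))

        F₂-odd : ∀ z → F₂ (ℤ.- z) ≡ ℤ.- F₂ z
        F₂-odd z = trans (cong F (sym (ℤₚ.neg-distribʳ-* (+ p) z))) (F-odd (+ p ℤ.* z))

        h-cong : 𝔭.Periodic h
        h-cong e = cong₂ ℤ._+_ (F₁-cong e) (F₂-cong e)

        h-odd : ∀ z → h (ℤ.- z) ≡ ℤ.- h z
        h-odd z = trans (cong₂ ℤ._+_ (F₁-odd z) (F₂-odd z)) (sym (ℤₚ.neg-distrib-+ (F₁ z) (F₂ z)))

        nonunit~0 : ∀ {a} → ¬ 𝔭.Unit a → a ~ₚ + 0
        nonunit~0 {a} ¬u = go (a ~ₚ? + 0)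
          where
          go : Dec (a ~ₚ + 0) → a ~ₚ + 0
          go (yes z) = z
          go (no n)  = ⊥-elim (¬u (𝔭P.nonzero⇒unit n))

        h-nonunit : ∀ {a} → ¬ 𝔭.Unit a → h a ≡ + 0
        h-nonunit ¬u = cong₂ ℤ._+_ (F₁-0 (nonunit~0 ¬u)) (F₂-0 (nonunit~0 ¬u))

        module Orthogonality (j : ℤ) (j-unit : 𝔭.Unit j) where

          V : ℕ → ℚ
          V a = ∑ 𝔭.residues (λ k → ι (F (+ (a ℕ.+ k ℕ.* p))) * ν 𝔪.⌊ j ℤ.* + (a ℕ.+ k ℕ.* p) ⌋)

          X : ℚ
          X = ∑ 𝔭.residues (λ k → ι (F₂ (+ k)) * ν 𝔭.⌊ j ℤ.* + k ⌋)

          V-unit : ∀ a → ¬ (+ a ~ₚ + 0) → V a ≡ ν p * (ι (F₁ (+ a)) * ν 𝔭.⌊ j ℤ.* + a ⌋) + ι (F₁ (+ a)) * (T * ν p)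
          V-unit a a≁0 = begin
            V a
              ≡⟨ trans (∑-cong 𝔭.residues (λ k → cong (λ x → ι x * ν 𝔪.⌊ j ℤ.* + (a ℕ.+ k ℕ.* p) ⌋) (F-fibre k))) (sym (∑-*ˡ 𝔭.residues (ι (F₁ (+ a))) _)) ⟩
            ι (F₁ (+ a)) * ∑ 𝔭.residues (λ k → ν 𝔪.⌊ j ℤ.* + (a ℕ.+ k ℕ.* p) ⌋)
              ≡⟨ cong (ι (F₁ (+ a)) *_) (fibre-sum j-unit a) ⟩
            ι (F₁ (+ a)) * (ν p * ν r + T * ν p)
              ≡⟨ lemma (ι (F₁ (+ a))) (ν p) (ν r) (T * ν p) ⟩
            ν p * (ι (F₁ (+ a)) * ν r) + ι (F₁ (+ a)) * (T * ν p) ∎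
            where
            open ≡-Reasoning
            r = 𝔭.⌊ j ℤ.* + a ⌋
            lemma : ∀ f p r t → f * (p * r + t) ≡ p * (f * r) + f * t
            lemma = solve-∀ ℚring
            F-fibre : ∀ k → F (+ (a ℕ.+ k ℕ.* p)) ≡ F₁ (+ a)
            F-fibre k = trans (sym (reduction a≁0 (𝔭.mk~ (divides (ℤ.- + k) (trans (cong (λ z → + a ℤ.- z) (trans (ℤₚ.pos-+ a (k ℕ.* p)) (cong (λ z → + a ℤ.+ z) (ℤₚ.pos-* k p))))
                (cancel (+ a) (+ k) (+ p))))))) (sym (F₁-F a≁0))
              where
              cancel : ∀ a k p → a ℤ.- (a ℤ.+ k ℤ.* p) ≡ ℤ.- k ℤ.* p
              cancel = ℤSolver.solve-∀

          V-zero : V 0 ≡ ν p * X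
          V-zero = trans (∑-cong 𝔭.residues (λ k → trans (cong₂ (λ x n → ι x * n) (cong F (trans (ℤₚ.pos-* k p) (ℤₚ.*-comm (+ k) (+ p)))) (value k))
              (lemma (ι (F₂ (+ k))) (ν 𝔭.⌊ j ℤ.* + k ⌋) (ν p)))) (sym (∑-*ˡ 𝔭.residues (ν p) _))
            where
            lemma : ∀ f n p → f * (n * p) ≡ p * (f * n)
            lemma = solve-∀ ℚring
            value : ∀ k → ν 𝔪.⌊ j ℤ.* + (0 ℕ.+ k ℕ.* p) ⌋ ≡ ν 𝔭.⌊ j ℤ.* + k ⌋ * ν p
            value k = trans (cong ν (⌊multiple⌋ j k)) (ν-* 𝔭.⌊ j ℤ.* + k ⌋ p)

          V-all : ∀ {a} → a ∈ 𝔭.residues → V a ≡ (ν p * (ι (F₁ (+ a)) * ν 𝔭.⌊ j ℤ.* + a ⌋) + ι (F₁ (+ a)) * (T * ν p)) + χ (a ℕ.≟ 0) * (ν p * X)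
          V-all {a} a∈ = go (a ℕ.≟ 0)
            where
            go : Dec (a ≡ 0) → V a ≡ (ν p * (ι (F₁ (+ a)) * ν 𝔭.⌊ j ℤ.* + a ⌋) + ι (F₁ (+ a)) * (T * ν p)) + χ (a ℕ.≟ 0) * (ν p * X)
            go (yes refl) = trans V-zero (sym (zero-+ˡ (trans (cong₂ _+_ (zero-*ʳ (ν p) (zero-*ˡ (ν 𝔭.⌊ j ℤ.* + 0 ⌋) F₁0)) (zero-*ˡ (T * ν p) F₁0)) (+-identityˡ 0ℚ))
                (χ-1 (0 ℕ.≟ 0) refl (ν p * X))))
              where
              F₁0 : ι (F₁ (+ 0)) ≡ 0ℚ
              F₁0 = trans (cong ι (F₁-0 𝔭.~-refl)) ι-0
            go (no a≢0) = trans (V-unit a (λ e → a≢0 (𝔭.residue-unique (∈-downFrom⁻ a∈) (ℕₚ.<-trans (ℕ.s≤s ℕ.z≤n) 𝔭P.1<p) e)))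
              (sym (zero-+ʳ refl (χ-0 (a ℕ.≟ 0) a≢0 (ν p * X))))

          F₁-sum : ∑ 𝔭.residues (λ a → ι (F₁ (+ a))) ≡ 0ℚ
          F₁-sum = self-negative (trans (sym (𝔭.∑-neg-index {λ z → ι (F₁ z)} (λ e → cong ι (F₁-cong e))))
            (trans (∑-cong 𝔭.residues (λ a → trans (cong ι (F₁-odd (+ a))) (ι-neg (F₁ (+ a))))) (∑-neg 𝔭.residues _)))

          Y : ℚ
          Y = ∑ 𝔭.residues (λ a → ι (F₁ (+ a)) * ν 𝔭.⌊ j ℤ.* + a ⌋)

          -- Sort the relation modulo p² by residues a modulo p. Over a ≢ 0 the function has the
          -- constant value F₁(a), and `fibre-sum` gives p⟨ja⟩ + Tp; the part with Tp drops out
          -- because F₁ is odd. The fibre over 0 gives pX.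
          total : ν p * (Y + X) ≡ 0ℚ
          total = begin
            ν p * (Y + X)
              ≡⟨ *-distribˡ-+ (ν p) Y X ⟩
            ν p * Y + ν p * X
              ≡⟨ cong₂ _+_ (sym (zero-+ʳ (sym (∑-*ˡ 𝔭.residues (ν p) _)) (trans (sym (∑-*ʳ 𝔭.residues (T * ν p) _)) (zero-*ˡ (T * ν p) F₁-sum))))
                   (sym (∑-one (λ a → a ℕ.≟ 0) (λ _ → ν p * X) (downFrom⁺ p) (∈-downFrom⁺ (ℕₚ.<-trans (ℕ.s≤s ℕ.z≤n) 𝔭P.1<p)) refl (λ _ e → e))) ⟩
            (∑ 𝔭.residues (λ a → ν p * (ι (F₁ (+ a)) * ν 𝔭.⌊ j ℤ.* + a ⌋)) + ∑ 𝔭.residues (λ a → ι (F₁ (+ a)) * (T * ν p))) + ∑ 𝔭.residues (λ a → χ (a ℕ.≟ 0) * (ν p * X))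
              ≡⟨ sym (trans (∑-cong∈ 𝔭.residues (λ a∈ → V-all a∈)) (trans (∑-+ 𝔭.residues _ _) (cong (_+ ∑ 𝔭.residues (λ a → χ (a ℕ.≟ 0) * (ν p * X))) (∑-+ 𝔭.residues _ _)))) ⟩
            ∑ 𝔭.residues V
              ≡⟨ sym (∑-swap 𝔭.residues 𝔭.residues _) ⟩
            ∑ 𝔭.residues (λ k → ∑ 𝔭.residues (λ a → ι (F (+ (a ℕ.+ k ℕ.* p))) * ν 𝔪.⌊ j ℤ.* + (a ℕ.+ k ℕ.* p) ⌋))
              ≡⟨ sym (∑-blocks p p (λ b → ι (F (+ b)) * ν 𝔪.⌊ j ℤ.* + b ⌋)) ⟩
            ∑ 𝔪.residues (λ b → ι (F (+ b)) * ν 𝔪.⌊ j ℤ.* + b ⌋)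
              ≡⟨ orth j (unitₘ (unit≁0 j-unit)) ⟩
            0ℚ ∎
            where
            open ≡-Reasoning
            unit≁0 : ∀ {a} → 𝔭.Unit a → ¬ (a ~ₚ + 0)
            unit≁0 {a} (a′ 𝔭., e) a~0 = 1≁0 (𝔭.~-trans (𝔭.~-sym e) (𝔭.~-*ʳ a′ a~0))

          conclusion : ∑ 𝔭.residues (λ a → ι (h (+ a)) * ν 𝔭.⌊ j ℤ.* + a ⌋) ≡ 0ℚ
          conclusion = trans (∑-cong 𝔭.residues (λ a → trans (cong (_* ν 𝔭.⌊ j ℤ.* + a ⌋) (ι-+ (F₁ (+ a)) (F₂ (+ a))))
              (*-distribʳ-+ (ν 𝔭.⌊ j ℤ.* + a ⌋) (ι (F₁ (+ a))) (ι (F₂ (+ a)))))) (trans (∑-+ 𝔭.residues _ _) (cancel-p total))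
            where
            cancel-p : ∀ {x} → ν p * x ≡ 0ℚ → x ≡ 0ℚ
            cancel-p {x} e = trans (sym (*-identityˡ x)) (trans (cong (_* x) (trans (sym (ν*rec′ (ℕₚ.<⇒≤ 𝔭P.1<p))) (*-comm (ν p) (rec p))))
              (trans (*-assoc (rec p) (ν p) x) (zero-*ʳ (rec p) e)))

        h-orth : ∀ j → ∑ 𝔭.residues (λ a → ι (h (+ a)) * ν 𝔭.⌊ j ℤ.* + a ⌋) ≡ 0ℚ
        h-orth j = go (j ~ₚ? + 0)
          where
          go : Dec (j ~ₚ + 0) → ∑ 𝔭.residues (λ a → ι (h (+ a)) * ν 𝔭.⌊ j ℤ.* + a ⌋) ≡ 0ℚ
          go (no n)  = Orthogonality.conclusion j (𝔭P.nonzero⇒unit n)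
          go (yes z) = ∑-zero∈ 𝔭.residues (λ {a} _ → zero-*ʳ (ι (h (+ a))) (trans (cong ν (𝔭.⌊⌋≡0 (𝔭.~-*ʳ (+ a) z))) ι-0))

      antisymmetry : ∀ a → ¬ (a ~ₚ + 0) → F (+ p ℤ.* a) ≡ ℤ.- F a
      antisymmetry a a≁0 = solve-for (F a) (F₂ a) (trans (cong (λ z → z ℤ.+ F₂ a) (sym (F₁-F a≁0))) (𝔭P.orthogonal⇒zero h h-cong h-odd h-nonunit h-orth a))
        where
        solve-for : ∀ x y → x ℤ.+ y ≡ + 0 → y ≡ ℤ.- x
        solve-for x y e = trans (lemma x y) (trans (cong (λ z → z ℤ.- x) e) (ℤₚ.+-identityˡ (ℤ.- x)))
          where
          lemma : ∀ x y → y ≡ x ℤ.+ y ℤ.- x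
          lemma = ℤSolver.solve-∀

-- Strictly increasing lists as finite sets

module SortedLists where

  open import Data.List using (List; []; _∷_; length)
  open import Data.List.Membership.Propositional using (_∈_)
  open import Data.List.Relation.Binary.Permutation.Propositional using (↭-sym)
  open import Data.List.Relation.Binary.Permutation.Setoid.Properties using (Unique-resp-↭)
  import Data.List.Relation.Binary.Permutation.Propositional as ↭
  open import Data.List.Relation.Binary.Pointwise using (Pointwise-≡⇒≡)
  open import Data.List.Relation.Binary.Sublist.Propositional using (_⊆_; []; _∷_; _∷ʳ_; minimum)
  open import Data.List.Relation.Binary.Sublist.Heterogeneous.Properties using (toPointwise)
  open import Data.List.Relation.Binary.Sublist.Propositional.Properties using (All-resp-⊆)
  open import Data.List.Relation.Unary.All as All using (All; []; _∷_)
  open import Data.List.Relation.Unary.AllPairs as AllPairs using (AllPairs; []; _∷_)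
  open import Data.List.Relation.Unary.Any using (here; there)
  open import Data.List.Relation.Unary.Linked using (Linked)
  open import Data.List.Relation.Unary.Linked.Properties using (Linked⇒AllPairs)
  open import Data.List.Relation.Unary.Unique.Propositional using (Unique)
  open import Data.Empty using (⊥-elim)
  open import Data.Nat using (ℕ; _<_; _≟_)
  open import Data.Nat.Properties using (≤-decTotalOrder; <-irrefl; <-trans; ≤-trans; <⇒≢; ≤∧≢⇒<)
  open import Data.List.Sort ≤-decTotalOrder using (sort; sort-↭; sort-↗)
  open import Data.Product using (_,_)
  open import Relation.Binary.PropositionalEquality using (_≡_; refl; setoid)
  open import Relation.Nullary using (yes; no)

  Increasing : List ℕ → Set
  Increasing = AllPairs _<_

  increasing⇒unique : ∀ {xs} → Increasing xs → Unique xs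
  increasing⇒unique = AllPairs.map <⇒≢

  -- Parts of a tuple are sublists, so an inclusion of sets has to be turned into an
  -- order-preserving embedding; strict monotonicity of both lists makes the embedding exist.
  ∈⇒⊆ : ∀ {xs ys} → Increasing xs → Increasing ys → (∀ {x} → x ∈ xs → x ∈ ys) → xs ⊆ ys
  ∈⇒⊆ {[]} {ys} [] _ _ = minimum ys
  ∈⇒⊆ {x ∷ xs} {[]} _ _ sub with sub (here refl)
  ... | ()
  ∈⇒⊆ {x ∷ xs} {y ∷ ys} (x< ∷ inc) (y< ∷ inc′) sub with x ≟ y
  ... | yes refl = refl ∷ ∈⇒⊆ inc inc′ tail
    where
    tail : ∀ {z} → z ∈ xs → z ∈ ys
    tail z∈ with sub (there z∈)
    ... | here refl = ⊥-elim (<-irrefl refl (All.lookup x< z∈))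
    ... | there z∈′ = z∈′
  ... | no x≢y = y ∷ʳ ∈⇒⊆ (x< ∷ inc) inc′ rest
    where
    x∈ys : x ∈ ys
    x∈ys with sub (here refl)
    ... | here x≡y = ⊥-elim (x≢y x≡y)
    ... | there x∈ = x∈
    rest : ∀ {z} → z ∈ x ∷ xs → z ∈ ys
    rest (here refl) = x∈ys
    rest (there z∈) with sub (there z∈)
    ... | there z∈′ = z∈′
    ... | here refl = ⊥-elim (<-irrefl refl (<-trans (All.lookup x< z∈) (All.lookup y< x∈ys)))

  ⊆-length⇒≡ : ∀ {xs ys : List ℕ} → xs ⊆ ys → length xs ≡ length ys → xs ≡ ys
  ⊆-length⇒≡ xs⊆ys eq = Pointwise-≡⇒≡ (toPointwise eq xs⊆ys)

  sort-increasing : ∀ {xs} → Unique xs → Increasing (sort xs)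
  sort-increasing {xs} u = AllPairs.zipWith (λ (x≤y , x≢y) → ≤∧≢⇒< x≤y x≢y)
    (Linked⇒AllPairs ≤-trans (sort-↗ xs) , Unique-resp-↭ (setoid ℕ) (↭.↭⇒↭ₛ (↭-sym (sort-↭ xs))) u)

  unique-⊆ : ∀ {xs ys : List ℕ} → xs ⊆ ys → Unique ys → Unique xs
  unique-⊆ []           []       = []
  unique-⊆ (y ∷ʳ xs⊆)   (_ ∷ u)  = unique-⊆ xs⊆ u
  unique-⊆ (refl ∷ xs⊆) (x∉ ∷ u) = All-resp-⊆ xs⊆ x∉ ∷ unique-⊆ xs⊆ u

-- The odd function attached to a tuple

module Indicator where

  open import Data.Empty using (⊥-elim)
  open import Data.Integer as ℤ using (ℤ; +_)
  import Data.Integer.Properties as ℤₚ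
  import Data.Integer.Tactic.RingSolver as ℤSolver
  open import Data.List using (List; []; _∷_; map)
  open import Data.List.Membership.Propositional using (_∈_)
  open import Data.List.Membership.Propositional.Properties using (∈-downFrom⁺; ∈-downFrom⁻)
  open import Data.List.Relation.Unary.All as All using ()
  open import Data.List.Relation.Unary.Linked.Properties using (Linked⇒AllPairs)
  open import Data.List.Relation.Unary.Unique.Propositional using (Unique)
  open import Data.List.Relation.Unary.Unique.Propositional.Properties using (downFrom⁺)
  open import Data.Nat as ℕ using (ℕ; zero; suc; NonZero)
  open import Data.Nat.Coprimality using (Coprime)
  open import Data.Nat.ListAction using (sum)
  import Data.Nat.Divisibility as ℕ
  import Data.Nat.Properties as ℕₚ
  open import Data.List.Membership.DecPropositional ℕ._≟_ using (_∈?_)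
  open import Data.Product using (_,_; proj₁; proj₂)
  open import Data.Rational hiding (NonZero; floor)
  open import Data.Rational.Properties
  open import Relation.Binary.PropositionalEquality
    using (_≡_; refl; sym; trans; cong; cong₂; subst; module ≡-Reasoning)
  open import Relation.Nullary using (Dec; yes; no; ¬_)
  open import Tactic.RingSolver using (solve-∀)
  open import Defs
  open Rat
  open Mod
  open Quadratic using (module Units)
  open SortedLists

  ∑-∈? : ∀ {xs ys} → Unique xs → Unique ys → (∀ {x} → x ∈ ys → x ∈ xs) → (g : ℕ → ℚ) →
    ∑ xs (λ x → χ (x ∈? ys) * g x) ≡ ∑ ys g
  ∑-∈? {xs} {ys} u v ys⊆xs g = begin
    ∑ xs (λ x → χ (x ∈? ys) * g x)
      ≡⟨ ∑-cong xs (λ x → by-membership x (x ∈? ys)) ⟩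
    ∑ xs (λ x → ∑ ys (λ y → χ (y ℕ.≟ x) * g y))
      ≡⟨ ∑-swap xs ys _ ⟩
    ∑ ys (λ y → ∑ xs (λ x → χ (y ℕ.≟ x) * g y))
      ≡⟨ ∑-cong∈ ys (λ {y} y∈ → ∑-one (λ x → y ℕ.≟ x) (λ _ → g y) u (ys⊆xs y∈) refl (λ _ e → sym e)) ⟩
    ∑ ys g ∎
    where
    open ≡-Reasoning
    by-membership : ∀ x (d : Dec (x ∈ ys)) → χ d * g x ≡ ∑ ys (λ y → χ (y ℕ.≟ x) * g y)
    by-membership x (yes x∈) = trans (*-identityˡ (g x)) (sym (∑-one (λ y → y ℕ.≟ x) g v x∈ refl (λ _ e → e)))
    by-membership x (no x∉)  = trans (zero-*ˡ (g x) refl) (sym (∑-none (λ y → y ℕ.≟ x) g ys (λ { y∈ refl → x∉ y∈ })))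

  ν-sum : ∀ (f : ℕ → ℕ) xs → ν (sum (map f xs)) ≡ ∑ xs (λ x → ν (f x))
  ν-sum f []       = trans ι-0 (sym (∑-[] (λ x → ν (f x))))
  ν-sum f (x ∷ xs) = trans (ν-+ (f x) (sum (map f xs))) (trans (cong (_+_ (ν (f x))) (ν-sum f xs)) (sym (∑-∷ x xs (λ x → ν (f x)))))

  ⟨⟩≡% : ∀ x m .{{_ : NonZero m}} → ⟨ x ⟩ m ≡ x ℕ.% m
  ⟨⟩≡% x (suc m) = refl

  module Weights (m : ℕ) .{{m≢0 : NonZero m}} (1<m : 1 ℕ.< m) where

    open Modulo m
    open Units m using (unit⇒coprime; coprime⇒unit)

    ⟨⟩≡⌊⌋ : ∀ t b → ⟨ t ℕ.* b ⟩ m ≡ ⌊ + t ℤ.* + b ⌋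
    ⟨⟩≡⌊⌋ t b = trans (⟨⟩≡% (t ℕ.* b) m) (cong ⌊_⌋ (ℤₚ.pos-* t b))

    module Tuple {d : ℕ} {β : List ℕ} (inB : InB m d β) where

      open InB inB

      β-increasing : Increasing β
      β-increasing = Linked⇒AllPairs ℕₚ.<-trans increasing

      entry≥1 : ∀ {b} → b ∈ β → 1 ℕ.≤ b
      entry≥1 b∈ = proj₁ (All.lookup bounds b∈)

      entry<m : ∀ {b} → b ∈ β → b ℕ.< m
      entry<m {b} b∈ = subst (suc b ℕ.≤_) (ℕₚ.suc-pred m) (ℕ.s≤s (proj₂ (All.lookup bounds b∈)))

      indicator : ∀ {P : Set} → Dec P → ℤ
      indicator (yes _) = + 1
      indicator (no _)  = + 0

      F : ℤ → ℤ
      F z = indicator (⌊ z ⌋ ∈? β) ℤ.- indicator (⌊ ℤ.- z ⌋ ∈? β)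

      F-cong : Periodic F
      F-cong e = cong₂ (λ x y → indicator (x ∈? β) ℤ.- indicator (y ∈? β)) (⌊⌋-cong e) (⌊⌋-cong (~-neg e))

      F-odd : ∀ z → F (ℤ.- z) ≡ ℤ.- F z
      F-odd z = trans (cong (λ w → indicator (⌊ ℤ.- z ⌋ ∈? β) ℤ.- indicator (⌊ w ⌋ ∈? β)) (ℤₚ.neg-involutive z))
        (lemma (indicator (⌊ ℤ.- z ⌋ ∈? β)) (indicator (⌊ z ⌋ ∈? β)))
        where
        lemma : ∀ x y → x ℤ.- y ≡ ℤ.- (y ℤ.- x)
        lemma = ℤSolver.solve-∀

      F≡1⇒∈ : ∀ z → F z ≡ + 1 → ⌊ z ⌋ ∈ β
      F≡1⇒∈ z = go (⌊ z ⌋ ∈? β) (⌊ ℤ.- z ⌋ ∈? β)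
        where
        go : (d : Dec (⌊ z ⌋ ∈ β)) (e : Dec (⌊ ℤ.- z ⌋ ∈ β)) → indicator d ℤ.- indicator e ≡ + 1 → ⌊ z ⌋ ∈ β
        go (yes z∈) _       _ = z∈
        go (no _)   (yes _) ()
        go (no _)   (no _)  ()

      ∈⇒F≡1 : ∀ {b} → b ∈ β → ¬ (⌊ ℤ.- + b ⌋ ∈ β) → F (+ b) ≡ + 1
      ∈⇒F≡1 {b} b∈ -b∉ = go (⌊ + b ⌋ ∈? β) (⌊ ℤ.- + b ⌋ ∈? β)
        where
        go : (d : Dec (⌊ + b ⌋ ∈ β)) (e : Dec (⌊ ℤ.- + b ⌋ ∈ β)) → indicator d ℤ.- indicator e ≡ + 1
        go _        (yes -b∈) = ⊥-elim (-b∉ -b∈)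
        go (yes _)  (no _)    = refl
        go (no b∉)  (no _)    = ⊥-elim (b∉ (subst (_∈ β) (sym (⌊⌋-small (entry<m b∈))) b∈))

      private
        ι-indicator : ∀ {P : Set} (d : Dec P) → ι (indicator d) ≡ χ d
        ι-indicator (yes _) = ι-1
        ι-indicator (no _)  = ι-0

        weight-unit : ∀ t → Unit t → ∑ β (λ b → ν ⌊ t ℤ.* + b ⌋) ≡ ν (d ℕ.* m)
        weight-unit t u = trans (∑-cong β (λ b → cong ν (trans (⌊⌋-cong (~-*ʳ (+ b) (~⌊⌋ t))) (sym (⟨⟩≡⌊⌋ ⌊ t ⌋ b)))))
            (trans (sym (ν-sum (λ b → ⟨ ⌊ t ⌋ ℕ.* b ⟩ m) β))
              (cong ν (weight ⌊ t ⌋ (nonzero ⌊ t ⌋ coprime) (⌊⌋<m t) coprime)))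
          where
          coprime : Coprime ⌊ t ⌋ m
          coprime = unit⇒coprime {+ ⌊ t ⌋} (unit-resp (~⌊⌋ t) u)
          nonzero : ∀ r → Coprime r m → 1 ℕ.≤ r
          nonzero zero    c = ⊥-elim (ℕₚ.<⇒≢ 1<m (sym (c (m ℕ.∣0 , ℕ.∣-refl))))
          nonzero (suc _) _ = ℕ.s≤s ℕ.z≤n

      private
        S : ℤ → ℚ
        S t = ∑ residues (λ b → χ (⌊ + b ⌋ ∈? β) * ν ⌊ t ℤ.* + b ⌋)

        S-β : ∀ t → S t ≡ ∑ β (λ b → ν ⌊ t ℤ.* + b ⌋)
        S-β t = trans (∑-cong∈ residues (λ {b} b∈ → cong (λ x → χ (x ∈? β) * ν ⌊ t ℤ.* + b ⌋) (⌊⌋-small (∈-downFrom⁻ b∈))))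
          (∑-∈? (downFrom⁺ m) (increasing⇒unique β-increasing) (λ b∈ → ∈-downFrom⁺ (entry<m b∈)) (λ b → ν ⌊ t ℤ.* + b ⌋))

      -- With t also -t is a unit, so the weights at t and -t are both dm. Replacing b by -b in the
      -- second sum shows that their difference is the sum of F(b)⟨tb⟩.
      orthogonality : ∀ t → Unit t → ∑ residues (λ b → ι (F (+ b)) * ν ⌊ t ℤ.* + b ⌋) ≡ 0ℚ
      orthogonality t u = begin
        ∑ residues (λ b → ι (F (+ b)) * ν ⌊ t ℤ.* + b ⌋)
          ≡⟨ ∑-cong residues (λ b → trans (cong (_* ν ⌊ t ℤ.* + b ⌋) (trans (ι-+ (indicator (⌊ + b ⌋ ∈? β)) (ℤ.- indicator (⌊ ℤ.- + b ⌋ ∈? β)))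
               (cong₂ _+_ (ι-indicator (⌊ + b ⌋ ∈? β)) (trans (ι-neg (indicator (⌊ ℤ.- + b ⌋ ∈? β))) (cong -_ (ι-indicator (⌊ ℤ.- + b ⌋ ∈? β)))))))
               (trans (expand (χ (⌊ + b ⌋ ∈? β)) (χ (⌊ ℤ.- + b ⌋ ∈? β)) (ν ⌊ t ℤ.* + b ⌋))
                 (cong (λ x → χ (⌊ + b ⌋ ∈? β) * ν ⌊ t ℤ.* + b ⌋ + - (χ (⌊ ℤ.- + b ⌋ ∈? β) * ν ⌊ x ⌋)) (reverse-sign t (+ b))))) ⟩
        ∑ residues (λ b → χ (⌊ + b ⌋ ∈? β) * ν ⌊ t ℤ.* + b ⌋ + - H (ℤ.- + b))
          ≡⟨ trans (∑-+ residues _ _) (cong (_+_ (S t)) (trans (∑-neg residues _) (cong -_ (∑-neg-index {H} H-cong)))) ⟩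
        S t - S (ℤ.- t)
          ≡⟨ cong₂ _-_ (trans (S-β t) (weight-unit t u)) (trans (S-β (ℤ.- t)) (weight-unit (ℤ.- t) (unit-neg u))) ⟩
        ν (d ℕ.* m) - ν (d ℕ.* m)
          ≡⟨ +-inverseʳ (ν (d ℕ.* m)) ⟩
        0ℚ ∎
        where
        open ≡-Reasoning
        H : ℤ → ℚ
        H z = χ (⌊ z ⌋ ∈? β) * ν ⌊ ℤ.- t ℤ.* z ⌋
        H-cong : Periodic H
        H-cong e = cong₂ (λ x y → χ (x ∈? β) * ν y) (⌊⌋-cong e) (⌊⌋-cong (~-*ˡ (ℤ.- t) e))
        expand : ∀ x y n → (x - y) * n ≡ x * n + - (y * n)
        expand = solve-∀ ℚring
        reverse-sign : ∀ t b → t ℤ.* b ≡ ℤ.- t ℤ.* (ℤ.- b)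
        reverse-sign = ℤSolver.solve-∀

-- The tuples β_i and the classification of indecomposable tuples

module Tuples where

  open import Data.Empty using (⊥; ⊥-elim)
  open import Data.Integer as ℤ using (ℤ; +_)
  import Data.Integer.Properties as ℤₚ
  import Data.Integer.Tactic.RingSolver as ℤSolver
  open import Data.Integer.Divisibility.Signed as Signed using (divides; ∣⇒∣ᵤ)
  open import Data.List using (List; []; _∷_; [_]; _++_; downFrom; upTo; map; length)
  open import Data.List.Properties using (reverse-upTo; length-++; length-map; length-upTo; map-id-local)
  open import Data.List.Membership.Propositional using (_∈_)
  open import Data.List.Membership.Propositional.Properties
    using (∈-map⁺; ∈-map⁻; ∈-++⁺ˡ; ∈-++⁻; ∈-upTo⁺; ∈-upTo⁻)
  open import Data.List.Relation.Binary.Permutation.Propositional using (_↭_; ↭-refl; ↭-sym; ↭-trans)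
  open import Data.List.Relation.Binary.Permutation.Propositional.Properties
    using (∈-resp-↭; ↭-length; ↭-reverse; map⁺; ++⁺ʳ)
  open import Data.List.Relation.Binary.Sublist.Propositional using (_⊆_; _∷_; from∈; lookup)
  open import Data.List.Relation.Binary.Sublist.Heterogeneous.Properties using (length-mono-≤)
  open import Data.List.Relation.Unary.All as All using (All; []; _∷_)
  open import Data.List.Relation.Unary.AllPairs using ([]; _∷_)
  open import Data.List.Relation.Unary.Any using (here; there)
  open import Data.List.Relation.Unary.Linked.Properties using (AllPairs⇒Linked)
  open import Data.List.Relation.Unary.Unique.Propositional using (Unique)
  open import Data.List.Relation.Unary.Unique.Propositional.Properties as Uniqueₚ using (upTo⁺)
  open import Data.Nat as ℕ using (ℕ; zero; suc; NonZero)
  import Data.Nat.Properties as ℕₚ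
  import Data.Nat.Divisibility as ℕ
  import Data.Nat.DivMod as ℕ
  open import Data.List.Membership.DecPropositional ℕ._≟_ using (_∈?_)
  open import Data.List.Sort ℕₚ.≤-decTotalOrder using (sort-↭)
  open import Data.Nat.Coprimality using (Coprime; 1-coprimeTo)
  open import Data.Nat.ListAction using (sum)
  open import Data.Nat.ListAction.Properties using (sum-↭)
  open import Data.Nat.Primality using (Prime; prime⇒nonZero; euclidsLemma; prime[2])
  open import Data.Product using (∃; _×_; _,_; proj₁; proj₂)
  open import Data.Rational using (1ℚ; _+_; _*_; -_; _-_)
  open import Data.Rational.Properties
  open import Data.Sum using (_⊎_; inj₁; inj₂)
  open import Relation.Binary.Definitions using (tri<; tri≈; tri>)
  open import Relation.Binary.PropositionalEquality
    using (_≡_; _≢_; refl; sym; trans; cong; cong₂; subst; subst₂; module ≡-Reasoning)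
  open import Relation.Nullary using (Dec; yes; no; ¬_)
  open import Tactic.RingSolver using (solve-∀)
  open import Defs
  open Rat
  open Mod
  open Divisor using (prime∣prime)
  open PrimeCase using (⌊-⌋)
  open SquareCase
  open SortedLists
  open Indicator

  upTo↭downFrom : ∀ n → upTo n ↭ downFrom n
  upTo↭downFrom n = subst (upTo n ↭_) (reverse-upTo n) (↭-sym (↭-reverse (upTo n)))

  even∨odd : ∀ n → (2 ℕ.∣ n) ⊎ (2 ℕ.∣ suc n)
  even∨odd zero    = inj₁ (2 ℕ.∣0)
  even∨odd (suc n) with even∨odd n
  ... | inj₁ (ℕ.divides q refl) = inj₂ (ℕ.divides (suc q) refl)
  ... | inj₂ e = inj₁ e

  halve : ∀ {x y} → x + x ≡ y + y → x ≡ y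
  halve {x} {y} e = trans (restore x y) (trans (cong (_+ y) (self-negative {x - y} (trans (split x y) (trans (cong (λ z → z - x - y) e) (negate x y))))) (+-identityˡ y))
    where
    restore : ∀ x y → x ≡ (x - y) + y
    restore = solve-∀ ℚring
    split : ∀ x y → x - y ≡ x + x - x - y
    split = solve-∀ ℚring
    negate : ∀ x y → y + y - x - y ≡ - (x - y)
    negate = solve-∀ ℚring

  triangular : ∀ n → ∑ (downFrom n) ν + ∑ (downFrom n) ν + ν n ≡ ν n * ν n
  triangular zero    = trans (cong₂ (λ x y → x + x + y) (∑-[] ν) ι-0) (sym (zero-*ˡ (ν 0) ι-0))
  triangular (suc n) = trans (cong₂ (λ x y → x + x + y) (∑-∷ n (downFrom n) ν) (ν-suc n))
    (trans (regroup (ν n) (∑ (downFrom n) ν)) (trans (cong (_+ (ν n + ν n + 1ℚ)) (triangular n)) (trans (square (ν n)) (sym (cong₂ _*_ (ν-suc n) (ν-suc n))))))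
    where
    regroup : ∀ n t → (n + t) + (n + t) + (1ℚ + n) ≡ (t + t + n) + (n + n + 1ℚ)
    regroup = solve-∀ ℚring
    square : ∀ n → n * n + (n + n + 1ℚ) ≡ (1ℚ + n) * (1ℚ + n)
    square = solve-∀ ℚring

  NoEvenPart : ℕ → List ℕ → Set
  NoEvenPart m β = ∀ s → s ⊆ β → 1 ℕ.≤ length s → length s ℕ.< length β → 2 ℕ.∣ length s → ¬ (m ℕ.∣ sum s)

  -- The first pair of a pairing would itself be an even part with sum divisible by m, and a proper
  -- one as there are more than two entries.
  noEvenPart⇒exceptional : ∀ {m β} → 2 ℕ.< length β → NoEvenPart m β → Exceptional m β
  noEvenPart⇒exceptional {m} 2<len indec (pair {x} {y} {xs} xs↭ m∣x+y _) = indec (x ∷ y ∷ [])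
    (refl ∷ from∈ (∈-resp-↭ (↭-sym xs↭) (here refl))) (ℕ.s≤s ℕ.z≤n) 2<len ℕ.∣-refl
    (subst (λ z → m ℕ.∣ x ℕ.+ z) (sym (ℕₚ.+-identityʳ y)) m∣x+y)

  module Congruence (p : ℕ) .{{p≢0 : NonZero p}} where

    open Modulo p

    sum~ : ∀ {i} xs → (∀ {x} → x ∈ xs → + x ~ + i) → + sum xs ~ + length xs ℤ.* + i
    sum~ {i} [] _ = ~-reflexive (sym (ℤₚ.*-zeroˡ (+ i)))
    sum~ {i} (x ∷ xs) x~i = subst₂ _~_ (sym (ℤₚ.pos-+ x (sum xs))) (sym (trans (cong (λ z → z ℤ.* + i) (ℤₚ.pos-+ 1 (length xs))) (lemma (+ length xs) (+ i))))
        (~-+ {+ x} {+ i} {+ sum xs} {+ length xs ℤ.* + i} (x~i (here refl)) (sum~ xs (λ x∈ → x~i (there x∈))))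
      where
      lemma : ∀ l i → (+ 1 ℤ.+ l) ℤ.* i ≡ i ℤ.+ l ℤ.* i
      lemma = ℤSolver.solve-∀

    -- Uniqueness ensures that y is met only once, so exactly one entry drops out of the count.
    sum~-except : ∀ {i y} xs → Unique xs → y ∈ xs → + y ~ + 0 → (∀ {x} → x ∈ xs → x ≢ y → + x ~ + i) →
      ∃ λ k → (length xs ≡ suc k) × (+ sum xs ~ + k ℤ.* + i)
    sum~-except {i} (y ∷ xs) (y∉ ∷ u) (here refl) y~0 x~i = length xs , refl ,
      subst₂ _~_ (sym (ℤₚ.pos-+ y (sum xs))) (ℤₚ.+-identityˡ (+ length xs ℤ.* + i))
        (~-+ {+ y} {+ 0} {+ sum xs} {+ length xs ℤ.* + i} y~0 (sum~ xs (λ x∈ → x~i (there x∈) (λ e → All.lookup y∉ x∈ (sym e)))))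
    sum~-except {i} {y} (x ∷ xs) (x∉ ∷ u) (there y∈) y~0 x~i = extend (sum~-except xs u y∈ y~0 (λ z∈ → x~i (there z∈)))
      where
      lemma : ∀ l i → (+ 1 ℤ.+ l) ℤ.* i ≡ i ℤ.+ l ℤ.* i
      lemma = ℤSolver.solve-∀
      extend : (∃ λ k → (length xs ≡ suc k) × (+ sum xs ~ + k ℤ.* + i)) → ∃ λ k → (length (x ∷ xs) ≡ suc k) × (+ sum (x ∷ xs) ~ + k ℤ.* + i)
      extend (k , eq , e) = suc k , cong suc eq , subst₂ _~_ (sym (ℤₚ.pos-+ x (sum xs))) (sym (trans (cong (λ z → z ℤ.* + i) (ℤₚ.pos-+ 1 k)) (lemma (+ k) (+ i))))
        (~-+ {+ x} {+ i} {+ sum xs} {+ k ℤ.* + i} (x~i (here refl) (λ x≡y → All.lookup x∉ y∈ x≡y)) e)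

  module SquareTuples (p : ℕ) (pp : Prime p) (p≢2 : p ≢ 2) where

    private
      instance
        p≢0 : NonZero p
        p≢0 = prime⇒nonZero pp
        pp≢0 : NonZero (p ℕ.* p)
        pp≢0 = ℕₚ.m*n≢0 p p

    open SquareModulus p pp p≢2
    open 𝔭 using () renaming (_~_ to _~ₚ_; _~?_ to _~ₚ?_)
    open 𝔪 using () renaming (_~_ to _~ₘ_)
    open Congruence p
    open Weights (p ℕ.* p) 1<pp

    0<p : 0 ℕ.< p
    0<p = ℕₚ.<-trans (ℕ.s≤s ℕ.z≤n) 𝔭P.1<p

    2∤p : ¬ (2 ℕ.∣ p)
    2∤p d = p≢2 (sym (prime∣prime prime[2] pp d))

    2∣1+p : 2 ℕ.∣ suc p
    2∣1+p with even∨odd p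
    ... | inj₁ e = ⊥-elim (2∤p e)
    ... | inj₂ o = o

    2*half : 2 ℕ.* (suc p ℕ./ 2) ≡ suc p
    2*half = ℕ.m*[n/m]≡n 2∣1+p

    1≤half : 1 ℕ.≤ suc p ℕ./ 2
    1≤half = ℕ.m≥n⇒m/n>0 (ℕₚ.m≤n⇒m≤1+n 𝔭P.1<p)

    ~0⇒∣ : ∀ {n} → + n ~ₚ + 0 → p ℕ.∣ n
    ~0⇒∣ {n} e = ∣⇒∣ᵤ (subst ((+ p) Signed.∣_) (ℤₚ.+-identityʳ (+ n)) (𝔭.divisible e))

    *p~0 : ∀ k → + (k ℕ.* p) ~ₚ + 0
    *p~0 k = 𝔭.mk~ (divides (+ k) (trans (ℤₚ.+-identityʳ (+ (k ℕ.* p))) (ℤₚ.pos-* k p)))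

    p*~0 : ∀ k → + (p ℕ.* k) ~ₚ + 0
    p*~0 k = subst (λ z → + z ~ₚ + 0) (ℕₚ.*-comm k p) (*p~0 k)

    fibre~ : ∀ i k → + (i ℕ.+ k ℕ.* p) ~ₚ + i
    fibre~ i k = subst₂ _~ₚ_ (sym (ℤₚ.pos-+ i (k ℕ.* p))) (ℤₚ.+-identityʳ (+ i)) (𝔭.~-+ {+ i} {+ i} {+ (k ℕ.* p)} {+ 0} 𝔭.~-refl (*p~0 k))

    complement~ : ∀ {i} → i ℕ.≤ p → + (p ℕ.∸ i) ~ₚ ℤ.- + i
    complement~ {i} i≤p = subst₂ _~ₚ_ (trans (ℤₚ.m-n≡m⊖n p i) (ℤₚ.⊖-≥ i≤p)) (ℤₚ.+-identityˡ (ℤ.- + i))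
      (𝔭.~-+ {+ p} {+ 0} {ℤ.- + i} {ℤ.- + i} 𝔭.m~0 𝔭.~-refl)

    residue≁0 : ∀ {i} → 1 ℕ.≤ i → i ℕ.< p → ¬ (+ i ~ₚ + 0)
    residue≁0 1≤i i<p e = ℕₚ.<⇒≢ 1≤i (sym (𝔭.residue-unique i<p 0<p e))

    module Entries (i : ℕ) (1≤i : 1 ℕ.≤ i) (i<p : i ℕ.< p) where

      β : List ℕ
      β = betaTuple p i

      y : ℕ
      y = p ℕ.* (p ℕ.∸ i)

      i≁0 : ¬ (+ i ~ₚ + 0)
      i≁0 = residue≁0 1≤i i<p

      entry : ℕ → ℕ
      entry k = i ℕ.+ k ℕ.* p

      β↭ : β ↭ map entry (downFrom p) ++ [ y ]
      β↭ = ↭-trans (sort-↭ (map entry (upTo p) ++ [ y ])) (++⁺ʳ [ y ] (map⁺ entry (upTo↭downFrom p)))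

      ∈β⁻ : ∀ {x} → x ∈ β → (∃ λ k → (k ℕ.< p) × (x ≡ entry k)) ⊎ (x ≡ y)
      ∈β⁻ x∈ with ∈-++⁻ (map entry (upTo p)) (∈-resp-↭ (sort-↭ (map entry (upTo p) ++ [ y ])) x∈)
      ... | inj₂ (here e) = inj₂ e
      ... | inj₁ x∈′ with ∈-map⁻ entry x∈′
      ... | k , k∈ , e = inj₁ (k , ∈-upTo⁻ k∈ , e)

      i∈β : i ∈ β
      i∈β = ∈-resp-↭ (↭-sym (sort-↭ (map entry (upTo p) ++ [ y ])))
        (∈-++⁺ˡ (subst (_∈ map entry (upTo p)) (ℕₚ.+-identityʳ i) (∈-map⁺ entry (∈-upTo⁺ 0<p))))

      y~0 : + y ~ₚ + 0
      y~0 = p*~0 (p ℕ.∸ i)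

      entry~i : ∀ {x} → x ∈ β → x ≢ y → + x ~ₚ + i
      entry~i x∈ x≢y with ∈β⁻ x∈
      ... | inj₁ (k , _ , refl) = fibre~ i k
      ... | inj₂ x≡y            = ⊥-elim (x≢y x≡y)

      increasing : Increasing β
      increasing = sort-increasing (Uniqueₚ.++⁺ (Uniqueₚ.map⁺ injective (upTo⁺ p)) ([] ∷ []) disjoint)
        where
        injective : ∀ {k l} → entry k ≡ entry l → k ≡ l
        injective {k} {l} e = ℕₚ.*-cancelʳ-≡ k l p (ℕₚ.+-cancelˡ-≡ i (k ℕ.* p) (l ℕ.* p) e)
        disjoint : ∀ {x} → ¬ (x ∈ map entry (upTo p) × x ∈ [ y ])
        disjoint (x∈ , here refl) with ∈-map⁻ entry x∈
        ... | k , _ , e = i≁0 (𝔭.~-trans (𝔭.~-sym (fibre~ i k)) (subst (λ z → + z ~ₚ + 0) e y~0))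

      length-β : length β ≡ suc p
      length-β = trans (↭-length (sort-↭ (map entry (upTo p) ++ [ y ]))) (trans (length-++ (map entry (upTo p)))
        (trans (cong (ℕ._+ 1) (trans (length-map entry (upTo p)) (length-upTo p))) (ℕₚ.+-comm p 1)))

      entry≥1 : ∀ {x} → x ∈ β → 1 ℕ.≤ x
      entry≥1 x∈ with ∈β⁻ x∈
      ... | inj₁ (k , _ , refl) = ℕₚ.≤-trans 1≤i (ℕₚ.m≤m+n i (k ℕ.* p))
      ... | inj₂ refl           = ℕₚ.*-mono-≤ 0<p (ℕₚ.m<n⇒0<n∸m i<p)

      entry<pp : ∀ {x} → x ∈ β → x ℕ.< p ℕ.* p
      entry<pp x∈ with ∈β⁻ x∈
      ... | inj₁ (k , k<p , refl) = ℕₚ.<-≤-trans (ℕₚ.+-monoˡ-< (k ℕ.* p) i<p) (ℕₚ.*-monoˡ-≤ p k<p)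
      ... | inj₂ refl             = ℕₚ.*-monoʳ-< p (ℕₚ.∸-monoʳ-< {p} 1≤i (ℕₚ.<⇒≤ i<p))

      -- By `fibre-sum` the entries i + kp contribute p⟨ti⟩ + Tp, and the remaining entry
      -- contributes p(p - ⟨ti⟩). The dependence on t cancels, leaving p(T + p) = p²(p + 1)/2.
      weight : ∀ t → Coprime t (p ℕ.* p) → sum (map (λ b → ⟨ t ℕ.* b ⟩ (p ℕ.* p)) β) ≡ (suc p ℕ./ 2) ℕ.* (p ℕ.* p)
      weight t coprime = ℤₚ.+-injective (ι-injective (begin
        ν (sum (map f β))
          ≡⟨ cong ν (sum-↭ (map⁺ f β↭)) ⟩
        ν (sum (map f (map entry (downFrom p) ++ [ y ])))
          ≡⟨ trans (ν-sum f (map entry (downFrom p) ++ [ y ])) (trans (∑-++ (map entry (downFrom p)) [ y ] (λ x → ν (f x)))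
               (cong₂ _+_ (∑-map entry (downFrom p) (λ x → ν (f x))) (trans (∑-∷ y [] (λ x → ν (f x))) (zero-+ʳ refl (∑-[] (λ x → ν (f x))))))) ⟩
        ∑ (downFrom p) (λ k → ν (f (entry k))) + ν (f y)
          ≡⟨ cong₂ _+_ (trans (∑-cong (downFrom p) (λ k → cong ν (⟨⟩≡⌊⌋ t (entry k)))) (fibre-sum t-unit i)) top ⟩
        (ν p * R + T * ν p) + (ν p - R) * ν p
          ≡⟨ halve (trans (double (ν p) R T) (trans (cong (λ z → ν p * (z + ν p)) (triangular p)) (half-weight))) ⟩
        ν ((suc p ℕ./ 2) ℕ.* (p ℕ.* p)) ∎))
        where
        open ≡-Reasoning
        f : ℕ → ℕ
        f b = ⟨ t ℕ.* b ⟩ (p ℕ.* p)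
        R = ν 𝔭.⌊ + t ℤ.* + i ⌋
        t≁0 : ¬ (+ t ~ₚ + 0)
        t≁0 e = ℕₚ.<⇒≢ 𝔭P.1<p (sym (coprime (~0⇒∣ e , ℕ.divides p refl)))
        t-unit : 𝔭.Unit (+ t)
        t-unit = 𝔭P.nonzero⇒unit t≁0
        ti≁0 : ¬ (+ t ℤ.* + i ~ₚ + 0)
        ti≁0 e with 𝔭P.no-zero-divisors (+ t) (+ i) e
        ... | inj₁ z = t≁0 z
        ... | inj₂ z = i≁0 z
        top : ν (f y) ≡ (ν p - R) * ν p
        top = trans (cong ν (trans (⟨⟩≡⌊⌋ t y) (trans (cong (λ z → 𝔪.⌊ + t ℤ.* + z ⌋) (ℕₚ.*-comm p (p ℕ.∸ i))) (⌊multiple⌋ (+ t) (p ℕ.∸ i)))))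
          (trans (ν-* 𝔭.⌊ + t ℤ.* + (p ℕ.∸ i) ⌋ p) (cong (_* ν p) (trans (cong ν (𝔭.⌊⌋-cong
            (subst (+ t ℤ.* + (p ℕ.∸ i) ~ₚ_) (sym (ℤₚ.neg-distribʳ-* (+ t) (+ i))) (𝔭.~-*ˡ (+ t) (complement~ (ℕₚ.<⇒≤ i<p))))))
            (⌊-⌋ p (+ t ℤ.* + i) ti≁0))))
        double : ∀ p r t → ((p * r + t * p) + (p - r) * p) + ((p * r + t * p) + (p - r) * p) ≡ p * ((t + t + p) + p)
        double = solve-∀ ℚring
        half-weight : ν p * (ν p * ν p + ν p) ≡ ν ((suc p ℕ./ 2) ℕ.* (p ℕ.* p)) + ν ((suc p ℕ./ 2) ℕ.* (p ℕ.* p))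
        half-weight = trans (factor (ν p)) (trans (cong₂ _*_ (trans (sym (ν-suc p)) (trans (cong ν (sym 2*half)) (trans (cong (λ z → ν (h ℕ.+ z)) (ℕₚ.+-identityʳ h)) (ν-+ h h))))
            (sym (ν-* p p))) (trans (*-distribʳ-+ (ν (p ℕ.* p)) (ν h) (ν h)) (sym (cong₂ _+_ (ν-* h (p ℕ.* p)) (ν-* h (p ℕ.* p))))))
          where
          h = suc p ℕ./ 2
          factor : ∀ p → p * (p * p + p) ≡ (1ℚ + p) * (p * p)
          factor = solve-∀ ℚring

      -- At t = 1 every entry is its own residue, so the weight formula evaluates the sum.
      sumZero : p ℕ.* p ℕ.∣ sum β
      sumZero = ℕ.divides (suc p ℕ./ 2) (trans (cong sum (sym (map-id-local (All.tabulate reduced)))) (weight 1 (1-coprimeTo (p ℕ.* p))))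
        where
        reduced : ∀ {x} → x ∈ β → ⟨ 1 ℕ.* x ⟩ (p ℕ.* p) ≡ x
        reduced {x} x∈ = trans (⟨⟩≡% (1 ℕ.* x) (p ℕ.* p)) (trans (cong (ℕ._% (p ℕ.* p)) (ℕₚ.*-identityˡ x)) (ℕ.m<n⇒m%n≡m (entry<pp x∈)))

      inB : InB (p ℕ.* p) (suc p ℕ./ 2) β
      inB = record
        { len        = trans length-β (sym 2*half)
        ; increasing = AllPairs⇒Linked increasing
        ; bounds     = All.tabulate (λ x∈ → entry≥1 x∈ , ℕₚ.<⇒≤pred (entry<pp x∈))
        ; sumZero    = sumZero
        ; weight     = λ t _ _ → weight t
        }

      -- Modulo p every entry is i except y, which is 0. If p divides the sum of a part, then p
      -- divides the number of its entries other than y; a proper part has at most p entries, so it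
      -- consists of p entries without y or of y alone. Both sizes are odd.
      noEvenPart : NoEvenPart (p ℕ.* p) β
      noEvenPart s s⊆β 1≤len len< 2∣len pp∣sum = go (y ∈? s)
        where
        len≤p : length s ℕ.≤ p
        len≤p = ℕₚ.≤-pred (subst (length s ℕ.<_) length-β len<)
        sum~0 : + sum s ~ₚ + 0
        sum~0 = 𝔭P.∣⇒~0 {+ sum s} (ℕ.∣-trans (ℕ.divides p refl) pp∣sum)
        multiple : ∀ {k} → + sum s ~ₚ + k ℤ.* + i → p ℕ.∣ k
        multiple {k} e with 𝔭P.no-zero-divisors (+ k) (+ i) (𝔭.~-trans (𝔭.~-sym e) sum~0)
        ... | inj₁ z = ~0⇒∣ z
        ... | inj₂ z = ⊥-elim (i≁0 z)
        s-unique : Unique s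
        s-unique = unique-⊆ s⊆β (increasing⇒unique increasing)
        go : Dec (y ∈ s) → ⊥
        go (no y∉) = 2∤p (subst (2 ℕ.∣_) (ℕₚ.≤-antisym len≤p (ℕ.∣⇒≤ {{ℕ.>-nonZero 1≤len}} (multiple
          (sum~ s (λ x∈ → entry~i (lookup s⊆β x∈) (λ { refl → y∉ x∈ })))))) 2∣len)
        go (yes y∈) = odd (sum~-except s s-unique y∈ y~0 (λ x∈ → entry~i (lookup s⊆β x∈)))
          where
          small : ∀ k → k ℕ.< p → p ℕ.∣ k → k ≡ 0
          small zero    _   _ = refl
          small (suc k) k<p d = ⊥-elim (ℕ.>⇒∤ k<p d)
          odd : (∃ λ k → (length s ≡ suc k) × (+ sum s ~ₚ + k ℤ.* + i)) → ⊥
          odd (k , eq , e) with small k (subst (ℕ._≤ p) eq len≤p) (multiple e)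
          ... | refl with subst (2 ℕ.∣_) eq 2∣len
          ... | 2∣1 = ℕ.>⇒∤ (ℕₚ.≤-refl {2}) 2∣1

      indecomposable : Indecomposable (p ℕ.* p) β
      indecomposable = noEvenPart⇒exceptional (subst (2 ℕ.<_) (sym length-β) (ℕ.s≤s 𝔭P.1<p)) noEvenPart , noEvenPart

    -- The number i is itself an entry of β_i. As an entry of β_j it cannot be the multiple of p, so
    -- it lies in the fibre over j.
    betaTuple-injective : ∀ i j → 1 ℕ.≤ i → i ℕ.< p → 1 ℕ.≤ j → j ℕ.< p → betaTuple p i ≡ betaTuple p j → i ≡ j
    betaTuple-injective i j 1≤i i<p 1≤j j<p e with Entries.∈β⁻ j 1≤j j<p (subst (i ∈_) e (Entries.i∈β i 1≤i i<p))
    ... | inj₁ (k , _ , i≡) = 𝔭.residue-unique i<p j<p (subst (λ z → + z ~ₚ + j) (sym i≡) (fibre~ j k))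
    ... | inj₂ i≡           = ⊥-elim (residue≁0 1≤i i<p (subst (λ z → + z ~ₚ + 0) (sym i≡) (p*~0 (p ℕ.∸ j))))

    module Classification {d : ℕ} {β : List ℕ} (1≤d : 1 ℕ.≤ d) (inB : InB (p ℕ.* p) d β) (indec : Indecomposable (p ℕ.* p) β) where

      open Tuple inB

      private
        -- Such a pair is an even part with sum divisible by p². If it is proper, this contradicts
        -- the second half of indecomposability; if it is all of β, it contradicts exceptionality.
        not-complementary : ∀ {b c} → b ℕ.< c → b ∈ β → c ∈ β → b ℕ.+ c ≢ p ℕ.* p
        not-complementary {b} {c} b<c b∈ c∈ e = go (ℕₚ.m≤n⇒m<n∨m≡n (length-mono-≤ bc⊆β))
          where
          pp∣ : p ℕ.* p ℕ.∣ b ℕ.+ c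
          pp∣ = ℕ.divides 1 (trans e (sym (ℕₚ.*-identityˡ (p ℕ.* p))))
          bc⊆β : b ∷ c ∷ [] ⊆ β
          bc⊆β = ∈⇒⊆ ((b<c ∷ []) ∷ [] ∷ []) β-increasing (λ { (here refl) → b∈ ; (there (here refl)) → c∈ })
          go : (2 ℕ.< length β) ⊎ (2 ≡ length β) → ⊥
          go (inj₁ 2<) = proj₂ indec (b ∷ c ∷ []) bc⊆β (ℕ.s≤s ℕ.z≤n) 2< ℕ.∣-refl (subst (λ z → p ℕ.* p ℕ.∣ b ℕ.+ z) (sym (ℕₚ.+-identityʳ c)) pp∣)
          go (inj₂ 2≡) = proj₁ indec (subst (PairsOff (p ℕ.* p)) (⊆-length⇒≡ bc⊆β 2≡) (pair ↭-refl pp∣ done))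

        complement∉ : ∀ {b} → b ∈ β → ¬ (𝔪.⌊ ℤ.- + b ⌋ ∈ β)
        complement∉ {b} b∈ c∈ = go (ℕₚ.<-cmp b c)
          where
          c = 𝔪.⌊ ℤ.- + b ⌋
          b≁0 : ¬ (+ b ~ₘ + 0)
          b≁0 e = ℕₚ.<⇒≢ (entry≥1 b∈) (sym (𝔪.residue-unique (entry<m b∈) (ℕₚ.<-trans (ℕ.s≤s ℕ.z≤n) 1<pp) e))
          cancel : ∀ x y → x + (y - x) ≡ y
          cancel = solve-∀ ℚring
          b+c : b ℕ.+ c ≡ p ℕ.* p
          b+c = ℤₚ.+-injective (ι-injective (trans (ν-+ b c) (trans (cong (_+_ (ν b)) (trans (⌊-⌋ (p ℕ.* p) (+ b) b≁0)
            (cong (λ z → ν (p ℕ.* p) - ν z) (𝔪.⌊⌋-small (entry<m b∈))))) (cancel (ν b) (ν (p ℕ.* p))))))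
          go : _ → ⊥
          go (tri< b<c _ _) = not-complementary b<c b∈ c∈ b+c
          go (tri> _ _ c<b) = not-complementary c<b c∈ b∈ (trans (ℕₚ.+-comm c b) b+c)
          -- Here 2b = p², which is impossible for odd p.
          go (tri≈ _ b≡c _) = even (euclidsLemma p p prime[2] (ℕ.divides b (trans (sym b+c) (trans (cong (b ℕ.+_) (trans (sym b≡c) (sym (ℕₚ.+-identityʳ b)))) (ℕₚ.*-comm 2 b)))))
            where
            even : (2 ℕ.∣ p) ⊎ (2 ℕ.∣ p) → ⊥
            even (inj₁ d) = 2∤p d
            even (inj₂ d) = 2∤p d

        F-entry : ∀ {b} → b ∈ β → F (+ b) ≡ + 1
        F-entry b∈ = ∈⇒F≡1 b∈ (complement∉ b∈)

        F-reduction : ∀ {a b} → ¬ (a ~ₚ + 0) → a ~ₚ b → F a ≡ F b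
        F-reduction = reduction F F-cong F-odd orthogonality

        F-antisymmetry : ∀ a → ¬ (a ~ₚ + 0) → F (+ p ℤ.* a) ≡ ℤ.- F a
        F-antisymmetry = antisymmetry F F-cong F-odd orthogonality

        -- F(pk) = -F(k) = F(-k) and -k ≡ p - k modulo p. This is what attaches the entry p(p - i)
        -- to the class of i.
        F-multiple : ∀ {k} → 1 ℕ.≤ k → k ℕ.< p → F (+ (p ℕ.* k)) ≡ F (+ (p ℕ.∸ k))
        F-multiple {k} 1≤k k<p = trans (cong F (ℤₚ.pos-* p k)) (trans (F-antisymmetry (+ k) (residue≁0 1≤k k<p)) (trans (sym (F-odd (+ k)))
          (sym (F-reduction (residue≁0 (ℕₚ.m<n⇒0<n∸m k<p) (ℕₚ.∸-monoʳ-< {p} 1≤k (ℕₚ.<⇒≤ k<p))) (complement~ (ℕₚ.<⇒≤ k<p))))))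

        member : ∃ λ b → b ∈ β
        member = go β (InB.len inB)
          where
          go : ∀ xs → length xs ≡ 2 ℕ.* d → ∃ λ b → b ∈ xs
          go []       eq = ⊥-elim (ℕₚ.<⇒≢ (ℕₚ.*-mono-≤ (ℕ.s≤s (ℕ.z≤n {1})) 1≤d) eq)
          go (x ∷ xs) _  = x , here refl

        Base : Set
        Base = ∃ λ i → (1 ℕ.≤ i) × (i ℕ.< p) × (F (+ i) ≡ + 1)

        -- An entry prime to p supplies its residue modulo p, and an entry pk supplies p - k through
        -- `F-multiple`.
        base : Base
        base = go (proj₂ member)
          where
          nonzero : ∀ {r} → r ≢ 0 → 1 ℕ.≤ r
          nonzero {zero}  r≢0 = ⊥-elim (r≢0 refl)
          nonzero {suc _} _   = ℕ.s≤s ℕ.z≤n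
          by-residue : ∀ {b} → b ∈ β → Dec (+ b ~ₚ + 0) → Base
          by-residue {b} b∈ (no b≁0) = 𝔭.⌊ + b ⌋ , nonzero (λ e → b≁0 (subst (λ r → + b ~ₚ + r) e (𝔭.~⌊⌋ (+ b)))) , 𝔭.⌊⌋<m (+ b) ,
            trans (sym (F-reduction b≁0 (𝔭.~⌊⌋ (+ b)))) (F-entry b∈)
          by-residue {b} b∈ (yes b~0) with ~0⇒∣ b~0
          ... | ℕ.divides k b≡ = p ℕ.∸ k , ℕₚ.m<n⇒0<n∸m k<p , ℕₚ.∸-monoʳ-< {p} 1≤k (ℕₚ.<⇒≤ k<p) ,
              trans (sym (F-multiple 1≤k k<p)) (trans (cong (λ z → F (+ z)) (sym (trans b≡ (ℕₚ.*-comm k p)))) (F-entry b∈))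
            where
            k<p : k ℕ.< p
            k<p = ℕₚ.*-cancelʳ-< p k p (subst (ℕ._< p ℕ.* p) b≡ (entry<m b∈))
            1≤k : 1 ℕ.≤ k
            1≤k = nonzero (λ { refl → ℕₚ.<⇒≢ (entry≥1 b∈) (sym b≡) })
          go : ∀ {b} → b ∈ β → Base
          go {b} b∈ = by-residue b∈ (+ b ~ₚ? + 0)

      -- F = 1 at every entry of β_i, so β_i embeds into β. It has p + 1 entries, an even number,
      -- and sum divisible by p²; indecomposability forbids a proper embedding.
      classification : ∃ λ i → (1 ℕ.≤ i) × (i ℕ.< p) × (β ≡ betaTuple p i)
      classification = go base
        where
        go : Base → ∃ λ i → (1 ℕ.≤ i) × (i ℕ.< p) × (β ≡ betaTuple p i)
        go (i , 1≤i , i<p , Fi≡1) = i , 1≤i , i<p , by-length (ℕₚ.m≤n⇒m<n∨m≡n (length-mono-≤ βᵢ⊆β))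
          where
          module βᵢ = Entries i 1≤i i<p
          F≡1 : ∀ {x} → x ∈ βᵢ.β → F (+ x) ≡ + 1
          F≡1 x∈ with βᵢ.∈β⁻ x∈
          ... | inj₁ (k , _ , refl) = trans (sym (F-reduction βᵢ.i≁0 (𝔭.~-sym (fibre~ i k)))) Fi≡1
          ... | inj₂ refl = trans (F-multiple (ℕₚ.m<n⇒0<n∸m i<p) (ℕₚ.∸-monoʳ-< {p} 1≤i (ℕₚ.<⇒≤ i<p)))
            (trans (cong (λ z → F (+ z)) (ℕₚ.m∸[m∸n]≡n (ℕₚ.<⇒≤ i<p))) Fi≡1)
          βᵢ⊆β : βᵢ.β ⊆ β
          βᵢ⊆β = ∈⇒⊆ βᵢ.increasing β-increasing (λ {x} x∈ → subst (_∈ β) (𝔪.⌊⌋-small (βᵢ.entry<pp x∈)) (F≡1⇒∈ (+ x) (F≡1 x∈)))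
          by-length : (length βᵢ.β ℕ.< length β) ⊎ (length βᵢ.β ≡ length β) → β ≡ betaTuple p i
          by-length (inj₁ <len) = ⊥-elim (proj₂ indec βᵢ.β βᵢ⊆β (subst (1 ℕ.≤_) (sym βᵢ.length-β) (ℕ.s≤s ℕ.z≤n)) <len
            (subst (2 ℕ.∣_) (sym βᵢ.length-β) 2∣1+p) βᵢ.sumZero)
          by-length (inj₂ ≡len) = sym (⊆-length⇒≡ βᵢ⊆β ≡len)

-- Existence, distinctness and exclusion of other degrees

open import Defs
open import Data.Nat using (ℕ; suc; _*_; _∸_; _≤_; _<_; _/_)
open import Data.Nat.Primality using (Prime; prime⇒nonZero)
open import Data.Nat.Properties using (*-cancelˡ-≡; <⇒≤pred; m≤pred[n]⇒suc[m]≤n)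
open import Data.List using (List)
open import Data.Product using (_×_; _,_; ∃-syntax)
open import Function.Bundles using (_⇔_; mk⇔)
open import Relation.Binary.PropositionalEquality using (_≡_; _≢_; refl; sym; trans)
open import Relation.Nullary using (¬_)

theorem3p21 : ∀ (p : ℕ) → Prime p → p ≢ 2 →
    (∀ (β : List ℕ) →
    (InB (p * p) (suc p / 2) β × Indecomposable (p * p) β)
    ⇔ (∃[ i ] (1 ≤ i × i ≤ p ∸ 1 × β ≡ betaTuple p i)))
    ×
    (∀ (i j : ℕ) → 1 ≤ i → i ≤ p ∸ 1 → 1 ≤ j → j ≤ p ∸ 1 →
    betaTuple p i ≡ betaTuple p j → i ≡ j)
    ×
    (∀ (d′ : ℕ) (β : List ℕ) → 1 ≤ d′ → d′ ≤ (p * p ∸ 1) / 2 → d′ ≢ suc p / 2 →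
    InB (p * p) d′ β → ¬ Indecomposable (p * p) β)
theorem3p21 p pp p≢2 =
    (λ β → mk⇔ to from) ,
    (λ i j 1≤i i≤ 1≤j j≤ → betaTuple-injective i j 1≤i (below i≤) 1≤j (below j≤)) ,
    (λ d′ β 1≤d′ _ d′≢ inB indec → d′≢ (degree inB (classification 1≤d′ inB indec)))
  where
  open Tuples.SquareTuples p pp p≢2
  open Classification using (classification)

  below : ∀ {i} → i ≤ p ∸ 1 → i < p
  below = m≤pred[n]⇒suc[m]≤n {{prime⇒nonZero pp}}

  to : ∀ {β} → InB (p * p) (suc p / 2) β × Indecomposable (p * p) β → ∃[ i ] (1 ≤ i × i ≤ p ∸ 1 × β ≡ betaTuple p i)
  to (inB , indec) with classification 1≤half inB indec
  ... | i , 1≤i , i<p , β≡ = i , 1≤i , <⇒≤pred i<p , β≡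

  from : ∀ {β} → ∃[ i ] (1 ≤ i × i ≤ p ∸ 1 × β ≡ betaTuple p i) → InB (p * p) (suc p / 2) β × Indecomposable (p * p) β
  from (i , 1≤i , i≤ , refl) = Entries.inB i 1≤i (below i≤) , Entries.indecomposable i 1≤i (below i≤)

  -- The classification covers every positive degree, and the length p + 1 of the tuple that it
  -- finds determines the degree.
  degree : ∀ {d′ β} → InB (p * p) d′ β → ∃[ i ] (1 ≤ i × i < p × β ≡ betaTuple p i) → d′ ≡ suc p / 2
  degree {d′} inB (i , 1≤i , i<p , refl) = *-cancelˡ-≡ d′ (suc p / 2) 2
    (trans (sym (InB.len inB)) (InB.len (Entries.inB i 1≤i i<p)))
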